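{- Let $F\in\mathbb{Q}[x,y]$ be such that $C=\{F(x,y)=0\}\subset\mathbb{A}^2$ is a smooth curve not isomorphic over $\overline{\mathbb{Q}}$ to $\mathbb{A}^1$ or to $\mathbb{A}^1_*$, and suppose there is $G\in\overline{\mathbb{Q}}[x,y]$ such that for $a=0$ and for all but finitely many $a\in\overline{\mathbb{Q}}$, the curve $V(G-a)$ is isomorphic to $\mathbb{A}^1$ and meets $C$ in exactly one point. Then the set $\{(x,y)\in\mathbb{Q}^2: F(x,y)<0\}$ satisfies the weak approximation property.
   Context: $\mathbb{A}^1_*=\mathbb{A}^1\setminus\{0\}$. A set $R\subset\mathbb{Q}^2$ satisfies the weak approximation property if for every $(x_0,y_0)\in\mathbb{Q}^2$ and every positive integer $N$ there exists $(x,y)\in R$ with $x-x_0\in N\mathbb{Z}$ and $y-y_0\in N\mathbb{Z}$. -}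

module Defs where

open import Algebra.Bundles using (CommutativeRing; Semiring)
open import Algebra.Morphism.Structures using (IsRingHomomorphism)
import Algebra.Definitions.RawSemiring as RawSemiringDefs
open import Data.Fin.Base using (Fin; zero; suc; toℕ)
open import Data.Integer.Base as ℤ using (+_)
open import Data.List.Base as List using (List; []; _∷_)
import Data.List.Membership.Setoid as SetoidMembership
open import Data.List.Relation.Unary.All using (All)
open import Data.Nat.Base as ℕ using (ℕ; pred)
import Data.Nat.Properties as ℕ
open import Data.Product.Base using (_×_; _,_; proj₁; proj₂; ∃; Σ-syntax; ∃-syntax; map₁)
open import Data.Rational.Base as ℚ using (ℚ)
import Data.Rational.Properties as ℚ
open import Data.Vec.Base as Vec using (Vec; []; _∷_)
import Data.Vec.Properties as Vec
open import Data.Vec.Relation.Binary.Pointwise.Inductive using (Pointwise)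
open import Level using (_⊔_) renaming (suc to lsuc)
open import Relation.Binary.Definitions using (Decidable)
open import Relation.Binary.PropositionalEquality using (_≡_; _≢_)
open import Relation.Nullary using (¬_; does)
open import Relation.Unary using (Pred)
open import Data.Bool.Base using (if_then_else_)

-- A polynomial in n variables is a finite formal sum of terms c·x₁^e₁⋯xₙ^eₙ,
-- stored as pairs (c , e).  Exponent vectors may repeat, so different lists can
-- denote the same polynomial; `coeff` collects the repetitions.
Poly : ∀ {a} → Set a → ℕ → Set a
Poly A n = List (A × Vec ℕ n)

mapCoeff : ∀ {a b} {A : Set a} {B : Set b} {n} → (A → B) → Poly A n → Poly B n
mapCoeff f = List.map (map₁ f)

module Polynomials {c ℓ} (R : CommutativeRing c ℓ) where
  open CommutativeRing R
  open RawSemiringDefs (Semiring.rawSemiring semiring) using (_^_; sum) renaming (_×_ to _·_)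

  const : ∀ {n} → Carrier → Poly Carrier n
  const a = (a , Vec.replicate _ 0) ∷ []

  var : ∀ {n} → Fin n → Poly Carrier n
  var i = (1# , (Vec.replicate _ 0 Vec.[ i ]≔ 1)) ∷ []

  _⊖_ : ∀ {n} → Poly Carrier n → Carrier → Poly Carrier n
  G ⊖ a = G List.++ const (- a)

  monomial : ∀ {n} → Vec ℕ n → Vec Carrier n → Carrier
  monomial e x = Vec.foldr′ _*_ 1# (Vec.zipWith _^_ x e)

  eval : ∀ {n} → Poly Carrier n → Vec Carrier n → Carrier
  eval F x = List.foldr (λ (a , e) s → a * monomial e x + s) 0# F

  coeff : ∀ {n} → Vec ℕ n → Poly Carrier n → Carrier
  coeff e = List.foldr (λ (a , e′) s → if does (Vec.≡-dec ℕ._≟_ e e′) then a + s else s) 0#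

  NonConstant : ∀ {n} → Poly Carrier n → Set ℓ
  NonConstant F = ∃[ e ] e ≢ Vec.replicate _ 0 × ¬ (coeff e F ≈ 0#)

  -- When the exponent of xᵢ is 0 the resulting coefficient is 0.
  ∂ : ∀ {n} → Fin n → Poly Carrier n → Poly Carrier n
  ∂ i = List.map (λ (a , e) → Vec.lookup e i · a , Vec.updateAt e i pred)

  -- The value at x of the monic polynomial Xⁿ + Σ_{i<n} aᵢ Xⁱ.
  evalMonic : ∀ {n} → (Fin n → Carrier) → Carrier → Carrier
  evalMonic {n} a x = x ^ n + sum (λ i → a i * x ^ toℕ i)

record Field c ℓ : Set (lsuc (c ⊔ ℓ)) where
  field
    commutativeRing : CommutativeRing c ℓ
  open CommutativeRing commutativeRing public
  field
    _≟_    : Decidable _≈_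
    1≉0    : ¬ (1# ≈ 0#)
    invert : ∀ x → ¬ (x ≈ 0#) → ∃[ y ] x * y ≈ 1#

-- An algebraic closure of ℚ.  Algebraic elements are presented by monic
-- polynomials; the degree 0 case 1 ≈ 0 is excluded by 1≉0.
record AlgebraicClosureOfℚ c ℓ : Set (lsuc (c ⊔ ℓ)) where
  field
    field′ : Field c ℓ
  open Field field′ public
  open Polynomials commutativeRing using (evalMonic)
  field
    ι                   : ℚ → Carrier
    ι-isHomomorphism    : IsRingHomomorphism ℚ.+-*-rawRing rawRing ι
    algebraic           : ∀ x → ∃[ n ] Σ[ a ∈ (Fin n → ℚ) ] evalMonic (λ i → ι (a i)) x ≈ 0#
    algebraicallyClosed : ∀ {n} (a : Fin (ℕ.suc n) → Carrier) → ∃[ x ] evalMonic a x ≈ 0#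

-- Varieties are treated classically, through their points over K, which is
-- meant to be algebraically closed.
module Geometry {c ℓ} (K : Field c ℓ) where
  open Field K hiding (zero)
  open Polynomials commutativeRing
  open RawSemiringDefs (Semiring.rawSemiring semiring) using (_^_)

  -- The principal open subset {nonzero ≠ 0} of the closed subset
  -- {equations = 0} of affine space.
  record Variety : Set c where
    field
      {dim}     : ℕ
      equations : List (Poly Carrier dim)
      nonzero   : Poly Carrier dim

  open Variety

  infix 4 _∋_

  record _∋_ (X : Variety) (x : Vec Carrier (dim X)) : Set (c ⊔ ℓ) where
    field
      vanishes  : All (λ f → eval f x ≈ 0#) (equations X)
      nonzero≉0 : ¬ (eval (nonzero X) x ≈ 0#)

  open _∋_

  Point : Variety → Set (c ⊔ ℓ)
  Point X = ∃ (X ∋_)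

  _≈ₚ_ : ∀ {X} → Point X → Point X → Set (c ⊔ ℓ)
  (x , _) ≈ₚ (y , _) = Pointwise _≈_ x y

  -- The regular functions on {h ≠ 0} ⊂ V are the quotients p / hᵏ with p a
  -- polynomial; a pair (p , k) stands for p / hᵏ.
  Regular : Variety → Set c
  Regular X = Poly Carrier (dim X) × ℕ

  value : ∀ {X} → Regular X → Point X → Carrier
  value {X} (p , k) (x , x∈X) =
    eval p x * proj₁ (invert (eval (nonzero X) x) (nonzero≉0 x∈X)) ^ k

  record Morphism (X Y : Variety) : Set (c ⊔ ℓ) where
    field
      components : Vec (Regular X) (dim Y)
      lands      : ∀ P → Y ∋ Vec.map (λ f → value {X} f P) components

    apply : Point X → Point Y
    apply P = Vec.map (λ f → value {X} f P) components , lands P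

  open Morphism

  record _≅_ (X Y : Variety) : Set (c ⊔ ℓ) where
    field
      to      : Morphism X Y
      from    : Morphism Y X
      from∘to : ∀ P → _≈ₚ_ {X} (apply from (apply to P)) P
      to∘from : ∀ Q → _≈ₚ_ {Y} (apply to (apply from Q)) Q

  V : ∀ {n} → Poly Carrier n → Variety
  V F = record { equations = F ∷ [] ; nonzero = const 1# }

  𝔸¹ : Variety
  𝔸¹ = record { dim = 1 ; equations = [] ; nonzero = const 1# }

  𝔸¹* : Variety
  𝔸¹* = record { dim = 1 ; equations = [] ; nonzero = var zero }

  -- Smoothness is that of the scheme defined by the given equation F, by the
  -- Jacobian criterion.  In particular F has no repeated factor.
  record IsSmoothPlaneCurve (F : Poly Carrier 2) : Set (c ⊔ ℓ) where
    field
      nonConstant : NonConstant F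
      smooth      : ∀ P → eval F P ≈ 0# →
                    ¬ (eval (∂ zero F) P ≈ 0# × eval (∂ (suc zero) F) P ≈ 0#)

  MeetInExactlyOnePoint : ∀ {n} → Poly Carrier n → Poly Carrier n → Set (c ⊔ ℓ)
  MeetInExactlyOnePoint F G = ∃[ P ] Common P × (∀ Q → Common Q → Pointwise _≈_ Q P)
    where
    Common : Vec Carrier _ → Set (c ⊔ ℓ)
    Common P = (V F ∋ P) × (V G ∋ P)

  AllButFinitelyMany : ∀ {p} → Pred Carrier p → Set (c ⊔ ℓ ⊔ p)
  AllButFinitelyMany P = ∃[ exceptions ] (∀ a → a ∉ exceptions → P a)
    where open SetoidMembership setoid using (_∉_)

infix 4 _∈_·ℤ

_∈_·ℤ : ℚ → ℕ → Set
q ∈ N ·ℤ = ∃[ k ] q ≡ (+ N ℤ.* k) ℚ./ 1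

WeakApproximation : ∀ {p} → Pred (ℚ × ℚ) p → Set p
WeakApproximation R =
  ∀ x₀ y₀ (N : ℕ) → N ℕ.> 0 →
  ∃[ x ] ∃[ y ] R (x , y) × (x ℚ.- x₀) ∈ N ·ℤ × (y ℚ.- y₀) ∈ N ·ℤ

{-# OPTIONS --safe #-}
-- Write {f , g} for the Jacobian determinant of f and g, and ad G for {G , ·}.
-- On a generic line G = a, which is parametrised by t ∈ 𝔸¹, ad G is a constant
-- multiple of d/dt; hence ad G is locally nilpotent.  There F has a single zero
-- τ, so it is a constant multiple of a power of t - τ, and smoothness of the
-- curve F = 0 forces the exponent to be 1.  It follows that {G , F} = p(G).
-- If p is constant, the curve is isomorphic to 𝔸¹; if p is linear, it is
-- isomorphic to 𝔸¹* or singular.  So deg p ≥ 2.  A conjugate H of G satisfies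
-- {H , F} = q(H) with deg q = deg p, but {· , F} does not raise the degree with
-- respect to ad G, whereas q multiplies it by deg q ≥ 2.  So this degree of H
-- is 0, that is, {G , H} = 0, and the vector field ad G / {G , F} equals its
-- conjugates: it is defined over ℚ.  Its trajectory through a rational point P
-- with {G , F}(P) ≠ 0 is a polynomial curve γ with rational coefficients and
-- F(γ(s)) = F(P) + s.  Finally take s negative, large, and divisible by N and
-- by the denominators of γ.
module Submission where

open import Algebra.Bundles using (CommutativeRing; Semiring)
import Algebra.Definitions.RawSemiring as RawSemiringDefs
open import Algebra.Morphism.Structures using (IsRingHomomorphism)
import Algebra.Solver.Ring
open import Algebra.Solver.Ring.AlmostCommutativeRing using (fromCommutativeRing; _-Raw-AlmostCommutative⟶_)
open import Data.Bool.Base using (Bool; true; false; if_then_else_)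
open import Data.Empty using (⊥; ⊥-elim)
open import Data.Fin.Base as Fin using (Fin)
open import Data.Integer.Base as ℤ using (ℤ; +_; -[1+_])
import Data.Integer.Properties as ℤ
import Data.Integer.Solver
open import Data.List.Base as List using (List; []; _∷_; length; map; _++_; lookup)
import Data.List.Membership.Setoid as SetoidMembership
import Data.List.Properties as List
open import Data.List.Relation.Binary.Pointwise as Pointwise using (Pointwise; []; _∷_)
open import Data.List.Relation.Unary.All as All using (All; []; _∷_)
open import Data.List.Relation.Unary.All.Properties using (++⁺; ++⁻ˡ; ++⁻ʳ)
open import Data.List.Relation.Unary.AllPairs using (AllPairs; []; _∷_)
open import Data.List.Relation.Unary.Any as Any using (Any; here; there)
open import Data.List.Relation.Unary.Any.Properties using (++⁺ˡ; ++⁺ʳ)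
open import Data.Maybe.Base using (Maybe; just; nothing)
open import Data.Nat.Base as ℕ using (ℕ; suc; z≤n; s≤s)
open import Data.Nat.Coprimality as Coprimality using (Coprime; coprime-divisor)
open import Data.Nat.Divisibility as ℕ∣ using (_∣_; divides)
open import Data.Nat.Induction using (<-rec)
import Data.Nat.Properties as ℕ
open import Data.Product.Base using (_×_; _,_; proj₁; proj₂; ∃; Σ-syntax; ∃-syntax)
open import Data.Rational.Base as ℚ using (ℚ; mkℚ; 0ℚ; 1ℚ; _<_; ↥_; ↧_; ↧ₙ_)
open import Data.Rational.Properties as ℚ using (+-*-commutativeRing)
open import Data.Rational.Unnormalised.Base as ℚᵘ using (mkℚᵘ; *≡*; *<*)
import Data.Rational.Unnormalised.Properties as ℚᵘ
open import Data.Sum.Base using (_⊎_; inj₁; inj₂; [_,_]′)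
open import Data.Vec.Base as Vec using (Vec; []; _∷_)
open import Data.Vec.Relation.Binary.Pointwise.Inductive as VecPointwise using ([]; _∷_)
open import Level using (Lift; lift; lower; _⊔_)
open import Relation.Binary.PropositionalEquality as ≡ using (_≡_)
open import Relation.Nullary using (¬_; yes; no; Dec)
open import Relation.Nullary.Decidable using (map′; _⊎-dec_)
open import Defs

-- A single line may be tangent to a smooth curve, so smoothness does not bound the exponent line by
-- line. With `T` and `P` the last two iterates of F under ad G that need not vanish, an identity
-- `P Tⁿ = N Pⁿ F`, free of the constants of the line, holds in the whole plane; for n at least 2 it
-- makes F singular at its zero on any line where `P` is not zero. Local nilpotency needs one degree
-- bound for the parametrisations of all lines; it comes from counting the intersections with the
-- coordinate axes. If p is linear with root r and the curve meets G = r, the two share a formal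
-- branch, and G - r divides F. A shear by a natural number makes G monic in y up to a constant, so
-- that ideals and kernels are computed by division in y. Conjugations are homomorphisms from
-- subrings of the closure, extended by one element at a time. Minimal polynomials exist only up to
-- double negation; this is removed at the end because rationality of an algebraic number is
-- decidable by the rational root theorem.

module ℤS = Data.Integer.Solver.+-*-Solver


-- Integers inside the rational numbers

fromℤ : ℤ → ℚ
fromℤ i = i ℚ./ 1

toℚᵘ-fromℤ : ∀ i → ℚ.toℚᵘ (fromℤ i) ℚᵘ.≃ mkℚᵘ i 0
toℚᵘ-fromℤ i = ℚ.toℚᵘ-fromℚᵘ (mkℚᵘ i 0)

fromℤ-+ : ∀ i j → fromℤ (i ℤ.+ j) ≡ fromℤ i ℚ.+ fromℤ j
fromℤ-+ i j = ℚ.toℚᵘ-injective (begin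
  ℚ.toℚᵘ (fromℤ (i ℤ.+ j))                ≈⟨ toℚᵘ-fromℤ (i ℤ.+ j) ⟩
  mkℚᵘ (i ℤ.+ j) 0                         ≈⟨ *≡* (≡.cong (ℤ._* (+ 1)) (≡.sym (≡.cong₂ ℤ._+_ (ℤ.*-identityʳ i) (ℤ.*-identityʳ j)))) ⟩
  mkℚᵘ i 0 ℚᵘ.+ mkℚᵘ j 0                   ≈⟨ ℚᵘ.+-cong (toℚᵘ-fromℤ i) (toℚᵘ-fromℤ j) ⟨
  ℚ.toℚᵘ (fromℤ i) ℚᵘ.+ ℚ.toℚᵘ (fromℤ j)  ≈⟨ ℚ.toℚᵘ-homo-+ (fromℤ i) (fromℤ j) ⟨
  ℚ.toℚᵘ (fromℤ i ℚ.+ fromℤ j)            ∎)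
  where open import Relation.Binary.Reasoning.Setoid ℚᵘ.≃-setoid

fromℤ-* : ∀ i j → fromℤ (i ℤ.* j) ≡ fromℤ i ℚ.* fromℤ j
fromℤ-* i j = ℚ.toℚᵘ-injective (begin
  ℚ.toℚᵘ (fromℤ (i ℤ.* j))                ≈⟨ toℚᵘ-fromℤ (i ℤ.* j) ⟩
  mkℚᵘ i 0 ℚᵘ.* mkℚᵘ j 0                   ≈⟨ ℚᵘ.*-cong (toℚᵘ-fromℤ i) (toℚᵘ-fromℤ j) ⟨
  ℚ.toℚᵘ (fromℤ i) ℚᵘ.* ℚ.toℚᵘ (fromℤ j)  ≈⟨ ℚ.toℚᵘ-homo-* (fromℤ i) (fromℤ j) ⟨
  ℚ.toℚᵘ (fromℤ i ℚ.* fromℤ j)            ∎)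
  where open import Relation.Binary.Reasoning.Setoid ℚᵘ.≃-setoid

fromℤ-neg : ∀ i → fromℤ (ℤ.- i) ≡ ℚ.- fromℤ i
fromℤ-neg i = ℚ.toℚᵘ-injective (begin
  ℚ.toℚᵘ (fromℤ (ℤ.- i))  ≈⟨ toℚᵘ-fromℤ (ℤ.- i) ⟩
  ℚᵘ.- mkℚᵘ i 0            ≈⟨ ℚᵘ.-‿cong (toℚᵘ-fromℤ i) ⟨
  ℚᵘ.- ℚ.toℚᵘ (fromℤ i)   ≈⟨ ℚ.toℚᵘ-homo‿- (fromℤ i) ⟨
  ℚ.toℚᵘ (ℚ.- fromℤ i)    ∎)
  where open import Relation.Binary.Reasoning.Setoid ℚᵘ.≃-setoid

fromℤ-injective : ∀ {i j} → fromℤ i ≡ fromℤ j → i ≡ j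
fromℤ-injective {i} {j} eq with ℚᵘ.≃-trans (ℚᵘ.≃-sym (toℚᵘ-fromℤ i)) (ℚᵘ.≃-trans (ℚᵘ.≃-reflexive (≡.cong ℚ.toℚᵘ eq)) (toℚᵘ-fromℤ j))
... | *≡* e = ≡.trans (≡.sym (ℤ.*-identityʳ i)) (≡.trans e (ℤ.*-identityʳ j))

denominator-* : ∀ q → fromℤ (ℚ.↧ q) ℚ.* q ≡ fromℤ (ℚ.↥ q)
denominator-* q@record{} = ℚ.toℚᵘ-injective (begin
  ℚ.toℚᵘ (fromℤ (ℚ.↧ q) ℚ.* q)             ≈⟨ ℚ.toℚᵘ-homo-* (fromℤ (ℚ.↧ q)) q ⟩
  ℚ.toℚᵘ (fromℤ (ℚ.↧ q)) ℚᵘ.* ℚ.toℚᵘ q     ≈⟨ ℚᵘ.*-congʳ (toℚᵘ-fromℤ (ℚ.↧ q)) ⟩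
  mkℚᵘ (ℚ.↧ q) 0 ℚᵘ.* ℚ.toℚᵘ q             ≈⟨ *≡* (≡.trans (ℤ.*-identityʳ _) (≡.trans (ℤ.*-comm (ℚ.↧ q) (ℚ.↥ q)) (≡.cong (ℚ.↥ q ℤ.*_) (≡.sym (≡.cong +_ (ℕ.+-identityʳ _)))))) ⟩
  mkℚᵘ (ℚ.↥ q) 0                           ≈⟨ toℚᵘ-fromℤ (ℚ.↥ q) ⟨
  ℚ.toℚᵘ (fromℤ (ℚ.↥ q))                   ∎)
  where open import Relation.Binary.Reasoning.Setoid ℚᵘ.≃-setoid

module Closure {c ℓ} (ℚ̄ : AlgebraicClosureOfℚ c ℓ) where

  -- Arithmetic in the algebraic closure

  open AlgebraicClosureOfℚ ℚ̄ hiding (zero)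
  open RawSemiringDefs (Semiring.rawSemiring semiring) using (_^_; sum)
  open IsRingHomomorphism ι-isHomomorphism using () renaming (⟦⟧-cong to ι-cong; +-homo to ι-+; *-homo to ι-*; -‿homo to ι-neg; 0#-homo to ι-0; 1#-homo to ι-1)
  open Polynomials commutativeRing using (evalMonic)
  open SetoidMembership setoid using (_∈_; _∉_)
  open import Relation.Binary.Reasoning.Setoid setoid

  -- The clauses for 0, 1 and -1 let the ring solver see the literals 0#, 1# and - 1#.
  ιℤ : ℤ → Carrier
  ιℤ (+ 0)        = 0#
  ιℤ (+ 1)        = 1#
  ιℤ (ℤ.-[1+ 0 ]) = - 1#
  ιℤ i            = ι (fromℤ i)

  ιℤ≈ι : ∀ i → ιℤ i ≈ ι (fromℤ i)
  ιℤ≈ι (+ 0)             = sym ι-0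
  ιℤ≈ι (+ 1)             = sym ι-1
  ιℤ≈ι (+ suc (suc _))   = refl
  ιℤ≈ι ℤ.-[1+ 0 ]        = sym (trans (ι-neg 1ℚ) (-‿cong ι-1))
  ιℤ≈ι ℤ.-[1+ suc _ ]    = refl

  ιℤ-+ : ∀ i j → ιℤ (i ℤ.+ j) ≈ ιℤ i + ιℤ j
  ιℤ-+ i j = trans (ιℤ≈ι (i ℤ.+ j)) (trans (ι-cong (fromℤ-+ i j)) (trans (ι-+ _ _) (sym (+-cong (ιℤ≈ι i) (ιℤ≈ι j)))))

  ιℤ-morphism : ℤ.+-*-rawRing -Raw-AlmostCommutative⟶ fromCommutativeRing commutativeRing
  ιℤ-morphism = record
    { ⟦_⟧    = ιℤ
    ; +-homo = ιℤ-+
    ; *-homo = λ i j → trans (ιℤ≈ι (i ℤ.* j)) (trans (ι-cong (fromℤ-* i j)) (trans (ι-* _ _) (sym (*-cong (ιℤ≈ι i) (ιℤ≈ι j)))))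
    ; -‿homo = λ i → trans (ιℤ≈ι (ℤ.- i)) (trans (ι-cong (fromℤ-neg i)) (trans (ι-neg _) (-‿cong (sym (ιℤ≈ι i)))))
    ; 0-homo = refl
    ; 1-homo = refl
    }

  _coeff≟_ : ∀ i j → Maybe (ιℤ i ≈ ιℤ j)
  i coeff≟ j with i ℤ.≟ j
  ... | yes eq = just (reflexive (≡.cong ιℤ eq))
  ... | no  _  = nothing

  open Algebra.Solver.Ring ℤ.+-*-rawRing (fromCommutativeRing commutativeRing) ιℤ-morphism _coeff≟_ public
    using (solve; _:=_; con; _:+_; _:*_; :-_; _:-_; Polynomial)

  :0 :1 : ∀ {n} → Polynomial n
  :0 = con (+ 0)
  :1 = con (+ 1)

  infix 8 _⁻¹⟨_⟩

  _⁻¹⟨_⟩ : ∀ x → ¬ x ≈ 0# → Carrier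
  x ⁻¹⟨ x≉0 ⟩ = proj₁ (invert x x≉0)

  *-inverse : ∀ x (x≉0 : ¬ x ≈ 0#) → x * x ⁻¹⟨ x≉0 ⟩ ≈ 1#
  *-inverse x x≉0 = proj₂ (invert x x≉0)

  cancel : ∀ {x y} → ¬ x ≈ 0# → x * y ≈ 0# → y ≈ 0#
  cancel {x} {y} x≉0 xy≈0 with invert x x≉0
  ... | i , xi≈1 = begin
    y           ≈⟨ *-identityˡ y ⟨
    1# * y      ≈⟨ *-congʳ xi≈1 ⟨
    x * i * y   ≈⟨ solve 3 (λ x i y → x :* i :* y := i :* (x :* y)) refl x i y ⟩
    i * (x * y) ≈⟨ *-congˡ xy≈0 ⟩
    i * 0#      ≈⟨ zeroʳ i ⟩
    0#          ∎

  *-≉0 : ∀ {x y} → ¬ x ≈ 0# → ¬ y ≈ 0# → ¬ x * y ≈ 0#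
  *-≉0 x≉0 y≉0 xy≈0 = y≉0 (cancel x≉0 xy≈0)

  ^-≉0 : ∀ {x} n → ¬ x ≈ 0# → ¬ x ^ n ≈ 0#
  ^-≉0 0       x≉0 = 1≉0
  ^-≉0 (suc n) x≉0 = *-≉0 x≉0 (^-≉0 n x≉0)

  ^-≈0 : ∀ {x} n → x ^ n ≈ 0# → x ≈ 0#
  ^-≈0 {x} n eq with x ≟ 0#
  ... | yes x≈0 = x≈0
  ... | no  x≉0 = ⊥-elim (^-≉0 n x≉0 eq)

  ^-cong : ∀ {x y} n → x ≈ y → x ^ n ≈ y ^ n
  ^-cong 0       eq = refl
  ^-cong (suc n) eq = *-cong eq (^-cong n eq)

  ^-+ : ∀ x m n → x ^ (m ℕ.+ n) ≈ x ^ m * x ^ n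
  ^-+ x 0       n = sym (*-identityˡ _)
  ^-+ x (suc m) n = trans (*-congˡ (^-+ x m n)) (sym (*-assoc _ _ _))

  ^-* : ∀ x y n → (x * y) ^ n ≈ x ^ n * y ^ n
  ^-* x y 0       = sym (*-identityˡ _)
  ^-* x y (suc n) = trans (*-congˡ (^-* x y n)) (solve 4 (λ x y a b → x :* y :* (a :* b) := x :* a :* (y :* b)) refl x y (x ^ n) (y ^ n))

  1^ : ∀ n → 1# ^ n ≈ 1#
  1^ 0       = refl
  1^ (suc n) = trans (*-identityˡ _) (1^ n)

  x-y≈0⇒x≈y : ∀ {x y} → x - y ≈ 0# → x ≈ y
  x-y≈0⇒x≈y {x} {y} eq = begin
    x           ≈⟨ solve 2 (λ x y → x := x :- y :+ y) refl x y ⟩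
    x - y + y   ≈⟨ +-congʳ eq ⟩
    0# + y      ≈⟨ +-identityˡ y ⟩
    y           ∎

  x≈y⇒x-y≈0 : ∀ {x y} → x ≈ y → x - y ≈ 0#
  x≈y⇒x-y≈0 {x} {y} eq = trans (+-congʳ eq) (-‿inverseʳ y)

  cancel-≈ : ∀ {x y z} → ¬ x ≈ 0# → x * y ≈ x * z → y ≈ z
  cancel-≈ {x} {y} {z} x≉0 eq = x-y≈0⇒x≈y (cancel x≉0 (begin
    x * (y - z)   ≈⟨ solve 3 (λ x y z → x :* (y :- z) := x :* y :- x :* z) refl x y z ⟩
    x * y - x * z ≈⟨ x≈y⇒x-y≈0 eq ⟩
    0#            ∎))

  ≈-stable : ∀ {x y} → ¬ ¬ x ≈ y → x ≈ y
  ≈-stable {x} {y} nn with x ≟ y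
  ... | yes eq = eq
  ... | no neq = ⊥-elim (nn neq)

  ι-≈0 : ∀ {q} → ι q ≈ 0# → q ≡ 0ℚ
  ι-≈0 {q} eq with q ℚ.≟ 0ℚ
  ... | yes q≡0 = q≡0
  ... | no  q≢0 = ⊥-elim (1≉0 (begin
    1#              ≈⟨ ι-1 ⟨
    ι 1ℚ            ≈⟨ ι-cong (≡.sym (ℚ.*-inverseʳ q {{nz}})) ⟩
    ι (q ℚ.* (ℚ.1/ q) {{nz}}) ≈⟨ ι-* _ _ ⟩
    ι q * _         ≈⟨ *-congʳ eq ⟩
    0# * _          ≈⟨ zeroˡ _ ⟩
    0#              ∎))
    where nz = ℚ.≢-nonZero q≢0

  ι-injective : ∀ {p q} → ι p ≈ ι q → p ≡ q
  ι-injective {p} {q} eq = ℚ-lemma (ι-≈0 (begin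
    ι (p ℚ.- q)     ≈⟨ ι-+ _ _ ⟩
    ι p + ι (ℚ.- q) ≈⟨ +-cong eq (ι-neg q) ⟩
    ι q - ι q       ≈⟨ -‿inverseʳ _ ⟩
    0#              ∎))
    where
    ℚ-lemma : p ℚ.- q ≡ 0ℚ → p ≡ q
    ℚ-lemma e = ≡.trans (≡.sym (ℚ.+-identityʳ p)) (≡.trans (≡.cong (p ℚ.+_) (≡.sym (ℚ.+-inverseˡ q)))
      (≡.trans (≡.sym (ℚ.+-assoc p (ℚ.- q) q)) (≡.trans (≡.cong (ℚ._+ q) e) (ℚ.+-identityˡ q))))

  nat : ℕ → Carrier
  nat 0       = 0#
  nat (suc n) = 1# + nat n

  nat≈ι : ∀ n → nat n ≈ ι (fromℤ (+ n))
  nat≈ι 0       = sym ι-0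
  nat≈ι (suc n) = trans (+-cong (sym ι-1) (nat≈ι n)) (trans (sym (ι-+ _ _)) (ι-cong (≡.sym (fromℤ-+ (+ 1) (+ n)))))

  nat-injective : ∀ {m n} → nat m ≈ nat n → m ≡ n
  nat-injective {m} {n} eq = ℤ.+-injective (fromℤ-injective (ι-injective (trans (sym (nat≈ι m)) (trans eq (nat≈ι n)))))

  nat-suc≉0 : ∀ n → ¬ nat (suc n) ≈ 0#
  nat-suc≉0 n eq = ℕ.1+n≢0 (nat-injective {suc n} {0} eq)

  -- Univariate polynomials, as lists of coefficients starting with the constant term

  -- Abstracted from the coefficients because the same operations serve for numbers and for
  -- functions of a parameter (`Param`): polynomials in y over the polynomials in x, and polynomials
  -- paired with their conjugates.
  module ListOps {a} {A : Set a} (_+_ _*_ : A → A → A) (0# : A) where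

    infixl 6 _⊞_
    infixl 7 _⊠_

    _⊞_ : List A → List A → List A
    []       ⊞ bs       = bs
    (a ∷ as) ⊞ []       = a ∷ as
    (a ∷ as) ⊞ (b ∷ bs) = (a + b) ∷ as ⊞ bs

    scale : A → List A → List A
    scale a = map (a *_)

    _⊠_ : List A → List A → List A
    []       ⊠ bs = []
    (a ∷ as) ⊠ bs = scale a bs ⊞ (0# ∷ as ⊠ bs)

    length-⊞ : ∀ {n} as bs → length as ℕ.≤ n → length bs ℕ.≤ n → length (as ⊞ bs) ℕ.≤ n
    length-⊞ []       bs       p       q       = q
    length-⊞ (a ∷ as) []       p       q       = p
    length-⊞ (a ∷ as) (b ∷ bs) (s≤s p) (s≤s q) = s≤s (length-⊞ as bs p q)

    length-⊠ : ∀ {m n} as bs → length as ℕ.≤ m → length bs ℕ.≤ suc n → length (as ⊠ bs) ℕ.≤ m ℕ.+ n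
    length-⊠ []       bs p       q = z≤n
    length-⊠ {suc m} {n} (a ∷ as) bs (s≤s p) q = length-⊞ (scale a bs) _
      (≡.subst (ℕ._≤ suc m ℕ.+ n) (≡.sym (List.length-map (a *_) bs)) (ℕ.≤-trans q (s≤s (ℕ.m≤n+m n m))))
      (s≤s (length-⊠ as bs p q))

    module Closed {p} {P : A → Set p} (P+ : ∀ {x y} → P x → P y → P (x + y)) (P* : ∀ {x y} → P x → P y → P (x * y)) (P0 : P 0#) where

      All-⊞ : ∀ {as bs} → All P as → All P bs → All P (as ⊞ bs)
      All-⊞ []         qs       = qs
      All-⊞ (p ∷ ps)   []       = p ∷ ps
      All-⊞ (p ∷ ps)   (q ∷ qs) = P+ p q ∷ All-⊞ ps qs

      All-scale : ∀ {a bs} → P a → All P bs → All P (scale a bs)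
      All-scale p []       = []
      All-scale p (q ∷ qs) = P* p q ∷ All-scale p qs

      All-⊠ : ∀ {as bs} → All P as → All P bs → All P (as ⊠ bs)
      All-⊠ []       qs = []
      All-⊠ (p ∷ ps) qs = All-⊞ (All-scale p qs) (P0 ∷ All-⊠ ps qs)

  open ListOps _+_ _*_ 0# public

  ⟦_⟧ : List Carrier → Carrier → Carrier
  ⟦ [] ⟧     t = 0#
  ⟦ a ∷ as ⟧ t = a + t * ⟦ as ⟧ t

  ⟦⟧-cong : ∀ as {s t} → s ≈ t → ⟦ as ⟧ s ≈ ⟦ as ⟧ t
  ⟦⟧-cong []       eq = refl
  ⟦⟧-cong (a ∷ as) eq = +-congˡ (*-cong eq (⟦⟧-cong as eq))

  ⟦⟧-⊞ : ∀ as bs t → ⟦ as ⊞ bs ⟧ t ≈ ⟦ as ⟧ t + ⟦ bs ⟧ t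
  ⟦⟧-⊞ []       bs       t = sym (+-identityˡ _)
  ⟦⟧-⊞ (a ∷ as) []       t = sym (+-identityʳ _)
  ⟦⟧-⊞ (a ∷ as) (b ∷ bs) t = trans (+-congˡ (*-congˡ (⟦⟧-⊞ as bs t)))
    (solve 5 (λ a b t x y → a :+ b :+ t :* (x :+ y) := a :+ t :* x :+ (b :+ t :* y)) refl a b t (⟦ as ⟧ t) (⟦ bs ⟧ t))

  ⟦⟧-scale : ∀ a bs t → ⟦ scale a bs ⟧ t ≈ a * ⟦ bs ⟧ t
  ⟦⟧-scale a []       t = sym (zeroʳ a)
  ⟦⟧-scale a (b ∷ bs) t = trans (+-congˡ (*-congˡ (⟦⟧-scale a bs t)))
    (solve 4 (λ a b t y → a :* b :+ t :* (a :* y) := a :* (b :+ t :* y)) refl a b t (⟦ bs ⟧ t))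

  ⟦⟧-⊠ : ∀ as bs t → ⟦ as ⊠ bs ⟧ t ≈ ⟦ as ⟧ t * ⟦ bs ⟧ t
  ⟦⟧-⊠ []       bs t = sym (zeroˡ _)
  ⟦⟧-⊠ (a ∷ as) bs t = trans (⟦⟧-⊞ (scale a bs) (0# ∷ as ⊠ bs) t)
    (trans (+-cong (⟦⟧-scale a bs t) (+-congˡ (*-congˡ (⟦⟧-⊠ as bs t))))
    (solve 4 (λ a t x y → a :* y :+ (:0 :+ t :* (x :* y)) := (a :+ t :* x) :* y) refl a t (⟦ as ⟧ t) (⟦ bs ⟧ t)))

  -- Synthetic division: the quotient of a ∷ as by t - r.
  horner : Carrier → List Carrier → List Carrier
  horner r []       = []
  horner r (a ∷ as) = ⟦ a ∷ as ⟧ r ∷ horner r as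

  length-horner : ∀ r as → length (horner r as) ≡ length as
  length-horner r []       = ≡.refl
  length-horner r (a ∷ as) = ≡.cong suc (length-horner r as)

  ⟦⟧-horner : ∀ r a as t → ⟦ a ∷ as ⟧ t ≈ ⟦ a ∷ as ⟧ r + (t - r) * ⟦ horner r as ⟧ t
  ⟦⟧-horner r a []       t = solve 3 (λ r a t → a :+ t :* :0 := a :+ r :* :0 :+ (t :- r) :* :0) refl r a t
  ⟦⟧-horner r a (b ∷ bs) t = trans (+-congˡ (*-congˡ (⟦⟧-horner r b bs t)))
    (solve 5 (λ r a t y q → a :+ t :* (y :+ (t :- r) :* q) := a :+ r :* y :+ (t :- r) :* (y :+ t :* q)) refl r a t (⟦ b ∷ bs ⟧ r) (⟦ horner r bs ⟧ t))

  root-factor : ∀ {r a as} → ⟦ a ∷ as ⟧ r ≈ 0# → ∀ t → ⟦ a ∷ as ⟧ t ≈ (t - r) * ⟦ horner r as ⟧ t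
  root-factor {r} {a} {as} eq t = trans (⟦⟧-horner r a as t) (trans (+-congʳ eq) (+-identityˡ _))

  Distinct : List Carrier → Set (c ⊔ ℓ)
  Distinct = AllPairs (λ x y → ¬ x ≈ y)

  -- Each root is split off by synthetic division, and the other roots survive because they differ
  -- from it. A list of length n has degree below n, hence n roots suffice.
  vanish : ∀ {as} xs → Distinct xs → length as ℕ.≤ length xs → All (λ x → ⟦ as ⟧ x ≈ 0#) xs → ∀ t → ⟦ as ⟧ t ≈ 0#
  vanish {[]}     xs       _          _       _        t = refl
  vanish {a ∷ as} (x ∷ xs) (x∉ ∷ dis) (s≤s p) (z ∷ zs) t = trans (root-factor {x} {a} {as} z t)
    (trans (*-congˡ (vanish {horner x as} xs dis (≡.subst (ℕ._≤ length xs) (≡.sym (length-horner x as)) p) (rest x∉ zs) t)) (zeroʳ _))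
    where
    rest : ∀ {ys} → All (λ y → ¬ x ≈ y) ys → All (λ y → ⟦ a ∷ as ⟧ y ≈ 0#) ys → All (λ y → ⟦ horner x as ⟧ y ≈ 0#) ys
    rest []       []       = []
    rest (n ∷ ns) (e ∷ es) = cancel (λ eq → n (sym (x-y≈0⇒x≈y eq))) (trans (sym (root-factor {x} {a} {as} z _)) e) ∷ rest ns es

  shifts : Carrier → ℕ → ℕ → List Carrier
  shifts s k 0       = []
  shifts s k (suc n) = s + nat k ∷ shifts s (suc k) n

  length-shifts : ∀ s k n → length (shifts s k n) ≡ n
  length-shifts s k 0       = ≡.refl
  length-shifts s k (suc n) = ≡.cong suc (length-shifts s (suc k) n)

  shifts-All : ∀ {p} {P : Carrier → Set p} s k n → (∀ j → k ℕ.≤ j → P (s + nat j)) → All P (shifts s k n)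
  shifts-All s k 0       f = []
  shifts-All s k (suc n) f = f k ℕ.≤-refl ∷ shifts-All s (suc k) n (λ j le → f j (ℕ.<⇒≤ le))

  shift-injective : ∀ s {j k} → s + nat j ≈ s + nat k → j ≡ k
  shift-injective s {j} {k} eq = nat-injective (begin
    nat j             ≈⟨ solve 2 (λ s j → j := s :+ j :- s) refl s (nat j) ⟩
    s + nat j - s     ≈⟨ +-congʳ eq ⟩
    s + nat k - s     ≈⟨ solve 2 (λ s j → s :+ j :- s := j) refl s (nat k) ⟩
    nat k             ∎)

  shifts-distinct : ∀ s k n → Distinct (shifts s k n)
  shifts-distinct s k 0       = []
  shifts-distinct s k (suc n) =
    shifts-All s (suc k) n (λ j le eq → ℕ.<⇒≢ le (shift-injective s eq)) ∷ shifts-distinct s (suc k) n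

  vanish-shifts : ∀ {as} s k → (∀ j → k ℕ.≤ j → ⟦ as ⟧ (s + nat j) ≈ 0#) → ∀ t → ⟦ as ⟧ t ≈ 0#
  vanish-shifts {as} s k f = vanish {as} (shifts s k n) (shifts-distinct s k n) (ℕ.≤-reflexive (≡.sym (length-shifts s k n))) (shifts-All s k n f)
    where n = length as

  vanish-off-point : ∀ {as} s → (∀ t → ¬ t ≈ s → ⟦ as ⟧ t ≈ 0#) → ∀ t → ⟦ as ⟧ t ≈ 0#
  vanish-off-point {as} s f = vanish-shifts {as} s 1 λ where
    0       ()
    (suc j) _ → f _ (λ eq → ℕ.1+n≢0 (shift-injective s {suc j} {0} (trans eq (sym (+-identityʳ s)))))

  -- Multiplication by t - s turns vanishing off s ∷ S into vanishing off S. The factor is then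
  -- cancelled away from s, and `vanish-off-point` recovers the value at s.
  vanish-off : ∀ {as} S → (∀ t → t ∉ S → ⟦ as ⟧ t ≈ 0#) → ∀ t → ⟦ as ⟧ t ≈ 0#
  vanish-off {as} []      f t = f t (λ ())
  vanish-off {as} (s ∷ S) f = vanish-off-point {as} s λ t t≉s →
    cancel (λ eq → t≉s (x-y≈0⇒x≈y eq)) (trans (sym (⟦⟧-linear t)) (vanish-off {(- s ∷ 1# ∷ []) ⊠ as} S g t))
    where
    ⟦⟧-linear : ∀ t → ⟦ (- s ∷ 1# ∷ []) ⊠ as ⟧ t ≈ (t - s) * ⟦ as ⟧ t
    ⟦⟧-linear t = trans (⟦⟧-⊠ (- s ∷ 1# ∷ []) as t) (*-congʳ (solve 2 (λ s t → :- s :+ t :* (:1 :+ t :* :0) := t :- s) refl s t))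
    g : ∀ t → t ∉ S → ⟦ (- s ∷ 1# ∷ []) ⊠ as ⟧ t ≈ 0#
    g t t∉S with t ≟ s
    ... | yes eq = trans (⟦⟧-linear t) (trans (*-congʳ (x≈y⇒x-y≈0 eq)) (zeroˡ _))
    ... | no neq = trans (⟦⟧-linear t) (trans (*-congˡ (f t λ { (here e) → neq e ; (there m) → t∉S m })) (zeroʳ _))

  vanish⇒zero : ∀ as → (∀ t → ⟦ as ⟧ t ≈ 0#) → All (_≈ 0#) as
  vanish⇒zero []       f = []
  vanish⇒zero (a ∷ as) f = a≈0 ∷ vanish⇒zero as (vanish-off-point {as} 0# λ t t≉0 → cancel t≉0 (trans (sym (+-identityˡ _)) (trans (+-congʳ (sym a≈0)) (f t))))
    where
    a≈0 : a ≈ 0#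
    a≈0 = trans (solve 2 (λ a x → a := a :+ :0 :* x) refl a (⟦ as ⟧ 0#)) (f 0#)

  zero⇒vanish : ∀ {as} → All (_≈ 0#) as → ∀ t → ⟦ as ⟧ t ≈ 0#
  zero⇒vanish []       t = refl
  zero⇒vanish (p ∷ ps) t = trans (+-cong p (*-congˡ (zero⇒vanish ps t))) (trans (+-congˡ (zeroʳ t)) (+-identityʳ 0#))

  -- as + l tⁿ with n the length of as.
  Mon : List Carrier → Carrier → Carrier → Carrier
  Mon []       l t = l
  Mon (a ∷ as) l t = a + t * Mon as l t

  Mon-⟦⟧ : ∀ as l t → Mon as l t ≈ ⟦ as ⟧ t + l * t ^ length as
  Mon-⟦⟧ []       l t = solve 1 (λ l → l := :0 :+ l :* :1) refl l
  Mon-⟦⟧ (a ∷ as) l t = trans (+-congˡ (*-congˡ (Mon-⟦⟧ as l t)))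
    (solve 5 (λ a t x l p → a :+ t :* (x :+ l :* p) := a :+ t :* x :+ l :* (t :* p)) refl a t (⟦ as ⟧ t) l (t ^ length as))

  Mon-snoc : ∀ as l t → Mon as l t ≈ ⟦ as ++ l ∷ [] ⟧ t
  Mon-snoc []       l t = solve 2 (λ l t → l := l :+ t :* :0) refl l t
  Mon-snoc (a ∷ as) l t = +-congˡ (*-congˡ (Mon-snoc as l t))

  Mon-cong : ∀ as l {s t} → s ≈ t → Mon as l s ≈ Mon as l t
  Mon-cong []       l eq = refl
  Mon-cong (a ∷ as) l eq = +-congˡ (*-cong eq (Mon-cong as l eq))

  -- Exact degree and factorisation into linear factors

  strip : ∀ as → (∀ t → ⟦ as ⟧ t ≈ 0#) ⊎ (∃[ bs ] ∃[ l ] ¬ l ≈ 0# × (∀ t → ⟦ as ⟧ t ≈ Mon bs l t) × length bs ℕ.< length as)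
  strip []       = inj₁ λ _ → refl
  strip (a ∷ as) with strip as
  ... | inj₂ (bs , l , l≉0 , eq , le) = inj₂ (a ∷ bs , l , l≉0 , (λ t → +-congˡ (*-congˡ (eq t))) , s≤s le)
  ... | inj₁ z with a ≟ 0#
  ...   | yes a≈0 = inj₁ λ t → trans (+-cong a≈0 (*-congˡ (z t))) (trans (+-congˡ (zeroʳ t)) (+-identityʳ 0#))
  ...   | no  a≉0 = inj₂ ([] , a , a≉0 , (λ t → trans (+-congˡ (*-congˡ (z t))) (trans (+-congˡ (zeroʳ t)) (+-identityʳ a))) , s≤s z≤n)

  *-sum-cong : ∀ n t {f g : Fin n → Carrier} → (∀ i → t * f i ≈ g i) → t * sum f ≈ sum g
  *-sum-cong 0       t eq = zeroʳ t
  *-sum-cong (suc n) t eq = trans (distribˡ _ _ _) (+-cong (eq Fin.zero) (*-sum-cong n t (λ i → eq (Fin.suc i))))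

  ⟦⟧-sum : ∀ as t → ⟦ as ⟧ t ≈ sum (λ i → lookup as i * t ^ Fin.toℕ i)
  ⟦⟧-sum []       t = refl
  ⟦⟧-sum (a ∷ as) t = +-cong (sym (*-identityʳ a)) (trans (*-congˡ (⟦⟧-sum as t))
    (*-sum-cong (length as) t {λ i → lookup as i * t ^ Fin.toℕ i} {λ i → lookup as i * (t * t ^ Fin.toℕ i)} λ i → solve 3 (λ t x p → t :* (x :* p) := x :* (t :* p)) refl t (lookup as i) (t ^ Fin.toℕ i)))

  -- `algebraicallyClosed` concerns monic polynomials of positive degree: hence the division by l
  -- and the nonempty list.
  Mon-root : ∀ a as {l} → ¬ l ≈ 0# → ∃[ t ] Mon (a ∷ as) l t ≈ 0#
  Mon-root a as {l} l≉0 with algebraicallyClosed (λ i → l ⁻¹⟨ l≉0 ⟩ * lookup (a ∷ as) i)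
  ... | t , eq = t , (begin
    Mon (a ∷ as) l t        ≈⟨ Mon-⟦⟧ (a ∷ as) l t ⟩
    ⟦ a ∷ as ⟧ t + l * p    ≈⟨ +-congʳ (⟦⟧-sum (a ∷ as) t) ⟩
    S + l * p               ≈⟨ +-congʳ (trans (sym (*-identityˡ S)) (*-congʳ (sym (*-inverse l l≉0)))) ⟩
    l * i * S + l * p       ≈⟨ solve 4 (λ l i S p → l :* i :* S :+ l :* p := l :* (p :+ i :* S)) refl l i S p ⟩
    l * (p + i * S)         ≈⟨ *-congˡ (+-congˡ (*-sum-cong (length (a ∷ as)) i {λ j → lookup (a ∷ as) j * t ^ Fin.toℕ j} {λ j → i * lookup (a ∷ as) j * t ^ Fin.toℕ j} λ j → sym (*-assoc i _ _))) ⟩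
    l * evalMonic (λ j → i * lookup (a ∷ as) j) t ≈⟨ *-congˡ eq ⟩
    l * 0#                  ≈⟨ zeroʳ l ⟩
    0#                      ∎)
    where
    i = l ⁻¹⟨ l≉0 ⟩
    p = t ^ length (a ∷ as)
    S = sum (λ j → lookup (a ∷ as) j * t ^ Fin.toℕ j)

  Mon-horner : Carrier → Carrier → List Carrier → List Carrier
  Mon-horner l r []       = []
  Mon-horner l r (a ∷ as) = Mon (a ∷ as) l r ∷ Mon-horner l r as

  length-Mon-horner : ∀ l r as → length (Mon-horner l r as) ≡ length as
  length-Mon-horner l r []       = ≡.refl
  length-Mon-horner l r (a ∷ as) = ≡.cong suc (length-Mon-horner l r as)

  Mon-division : ∀ l r a as t → Mon (a ∷ as) l t ≈ Mon (a ∷ as) l r + (t - r) * Mon (Mon-horner l r as) l t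
  Mon-division l r a []       t = solve 4 (λ l r a t → a :+ t :* l := a :+ r :* l :+ (t :- r) :* l) refl l r a t
  Mon-division l r a (b ∷ bs) t = trans (+-congˡ (*-congˡ (Mon-division l r b bs t)))
    (solve 5 (λ r a t y q → a :+ t :* (y :+ (t :- r) :* q) := a :+ r :* y :+ (t :- r) :* (y :+ t :* q)) refl r a t (Mon (b ∷ bs) l r) (Mon (Mon-horner l r bs) l t))

  ∏ : List Carrier → Carrier → Carrier
  ∏ []       t = 1#
  ∏ (r ∷ rs) t = (t - r) * ∏ rs t

  ∏-root : ∀ {rs t} → t ∈ rs → ∏ rs t ≈ 0#
  ∏-root (here eq) = trans (*-congʳ (x≈y⇒x-y≈0 eq)) (zeroˡ _)
  ∏-root (there m) = trans (*-congˡ (∏-root m)) (zeroʳ _)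

  root-∏ : ∀ {rs t} → ∏ rs t ≈ 0# → t ∈ rs
  root-∏ {[]}     eq = ⊥-elim (1≉0 eq)
  root-∏ {r ∷ rs} {t} eq with t ≟ r
  ... | yes t≈r = here t≈r
  ... | no  t≉r = there (root-∏ (cancel (λ e → t≉r (x-y≈0⇒x≈y e)) eq))

  Mon-factor : ∀ n as {l} → length as ≡ n → ¬ l ≈ 0# → ∃[ rs ] length rs ≡ n × (∀ t → Mon as l t ≈ l * ∏ rs t)
  Mon-factor 0       []       _   l≉0 = [] , ≡.refl , λ t → sym (*-identityʳ _)
  Mon-factor (suc n) (a ∷ as) {l} len l≉0 =
    let r , root     = Mon-root a as l≉0
        rs , lr , eq = Mon-factor n (Mon-horner l r as) (≡.trans (length-Mon-horner l r as) (ℕ.suc-injective len)) l≉0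
    in r ∷ rs , ≡.cong suc lr , λ t → trans (Mon-division l r a as t) (trans (+-congʳ root) (trans (+-identityˡ _)
         (trans (*-congˡ (eq t)) (solve 3 (λ x l p → x :* (l :* p) := l :* (x :* p)) refl (t - r) l (∏ rs t)))))

  strip-factor : ∀ as → (∀ t → ⟦ as ⟧ t ≈ 0#) ⊎ (∃[ l ] ∃[ rs ] ¬ l ≈ 0# × (∀ t → ⟦ as ⟧ t ≈ l * ∏ rs t) × length rs ℕ.< length as)
  strip-factor as with strip as
  ... | inj₁ z = inj₁ z
  ... | inj₂ (bs , l , l≉0 , eq , le) =
    let rs , lr , eq′ = Mon-factor (length bs) bs ≡.refl l≉0
    in inj₂ (l , rs , l≉0 , (λ t → trans (eq t) (eq′ t)) , ≡.subst (ℕ._< length as) (≡.sym lr) le)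

  -- Derivatives of univariate polynomials

  IsPoly : (Carrier → Carrier) → Set (c ⊔ ℓ)
  IsPoly f = ∃[ as ] ∀ t → f t ≈ ⟦ as ⟧ t

  derivFrom : ℕ → List Carrier → List Carrier
  derivFrom k []       = []
  derivFrom k (a ∷ as) = nat k * a ∷ derivFrom (suc k) as

  deriv : List Carrier → List Carrier
  deriv []       = []
  deriv (a ∷ as) = derivFrom 1 as

  length-derivFrom : ∀ k as → length (derivFrom k as) ≡ length as
  length-derivFrom k []       = ≡.refl
  length-derivFrom k (a ∷ as) = ≡.cong suc (length-derivFrom (suc k) as)

  length-deriv : ∀ {n} as → length as ℕ.≤ suc n → length (deriv as) ℕ.≤ n
  length-deriv []       le       = z≤n
  length-deriv {n} (a ∷ as) (s≤s le) = ≡.subst (ℕ._≤ n) (≡.sym (length-derivFrom 1 as)) le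

  derivFrom-suc : ∀ k as t → ⟦ derivFrom (suc k) as ⟧ t ≈ ⟦ as ⟧ t + ⟦ derivFrom k as ⟧ t
  derivFrom-suc k []       t = sym (+-identityʳ _)
  derivFrom-suc k (a ∷ as) t = trans (+-congˡ (*-congˡ (derivFrom-suc (suc k) as t)))
    (solve 5 (λ n a t x y → (:1 :+ n) :* a :+ t :* (x :+ y) := a :+ t :* x :+ (n :* a :+ t :* y)) refl (nat k) a t (⟦ as ⟧ t) (⟦ derivFrom (suc k) as ⟧ t))

  ⟦⟧-deriv-∷ : ∀ a as t → ⟦ deriv (a ∷ as) ⟧ t ≈ ⟦ as ⟧ t + t * ⟦ deriv as ⟧ t
  ⟦⟧-deriv-∷ a []       t = solve 1 (λ t → :0 := :0 :+ t :* :0) refl t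
  ⟦⟧-deriv-∷ a (b ∷ bs) t = trans (+-congˡ (*-congˡ (derivFrom-suc 1 bs t)))
    (solve 4 (λ b t x y → (:1 :+ :0) :* b :+ t :* (x :+ y) := b :+ t :* x :+ t :* y) refl b t (⟦ bs ⟧ t) (⟦ deriv (b ∷ bs) ⟧ t))

  ⟦⟧-deriv-⊞ : ∀ as bs t → ⟦ deriv (as ⊞ bs) ⟧ t ≈ ⟦ deriv as ⟧ t + ⟦ deriv bs ⟧ t
  ⟦⟧-deriv-⊞ []       bs       t = sym (+-identityˡ _)
  ⟦⟧-deriv-⊞ (a ∷ as) []       t = sym (+-identityʳ _)
  ⟦⟧-deriv-⊞ (a ∷ as) (b ∷ bs) t = begin
    ⟦ deriv (a + b ∷ as ⊞ bs) ⟧ t                  ≈⟨ ⟦⟧-deriv-∷ (a + b) (as ⊞ bs) t ⟩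
    ⟦ as ⊞ bs ⟧ t + t * ⟦ deriv (as ⊞ bs) ⟧ t       ≈⟨ +-cong (⟦⟧-⊞ as bs t) (*-congˡ (⟦⟧-deriv-⊞ as bs t)) ⟩
    ⟦ as ⟧ t + ⟦ bs ⟧ t + t * (⟦ deriv as ⟧ t + ⟦ deriv bs ⟧ t)
      ≈⟨ solve 5 (λ x y t z w → x :+ y :+ t :* (z :+ w) := x :+ t :* z :+ (y :+ t :* w)) refl (⟦ as ⟧ t) (⟦ bs ⟧ t) t (⟦ deriv as ⟧ t) (⟦ deriv bs ⟧ t) ⟩
    ⟦ as ⟧ t + t * ⟦ deriv as ⟧ t + (⟦ bs ⟧ t + t * ⟦ deriv bs ⟧ t) ≈⟨ +-cong (⟦⟧-deriv-∷ a as t) (⟦⟧-deriv-∷ b bs t) ⟨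
    ⟦ deriv (a ∷ as) ⟧ t + ⟦ deriv (b ∷ bs) ⟧ t     ∎

  ⟦⟧-deriv-scale : ∀ a bs t → ⟦ deriv (scale a bs) ⟧ t ≈ a * ⟦ deriv bs ⟧ t
  ⟦⟧-deriv-scale a []       t = sym (zeroʳ a)
  ⟦⟧-deriv-scale a (b ∷ bs) t = begin
    ⟦ deriv (scale a (b ∷ bs)) ⟧ t                 ≈⟨ ⟦⟧-deriv-∷ (a * b) (scale a bs) t ⟩
    ⟦ scale a bs ⟧ t + t * ⟦ deriv (scale a bs) ⟧ t ≈⟨ +-cong (⟦⟧-scale a bs t) (*-congˡ (⟦⟧-deriv-scale a bs t)) ⟩
    a * ⟦ bs ⟧ t + t * (a * ⟦ deriv bs ⟧ t)         ≈⟨ solve 4 (λ a x t y → a :* x :+ t :* (a :* y) := a :* (x :+ t :* y)) refl a (⟦ bs ⟧ t) t (⟦ deriv bs ⟧ t) ⟩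
    a * (⟦ bs ⟧ t + t * ⟦ deriv bs ⟧ t)             ≈⟨ *-congˡ (⟦⟧-deriv-∷ b bs t) ⟨
    a * ⟦ deriv (b ∷ bs) ⟧ t                        ∎

  ⟦⟧-deriv-⊠ : ∀ as bs t → ⟦ deriv (as ⊠ bs) ⟧ t ≈ ⟦ deriv as ⟧ t * ⟦ bs ⟧ t + ⟦ as ⟧ t * ⟦ deriv bs ⟧ t
  ⟦⟧-deriv-⊠ []       bs t = solve 2 (λ x y → :0 := :0 :* x :+ :0 :* y) refl (⟦ bs ⟧ t) (⟦ deriv bs ⟧ t)
  ⟦⟧-deriv-⊠ (a ∷ as) bs t = begin
    ⟦ deriv (scale a bs ⊞ (0# ∷ as ⊠ bs)) ⟧ t                       ≈⟨ ⟦⟧-deriv-⊞ (scale a bs) (0# ∷ as ⊠ bs) t ⟩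
    ⟦ deriv (scale a bs) ⟧ t + ⟦ deriv (0# ∷ as ⊠ bs) ⟧ t           ≈⟨ +-cong (⟦⟧-deriv-scale a bs t) (⟦⟧-deriv-∷ 0# (as ⊠ bs) t) ⟩
    a * B′ + (⟦ as ⊠ bs ⟧ t + t * ⟦ deriv (as ⊠ bs) ⟧ t)             ≈⟨ +-congˡ (+-cong (⟦⟧-⊠ as bs t) (*-congˡ (⟦⟧-deriv-⊠ as bs t))) ⟩
    a * B′ + (A * B + t * (A′ * B + A * B′))                         ≈⟨ solve 6 (λ a t A B A′ B′ → a :* B′ :+ (A :* B :+ t :* (A′ :* B :+ A :* B′)) := (A :+ t :* A′) :* B :+ (a :+ t :* A) :* B′) refl a t A B A′ B′ ⟩
    (A + t * A′) * B + (a + t * A) * B′                              ≈⟨ +-congʳ (*-congʳ (⟦⟧-deriv-∷ a as t)) ⟨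
    ⟦ deriv (a ∷ as) ⟧ t * B + ⟦ a ∷ as ⟧ t * B′                    ∎
    where
    A = ⟦ as ⟧ t
    B = ⟦ bs ⟧ t
    A′ = ⟦ deriv as ⟧ t
    B′ = ⟦ deriv bs ⟧ t

  derivFrom-zero : ∀ k {as} → All (_≈ 0#) as → All (_≈ 0#) (derivFrom k as)
  derivFrom-zero k []       = []
  derivFrom-zero k (p ∷ ps) = trans (*-congˡ p) (zeroʳ _) ∷ derivFrom-zero (suc k) ps

  zero-derivFrom : ∀ k as → All (_≈ 0#) (derivFrom (suc k) as) → All (_≈ 0#) as
  zero-derivFrom k []       []       = []
  zero-derivFrom k (a ∷ as) (p ∷ ps) = cancel (nat-suc≉0 k) p ∷ zero-derivFrom (suc k) as ps

  -- Polynomials are treated as functions, which determine them because the field is infinite. The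
  -- coefficient list is only a witness: by `hasDeriv-unique` the derivative does not depend on it.
  record HasDeriv (f f′ : Carrier → Carrier) : Set (c ⊔ ℓ) where
    constructor hasDeriv
    field
      coeffs  : List Carrier
      value   : ∀ t → f t ≈ ⟦ coeffs ⟧ t
      value′  : ∀ t → f′ t ≈ ⟦ deriv coeffs ⟧ t

  ⟦⟧-hasDeriv : ∀ as → HasDeriv ⟦ as ⟧ ⟦ deriv as ⟧
  ⟦⟧-hasDeriv as = hasDeriv as (λ _ → refl) (λ _ → refl)

  const-hasDeriv : ∀ a → HasDeriv (λ _ → a) (λ _ → 0#)
  const-hasDeriv a = hasDeriv (a ∷ []) (λ t → solve 2 (λ a t → a := a :+ t :* :0) refl a t) (λ _ → refl)

  id-hasDeriv : HasDeriv (λ t → t) (λ _ → 1#)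
  id-hasDeriv = hasDeriv (0# ∷ 1# ∷ []) (λ t → solve 1 (λ t → t := :0 :+ t :* (:1 :+ t :* :0)) refl t)
    (λ t → solve 1 (λ t → :1 := (:1 :+ :0) :* :1 :+ t :* :0) refl t)

  +-hasDeriv : ∀ {f f′ g g′} → HasDeriv f f′ → HasDeriv g g′ → HasDeriv (λ t → f t + g t) (λ t → f′ t + g′ t)
  +-hasDeriv (hasDeriv as v v′) (hasDeriv bs w w′) = hasDeriv (as ⊞ bs)
    (λ t → trans (+-cong (v t) (w t)) (sym (⟦⟧-⊞ as bs t))) (λ t → trans (+-cong (v′ t) (w′ t)) (sym (⟦⟧-deriv-⊞ as bs t)))

  *-hasDeriv : ∀ {f f′ g g′} → HasDeriv f f′ → HasDeriv g g′ → HasDeriv (λ t → f t * g t) (λ t → f′ t * g t + f t * g′ t)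
  *-hasDeriv (hasDeriv as v v′) (hasDeriv bs w w′) = hasDeriv (as ⊠ bs)
    (λ t → trans (*-cong (v t) (w t)) (sym (⟦⟧-⊠ as bs t)))
    (λ t → trans (+-cong (*-cong (v′ t) (w t)) (*-cong (v t) (w′ t))) (sym (⟦⟧-deriv-⊠ as bs t)))

  hasDeriv-resp : ∀ {f f′ g g′} → (∀ t → g t ≈ f t) → (∀ t → g′ t ≈ f′ t) → HasDeriv f f′ → HasDeriv g g′
  hasDeriv-resp e e′ (hasDeriv as v v′) = hasDeriv as (λ t → trans (e t) (v t)) (λ t → trans (e′ t) (v′ t))

  hasDeriv-zero : ∀ {f f′} → HasDeriv f f′ → (∀ t → f t ≈ 0#) → ∀ t → f′ t ≈ 0#
  hasDeriv-zero (hasDeriv []       v v′) z t = v′ t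
  hasDeriv-zero (hasDeriv (a ∷ as) v v′) z t with vanish⇒zero (a ∷ as) (λ s → trans (sym (v s)) (z s))
  ... | _ ∷ ps = trans (v′ t) (zero⇒vanish (derivFrom-zero 1 ps) t)

  hasDeriv-const : ∀ {f f′} → HasDeriv f f′ → (∀ t → f′ t ≈ 0#) → ∀ s t → f s ≈ f t
  hasDeriv-const (hasDeriv []       v v′) z s t = trans (v s) (sym (v t))
  hasDeriv-const (hasDeriv (a ∷ as) v v′) z s t = trans (const s) (sym (const t))
    where
    ps = zero-derivFrom 0 as (vanish⇒zero (derivFrom 1 as) (λ r → trans (sym (v′ r)) (z r)))
    const : ∀ r → _ ≈ a
    const r = trans (v r) (trans (+-congˡ (trans (*-congˡ (zero⇒vanish ps r)) (zeroʳ r))) (+-identityʳ a))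

  hasDeriv-unique : ∀ {f f′ g g′} → HasDeriv f f′ → HasDeriv g g′ → (∀ t → f t ≈ g t) → ∀ t → f′ t ≈ g′ t
  hasDeriv-unique {f} {f′} {g} {g′} F G e t = x-y≈0⇒x≈y (trans (solve 3 (λ x y z → x :- y := x :+ (:0 :* z :+ :- :1 :* y)) refl (f′ t) (g′ t) (g t))
    (hasDeriv-zero (+-hasDeriv F (*-hasDeriv (const-hasDeriv (- 1#)) G)) (λ s → trans (+-congʳ (e s)) (solve 1 (λ y → y :+ :- :1 :* y := :0) refl (g s))) t))

  hasDeriv-isPoly : ∀ {f f′} → HasDeriv f f′ → IsPoly f
  hasDeriv-isPoly (hasDeriv as v _) = as , v

  isPoly-hasDeriv : ∀ {f} → IsPoly f → ∃[ f′ ] HasDeriv f f′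
  isPoly-hasDeriv (as , v) = _ , hasDeriv as v (λ _ → refl)

  minus-hasDeriv : ∀ {f f′} a → HasDeriv f f′ → HasDeriv (λ t → f t - a) f′
  minus-hasDeriv a F = hasDeriv-resp (λ _ → refl) (λ _ → sym (+-identityʳ _)) (+-hasDeriv F (const-hasDeriv (- a)))

  pow-hasDeriv : ∀ {f f′} n → HasDeriv f f′ → HasDeriv (λ t → f t ^ suc n) (λ t → nat (suc n) * f t ^ n * f′ t)
  pow-hasDeriv {f} {f′} 0 F = hasDeriv-resp (λ t → *-identityʳ _) (λ t → solve 1 (λ x → (:1 :+ :0) :* :1 :* x := x) refl (f′ t)) F
  pow-hasDeriv {f} {f′} (suc n) F = hasDeriv-resp (λ _ → refl)
    (λ t → solve 4 (λ n x p y → (:1 :+ (:1 :+ n)) :* (x :* p) :* y := y :* (x :* p) :+ x :* ((:1 :+ n) :* p :* y)) refl (nat n) (f t) (f t ^ n) (f′ t))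
    (*-hasDeriv F (pow-hasDeriv n F))

  ∏-hasDeriv : ∀ rs → ∃[ f′ ] HasDeriv (∏ rs) f′
  ∏-hasDeriv []       = _ , const-hasDeriv 1#
  ∏-hasDeriv (r ∷ rs) = _ , *-hasDeriv (minus-hasDeriv r id-hasDeriv) (proj₂ (∏-hasDeriv rs))

  -- Zeros of polynomials in one variable

  double-root : ∀ {f f′ r gs l} → HasDeriv f f′ → (∀ t → f t ≈ l * ((t - r) * ((t - r) * ∏ gs t))) → f r ≈ 0# × f′ r ≈ 0#
  double-root {f} {f′} {r} {gs} {l} F eq = trans (eq r) (trans (*-congˡ (trans (*-congʳ (-‿inverseʳ r)) (zeroˡ _))) (zeroʳ l)) ,
    trans (hasDeriv-unique F (*-hasDeriv (const-hasDeriv l) (*-hasDeriv lin (*-hasDeriv lin (proj₂ (∏-hasDeriv gs))))) eq r)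
    (solve 4 (λ l r p q → :0 :* ((r :- r) :* ((r :- r) :* p)) :+ l :* (:1 :* ((r :- r) :* p) :+ (r :- r) :* (:1 :* p :+ (r :- r) :* q)) := :0)
      refl l r (∏ gs r) (proj₁ (∏-hasDeriv gs) r))
    where lin = minus-hasDeriv r id-hasDeriv

  -- The nonzero f has finitely many zeros, and g vanishes off them.
  poly-domain : ∀ {f g} → IsPoly f → IsPoly g → (∀ t → f t * g t ≈ 0#) → ∀ {s} → ¬ f s ≈ 0# → ∀ t → g t ≈ 0#
  poly-domain {f} {g} (as , v) (bs , w) z {s} nz t with strip-factor as
  ... | inj₁ zero = ⊥-elim (nz (trans (v s) (zero s)))
  ... | inj₂ (l , rs , l≉0 , eq , _) = trans (w t) (vanish-off {bs} rs
          (λ r r∉ → trans (sym (w r)) (cancel (λ fr≈0 → r∉ (root-∏ (cancel l≉0 (trans (sym (eq r)) (trans (sym (v r)) fr≈0))))) (z r))) t)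

  nonvanishing⇒const : ∀ {f} → IsPoly f → (∀ t → ¬ f t ≈ 0#) → ∀ s t → f s ≈ f t
  nonvanishing⇒const {f} (as , v) nz s t with strip as
  ... | inj₁ zero = ⊥-elim (nz s (trans (v s) (zero s)))
  ... | inj₂ ([]     , l , _   , eq , _) = trans (trans (v s) (eq s)) (sym (trans (v t) (eq t)))
  ... | inj₂ (b ∷ bs , l , l≉0 , eq , _) = let r , root = Mon-root b bs l≉0 in ⊥-elim (nz r (trans (v r) (trans (eq r) root)))

  ∏-single : ∀ {rs r} → All (_≈ r) rs → ∀ t → ∏ rs t ≈ (t - r) ^ length rs
  ∏-single []       t = refl
  ∏-single (p ∷ ps) t = *-cong (+-congˡ (-‿cong p)) (∏-single ps t)

  ∏-roots : ∀ rs → All (λ r → ∏ rs r ≈ 0#) rs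
  ∏-roots []       = []
  ∏-roots (r ∷ rs) = trans (*-congʳ (-‿inverseʳ r)) (zeroˡ _) ∷ All.map (λ e → trans (*-congˡ e) (zeroʳ _)) (∏-roots rs)

  -- All roots in the linear factorisation coincide with r. The zero polynomial is excluded because
  -- r + 1 would be another root.
  unique-root : ∀ {f r} → IsPoly f → f r ≈ 0# → (∀ t → f t ≈ 0# → t ≈ r) → ∃[ l ] ∃[ k ] ¬ l ≈ 0# × (∀ t → f t ≈ l * (t - r) ^ suc k)
  unique-root {f} {r} (as , v) root uniq with strip-factor as
  ... | inj₁ zero = ⊥-elim (1≉0 (begin
          1#          ≈⟨ solve 1 (λ r → :1 := r :+ :1 :- r) refl r ⟩
          r + 1# - r  ≈⟨ x≈y⇒x-y≈0 (uniq (r + 1#) (trans (v _) (zero _))) ⟩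
          0#          ∎))
  ... | inj₂ (l , rs , l≉0 , eq , _) = go rs eq (∏-single (All.map (λ {x} e → uniq x (trans (v x) (trans (eq x) (trans (*-congˡ e) (zeroʳ l))))) (∏-roots rs)))
    where
    go : ∀ rs → (∀ t → ⟦ as ⟧ t ≈ l * ∏ rs t) → (∀ t → ∏ rs t ≈ (t - r) ^ length rs) → ∃[ l ] ∃[ k ] ¬ l ≈ 0# × (∀ t → f t ≈ l * (t - r) ^ suc k)
    go []       eq e = ⊥-elim (l≉0 (trans (sym (*-identityʳ l)) (trans (sym (trans (v r) (eq r))) root)))
    go (s ∷ rs) eq e = l , length rs , l≉0 , λ t → trans (v t) (trans (eq t) (*-congˡ (e t)))

  extract : ∀ {r} rs → r ∈ rs → ∃[ gs ] ∀ t → ∏ rs t ≈ (t - r) * ∏ gs t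
  extract (s ∷ rs) (here eq) = rs , λ t → *-congʳ (+-congˡ (-‿cong (sym eq)))
  extract {r} (s ∷ rs) (there m) = let gs , e = extract rs m in s ∷ gs , λ t → trans (*-congˡ (e t))
    (solve 3 (λ x y z → x :* (y :* z) := y :* (x :* z)) refl (t - s) (t - r) (∏ gs t))

  distinct-or-double : ∀ rs → Distinct rs ⊎ (∃[ r ] ∃[ gs ] ∀ t → ∏ rs t ≈ (t - r) * ((t - r) * ∏ gs t))
  distinct-or-double [] = inj₁ []
  distinct-or-double (r ∷ rs) with Any.any? (r ≟_) rs
  ... | yes m = let gs , e = extract rs m in inj₂ (r , gs , λ t → *-congˡ (e t))
  ... | no ¬m with distinct-or-double rs
  ...   | inj₁ d = inj₁ (notAny rs ¬m ∷ d)
    where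
    notAny : ∀ rs → ¬ Any (r ≈_) rs → All (λ s → ¬ r ≈ s) rs
    notAny []       _ = []
    notAny (s ∷ rs) n = (λ e → n (here e)) ∷ notAny rs (λ m → n (there m))
  ...   | inj₂ (s , gs , e) = inj₂ (s , r ∷ gs , λ t → trans (*-congˡ (e t)) (solve 3 (λ x y z → x :* (y :* (y :* z)) := y :* (y :* (x :* z))) refl (t - r) (t - s) (∏ gs t)))

  ∈-resp-≈ : ∀ {x y} {S : List Carrier} → x ≈ y → y ∈ S → x ∈ S
  ∈-resp-≈ e = Any.map (trans e)

  ∈-map : ∀ {f : Carrier → Carrier} → (∀ {x y} → x ≈ y → f x ≈ f y) → ∀ {x} {S : List Carrier} → x ∈ S → f x ∈ map f S
  ∈-map cong (here e)  = here (cong e)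
  ∈-map cong (there m) = there (∈-map cong m)

  -- Sard's theorem for polynomials: a nonzero derivative has finitely many zeros, and with
  -- derivative zero f takes a single value.
  critical-values : ∀ {f f′} → HasDeriv f f′ → ∃[ S ] ∀ w → f′ w ≈ 0# → f w ∈ S
  critical-values {f} {f′} F@(hasDeriv as v v′) with strip-factor (deriv as)
  ... | inj₁ zero = f 0# ∷ [] , λ w _ → here (hasDeriv-const F (λ t → trans (v′ t) (zero t)) w 0#)
  ... | inj₂ (l , rs , l≉0 , eq , _) = map ⟦ as ⟧ rs , λ w e →
          ∈-resp-≈ (v w) (∈-map (⟦⟧-cong as) (root-∏ (cancel l≉0 (trans (sym (trans (v′ w) (eq w))) e))))

  simple-roots : ∀ {f f′ l rs} → HasDeriv f f′ → (∀ t → f t ≈ l * ∏ rs t) → (∀ t → f t ≈ 0# → ¬ f′ t ≈ 0#) → Distinct rs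
  simple-roots {f} {f′} {l} {rs} F eq simple with distinct-or-double rs
  ... | inj₁ d = d
  ... | inj₂ (r , gs , e) = let z , z′ = double-root {gs = gs} F (λ t → trans (eq t) (*-congˡ (e t))) in ⊥-elim (simple r z z′)

  map-Distinct : ∀ {w : Carrier → Carrier} {p} {P : Carrier → Set p} → (∀ {s t} → P s → P t → w s ≈ w t → s ≈ t) → ∀ {rs} → All P rs → Distinct rs → Distinct (map w rs)
  map-Distinct inj []       []       = []
  map-Distinct {w} {P = P} inj (p ∷ ps) (n ∷ d) = go ps n ∷ map-Distinct inj ps d
    where
    go : ∀ {rs} → All P rs → All (λ s → ¬ _ ≈ s) rs → All (λ s → ¬ w _ ≈ s) (map w rs)
    go []       []       = []
    go (q ∷ qs) (n ∷ ns) = (λ e → n (inj p q e)) ∷ go qs ns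

  -- The curve (z , w) meets the line z = 0 transversally, at points where the
  -- restriction h of the equation takes the noncritical value a.
  degree-bound : ∀ {z z′ w h h′ a n} → HasDeriv z z′ → (H : HasDeriv h h′) → length (HasDeriv.coeffs H) ℕ.≤ suc n →
    (∀ t → z t ≈ 0# → h (w t) ≈ a) → (∀ {s t} → z s ≈ 0# → z t ≈ 0# → w s ≈ w t → s ≈ t) →
    (∀ t → z t ≈ 0# → z′ t ≈ 0# → h′ (w t) ≈ 0#) → (∀ v → h′ v ≈ 0# → ¬ h v ≈ a) →
    ∃[ as ] length as ℕ.≤ suc n × (∀ t → z t ≈ ⟦ as ⟧ t)
  degree-bound {z} {z′} {w} {h} {h′} {a} {n} Z H@(hasDeriv hs hv hv′) len on inj transversal noncritical with strip (HasDeriv.coeffs Z)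
  ... | inj₁ zero = [] , z≤n , λ t → trans (HasDeriv.value Z t) (zero t)
  ... | inj₂ (bs , l , l≉0 , eq , _) = bs ++ l ∷ [] , bound , λ t → trans (HasDeriv.value Z t) (trans (eq t) (Mon-snoc bs l t))
    where
    fac = Mon-factor (length bs) bs ≡.refl l≉0
    rs = proj₁ fac
    zeq : ∀ t → z t ≈ l * ∏ rs t
    zeq t = trans (HasDeriv.value Z t) (trans (eq t) (proj₂ (proj₂ fac) t))
    zroots : All (λ r → z r ≈ 0#) rs
    zroots = All.map (λ {r} e → trans (zeq r) (trans (*-congˡ e) (zeroʳ l))) (∏-roots rs)
    dis : Distinct (map w rs)
    dis = map-Distinct inj zroots (simple-roots Z zeq (λ t e e′ → noncritical (w t) (transversal t e e′) (on t e)))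
    ks = hs ⊞ (- a ∷ [])
    kv : ∀ t → ⟦ ks ⟧ t ≈ h t - a
    kv t = trans (⟦⟧-⊞ hs (- a ∷ []) t) (+-cong (sym (hv t)) (solve 2 (λ a t → :- a :+ t :* :0 := :- a) refl a t))
    kroots : ∀ {rs} → All (λ r → z r ≈ 0#) rs → All (λ x → ⟦ ks ⟧ x ≈ 0#) (map w rs)
    kroots []       = []
    kroots (p ∷ ps) = trans (kv _) (x≈y⇒x-y≈0 (on _ p)) ∷ kroots ps
    -- With at least `length ks` zeros, h - a would vanish identically; then 0 would be a critical
    -- point with value a.
    few : length rs ℕ.< length ks
    few = ℕ.≰⇒> λ le →
      let van = λ t → x-y≈0⇒x≈y (trans (sym (kv t)) (vanish {ks} (map w rs) dis (≡.subst (length ks ℕ.≤_) (≡.sym (List.length-map w rs)) le) (kroots zroots) t))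
      in noncritical 0# (hasDeriv-unique H (const-hasDeriv a) van 0#) (van 0#)
    bound : length (bs ++ l ∷ []) ℕ.≤ suc n
    bound = ≡.subst (ℕ._≤ suc n) (≡.sym (≡.trans (List.length-++ bs) (ℕ.+-comm (length bs) 1)))
      (ℕ.≤-trans (≡.subst (λ k → suc k ℕ.≤ length ks) (proj₁ (proj₂ fac)) few) (length-⊞ hs (- a ∷ []) len (s≤s z≤n)))

  -- Polynomials in two variables and their bracket

  isPoly-0 : IsPoly (λ _ → 0#)
  isPoly-0 = [] , λ _ → refl

  isPoly-const : ∀ a → IsPoly (λ _ → a)
  isPoly-const a = hasDeriv-isPoly (const-hasDeriv a)

  isPoly-id : IsPoly (λ t → t)
  isPoly-id = hasDeriv-isPoly id-hasDeriv

  isPoly-+ : ∀ {f g} → IsPoly f → IsPoly g → IsPoly (λ t → f t + g t)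
  isPoly-+ (as , v) (bs , w) = as ⊞ bs , λ t → trans (+-cong (v t) (w t)) (sym (⟦⟧-⊞ as bs t))

  isPoly-* : ∀ {f g} → IsPoly f → IsPoly g → IsPoly (λ t → f t * g t)
  isPoly-* (as , v) (bs , w) = as ⊠ bs , λ t → trans (*-cong (v t) (w t)) (sym (⟦⟧-⊠ as bs t))

  isPoly-neg : ∀ {f} → IsPoly f → IsPoly (λ t → - f t)
  isPoly-neg (as , v) = scale (- 1#) as , λ t → trans (-‿cong (v t)) (trans (solve 1 (λ x → :- x := :- :1 :* x) refl _) (sym (⟦⟧-scale (- 1#) as t)))

  -- Polynomials whose coefficients depend on a parameter i ∈ I.
  module Param {i} (I : Set i) where

    private
      module F = ListOps {A = I → Carrier} (λ f g i → f i + g i) (λ f g i → f i * g i) (λ _ → 0#)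
    open F public using () renaming (_⊞_ to _⊞F_; scale to scaleF; _⊠_ to _⊠F_; length-⊞ to length-⊞F; length-⊠ to length-⊠F; module Closed to ClosedF)

    at : I → List (I → Carrier) → List Carrier
    at i = map (λ f → f i)

    at-⊞ : ∀ i fs gs → at i (fs ⊞F gs) ≡ at i fs ⊞ at i gs
    at-⊞ i []       gs       = ≡.refl
    at-⊞ i (f ∷ fs) []       = ≡.refl
    at-⊞ i (f ∷ fs) (g ∷ gs) = ≡.cong (_ ∷_) (at-⊞ i fs gs)

    at-scale : ∀ i f gs → at i (scaleF f gs) ≡ scale (f i) (at i gs)
    at-scale i f []       = ≡.refl
    at-scale i f (g ∷ gs) = ≡.cong (_ ∷_) (at-scale i f gs)

    at-⊠ : ∀ i fs gs → at i (fs ⊠F gs) ≡ at i fs ⊠ at i gs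
    at-⊠ i []       gs = ≡.refl
    at-⊠ i (f ∷ fs) gs = ≡.trans (at-⊞ i (scaleF f gs) _) (≡.cong₂ _⊞_ (at-scale i f gs) (≡.cong (0# ∷_) (at-⊠ i fs gs)))

    ⟦⟧F-⊞ : ∀ i fs gs t → ⟦ at i (fs ⊞F gs) ⟧ t ≈ ⟦ at i fs ⟧ t + ⟦ at i gs ⟧ t
    ⟦⟧F-⊞ i fs gs t = trans (reflexive (≡.cong (λ l → ⟦ l ⟧ t) (at-⊞ i fs gs))) (⟦⟧-⊞ (at i fs) (at i gs) t)

    ⟦⟧F-⊠ : ∀ i fs gs t → ⟦ at i (fs ⊠F gs) ⟧ t ≈ ⟦ at i fs ⟧ t * ⟦ at i gs ⟧ t
    ⟦⟧F-⊠ i fs gs t = trans (reflexive (≡.cong (λ l → ⟦ l ⟧ t) (at-⊠ i fs gs))) (⟦⟧-⊠ (at i fs) (at i gs) t)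

    ⟦⟧F-scale : ∀ i f gs t → ⟦ at i (scaleF f gs) ⟧ t ≈ f i * ⟦ at i gs ⟧ t
    ⟦⟧F-scale i f gs t = trans (reflexive (≡.cong (λ l → ⟦ l ⟧ t) (at-scale i f gs))) (⟦⟧-scale (f i) (at i gs) t)

    -- Pseudo-division: the leading coefficient `l` need not be invertible, so the dividend is
    -- multiplied by a power of it. The predicate `P` is carried along so that quotient and
    -- remainder have coefficients of the same kind as the input.
    module Division {p} {P : (I → Carrier) → Set p}
      (P+ : ∀ {f g} → P f → P g → P (λ i → f i + g i)) (P* : ∀ {f g} → P f → P g → P (λ i → f i * g i))
      (P- : ∀ {f} → P f → P (λ i → - f i)) (P0 : P (λ _ → 0#)) (P1 : P (λ _ → 1#))
      (l : I → Carrier) (Pl : P l) where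

      -- The coefficient of the dividend in the degree of the divisor; 0 when the dividend is too
      -- short to have one.
      top : List (I → Carrier) → List (I → Carrier) → I → Carrier
      top []       []       i = 0#
      top []       (f ∷ fs) i = f i
      top (m ∷ ms) []       i = 0#
      top (m ∷ ms) (f ∷ fs) i = top ms fs i

      rest : (I → Carrier) → List (I → Carrier) → List (I → Carrier) → List (I → Carrier)
      rest τ []       fs       = []
      rest τ (m ∷ ms) []       = []
      rest τ (m ∷ ms) (f ∷ fs) = (λ i → l i * f i + - (τ i * m i)) ∷ rest τ ms fs

      length-rest : ∀ τ ms fs → length (rest τ ms fs) ℕ.≤ length ms
      length-rest τ []       fs       = z≤n
      length-rest τ (m ∷ ms) []       = z≤n
      length-rest τ (m ∷ ms) (f ∷ fs) = s≤s (length-rest τ ms fs)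

      rest-eval : ∀ ms fs → length fs ℕ.≤ suc (length ms) → ∀ i t →
        l i * ⟦ at i fs ⟧ t ≈ top ms fs i * Mon (at i ms) (l i) t + ⟦ at i (rest (top ms fs) ms fs) ⟧ t
      rest-eval []       []           le i t = solve 1 (λ l → l :* :0 := :0 :* l :+ :0) refl (l i)
      rest-eval []       (f ∷ [])     le i t = solve 3 (λ l f t → l :* (f :+ t :* :0) := f :* l :+ :0) refl (l i) (f i) t
      rest-eval []       (f ∷ g ∷ fs) (s≤s ()) i t
      rest-eval (m ∷ ms) []           le i t = solve 2 (λ l x → l :* :0 := :0 :* x :+ :0) refl (l i) _
      rest-eval (m ∷ ms) (f ∷ fs)     (s≤s le) i t = begin
        l i * (f i + t * ⟦ at i fs ⟧ t)         ≈⟨ solve 4 (λ l f t x → l :* (f :+ t :* x) := l :* f :+ t :* (l :* x)) refl (l i) (f i) t (⟦ at i fs ⟧ t) ⟩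
        l i * f i + t * (l i * ⟦ at i fs ⟧ t)   ≈⟨ +-congˡ (*-congˡ (rest-eval ms fs le i t)) ⟩
        l i * f i + t * (top ms fs i * Mon (at i ms) (l i) t + r)
          ≈⟨ solve 7 (λ l f t τ M r m → l :* f :+ t :* (τ :* M :+ r) := τ :* (m :+ t :* M) :+ (l :* f :- τ :* m :+ t :* r)) refl (l i) (f i) t (top ms fs i) (Mon (at i ms) (l i) t) r (m i) ⟩
        top ms fs i * (m i + t * Mon (at i ms) (l i) t) + (l i * f i + - (top ms fs i * m i) + t * r) ∎
        where r = ⟦ at i (rest (top ms fs) ms fs) ⟧ t

      P-top : ∀ ms fs → All P fs → P (top ms fs)
      P-top []       []       ps       = P0
      P-top []       (f ∷ fs) (p ∷ ps) = p
      P-top (m ∷ ms) []       ps       = P0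
      P-top (m ∷ ms) (f ∷ fs) (p ∷ ps) = P-top ms fs ps

      P-rest : ∀ {τ} → P τ → ∀ {ms fs} → All P ms → All P fs → All P (rest τ ms fs)
      P-rest pτ []       ps       = []
      P-rest pτ (q ∷ qs) []       = []
      P-rest pτ (q ∷ qs) (p ∷ ps) = P+ (P* Pl p) (P- (P* pτ q)) ∷ P-rest pτ qs ps

      P-pow : ∀ k → P (λ i → l i ^ k)
      P-pow 0       = P1
      P-pow (suc k) = P* Pl (P-pow k)

      open ClosedF {P = P} P+ P* P0

      record DivMod (ms fs : List (I → Carrier)) : Set (i ⊔ c ⊔ ℓ ⊔ p) where
        field
          power       : ℕ
          quotient    : List (I → Carrier)
          remainder   : List (I → Carrier)
          P-quotient  : All P quotient
          P-remainder : All P remainder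
          length-quotient  : length quotient ℕ.≤ length fs ℕ.∸ length ms
          length-remainder : length remainder ℕ.≤ length ms
          equation    : ∀ i t → l i ^ power * ⟦ at i fs ⟧ t ≈ Mon (at i ms) (l i) t * ⟦ at i quotient ⟧ t + ⟦ at i remainder ⟧ t

      divMod : ∀ ms fs → All P ms → All P fs → DivMod ms fs
      divMod ms fs pms pfs with length fs ℕ.≤? length ms
      ... | yes le = record { power = 0 ; quotient = [] ; remainder = fs ; P-quotient = [] ; P-remainder = pfs ; length-quotient = z≤n ; length-remainder = le
                            ; equation = λ i t → solve 2 (λ x m → :1 :* x := m :* :0 :+ x) refl _ _ }
      divMod ms [] pms pfs | no ¬le = ⊥-elim (¬le z≤n)
      divMod ms (f ∷ fs) pms (pf ∷ pfs) | no ¬le = record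
        { power = suc k ; quotient = τ ∷ scaleF l q ; remainder = rest τ ms g ; P-quotient = pτ ∷ All-scale Pl P-quotient
        ; P-remainder = P-rest pτ pms pg
        ; length-quotient = ≡.subst₂ ℕ._≤_ (≡.cong suc (≡.sym (List.length-map _ q))) (≡.sym (ℕ.+-∸-assoc 1 (ℕ.≤-pred (ℕ.≰⇒> ¬le)))) (s≤s length-quotient)
        ; length-remainder = length-rest τ ms g
        ; equation = λ i t → let r = ⟦ at i remainder ⟧ t ; Q = ⟦ at i q ⟧ t ; M = Mon (at i ms) (l i) t in begin
            l i * l i ^ k * (f i + t * ⟦ at i fs ⟧ t)
              ≈⟨ solve 5 (λ l p f t x → l :* p :* (f :+ t :* x) := l :* (p :* f :+ t :* (p :* x))) refl (l i) (l i ^ k) (f i) t (⟦ at i fs ⟧ t) ⟩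
            l i * (l i ^ k * f i + t * (l i ^ k * ⟦ at i fs ⟧ t)) ≈⟨ *-congˡ (+-congˡ (*-congˡ (equation i t))) ⟩
            l i * (l i ^ k * f i + t * (M * Q + r))
              ≈⟨ solve 6 (λ l f t M Q r → l :* (f :+ t :* (M :* Q :+ r)) := M :* (t :* (l :* Q)) :+ l :* (f :+ t :* r)) refl (l i) (l i ^ k * f i) t M Q r ⟩
            M * (t * (l i * Q)) + l i * (l i ^ k * f i + t * r) ≈⟨ +-cong (*-congˡ (*-congˡ (sym (⟦⟧F-scale i l q t)))) (rest-eval ms g (s≤s length-remainder) i t) ⟩
            M * (t * ⟦ at i (scaleF l q) ⟧ t) + (τ i * M + ⟦ at i (rest τ ms g) ⟧ t)
              ≈⟨ solve 5 (λ M t q τ r → M :* (t :* q) :+ (τ :* M :+ r) := M :* (τ :+ t :* q) :+ r) refl M t (⟦ at i (scaleF l q) ⟧ t) (τ i) (⟦ at i (rest τ ms g) ⟧ t) ⟩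
            M * (τ i + t * ⟦ at i (scaleF l q) ⟧ t) + ⟦ at i (rest τ ms g) ⟧ t ∎
        }
        where
        open DivMod (divMod ms fs pms pfs)
        k = power
        q = quotient
        -- The dividend is f + t·fs. Once fs is divided, t times its remainder plus the scaled f
        -- exceeds the divisor by at most one place, so one elimination step with `τ` finishes.
        g : List (I → Carrier)
        g = (λ i → l i ^ k * f i) ∷ remainder
        pg : All P g
        pg = P* (P-pow k) pf ∷ P-remainder
        τ = top ms g
        pτ = P-top ms g pg

  -- Syntax trees make derivatives, substitution and conjugation of the constants structural.
  -- Equality is equality of values, `_≗_`, which loses nothing over an infinite field.
  data Expr : Set c where
    const   : Carrier → Expr
    X Y     : Expr
    _⊕_ _⊗_ : Expr → Expr → Expr

  infixl 6 _⊕_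
  infixl 7 _⊗_

  ⟪_⟫ : Expr → Carrier → Carrier → Carrier
  ⟪ const a ⟫ x y = a
  ⟪ X ⟫       x y = x
  ⟪ Y ⟫       x y = y
  ⟪ f ⊕ g ⟫   x y = ⟪ f ⟫ x y + ⟪ g ⟫ x y
  ⟪ f ⊗ g ⟫   x y = ⟪ f ⟫ x y * ⟪ g ⟫ x y

  ⟪⟫-cong : ∀ f {x x′ y y′} → x ≈ x′ → y ≈ y′ → ⟪ f ⟫ x y ≈ ⟪ f ⟫ x′ y′
  ⟪⟫-cong (const a) p q = refl
  ⟪⟫-cong X         p q = p
  ⟪⟫-cong Y         p q = q
  ⟪⟫-cong (f ⊕ g)   p q = +-cong (⟪⟫-cong f p q) (⟪⟫-cong g p q)
  ⟪⟫-cong (f ⊗ g)   p q = *-cong (⟪⟫-cong f p q) (⟪⟫-cong g p q)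

  infix 4 _≗_

  _≗_ : Expr → Expr → Set (c ⊔ ℓ)
  f ≗ g = ∀ x y → ⟪ f ⟫ x y ≈ ⟪ g ⟫ x y

  Zero : Expr → Set (c ⊔ ℓ)
  Zero f = ∀ x y → ⟪ f ⟫ x y ≈ 0#

  ⊝_ : Expr → Expr
  ⊝ f = const (- 1#) ⊗ f

  ∂₁ ∂₂ : Expr → Expr
  ∂₁ (const a) = const 0#
  ∂₁ X         = const 1#
  ∂₁ Y         = const 0#
  ∂₁ (f ⊕ g)   = ∂₁ f ⊕ ∂₁ g
  ∂₁ (f ⊗ g)   = ∂₁ f ⊗ g ⊕ f ⊗ ∂₁ g
  ∂₂ (const a) = const 0#
  ∂₂ X         = const 0#
  ∂₂ Y         = const 1#
  ∂₂ (f ⊕ g)   = ∂₂ f ⊕ ∂₂ g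
  ∂₂ (f ⊗ g)   = ∂₂ f ⊗ g ⊕ f ⊗ ∂₂ g

  chain : ∀ f {x x′ y y′} → HasDeriv x x′ → HasDeriv y y′ →
    HasDeriv (λ t → ⟪ f ⟫ (x t) (y t)) (λ t → ⟪ ∂₁ f ⟫ (x t) (y t) * x′ t + ⟪ ∂₂ f ⟫ (x t) (y t) * y′ t)
  chain (const a) {x} {x′} {y} {y′} p q = hasDeriv-resp (λ _ → refl) (λ t → solve 2 (λ u v → :0 :* u :+ :0 :* v := :0) refl (x′ t) (y′ t)) (const-hasDeriv a)
  chain X {x} {x′} {y} {y′} p q = hasDeriv-resp (λ _ → refl) (λ t → solve 2 (λ u v → :1 :* u :+ :0 :* v := u) refl (x′ t) (y′ t)) p
  chain Y {x} {x′} {y} {y′} p q = hasDeriv-resp (λ _ → refl) (λ t → solve 2 (λ u v → :0 :* u :+ :1 :* v := v) refl (x′ t) (y′ t)) q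
  chain (f ⊕ g) {x} {x′} {y} {y′} p q = hasDeriv-resp (λ _ → refl)
    (λ t → solve 6 (λ a b c d u v → (a :+ b) :* u :+ (c :+ d) :* v := a :* u :+ c :* v :+ (b :* u :+ d :* v)) refl (⟪ ∂₁ f ⟫ (x t) (y t)) (⟪ ∂₁ g ⟫ (x t) (y t)) (⟪ ∂₂ f ⟫ (x t) (y t)) (⟪ ∂₂ g ⟫ (x t) (y t)) (x′ t) (y′ t))
    (+-hasDeriv (chain f p q) (chain g p q))
  chain (f ⊗ g) {x} {x′} {y} {y′} p q = hasDeriv-resp (λ _ → refl)
    (λ t → solve 8 (λ f f₁ f₂ g g₁ g₂ u v → (f₁ :* g :+ f :* g₁) :* u :+ (f₂ :* g :+ f :* g₂) :* v := (f₁ :* u :+ f₂ :* v) :* g :+ f :* (g₁ :* u :+ g₂ :* v)) refl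
      (⟪ f ⟫ (x t) (y t)) (⟪ ∂₁ f ⟫ (x t) (y t)) (⟪ ∂₂ f ⟫ (x t) (y t)) (⟪ g ⟫ (x t) (y t)) (⟪ ∂₁ g ⟫ (x t) (y t)) (⟪ ∂₂ g ⟫ (x t) (y t)) (x′ t) (y′ t))
    (*-hasDeriv (chain f p q) (chain g p q))

  ∂₁-hasDeriv : ∀ f y → HasDeriv (λ x → ⟪ f ⟫ x y) (λ x → ⟪ ∂₁ f ⟫ x y)
  ∂₁-hasDeriv f y = hasDeriv-resp (λ _ → refl) (λ x → solve 2 (λ a b → a := a :* :1 :+ b :* :0) refl (⟪ ∂₁ f ⟫ x y) (⟪ ∂₂ f ⟫ x y)) (chain f id-hasDeriv (const-hasDeriv y))

  ∂₂-hasDeriv : ∀ f x → HasDeriv (λ y → ⟪ f ⟫ x y) (λ y → ⟪ ∂₂ f ⟫ x y)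
  ∂₂-hasDeriv f x = hasDeriv-resp (λ _ → refl) (λ y → solve 2 (λ a b → b := a :* :0 :+ b :* :1) refl (⟪ ∂₁ f ⟫ x y) (⟪ ∂₂ f ⟫ x y)) (chain f (const-hasDeriv x) id-hasDeriv)

  ∂₁-cong : ∀ {f g} → f ≗ g → ∂₁ f ≗ ∂₁ g
  ∂₁-cong {f} {g} e x y = hasDeriv-unique (∂₁-hasDeriv f y) (∂₁-hasDeriv g y) (λ t → e t y) x

  ∂₂-cong : ∀ {f g} → f ≗ g → ∂₂ f ≗ ∂₂ g
  ∂₂-cong {f} {g} e x y = hasDeriv-unique (∂₂-hasDeriv f x) (∂₂-hasDeriv g x) (λ t → e x t) y

  ∂₁∂₂ : ∀ f → ∂₁ (∂₂ f) ≗ ∂₂ (∂₁ f)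
  ∂₁∂₂ (const a) x y = refl
  ∂₁∂₂ X         x y = refl
  ∂₁∂₂ Y         x y = refl
  ∂₁∂₂ (f ⊕ g)   x y = +-cong (∂₁∂₂ f x y) (∂₁∂₂ g x y)
  ∂₁∂₂ (f ⊗ g)   x y = begin
    ⟪ ∂₁ (∂₂ f) ⟫ x y * g₀ + f₂ * g₁ + (f₁ * g₂ + f₀ * ⟪ ∂₁ (∂₂ g) ⟫ x y) ≈⟨ +-cong (+-congʳ (*-congʳ (∂₁∂₂ f x y))) (+-congˡ (*-congˡ (∂₁∂₂ g x y))) ⟩
    f₂₁ * g₀ + f₂ * g₁ + (f₁ * g₂ + f₀ * g₂₁)
      ≈⟨ solve 4 (λ a b c d → a :+ b :+ (c :+ d) := a :+ c :+ (b :+ d)) refl (f₂₁ * g₀) (f₂ * g₁) (f₁ * g₂) (f₀ * g₂₁) ⟩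
    f₂₁ * g₀ + f₁ * g₂ + (f₂ * g₁ + f₀ * g₂₁) ∎
    where
    f₀ = ⟪ f ⟫ x y
    g₀ = ⟪ g ⟫ x y
    f₁ = ⟪ ∂₁ f ⟫ x y
    g₁ = ⟪ ∂₁ g ⟫ x y
    f₂ = ⟪ ∂₂ f ⟫ x y
    g₂ = ⟪ ∂₂ g ⟫ x y
    f₂₁ = ⟪ ∂₂ (∂₁ f) ⟫ x y
    g₂₁ = ⟪ ∂₂ (∂₁ g) ⟫ x y

  app : List Carrier → Expr → Expr
  app []       e = const 0#
  app (a ∷ as) e = const a ⊕ e ⊗ app as e

  ⟪⟫-app : ∀ as e x y → ⟪ app as e ⟫ x y ≈ ⟦ as ⟧ (⟪ e ⟫ x y)
  ⟪⟫-app []       e x y = refl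
  ⟪⟫-app (a ∷ as) e x y = +-congˡ (*-congˡ (⟪⟫-app as e x y))

  infixr 8 _⊛_

  _⊛_ : Expr → ℕ → Expr
  e ⊛ 0     = const 1#
  e ⊛ suc n = e ⊗ e ⊛ n

  ⟪⟫-⊛ : ∀ e n x y → ⟪ e ⊛ n ⟫ x y ≈ ⟪ e ⟫ x y ^ n
  ⟪⟫-⊛ e 0       x y = refl
  ⟪⟫-⊛ e (suc n) x y = *-congˡ (⟪⟫-⊛ e n x y)

  subst : Expr → Expr → Expr → Expr
  subst (const a) p q = const a
  subst X         p q = p
  subst Y         p q = q
  subst (f ⊕ g)   p q = subst f p q ⊕ subst g p q
  subst (f ⊗ g)   p q = subst f p q ⊗ subst g p q

  ⟪⟫-subst : ∀ f p q x y → ⟪ subst f p q ⟫ x y ≡ ⟪ f ⟫ (⟪ p ⟫ x y) (⟪ q ⟫ x y)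
  ⟪⟫-subst (const a) p q x y = ≡.refl
  ⟪⟫-subst X         p q x y = ≡.refl
  ⟪⟫-subst Y         p q x y = ≡.refl
  ⟪⟫-subst (f ⊕ g)   p q x y = ≡.cong₂ _+_ (⟪⟫-subst f p q x y) (⟪⟫-subst g p q x y)
  ⟪⟫-subst (f ⊗ g)   p q x y = ≡.cong₂ _*_ (⟪⟫-subst f p q x y) (⟪⟫-subst g p q x y)

  open Param Carrier public using (at; _⊞F_; _⊠F_; scaleF; length-⊞F; length-⊠F; ⟦⟧F-⊞; ⟦⟧F-⊠; ⟦⟧F-scale; module Division)
  open Param.ClosedF Carrier {P = IsPoly} isPoly-+ isPoly-* isPoly-0 public

  ⟦_⟧₂ : List (Carrier → Carrier) → Carrier → Carrier → Carrier
  ⟦ fs ⟧₂ x y = ⟦ at x fs ⟧ y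

  coeffs₂ : Expr → List (Carrier → Carrier)
  coeffs₂ (const a) = (λ _ → a) ∷ []
  coeffs₂ X         = (λ x → x) ∷ []
  coeffs₂ Y         = (λ _ → 0#) ∷ (λ _ → 1#) ∷ []
  coeffs₂ (f ⊕ g)   = coeffs₂ f ⊞F coeffs₂ g
  coeffs₂ (f ⊗ g)   = coeffs₂ f ⊠F coeffs₂ g

  ⟪⟫-coeffs₂ : ∀ f x y → ⟪ f ⟫ x y ≈ ⟦ coeffs₂ f ⟧₂ x y
  ⟪⟫-coeffs₂ (const a) x y = solve 2 (λ a y → a := a :+ y :* :0) refl a y
  ⟪⟫-coeffs₂ X         x y = solve 2 (λ a y → a := a :+ y :* :0) refl x y
  ⟪⟫-coeffs₂ Y         x y = solve 1 (λ y → y := :0 :+ y :* (:1 :+ y :* :0)) refl y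
  ⟪⟫-coeffs₂ (f ⊕ g)   x y = trans (+-cong (⟪⟫-coeffs₂ f x y) (⟪⟫-coeffs₂ g x y)) (sym (⟦⟧F-⊞ x (coeffs₂ f) (coeffs₂ g) y))
  ⟪⟫-coeffs₂ (f ⊗ g)   x y = trans (*-cong (⟪⟫-coeffs₂ f x y) (⟪⟫-coeffs₂ g x y)) (sym (⟦⟧F-⊠ x (coeffs₂ f) (coeffs₂ g) y))

  coeffs₂-isPoly : ∀ f → All IsPoly (coeffs₂ f)
  coeffs₂-isPoly (const a) = isPoly-const a ∷ []
  coeffs₂-isPoly X         = isPoly-id ∷ []
  coeffs₂-isPoly Y         = isPoly-0 ∷ isPoly-const 1# ∷ []
  coeffs₂-isPoly (f ⊕ g)   = All-⊞ (coeffs₂-isPoly f) (coeffs₂-isPoly g)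
  coeffs₂-isPoly (f ⊗ g)   = All-⊠ (coeffs₂-isPoly f) (coeffs₂-isPoly g)

  expr : ∀ {fs} → All IsPoly fs → Expr
  expr []              = const 0#
  expr ((as , _) ∷ ps) = app as X ⊕ Y ⊗ expr ps

  ⟪⟫-expr : ∀ {fs} (ps : All IsPoly fs) x y → ⟪ expr ps ⟫ x y ≈ ⟦ fs ⟧₂ x y
  ⟪⟫-expr []              x y = refl
  ⟪⟫-expr ((as , v) ∷ ps) x y = +-cong (trans (⟪⟫-app as X x y) (sym (v x))) (*-congˡ (⟪⟫-expr ps x y))

  -- The test points are natural numbers: a witness of nonvanishing is then fixed by every
  -- conjugation (`rel-zero`), stays in a given congruence class (`base-point`) and gives an
  -- integral shear (`monic-shear`).
  search : ∀ as → (∃[ n ] ¬ ⟦ as ⟧ (nat n) ≈ 0#) ⊎ (∀ t → ⟦ as ⟧ t ≈ 0#)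
  search as = [ inj₁ , (λ all → inj₂ (vanish {as} _ (shifts-distinct 0# 0 n) (ℕ.≤-reflexive (≡.sym (length-shifts 0# 0 n))) all)) ]′ (go 0 n)
    where
    n = length as
    go : ∀ k n → (∃[ j ] ¬ ⟦ as ⟧ (nat j) ≈ 0#) ⊎ All (λ x → ⟦ as ⟧ x ≈ 0#) (shifts 0# k n)
    go k 0       = inj₂ []
    go k (suc n) with ⟦ as ⟧ (nat k) ≟ 0#
    ... | no  neq = inj₁ (k , neq)
    ... | yes eq  = [ inj₁ , (λ all → inj₂ (trans (⟦⟧-cong as (+-identityˡ (nat k))) eq ∷ all)) ]′ (go (suc k) n)

  search₂ : ∀ f → (∃[ i ] ∃[ j ] ¬ ⟪ f ⟫ (nat i) (nat j) ≈ 0#) ⊎ Zero f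
  search₂ f with go (coeffs₂-isPoly f)
    where
    go : ∀ {fs} → All IsPoly fs → (∃[ i ] ¬ All (_≈ 0#) (at (nat i) fs)) ⊎ (∀ x → All (_≈ 0#) (at x fs))
    go []              = inj₂ λ _ → []
    go ((as , v) ∷ ps) with search as | go ps
    ... | inj₁ (i , neq) | _              = inj₁ (i , λ { (e ∷ _) → neq (trans (sym (v _)) e) })
    ... | inj₂ z         | inj₁ (i , neq) = inj₁ (i , λ { (_ ∷ es) → neq es })
    ... | inj₂ z         | inj₂ zs        = inj₂ λ x → trans (v x) (z x) ∷ zs x
  ... | inj₂ z = inj₂ λ x y → trans (⟪⟫-coeffs₂ f x y) (zero⇒vanish (z x) y)
  ... | inj₁ (i , neq) with search (at (nat i) (coeffs₂ f))
  ...   | inj₁ (j , nz) = inj₁ (i , j , λ e → nz (trans (sym (⟪⟫-coeffs₂ f _ _)) e))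
  ...   | inj₂ z        = ⊥-elim (neq (vanish⇒zero _ z))

  -- Derivations and the Jacobian bracket

  record IsDerivation (d : Expr → Expr) : Set (c ⊔ ℓ) where
    field
      d-cong  : ∀ {f g} → f ≗ g → d f ≗ d g
      d-const : ∀ a → Zero (d (const a))
      d-⊕     : ∀ f g → d (f ⊕ g) ≗ d f ⊕ d g
      d-⊗     : ∀ f g → d (f ⊗ g) ≗ d f ⊗ g ⊕ f ⊗ d g

    d-app : ∀ as e → d (app as e) ≗ app (deriv as) e ⊗ d e
    d-app []       e x y = trans (d-const 0# x y) (sym (zeroˡ _))
    d-app (a ∷ as) e x y = begin
      ⟪ d (const a ⊕ e ⊗ app as e) ⟫ x y  ≈⟨ trans (d-⊕ _ _ x y) (+-cong (d-const a x y) (d-⊗ e _ x y)) ⟩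
      0# + (E′ * ⟪ app as e ⟫ x y + E * ⟪ d (app as e) ⟫ x y) ≈⟨ +-congˡ (+-cong (*-congˡ (⟪⟫-app as e x y)) (*-congˡ (trans (d-app as e x y) (*-congʳ (⟪⟫-app (deriv as) e x y))))) ⟩
      0# + (E′ * ⟦ as ⟧ E + E * (⟦ deriv as ⟧ E * E′)) ≈⟨ solve 4 (λ e′ A e A′ → :0 :+ (e′ :* A :+ e :* (A′ :* e′)) := (A :+ e :* A′) :* e′) refl E′ (⟦ as ⟧ E) E (⟦ deriv as ⟧ E) ⟩
      (⟦ as ⟧ E + E * ⟦ deriv as ⟧ E) * E′ ≈⟨ *-congʳ (trans (⟪⟫-app (deriv (a ∷ as)) e x y) (⟦⟧-deriv-∷ a as E)) ⟨
      ⟪ app (deriv (a ∷ as)) e ⟫ x y * E′ ∎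
      where
      E = ⟪ e ⟫ x y
      E′ = ⟪ d e ⟫ x y

    d-zero : ∀ {f} → Zero f → Zero (d f)
    d-zero z x y = trans (d-cong {g = const 0#} z x y) (d-const 0# x y)

  br₀ : Expr → Expr → Expr
  br₀ f g = ∂₁ f ⊗ ∂₂ g ⊕ ⊝ (∂₂ f ⊗ ∂₁ g)

  br₀-derivationʳ : ∀ f → IsDerivation (br₀ f)
  br₀-derivationʳ f = record
    { d-cong  = λ {g} {h} e x y → +-cong (*-congˡ (∂₂-cong {g} {h} e x y)) (*-congˡ (*-congˡ (∂₁-cong {g} {h} e x y)))
    ; d-const = λ a x y → solve 2 (λ u v → u :* :0 :+ :- :1 :* (v :* :0) := :0) refl (⟪ ∂₁ f ⟫ x y) (⟪ ∂₂ f ⟫ x y)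
    ; d-⊕     = λ g h x y → solve 6 (λ f₁ f₂ g₁ g₂ h₁ h₂ → f₁ :* (g₂ :+ h₂) :+ :- :1 :* (f₂ :* (g₁ :+ h₁)) := (f₁ :* g₂ :+ :- :1 :* (f₂ :* g₁)) :+ (f₁ :* h₂ :+ :- :1 :* (f₂ :* h₁)))
                  refl (⟪ ∂₁ f ⟫ x y) (⟪ ∂₂ f ⟫ x y) (⟪ ∂₁ g ⟫ x y) (⟪ ∂₂ g ⟫ x y) (⟪ ∂₁ h ⟫ x y) (⟪ ∂₂ h ⟫ x y)
    ; d-⊗     = λ g h x y → solve 8 (λ f₁ f₂ g₁ g₂ h₁ h₂ g h → f₁ :* (g₂ :* h :+ g :* h₂) :+ :- :1 :* (f₂ :* (g₁ :* h :+ g :* h₁))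
                  := (f₁ :* g₂ :+ :- :1 :* (f₂ :* g₁)) :* h :+ g :* (f₁ :* h₂ :+ :- :1 :* (f₂ :* h₁)))
                  refl (⟪ ∂₁ f ⟫ x y) (⟪ ∂₂ f ⟫ x y) (⟪ ∂₁ g ⟫ x y) (⟪ ∂₂ g ⟫ x y) (⟪ ∂₁ h ⟫ x y) (⟪ ∂₂ h ⟫ x y) (⟪ g ⟫ x y) (⟪ h ⟫ x y)
    }

  br₀-antisym : ∀ f g x y → ⟪ br₀ f g ⟫ x y ≈ - ⟪ br₀ g f ⟫ x y
  br₀-antisym f g x y = solve 4 (λ f₁ f₂ g₁ g₂ → f₁ :* g₂ :+ :- :1 :* (f₂ :* g₁) := :- (g₁ :* f₂ :+ :- :1 :* (g₂ :* f₁)))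
    refl (⟪ ∂₁ f ⟫ x y) (⟪ ∂₂ f ⟫ x y) (⟪ ∂₁ g ⟫ x y) (⟪ ∂₂ g ⟫ x y)

  br₀-derivationˡ : ∀ f → IsDerivation (λ g → br₀ g f)
  br₀-derivationˡ f = record
    { d-cong  = λ {g} {h} e x y → trans (br₀-antisym g f x y) (trans (-‿cong (d-cong {g} {h} e x y)) (sym (br₀-antisym h f x y)))
    ; d-const = λ a x y → trans (br₀-antisym (const a) f x y) (trans (-‿cong (d-const a x y)) (solve 0 (:- :0 := :0) refl))
    ; d-⊕     = λ g h x y → trans (br₀-antisym (g ⊕ h) f x y) (trans (-‿cong (d-⊕ g h x y)) (trans (solve 2 (λ u v → :- (u :+ v) := :- u :+ :- v) refl _ _) (sym (+-cong (br₀-antisym g f x y) (br₀-antisym h f x y)))))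
    ; d-⊗     = λ g h x y → trans (br₀-antisym (g ⊗ h) f x y) (trans (-‿cong (d-⊗ g h x y)) (trans (solve 4 (λ u h g v → :- (u :* h :+ g :* v) := :- u :* h :+ g :* :- v) refl _ _ _ _)
                  (sym (+-cong (*-congʳ (br₀-antisym g f x y)) (*-congˡ (br₀-antisym h f x y))))))
    }
    where open IsDerivation (br₀-derivationʳ f)

  -- Both sides expand to the same polynomial in first and second partial derivatives. The two
  -- orders of a mixed derivative are different atoms for the solver, whence `∂₁∂₂` before and after
  -- it.
  br₀-jacobi : ∀ f g h → br₀ f (br₀ g h) ≗ br₀ (br₀ f g) h ⊕ br₀ g (br₀ f h)
  br₀-jacobi f g h x y = begin
    f₁ * (⟪ ∂₂ (∂₁ g) ⟫ x y * h₂ + g₁ * h₂₂ + (0# * (g₂ * h₁) + - 1# * (g₂₂ * h₁ + g₂ * ⟪ ∂₂ (∂₁ h) ⟫ x y))) + - 1# * (f₂ * (g₁₁ * h₂ + g₁ * h₁₂ + (0# * (g₂ * h₁) + - 1# * (g₁₂ * h₁ + g₂ * h₁₁))))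
      ≈⟨ +-congʳ (*-congˡ (+-cong (+-congʳ (*-congʳ (sym (∂₁∂₂ g x y)))) (+-congˡ (*-congˡ (+-congˡ (*-congˡ (sym (∂₁∂₂ h x y)))))))) ⟩
    f₁ * (g₁₂ * h₂ + g₁ * h₂₂ + (0# * (g₂ * h₁) + - 1# * (g₂₂ * h₁ + g₂ * h₁₂))) + - 1# * (f₂ * (g₁₁ * h₂ + g₁ * h₁₂ + (0# * (g₂ * h₁) + - 1# * (g₁₂ * h₁ + g₂ * h₁₁))))
      ≈⟨ solve 15 (λ f₁ f₂ f₁₁ f₁₂ f₂₂ g₁ g₂ g₁₁ g₁₂ g₂₂ h₁ h₂ h₁₁ h₁₂ h₂₂ →
           f₁ :* (g₁₂ :* h₂ :+ g₁ :* h₂₂ :+ (:0 :* (g₂ :* h₁) :+ :- :1 :* (g₂₂ :* h₁ :+ g₂ :* h₁₂))) :+ :- :1 :* (f₂ :* (g₁₁ :* h₂ :+ g₁ :* h₁₂ :+ (:0 :* (g₂ :* h₁) :+ :- :1 :* (g₁₂ :* h₁ :+ g₂ :* h₁₁))))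
           := (f₁₁ :* g₂ :+ f₁ :* g₁₂ :+ (:0 :* (f₂ :* g₁) :+ :- :1 :* (f₁₂ :* g₁ :+ f₂ :* g₁₁))) :* h₂ :+ :- :1 :* ((f₁₂ :* g₂ :+ f₁ :* g₂₂ :+ (:0 :* (f₂ :* g₁) :+ :- :1 :* (f₂₂ :* g₁ :+ f₂ :* g₁₂))) :* h₁)
           :+ (g₁ :* (f₁₂ :* h₂ :+ f₁ :* h₂₂ :+ (:0 :* (f₂ :* h₁) :+ :- :1 :* (f₂₂ :* h₁ :+ f₂ :* h₁₂))) :+ :- :1 :* (g₂ :* (f₁₁ :* h₂ :+ f₁ :* h₁₂ :+ (:0 :* (f₂ :* h₁) :+ :- :1 :* (f₁₂ :* h₁ :+ f₂ :* h₁₁))))))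
         refl f₁ f₂ f₁₁ f₁₂ f₂₂ g₁ g₂ g₁₁ g₁₂ g₂₂ h₁ h₂ h₁₁ h₁₂ h₂₂ ⟩
    (f₁₁ * g₂ + f₁ * g₁₂ + (0# * (f₂ * g₁) + - 1# * (f₁₂ * g₁ + f₂ * g₁₁))) * h₂ + - 1# * ((f₁₂ * g₂ + f₁ * g₂₂ + (0# * (f₂ * g₁) + - 1# * (f₂₂ * g₁ + f₂ * g₁₂))) * h₁)
     + (g₁ * (f₁₂ * h₂ + f₁ * h₂₂ + (0# * (f₂ * h₁) + - 1# * (f₂₂ * h₁ + f₂ * h₁₂))) + - 1# * (g₂ * (f₁₁ * h₂ + f₁ * h₁₂ + (0# * (f₂ * h₁) + - 1# * (f₁₂ * h₁ + f₂ * h₁₁)))))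
      ≈⟨ +-cong (+-congˡ (*-congˡ (*-congʳ (+-cong (+-congʳ (*-congʳ (∂₁∂₂ f x y))) (+-congˡ (*-congˡ (+-congˡ (*-congˡ (∂₁∂₂ g x y)))))))))
                (+-congʳ (*-congˡ (+-cong (+-congʳ (*-congʳ (∂₁∂₂ f x y))) (+-congˡ (*-congˡ (+-congˡ (*-congˡ (∂₁∂₂ h x y)))))))) ⟩
    ⟪ br₀ (br₀ f g) h ⊕ br₀ g (br₀ f h) ⟫ x y ∎
    where
    f₁ = ⟪ ∂₁ f ⟫ x y
    f₂ = ⟪ ∂₂ f ⟫ x y
    f₁₁ = ⟪ ∂₁ (∂₁ f) ⟫ x y
    f₁₂ = ⟪ ∂₁ (∂₂ f) ⟫ x y
    f₂₂ = ⟪ ∂₂ (∂₂ f) ⟫ x y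
    g₁ = ⟪ ∂₁ g ⟫ x y
    g₂ = ⟪ ∂₂ g ⟫ x y
    g₁₁ = ⟪ ∂₁ (∂₁ g) ⟫ x y
    g₁₂ = ⟪ ∂₁ (∂₂ g) ⟫ x y
    g₂₂ = ⟪ ∂₂ (∂₂ g) ⟫ x y
    h₁ = ⟪ ∂₁ h ⟫ x y
    h₂ = ⟪ ∂₂ h ⟫ x y
    h₁₁ = ⟪ ∂₁ (∂₁ h) ⟫ x y
    h₁₂ = ⟪ ∂₁ (∂₂ h) ⟫ x y
    h₂₂ = ⟪ ∂₂ (∂₂ h) ⟫ x y

  -- The bracket is sealed, so that iterated brackets are not expanded.
  abstract
    br : Expr → Expr → Expr
    br = br₀

    br≡br₀ : br ≡ br₀
    br≡br₀ = ≡.refl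

  br-def : ∀ f g x y → ⟪ br f g ⟫ x y ≡ ⟪ ∂₁ f ⟫ x y * ⟪ ∂₂ g ⟫ x y + - 1# * (⟪ ∂₂ f ⟫ x y * ⟪ ∂₁ g ⟫ x y)
  br-def f g x y = ≡.cong (λ b → ⟪ b f g ⟫ x y) br≡br₀

  br-derivationʳ : ∀ f → IsDerivation (br f)
  br-derivationʳ f = ≡.subst (λ b → IsDerivation (b f)) (≡.sym br≡br₀) (br₀-derivationʳ f)

  br-derivationˡ : ∀ f → IsDerivation (λ g → br g f)
  br-derivationˡ f = ≡.subst (λ b → IsDerivation (λ g → b g f)) (≡.sym br≡br₀) (br₀-derivationˡ f)

  br-antisym : ∀ f g x y → ⟪ br f g ⟫ x y ≈ - ⟪ br g f ⟫ x y
  br-antisym = ≡.subst (λ b → ∀ f g x y → ⟪ b f g ⟫ x y ≈ - ⟪ b g f ⟫ x y) (≡.sym br≡br₀) br₀-antisym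

  jacobi : ∀ f g h → br f (br g h) ≗ br (br f g) h ⊕ br g (br f h)
  jacobi = ≡.subst (λ b → ∀ f g h → b f (b g h) ≗ b (b f g) h ⊕ b g (b f h)) (≡.sym br≡br₀) br₀-jacobi

  -- Taylor expansion along a derivation

  Seq : Set c
  Seq = ℕ → Carrier

  tail : Seq → Seq
  tail f k = f (suc k)

  conv : Seq → Seq → Seq
  conv f g 0       = f 0 * g 0
  conv f g (suc k) = f 0 * g (suc k) + conv (tail f) g k

  conv-cong : ∀ {f f′ g g′} → (∀ k → f k ≈ f′ k) → (∀ k → g k ≈ g′ k) → ∀ k → conv f g k ≈ conv f′ g′ k
  conv-cong p q 0       = *-cong (p 0) (q 0)
  conv-cong p q (suc k) = +-cong (*-cong (p 0) (q (suc k))) (conv-cong (λ j → p (suc j)) q k)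

  conv-+ˡ : ∀ f f′ g k → conv (λ i → f i + f′ i) g k ≈ conv f g k + conv f′ g k
  conv-+ˡ f f′ g 0       = distribʳ _ _ _
  conv-+ˡ f f′ g (suc k) = trans (+-congˡ (conv-+ˡ (tail f) (tail f′) g k))
    (solve 5 (λ a b z u v → (a :+ b) :* z :+ (u :+ v) := a :* z :+ u :+ (b :* z :+ v)) refl (f 0) (f′ 0) (g (suc k)) (conv (tail f) g k) (conv (tail f′) g k))

  -- The Euler operator t d/dt on coefficient sequences. Unlike d/dt it does not shift indices, so
  -- its Leibniz rule `conv-θ` is a plain induction.
  θ : Seq → Seq
  θ f k = nat k * f k

  conv-θ : ∀ f g k → nat k * conv f g k ≈ conv (θ f) g k + conv f (θ g) k
  conv-θ f g 0       = solve 2 (λ a b → :0 :* (a :* b) := :0 :* a :* b :+ a :* (:0 :* b)) refl (f 0) (g 0)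
  conv-θ f g (suc k) = begin
    (1# + nat k) * (f 0 * g (suc k) + C) ≈⟨ solve 4 (λ n a b c → (:1 :+ n) :* (a :* b :+ c) := (:1 :+ n) :* (a :* b) :+ (c :+ n :* c)) refl (nat k) (f 0) (g (suc k)) C ⟩
    (1# + nat k) * (f 0 * g (suc k)) + (C + nat k * C) ≈⟨ +-congˡ (+-congˡ (conv-θ (tail f) g k)) ⟩
    (1# + nat k) * (f 0 * g (suc k)) + (C + (conv (θ (tail f)) g k + conv (tail f) (θ g) k))
      ≈⟨ solve 6 (λ n a b c u v → (:1 :+ n) :* (a :* b) :+ (c :+ (u :+ v)) := :0 :* a :* b :+ (c :+ u) :+ (a :* ((:1 :+ n) :* b) :+ v)) refl (nat k) (f 0) (g (suc k)) C (conv (θ (tail f)) g k) (conv (tail f) (θ g) k) ⟩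
    0# * f 0 * g (suc k) + (C + conv (θ (tail f)) g k) + (f 0 * θ g (suc k) + conv (tail f) (θ g) k)
      ≈⟨ +-congʳ (+-congˡ (trans (conv-cong (λ j → solve 2 (λ n x → (:1 :+ n) :* x := x :+ n :* x) refl (nat j) (f (suc j))) (λ _ → refl) k) (conv-+ˡ (tail f) (θ (tail f)) g k))) ⟨
    0# * f 0 * g (suc k) + conv (tail (θ f)) g k + (f 0 * θ g (suc k) + conv (tail f) (θ g) k) ∎
    where C = conv (tail f) g k

  conv-tailʳ : ∀ f g → g 0 ≈ 0# → ∀ k → conv f g (suc k) ≈ conv f (tail g) k
  conv-tailʳ f g z 0       = trans (+-congˡ (trans (*-congˡ z) (zeroʳ _))) (+-identityʳ _)
  conv-tailʳ f g z (suc k) = +-congˡ (conv-tailʳ (tail f) g z k)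

  conv-tailˡ : ∀ f g → f 0 ≈ 0# → ∀ k → conv f g (suc k) ≈ conv (tail f) g k
  conv-tailˡ f g z k = trans (+-congʳ (trans (*-congʳ z) (zeroˡ _))) (+-identityˡ _)

  conv-deriv : ∀ f g k → nat (suc k) * conv f g (suc k) ≈ conv (tail (θ f)) g k + conv f (tail (θ g)) k
  conv-deriv f g k = trans (conv-θ f g (suc k)) (+-cong (conv-tailˡ (θ f) g (zeroˡ _) k) (conv-tailʳ f (θ g) (zeroˡ _) k))

  conv-zeroʳ : ∀ f g k → (∀ i → i ℕ.≤ k → g i ≈ 0#) → conv f g k ≈ 0#
  conv-zeroʳ f g 0       z = trans (*-congˡ (z 0 z≤n)) (zeroʳ _)
  conv-zeroʳ f g (suc k) z = trans (+-cong (trans (*-congˡ (z (suc k) ℕ.≤-refl)) (zeroʳ _)) (conv-zeroʳ (tail f) g k (λ i le → z i (ℕ.m≤n⇒m≤1+n le)))) (+-identityʳ _)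

  conv-zeroˡ : ∀ f g k → (∀ i → f i ≈ 0#) → conv f g k ≈ 0#
  conv-zeroˡ f g 0       z = trans (*-congʳ (z 0)) (zeroˡ _)
  conv-zeroˡ f g (suc k) z = trans (+-cong (trans (*-congʳ (z 0)) (zeroˡ _)) (conv-zeroˡ (tail f) g k (λ i → z (suc i)))) (+-identityʳ _)

  conv-constˡ : ∀ f g k → (∀ i → f (suc i) ≈ 0#) → conv f g k ≈ f 0 * g k
  conv-constˡ f g 0       z = refl
  conv-constˡ f g (suc k) z = trans (+-congˡ (conv-zeroˡ (tail f) g k z)) (+-identityʳ _)

  conv-lowest : ∀ f g j k → (∀ i → i ℕ.< j → f i ≈ 0#) → (∀ i → i ℕ.< k → g i ≈ 0#) → conv f g (j ℕ.+ k) ≈ f j * g k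
  conv-lowest f g 0       0       zf zg = refl
  conv-lowest f g 0       (suc k) zf zg = trans (+-congˡ (conv-zeroʳ (tail f) g k (λ i le → zg i (s≤s le)))) (+-identityʳ _)
  conv-lowest f g (suc j) k       zf zg = trans (conv-tailˡ f g (zf 0 (s≤s z≤n)) (j ℕ.+ k)) (conv-lowest (tail f) g j k (λ i lt → zf (suc i) (s≤s lt)) zg)

  conv-highest : ∀ f g m n → (∀ i → m ℕ.< i → f i ≈ 0#) → (∀ i → n ℕ.< i → g i ≈ 0#) → conv f g (m ℕ.+ n) ≈ f m * g n
  conv-highest f g 0       n zf zg = conv-constˡ f g n (λ i → zf (suc i) (s≤s z≤n))
  conv-highest f g (suc m) n zf zg = trans (+-congʳ (trans (*-congˡ (zg _ (s≤s (ℕ.m≤n+m n m)))) (zeroʳ _)))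
    (trans (+-identityˡ _) (conv-highest (tail f) g m n (λ i lt → zf (suc i) (s≤s lt)) zg))

  conv-above : ∀ f g m n → (∀ i → m ℕ.< i → f i ≈ 0#) → (∀ i → n ℕ.< i → g i ≈ 0#) → ∀ k → m ℕ.+ n ℕ.< k → conv f g k ≈ 0#
  conv-above f g 0       n zf zg k lt = trans (conv-constˡ f g k (λ i → zf (suc i) (s≤s z≤n))) (trans (*-congˡ (zg k lt)) (zeroʳ _))
  conv-above f g (suc m) n zf zg (suc k) (s≤s lt) = trans (+-congʳ (trans (*-congˡ (zg (suc k) (s≤s (ℕ.≤-trans (ℕ.m≤n+m n m) (ℕ.<⇒≤ lt))))) (zeroʳ _)))
    (trans (+-identityˡ _) (conv-above (tail f) g m n (λ i l → zf (suc i) (s≤s l)) zg k lt))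

  least : ∀ {p} {P : ℕ → Set p} → (∀ n → Dec (P n)) → ∀ n → P n → ∃[ m ] P m × (∀ k → k ℕ.< m → ¬ P k)
  least {P = P} P? = <-rec _ λ n rec pn → go n rec pn n ℕ.≤-refl (λ j le lt → ⊥-elim (ℕ.<⇒≱ lt le))
    where
    go : ∀ n → (∀ {m} → m ℕ.< n → P m → ∃[ k ] P k × (∀ j → j ℕ.< k → ¬ P j)) → P n → ∀ m → m ℕ.≤ n → (∀ j → m ℕ.≤ j → j ℕ.< n → ¬ P j) → ∃[ k ] P k × (∀ j → j ℕ.< k → ¬ P j)
    go n rec pn 0       le none = n , pn , λ j lt → none j z≤n lt
    go n rec pn (suc m) le none with P? m
    ... | yes pm = rec le pm
    ... | no ¬pm = go n rec pn m (ℕ.<⇒≤ le) λ j m≤j j<n pj → [ (λ m<j → none j m<j j<n pj) , (λ { ≡.refl → ¬pm pj }) ]′ (ℕ.m≤n⇒m<n∨m≡n m≤j)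

  dec-¬ : ∀ x → Dec (¬ x ≈ 0#)
  dec-¬ x with x ≟ 0#
  ... | yes e = no (λ n → n e)
  ... | no  n = yes n

  -- If g m is the first nonzero entry of g, the entry of the product at j + m gives f j = 0, by
  -- induction on j.
  conv-domain : ∀ f g → (∀ k → conv f g k ≈ 0#) → ¬ (∀ k → f k ≈ 0#) → ∀ k → g k ≈ 0#
  conv-domain f g z f≢0 k = ≈-stable λ gk≉0 →
    let m , gm≉0 , below = least (λ n → dec-¬ (g n)) k gk≉0
    in f≢0 (<-rec _ λ j rec → cancel gm≉0 (trans (*-comm _ _) (trans (sym (conv-lowest f g j m (λ i lt → rec lt) (λ i lt → ≈-stable (below i lt)))) (z (j ℕ.+ m)))))

  iter : (Expr → Expr) → ℕ → Expr → Expr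
  iter d 0       e = e
  iter d (suc k) e = iter d k (d e)

  iter-suc : ∀ d k e → iter d (suc k) e ≡ d (iter d k e)
  iter-suc d 0       e = ≡.refl
  iter-suc d (suc k) e = iter-suc d k (d e)

  iter-+ : ∀ d j k e → iter d (j ℕ.+ k) e ≡ iter d k (iter d j e)
  iter-+ d 0       k e = ≡.refl
  iter-+ d (suc j) k e = iter-+ d j k (d e)

  module Iterate {d} (D : IsDerivation d) where
    open IsDerivation D

    iter-cong : ∀ k {f g} → f ≗ g → iter d k f ≗ iter d k g
    iter-cong 0       e = e
    iter-cong (suc k) e = iter-cong k (d-cong e)

    iter-zero : ∀ k {f} → Zero f → Zero (iter d k f)
    iter-zero 0       z = z
    iter-zero (suc k) z = iter-zero k (d-zero z)

    iter-above : ∀ {j k f} → j ℕ.≤ k → Zero (iter d j f) → Zero (iter d k f)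
    iter-above {j} {k} {f} le z = ≡.subst Zero (≡.trans (≡.sym (iter-+ d j (k ℕ.∸ j) f)) (≡.cong (λ n → iter d n f) (ℕ.m+[n∸m]≡n le))) (iter-zero (k ℕ.∸ j) z)

    iter-⊕ : ∀ k f g → iter d k (f ⊕ g) ≗ iter d k f ⊕ iter d k g
    iter-⊕ 0       f g x y = refl
    iter-⊕ (suc k) f g x y = trans (iter-cong k (d-⊕ f g) x y) (iter-⊕ k (d f) (d g) x y)

    -- By the Leibniz rule every term has at least m derivatives on f or at least n on g.
    iter-⊗-zero : ∀ m n f g → Zero (iter d m f) → Zero (iter d n g) → Zero (iter d (m ℕ.+ n) (f ⊗ g))
    iter-⊗-zero 0       n       f g zf zg = iter-zero n (λ x y → trans (*-congʳ (zf x y)) (zeroˡ _))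
    iter-⊗-zero (suc m) 0       f g zf zg = iter-zero (suc m ℕ.+ 0) (λ x y → trans (*-congˡ (zg x y)) (zeroʳ _))
    iter-⊗-zero (suc m) (suc n) f g zf zg x y = begin
      ⟪ iter d (m ℕ.+ suc n) (d (f ⊗ g)) ⟫ x y ≈⟨ iter-cong (m ℕ.+ suc n) (d-⊗ f g) x y ⟩
      ⟪ iter d (m ℕ.+ suc n) (d f ⊗ g ⊕ f ⊗ d g) ⟫ x y ≈⟨ iter-⊕ (m ℕ.+ suc n) (d f ⊗ g) (f ⊗ d g) x y ⟩
      ⟪ iter d (m ℕ.+ suc n) (d f ⊗ g) ⟫ x y + ⟪ iter d (m ℕ.+ suc n) (f ⊗ d g) ⟫ x y
        ≈⟨ +-cong (iter-⊗-zero m (suc n) (d f) g zf zg x y) (≡.subst (λ k → Zero (iter d k (f ⊗ d g))) (≡.sym (ℕ.+-suc m n)) (iter-⊗-zero (suc m) n f (d g) zf zg) x y) ⟩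
      0# + 0# ≈⟨ +-identityʳ 0# ⟩
      0# ∎

    nilpotent : ∀ m n → Zero (iter d m X) → Zero (iter d n Y) → ∀ e → ∃[ k ] Zero (iter d k e)
    nilpotent m n zX zY (const a) = 1 , d-const a
    nilpotent m n zX zY X     = m , zX
    nilpotent m n zX zY Y     = n , zY
    nilpotent m n zX zY (f ⊕ g)   =
      let j , zf = nilpotent m n zX zY f
          k , zg = nilpotent m n zX zY g
      in j ℕ.+ k , λ x y → trans (iter-⊕ (j ℕ.+ k) f g x y) (trans (+-cong (iter-above (ℕ.m≤m+n j k) zf x y) (iter-above (ℕ.m≤n+m k j) zg x y)) (+-identityʳ 0#))
    nilpotent m n zX zY (f ⊗ g)   =
      let j , zf = nilpotent m n zX zY f
          k , zg = nilpotent m n zX zY g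
      in j ℕ.+ k , iter-⊗-zero j k f g zf zg

  recip-! : ℕ → Carrier
  recip-! 0       = 1#
  recip-! (suc k) = nat (suc k) ⁻¹⟨ nat-suc≉0 k ⟩ * recip-! k

  recip-!≉0 : ∀ k → ¬ recip-! k ≈ 0#
  recip-!≉0 0       = 1≉0
  recip-!≉0 (suc k) = *-≉0 (λ e → 1≉0 (trans (sym (*-inverse _ (nat-suc≉0 k))) (trans (*-congˡ e) (zeroʳ _)))) (recip-!≉0 k)

  coef : List Carrier → Seq
  coef []       k       = 0#
  coef (a ∷ as) 0       = a
  coef (a ∷ as) (suc k) = coef as k

  coef-⊞ : ∀ as bs k → coef (as ⊞ bs) k ≈ coef as k + coef bs k
  coef-⊞ []       bs       k       = sym (+-identityˡ _)
  coef-⊞ (a ∷ as) []       k       = sym (+-identityʳ _)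
  coef-⊞ (a ∷ as) (b ∷ bs) 0       = refl
  coef-⊞ (a ∷ as) (b ∷ bs) (suc k) = coef-⊞ as bs k

  coef-scale : ∀ a bs k → coef (scale a bs) k ≈ a * coef bs k
  coef-scale a []       k       = sym (zeroʳ a)
  coef-scale a (b ∷ bs) 0       = refl
  coef-scale a (b ∷ bs) (suc k) = coef-scale a bs k

  coef-⊠ : ∀ as bs k → coef (as ⊠ bs) k ≈ conv (coef as) (coef bs) k
  coef-⊠ []       bs k       = sym (conv-zeroˡ (coef []) (coef bs) k (λ _ → refl))
  coef-⊠ (a ∷ as) bs 0       = trans (coef-⊞ (scale a bs) (0# ∷ as ⊠ bs) 0) (trans (+-congʳ (coef-scale a bs 0)) (+-identityʳ _))
  coef-⊠ (a ∷ as) bs (suc k) = trans (coef-⊞ (scale a bs) (0# ∷ as ⊠ bs) (suc k)) (+-cong (coef-scale a bs (suc k)) (coef-⊠ as bs k))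

  coef-zero : ∀ as → (∀ k → coef as k ≈ 0#) → ∀ t → ⟦ as ⟧ t ≈ 0#
  coef-zero []       z t = refl
  coef-zero (a ∷ as) z t = trans (+-cong (z 0) (*-congˡ (coef-zero as (λ k → z (suc k)) t))) (trans (+-congˡ (zeroʳ t)) (+-identityʳ 0#))

  coef-const : ∀ as → (∀ k → coef as (suc k) ≈ 0#) → ∀ t → ⟦ as ⟧ t ≈ coef as 0
  coef-const []       z t = refl
  coef-const (a ∷ as) z t = trans (+-congˡ (trans (*-congˡ (coef-zero as z t)) (zeroʳ t))) (+-identityʳ a)

  coef-linear : ∀ as → (∀ k → coef as (suc (suc k)) ≈ 0#) → ∀ t → ⟦ as ⟧ t ≈ coef as 0 + t * coef as 1
  coef-linear []       z t = solve 1 (λ t → :0 := :0 :+ t :* :0) refl t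
  coef-linear (a ∷ as) z t = +-congˡ (*-congˡ (coef-const as z t))

  prefix : ℕ → Seq → List Carrier
  prefix 0       f = []
  prefix (suc n) f = f 0 ∷ prefix n (tail f)

  coef-prefix : ∀ n f → (∀ k → n ℕ.≤ k → f k ≈ 0#) → ∀ k → coef (prefix n f) k ≈ f k
  coef-prefix 0       f z k       = sym (z k z≤n)
  coef-prefix (suc n) f z 0       = refl
  coef-prefix (suc n) f z (suc k) = coef-prefix n (tail f) (λ j le → z (suc j) (s≤s le)) k

  -- The series with coefficients `taylor f k` is f along the formal trajectory of d through the
  -- point, that is, exp(t d) f evaluated there. By `taylor-⊕` and `taylor-⊗` this is a ring
  -- homomorphism to formal power series.
  module TaylorAt {d} (D : IsDerivation d) (x y : Carrier) where
    open IsDerivation D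
    open Iterate D

    taylor : Expr → Seq
    taylor e k = recip-! k * ⟪ iter d k e ⟫ x y

    taylor-suc : ∀ e k → nat (suc k) * taylor e (suc k) ≈ taylor (d e) k
    taylor-suc e k = trans (solve 4 (λ n i r z → n :* (i :* r :* z) := n :* i :* (r :* z)) refl (nat (suc k)) _ (recip-! k) _)
      (trans (*-congʳ (*-inverse _ (nat-suc≉0 k))) (*-identityˡ _))

    taylor-cong : ∀ {f g} → f ≗ g → ∀ k → taylor f k ≈ taylor g k
    taylor-cong e k = *-congˡ (iter-cong k e x y)

    taylor-zero : ∀ {e k} → Zero (iter d k e) → taylor e k ≈ 0#
    taylor-zero z = trans (*-congˡ (z x y)) (zeroʳ _)

    taylor-const : ∀ a k → taylor (const a) (suc k) ≈ 0#
    taylor-const a k = trans (*-congˡ (iter-zero k (d-const a) x y)) (zeroʳ _)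

    taylor-⊕ : ∀ f g k → taylor (f ⊕ g) k ≈ taylor f k + taylor g k
    taylor-⊕ f g k = trans (*-congˡ (iter-⊕ k f g x y)) (distribˡ _ _ _)

    taylor-⊗ : ∀ f g k → taylor (f ⊗ g) k ≈ conv (taylor f) (taylor g) k
    taylor-⊗ f g 0       = solve 2 (λ a b → :1 :* (a :* b) := :1 :* a :* (:1 :* b)) refl _ _
    taylor-⊗ f g (suc k) = cancel-≈ (nat-suc≉0 k) (begin
      nat (suc k) * taylor (f ⊗ g) (suc k)              ≈⟨ taylor-suc (f ⊗ g) k ⟩
      taylor (d (f ⊗ g)) k                               ≈⟨ trans (taylor-cong (d-⊗ f g) k) (taylor-⊕ (d f ⊗ g) (f ⊗ d g) k) ⟩
      taylor (d f ⊗ g) k + taylor (f ⊗ d g) k            ≈⟨ +-cong (taylor-⊗ (d f) g k) (taylor-⊗ f (d g) k) ⟩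
      conv (taylor (d f)) (taylor g) k + conv (taylor f) (taylor (d g)) k
        ≈⟨ +-cong (conv-cong (λ j → taylor-suc f j) (λ _ → refl) k) (conv-cong (λ _ → refl) (λ j → taylor-suc g j) k) ⟨
      conv (tail (θ (taylor f))) (taylor g) k + conv (taylor f) (tail (θ (taylor g))) k ≈⟨ conv-deriv (taylor f) (taylor g) k ⟨
      nat (suc k) * conv (taylor f) (taylor g) (suc k)   ∎)

    -- The polynomials that vanish along the formal trajectory. They form a prime ideal
    -- (`kernel-prime`) because power series have no zero divisors.
    Kernel : Expr → Set ℓ
    Kernel f = ∀ k → taylor f k ≈ 0#

    kernel-⊗ : ∀ {f} g → Kernel f → Kernel (f ⊗ g)
    kernel-⊗ {f} g z k = trans (taylor-⊗ f g k) (conv-zeroˡ _ _ k z)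

    kernel-⊕ : ∀ {f g} → Kernel f → Kernel g → Kernel (f ⊕ g)
    kernel-⊕ {f} {g} zf zg k = trans (taylor-⊕ f g k) (trans (+-cong (zf k) (zg k)) (+-identityʳ 0#))

    kernel-cong : ∀ {f g} → f ≗ g → Kernel f → Kernel g
    kernel-cong e z k = trans (sym (taylor-cong e k)) (z k)

    kernel-prime : ∀ {f} g → ¬ Kernel f → Kernel (f ⊗ g) → Kernel g
    kernel-prime {f} g f∉ fg∈ = conv-domain (taylor f) (taylor g) (λ k → trans (sym (taylor-⊗ f g k)) (fg∈ k)) f∉

    kernel-eval : ∀ {f} → Kernel f → ⟪ f ⟫ x y ≈ 0#
    kernel-eval z = trans (sym (*-identityˡ _)) (z 0)

    -- If the series of X and Y are polynomials, the trajectory is a polynomial curve, and every e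
    -- restricts to a polynomial on it whose coefficients are the Taylor coefficients of e.
    flow : ∀ xs ys → (∀ k → coef xs k ≈ taylor X k) → (∀ k → coef ys k ≈ taylor Y k) → ∀ e →
      ∃[ es ] (∀ s → ⟪ e ⟫ (⟦ xs ⟧ s) (⟦ ys ⟧ s) ≈ ⟦ es ⟧ s) × (∀ k → coef es k ≈ taylor e k)
    flow xs ys cx cy (const a) = a ∷ [] , (λ s → solve 2 (λ a s → a := a :+ s :* :0) refl a s) , λ { 0 → sym (*-identityˡ a) ; (suc k) → sym (taylor-const a k) }
    flow xs ys cx cy X = xs , (λ s → refl) , cx
    flow xs ys cx cy Y = ys , (λ s → refl) , cy
    flow xs ys cx cy (f ⊕ g) =
      let fs , vf , cf = flow xs ys cx cy f
          gs , vg , cg = flow xs ys cx cy g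
      in fs ⊞ gs , (λ s → trans (+-cong (vf s) (vg s)) (sym (⟦⟧-⊞ fs gs s))) ,
         λ k → trans (coef-⊞ fs gs k) (trans (+-cong (cf k) (cg k)) (sym (taylor-⊕ f g k)))
    flow xs ys cx cy (f ⊗ g) =
      let fs , vf , cf = flow xs ys cx cy f
          gs , vg , cg = flow xs ys cx cy g
      in fs ⊠ gs , (λ s → trans (*-cong (vf s) (vg s)) (sym (⟦⟧-⊠ fs gs s))) ,
         λ k → trans (coef-⊠ fs gs k) (trans (conv-cong cf cg k) (sym (taylor-⊗ f g k)))

  -- The lines G = a

  trivial-derivation : ∀ (d : Expr → Expr) → (∀ {f g} → f ≗ g → d f ≗ d g) → (∀ a → Zero (d (const a))) →
    (∀ f g → d (f ⊕ g) ≡ d f ⊕ d g) → (∀ f g → d (f ⊗ g) ≡ d f ⊗ g ⊕ f ⊗ d g) → IsDerivation d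
  trivial-derivation d cong z p m = record { d-cong = cong ; d-const = z
    ; d-⊕ = λ f g x y → reflexive (≡.cong (λ e → ⟪ e ⟫ x y) (p f g)) ; d-⊗ = λ f g x y → reflexive (≡.cong (λ e → ⟪ e ⟫ x y) (m f g)) }

  ∂₁-derivation : IsDerivation ∂₁
  ∂₁-derivation = trivial-derivation ∂₁ (λ {f} {g} → ∂₁-cong {f} {g}) (λ _ _ _ → refl) (λ _ _ → ≡.refl) (λ _ _ → ≡.refl)

  ∂₂-derivation : IsDerivation ∂₂
  ∂₂-derivation = trivial-derivation ∂₂ (λ {f} {g} → ∂₂-cong {f} {g}) (λ _ _ _ → refl) (λ _ _ → ≡.refl) (λ _ _ → ≡.refl)

  fresh : ∀ S → ∃[ b ] b ∉ S
  fresh S with search (HasDeriv.coeffs (proj₂ (∏-hasDeriv S)))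
  ... | inj₁ (n , nz) = nat n , λ m → nz (trans (sym (HasDeriv.value (proj₂ (∏-hasDeriv S)) (nat n))) (∏-root m))
  ... | inj₂ z = ⊥-elim (1≉0 (trans (solve 0 (:1 := :1 :+ :0 :* :0) refl)
          (vanish-off {1# ∷ []} S (λ t t∉ → ⊥-elim (t∉ (root-∏ (trans (HasDeriv.value (proj₂ (∏-hasDeriv S)) t) (z t))))) 0#)))

  ⟦⟧₂-cong : ∀ {fs} → All IsPoly fs → ∀ {x x′ y y′} → x ≈ x′ → y ≈ y′ → ⟦ fs ⟧₂ x y ≈ ⟦ fs ⟧₂ x′ y′
  ⟦⟧₂-cong ps {x} {x′} {y} {y′} p q = trans (sym (⟪⟫-expr ps x y)) (trans (⟪⟫-cong (expr ps) p q) (⟪⟫-expr ps x′ y′))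

  restrict-isPoly : ∀ f xs ys → IsPoly (λ t → ⟪ f ⟫ (⟦ xs ⟧ t) (⟦ ys ⟧ t))
  restrict-isPoly f xs ys = hasDeriv-isPoly (chain f (⟦⟧-hasDeriv xs) (⟦⟧-hasDeriv ys))

  -- The product (n + 1)⋯(n + j): the factor that j derivatives of the power j + n leave in front of
  -- the power n.
  falling : ℕ → ℕ → Carrier
  falling 0       n = 1#
  falling (suc j) n = nat (suc (j ℕ.+ n)) * falling j n

  falling≉0 : ∀ j n → ¬ falling j n ≈ 0#
  falling≉0 0       n = 1≉0
  falling≉0 (suc j) n = *-≉0 (nat-suc≉0 (j ℕ.+ n)) (falling≉0 j n)

  -- `first` is kept apart so that the degree in y is positive. With a nonzero constant as leading
  -- coefficient, division by G - a in y is possible without denominators in x, and every line x =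
  -- const meets every level of G (`solve-G`).
  record MonicInY (G : Expr) : Set (c ⊔ ℓ) where
    field
      first  : Carrier → Carrier
      others : List (Carrier → Carrier)
      lead   : Carrier
      lead≉0 : ¬ lead ≈ 0#
      first-isPoly  : IsPoly first
      others-isPoly : All IsPoly others
      monic  : ∀ x y → ⟪ G ⟫ x y ≈ Mon (at x (first ∷ others)) lead y

    degree : ℕ
    degree = suc (length others)

  -- A parametrisation γ = (xs , ys) of the line G = a with inverse s, and the
  -- intersection point of that line with F = 0.
  record Line (F G : Expr) (a : Carrier) : Set (c ⊔ ℓ) where
    field
      xs ys : List Carrier
      s     : Expr
      on    : ∀ t → ⟪ G ⟫ (⟦ xs ⟧ t) (⟦ ys ⟧ t) ≈ a
      s∘γ   : ∀ t → ⟪ s ⟫ (⟦ xs ⟧ t) (⟦ ys ⟧ t) ≈ t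
      γ∘s₁  : ∀ x y → ⟪ G ⟫ x y ≈ a → ⟦ xs ⟧ (⟪ s ⟫ x y) ≈ x
      γ∘s₂  : ∀ x y → ⟪ G ⟫ x y ≈ a → ⟦ ys ⟧ (⟪ s ⟫ x y) ≈ y
      px py : Carrier
      G-p   : ⟪ G ⟫ px py ≈ a
      F-p   : ⟪ F ⟫ px py ≈ 0#
      p-unique₁ : ∀ x y → ⟪ G ⟫ x y ≈ a → ⟪ F ⟫ x y ≈ 0# → x ≈ px
      p-unique₂ : ∀ x y → ⟪ G ⟫ x y ≈ a → ⟪ F ⟫ x y ≈ 0# → y ≈ py

  module MonicG (G : Expr) (M : MonicInY G) where
    open MonicInY M

    δ : Expr → Expr
    δ = br G
    open IsDerivation (br-derivationʳ G)

    G-_ : Carrier → Expr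
    G- a = G ⊕ const (- a)

    δ-G : ∀ a → Zero (δ (G- a))
    δ-G a x y = trans (reflexive (br-def G (G- a) x y)) (solve 2 (λ u v → u :* (v :+ :0) :+ :- :1 :* (v :* (u :+ :0)) := :0) refl (⟪ ∂₁ G ⟫ x y) (⟪ ∂₂ G ⟫ x y))

    δ-X : ∀ x y → ⟪ ∂₂ G ⟫ x y ≈ - ⟪ δ X ⟫ x y
    δ-X x y = trans (solve 2 (λ u v → v := :- (u :* :0 :+ :- :1 :* (v :* :1))) refl (⟪ ∂₁ G ⟫ x y) _) (-‿cong (reflexive (≡.sym (br-def G X x y))))

    δ-Y : ∀ x y → ⟪ ∂₁ G ⟫ x y ≈ ⟪ δ Y ⟫ x y
    δ-Y x y = trans (solve 2 (λ u v → v := v :* :1 :+ :- :1 :* (u :* :0)) refl (⟪ ∂₂ G ⟫ x y) _) (reflexive (≡.sym (br-def G Y x y)))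

    -0≈0 : - 0# ≈ 0#
    -0≈0 = solve 0 (:- :0 := :0) refl

    coeffs- : Carrier → List (Carrier → Carrier)
    coeffs- a = (λ x → first x + - a) ∷ others

    coeffs-isPoly : ∀ a → All IsPoly (coeffs- a)
    coeffs-isPoly a = isPoly-+ first-isPoly (isPoly-const (- a)) ∷ others-isPoly

    G-≈ : ∀ a x y → ⟪ G- a ⟫ x y ≈ Mon (at x (coeffs- a)) lead y
    G-≈ a x y = trans (+-congʳ (monic x y)) (solve 3 (λ f m a → f :+ m :+ :- a := f :+ :- a :+ m) refl (first x) _ a)

    solve-G : ∀ x a → ∃[ y ] ⟪ G ⟫ x y ≈ a
    solve-G x a = let y , root = Mon-root (first x + - a) (at x others) lead≉0 in y , x-y≈0⇒x≈y (trans (G-≈ a x y) root)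

    prod : List Carrier → Expr
    prod []      = const 1#
    prod (b ∷ S) = (G- b) ⊗ prod S

    ⟪⟫-prod : ∀ S x y → ⟪ prod S ⟫ x y ≈ ∏ S (⟪ G ⟫ x y)
    ⟪⟫-prod []      x y = refl
    ⟪⟫-prod (b ∷ S) x y = *-congˡ (⟪⟫-prod S x y)

    -- On a vertical line, e times the product of the G - b with b in S vanishes; the product is not
    -- zero there because G also takes a value outside S.
    dense : ∀ S e → (∀ x y → ⟪ G ⟫ x y ∉ S → ⟪ e ⟫ x y ≈ 0#) → Zero e
    dense S e z x = poly-domain (hasDeriv-isPoly (∂₂-hasDeriv (prod S) x)) (hasDeriv-isPoly (∂₂-hasDeriv e x)) vanishes
      {proj₁ (solve-G x b)} (λ eq → b∉S (∈-resp-≈ (sym (proj₂ (solve-G x b))) (root-∏ (trans (sym (⟪⟫-prod S x _)) eq))))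
      where
      b = proj₁ (fresh S)
      b∉S = proj₂ (fresh S)
      vanishes : ∀ y → ⟪ prod S ⟫ x y * ⟪ e ⟫ x y ≈ 0#
      vanishes y with Any.any? (⟪ G ⟫ x y ≟_) S
      ... | yes m  = trans (*-congʳ (trans (⟪⟫-prod S x y) (∏-root m))) (zeroˡ _)
      ... | no  ¬m = trans (*-congˡ (z x y ¬m)) (zeroʳ _)

    dense-≗ : ∀ S e e′ → (∀ x y → ⟪ G ⟫ x y ∉ S → ⟪ e ⟫ x y ≈ ⟪ e′ ⟫ x y) → e ≗ e′
    dense-≗ S e e′ z x y = x-y≈0⇒x≈y (trans (+-congˡ (solve 1 (λ v → :- v := :- :1 :* v) refl _))
      (dense S (e ⊕ ⊝ e′) (λ x y n → trans (+-congʳ (z x y n)) (solve 1 (λ v → v :+ :- :1 :* v := :0) refl _)) x y))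

    -- On a generic line the zeros of x are simple and lie over the roots of G(0 , y) = a. So the
    -- degree of x in the parameter of the line has a bound independent of a, and likewise for y.
    -- This uniformity lets one iterate of δ vanish on all generic lines at once.
    nX nY : ℕ
    nX = suc (length (HasDeriv.coeffs (∂₂-hasDeriv G 0#)))
    nY = suc (length (HasDeriv.coeffs (∂₁-hasDeriv G 0#)))

    -- On the line, δ is λ₀ d/dt and F is l (t - τ)ᵏ⁺¹.
    record GenericLine (F : Expr) (a : Carrier) : Set (c ⊔ ℓ) where
      field
        xs ys : List Carrier
        s     : Expr
      infix 9 _∘γ
      _∘γ : Expr → Carrier → Carrier
      (f ∘γ) t = ⟪ f ⟫ (⟦ xs ⟧ t) (⟦ ys ⟧ t)
      field
        on        : ∀ t → (G ∘γ) t ≈ a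
        γ∘s       : ∀ f x y → ⟪ G ⟫ x y ≈ a → ⟪ f ⟫ x y ≈ (f ∘γ) (⟪ s ⟫ x y)
        divisible : ∀ {hs} → All IsPoly hs → (∀ x y → ⟪ G ⟫ x y ≈ a → ⟦ hs ⟧₂ x y ≈ 0#) →
          ∃[ qs ] All IsPoly qs × length qs ℕ.≤ length hs ℕ.∸ degree × (∀ x y → ⟦ hs ⟧₂ x y ≈ ⟪ G- a ⟫ x y * ⟦ qs ⟧₂ x y)
        λ₀        : Carrier
        λ₀≉0      : ¬ λ₀ ≈ 0#
        δ-on-line : ∀ f {f′} → HasDeriv (f ∘γ) f′ → ∀ t → (δ f ∘γ) t ≈ λ₀ * f′ t
        iter-δ-X  : ∀ t → (iter δ nX X ∘γ) t ≈ 0#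
        iter-δ-Y  : ∀ t → (iter δ nY Y ∘γ) t ≈ 0#
        τ l       : Carrier
        k         : ℕ
        l≉0       : ¬ l ≈ 0#
        F-eq      : ∀ t → (F ∘γ) t ≈ l * (t - τ) ^ suc k

      on-line : ∀ f → (∀ t → (f ∘γ) t ≈ 0#) → ∀ x y → ⟪ G ⟫ x y ≈ a → ⟪ f ⟫ x y ≈ 0#
      on-line f z x y g = trans (γ∘s f x y g) (z _)

      δ-power : ∀ f {c n} → (∀ t → (f ∘γ) t ≈ c * (t - τ) ^ suc n) → ∀ t → (δ f ∘γ) t ≈ λ₀ * (c * nat (suc n)) * (t - τ) ^ n
      δ-power f {c} {n} v t = trans (δ-on-line f (hasDeriv-resp v (λ _ → refl) (*-hasDeriv (const-hasDeriv c) (pow-hasDeriv n (minus-hasDeriv τ id-hasDeriv)))) t)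
        (solve 5 (λ L c m p q → L :* (:0 :* q :+ c :* (m :* p :* :1)) := L :* (c :* m) :* p) refl λ₀ c (nat (suc n)) ((t - τ) ^ n) ((t - τ) ^ suc n))

      iter-δ-power : ∀ j n f {c} → (∀ t → (f ∘γ) t ≈ c * (t - τ) ^ (j ℕ.+ n)) → ∀ t → (iter δ j f ∘γ) t ≈ λ₀ ^ j * (c * falling j n) * (t - τ) ^ n
      iter-δ-power 0       n f {c} v t = trans (v t) (*-congʳ (solve 1 (λ c → c := :1 :* (c :* :1)) refl c))
      iter-δ-power (suc j) n f {c} v t = trans (iter-δ-power j n (δ f) (δ-power f {c} {j ℕ.+ n} v) t)
        (*-congʳ (solve 5 (λ p L c m q → p :* (L :* (c :* m) :* q) := L :* p :* (c :* (m :* q))) refl (λ₀ ^ j) λ₀ c (nat (suc (j ℕ.+ n))) (falling j n)))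

    -- The two noncriticality hypotheses say that the line meets the coordinate axes transversally.
    -- They yield the distinct roots `rs` of G(0 , y) - a and the degree bounds for x and y.
    module OnLine (F : Expr) (a : Carrier) (L : Line F G a)
      (noncritical₂ : ∀ y → ⟪ ∂₂ G ⟫ 0# y ≈ 0# → ¬ ⟪ G ⟫ 0# y ≈ a)
      (noncritical₁ : ∀ x → ⟪ ∂₁ G ⟫ x 0# ≈ 0# → ¬ ⟪ G ⟫ x 0# ≈ a) where
      open Line L

      infix 9 _∘γ

      _∘γ : Expr → Carrier → Carrier
      (f ∘γ) t = ⟪ f ⟫ (⟦ xs ⟧ t) (⟦ ys ⟧ t)

      γ∘s : ∀ f x y → ⟪ G ⟫ x y ≈ a → ⟪ f ⟫ x y ≈ (f ∘γ) (⟪ s ⟫ x y)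
      γ∘s f x y e = ⟪⟫-cong f (sym (γ∘s₁ x y e)) (sym (γ∘s₂ x y e))

      G-∘γ : ∀ t → ⟪ G- a ⟫ (⟦ xs ⟧ t) (⟦ ys ⟧ t) ≈ 0#
      G-∘γ t = x≈y⇒x-y≈0 (on t)

      roots : ∃[ rs ] length rs ≡ degree × (∀ y → Mon (at 0# (coeffs- a)) lead y ≈ lead * ∏ rs y)
      roots = Mon-factor degree (at 0# (coeffs- a)) (≡.cong suc (List.length-map _ others)) lead≉0

      rs : List Carrier
      rs = proj₁ roots

      roots-eq : ∀ y → ⟪ G ⟫ 0# y - a ≈ lead * ∏ rs y
      roots-eq y = trans (G-≈ a 0# y) (proj₂ (proj₂ roots) y)

      rs-roots : All (λ r → ⟪ G ⟫ 0# r ≈ a) rs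
      rs-roots = All.map (λ {r} e → x-y≈0⇒x≈y (trans (roots-eq r) (trans (*-congˡ e) (zeroʳ lead)))) (∏-roots rs)

      rs-distinct : Distinct rs
      rs-distinct = simple-roots (minus-hasDeriv a (∂₂-hasDeriv G 0#)) roots-eq (λ y e e′ → noncritical₂ y e′ (x-y≈0⇒x≈y e))

      PolyOfLength : ℕ → (Carrier → Carrier) → Set (c ⊔ ℓ)
      PolyOfLength n f = ∃[ as ] length as ℕ.≤ n × (∀ t → f t ≈ ⟦ as ⟧ t)

      forget : ∀ {n ρ} → All (PolyOfLength n) ρ → All IsPoly ρ
      forget = All.map (λ (as , _ , v) → as , v)

      -- G(0,y) - a has as many distinct roots as its degree, so a remainder ρ
      -- vanishing on the line has ρ(0,y) = 0, and x may be divided out.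
      remainder-zero : ∀ n {ρ} → All (PolyOfLength n) ρ → length ρ ℕ.≤ degree → (∀ t → ⟦ ρ ⟧₂ (⟦ xs ⟧ t) (⟦ ys ⟧ t) ≈ 0#) → ∀ x y → ⟦ ρ ⟧₂ x y ≈ 0#
      remainder-zero 0 ps _ _ x y = zero⇒vanish (go ps) y
        where
        go : ∀ {ρ} → All (PolyOfLength 0) ρ → All (_≈ 0#) (at x ρ)
        go []                     = []
        go (([] , _ , v) ∷ ps)    = v x ∷ go ps
      remainder-zero (suc n) {ρ} ps le van x y = trans (ρ-eq x y) (trans (*-congˡ (remainder-zero n ps′ le′ van′ x y)) (zeroʳ x))
        where
        at0 : All (_≈ 0#) (at 0# ρ)
        at0 = vanish⇒zero _ (vanish {at 0# ρ} rs rs-distinct (≡.subst₂ ℕ._≤_ (≡.sym (List.length-map _ ρ)) (≡.sym (proj₁ (proj₂ roots))) le)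
          (All.map (λ {r} e → trans (⟦⟧₂-cong (forget ps) (sym (γ∘s₁ 0# r e)) (sym (γ∘s₂ 0# r e))) (van _)) rs-roots))
        divide : ∀ {ρ} → All (PolyOfLength (suc n)) ρ → All (_≈ 0#) (at 0# ρ) →
          ∃[ ρ′ ] All (PolyOfLength n) ρ′ × length ρ′ ≡ length ρ × (∀ x y → ⟦ ρ ⟧₂ x y ≈ x * ⟦ ρ′ ⟧₂ x y)
        divide [] [] = [] , [] , ≡.refl , λ x y → sym (zeroʳ x)
        divide (([] , _ , v) ∷ ps) (z ∷ zs) =
          let ρ′ , qs , l , e = divide ps zs
          in (λ _ → 0#) ∷ ρ′ , ([] , z≤n , λ _ → refl) ∷ qs , ≡.cong suc l ,
             λ x y → trans (+-cong (v x) (*-congˡ (e x y))) (solve 3 (λ x y r → :0 :+ y :* (x :* r) := x :* (:0 :+ y :* r)) refl x y (⟦ ρ′ ⟧₂ x y))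
        divide {f ∷ _} ((a ∷ as , s≤s le , v) ∷ ps) (z ∷ zs) =
          let ρ′ , qs , l , e = divide ps zs
          in ⟦ as ⟧ ∷ ρ′ , (as , le , λ _ → refl) ∷ qs , ≡.cong suc l ,
             λ x y → trans (+-cong (trans (v x) (trans (+-congʳ a≈0) (+-identityˡ _))) (*-congˡ (e x y))) (solve 4 (λ x y f r → x :* f :+ y :* (x :* r) := x :* (f :+ y :* r)) refl x y (⟦ as ⟧ x) (⟦ ρ′ ⟧₂ x y))
          where
          a≈0 : a ≈ 0#
          a≈0 = trans (solve 2 (λ a r → a := a :+ :0 :* r) refl a (⟦ as ⟧ 0#)) (trans (sym (v 0#)) z)
        divided = divide ps at0
        ρ′ = proj₁ divided
        ps′ = proj₁ (proj₂ divided)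
        le′ = ≡.subst (ℕ._≤ degree) (≡.sym (proj₁ (proj₂ (proj₂ divided)))) le
        ρ-eq = proj₂ (proj₂ (proj₂ divided))
        e′ = expr (forget ps′)
        y₁ = proj₁ (solve-G 1# a)
        -- The factor x is cancelled on the line: it is not identically zero there, because the line
        -- has a point with x = 1.
        van′ : ∀ t → ⟦ ρ′ ⟧₂ (⟦ xs ⟧ t) (⟦ ys ⟧ t) ≈ 0#
        van′ t = trans (sym (⟪⟫-expr (forget ps′) _ _)) (poly-domain (xs , λ _ → refl) (restrict-isPoly e′ xs ys)
          (λ r → trans (*-congˡ (⟪⟫-expr (forget ps′) _ _)) (trans (sym (ρ-eq _ _)) (van r)))
          {⟪ s ⟫ 1# y₁} (λ z → 1≉0 (trans (sym (γ∘s₁ 1# y₁ (proj₂ (solve-G 1# a)))) z)) t)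

      uniform : ∀ {ρ} → All IsPoly ρ → ∃[ n ] All (PolyOfLength n) ρ
      uniform [] = 0 , []
      uniform ((as , v) ∷ ps) = let n , qs = uniform ps in length as ℕ.+ n ,
        (as , ℕ.m≤m+n _ n , v) ∷ All.map (λ (bs , le , w) → bs , ℕ.≤-trans le (ℕ.m≤n+m n _) , w) qs

      -- The ideal of the line is generated by G - a.
      divisible : ∀ {hs} → All IsPoly hs → (∀ x y → ⟪ G ⟫ x y ≈ a → ⟦ hs ⟧₂ x y ≈ 0#) →
        ∃[ qs ] All IsPoly qs × length qs ℕ.≤ length hs ℕ.∸ degree × (∀ x y → ⟦ hs ⟧₂ x y ≈ ⟪ G- a ⟫ x y * ⟦ qs ⟧₂ x y)
      divisible {hs} ps van = scaleF (λ _ → i) quotient , All-scale (isPoly-const i) P-quotient ,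
        ≡.subst (ℕ._≤ length hs ℕ.∸ degree) (≡.sym (List.length-map _ quotient)) length-quotient , λ x y → cancel-≈ (^-≉0 power lead≉0) (begin
          lead ^ power * ⟦ hs ⟧₂ x y  ≈⟨ trans (eqn x y) (trans (+-congˡ (rem0 x y)) (+-identityʳ _)) ⟩
          ⟪ G- a ⟫ x y * ⟦ quotient ⟧₂ x y ≈⟨ trans (sym (*-identityˡ _)) (*-congʳ (sym (*-inverse (lead ^ power) (^-≉0 power lead≉0)))) ⟩
          lead ^ power * i * (⟪ G- a ⟫ x y * ⟦ quotient ⟧₂ x y) ≈⟨ solve 4 (λ p i g q → p :* i :* (g :* q) := p :* (g :* (i :* q))) refl (lead ^ power) i (⟪ G- a ⟫ x y) (⟦ quotient ⟧₂ x y) ⟩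
          lead ^ power * (⟪ G- a ⟫ x y * (i * ⟦ quotient ⟧₂ x y)) ≈⟨ *-congˡ (*-congˡ (⟦⟧F-scale x (λ _ → i) quotient y)) ⟨
          lead ^ power * (⟪ G- a ⟫ x y * ⟦ scaleF (λ _ → i) quotient ⟧₂ x y) ∎)
        where
        module Div = Division {P = IsPoly} isPoly-+ isPoly-* isPoly-neg isPoly-0 (isPoly-const 1#) (λ _ → lead) (isPoly-const lead)
        open Div.DivMod (Div.divMod (coeffs- a) hs (coeffs-isPoly a) ps)
        i = (lead ^ power) ⁻¹⟨ ^-≉0 power lead≉0 ⟩
        eqn : ∀ x y → lead ^ power * ⟦ hs ⟧₂ x y ≈ ⟪ G- a ⟫ x y * ⟦ quotient ⟧₂ x y + ⟦ remainder ⟧₂ x y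
        eqn x y = trans (equation x y) (+-congʳ (*-congʳ (sym (G-≈ a x y))))
        rem0 : ∀ x y → ⟦ remainder ⟧₂ x y ≈ 0#
        rem0 = remainder-zero _ (proj₂ (uniform P-remainder)) length-remainder λ t → begin
          ⟦ remainder ⟧₂ (⟦ xs ⟧ t) (⟦ ys ⟧ t) ≈⟨ solve 3 (λ r g q → r := :0 :* q :+ r) refl _ 0# _ ⟩
          0# * ⟦ quotient ⟧₂ (⟦ xs ⟧ t) (⟦ ys ⟧ t) + ⟦ remainder ⟧₂ (⟦ xs ⟧ t) (⟦ ys ⟧ t) ≈⟨ +-congʳ (*-congʳ (G-∘γ t)) ⟨
          _ ≈⟨ eqn _ _ ⟨
          lead ^ power * ⟦ hs ⟧₂ (⟦ xs ⟧ t) (⟦ ys ⟧ t) ≈⟨ trans (*-congˡ (van _ _ (on t))) (zeroʳ _) ⟩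
          0# ∎

      -- On the line f is a polynomial in `s`; the difference vanishes on the line and is therefore
      -- a multiple of G - a. This allows derivations of the plane to be compared with d/dt.
      lift-from-line : ∀ f {bs} → (∀ t → (f ∘γ) t ≈ ⟦ bs ⟧ t) → ∃[ h ] f ≗ app bs s ⊕ (G- a) ⊗ h
      lift-from-line f {bs} v =
        let H = f ⊕ ⊝ app bs s
            qs , ps , _ , e = divisible (coeffs₂-isPoly H) (λ x y g → trans (sym (⟪⟫-coeffs₂ H x y))
              (trans (+-cong (trans (γ∘s f x y g) (v _)) (*-congˡ (⟪⟫-app bs s x y))) (solve 1 (λ u → u :+ :- :1 :* u := :0) refl _)))
        in expr ps , λ x y → begin
          ⟪ f ⟫ x y ≈⟨ solve 2 (λ f g → f := g :+ (f :+ :- :1 :* g)) refl (⟪ f ⟫ x y) (⟪ app bs s ⟫ x y) ⟩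
          ⟪ app bs s ⟫ x y + ⟪ H ⟫ x y ≈⟨ +-congˡ (trans (⟪⟫-coeffs₂ H x y) (trans (e x y) (*-congˡ (sym (⟪⟫-expr ps x y))))) ⟩
          ⟪ app bs s ⟫ x y + ⟪ G- a ⟫ x y * ⟪ expr ps ⟫ x y ∎

      derive-on-line : ∀ {d} → IsDerivation d → ∀ f {bs h} → f ≗ app bs s ⊕ (G- a) ⊗ h → ∀ t →
        (d f ∘γ) t ≈ ⟦ deriv bs ⟧ t * (d s ∘γ) t + (d (G- a) ∘γ) t * (h ∘γ) t
      derive-on-line {d} D f {bs} {h} e t = begin
        (d f ∘γ) t ≈⟨ D.d-cong e _ _ ⟩
        (d (app bs s ⊕ (G- a) ⊗ h) ∘γ) t ≈⟨ trans (D.d-⊕ _ _ _ _) (+-cong (D.d-app bs s _ _) (D.d-⊗ _ _ _ _)) ⟩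
        (app (deriv bs) s ∘γ) t * (d s ∘γ) t + ((d (G- a) ∘γ) t * (h ∘γ) t + ((G- a) ∘γ) t * (d h ∘γ) t)
          ≈⟨ +-cong (*-congʳ (trans (⟪⟫-app (deriv bs) s _ _) (⟦⟧-cong (deriv bs) (s∘γ t)))) (trans (+-congˡ (trans (*-congʳ (G-∘γ t)) (zeroˡ _))) (+-identityʳ _)) ⟩
        ⟦ deriv bs ⟧ t * (d s ∘γ) t + (d (G- a) ∘γ) t * (h ∘γ) t ∎
        where module D = IsDerivation D

      δ-on-line′ : ∀ f {f′} → HasDeriv (f ∘γ) f′ → ∀ t → (δ f ∘γ) t ≈ (δ s ∘γ) t * f′ t
      δ-on-line′ f {f′} (hasDeriv bs v v′) t =
        let h , e = lift-from-line f {bs} v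
        in trans (derive-on-line (br-derivationʳ G) f {bs} {h} e t) (trans (+-cong (*-congʳ (sym (v′ t))) (trans (*-congʳ (δ-G a _ _)) (zeroˡ _)))
           (solve 2 (λ a b → a :* b :+ :0 := b :* a) refl (f′ t) ((δ s ∘γ) t)))

      -- A zero of δ s on the line would also be a zero of δ X and δ Y, hence a critical point of G.
      -- Differentiating the lifts of X and Y would then give 1 = x′s₁, 0 = x′s₂ and 1 = y′s₂, a
      -- contradiction.
      δs≉0 : ∀ t → ¬ (δ s ∘γ) t ≈ 0#
      δs≉0 t z = 1≉0 (begin
        1#                                     ≈⟨ one₂ ⟩
        y′ * s₂                                ≈⟨ *-congˡ (cancel (λ x′≈0 → 1≉0 (trans one₁ (trans (*-congʳ x′≈0) (zeroˡ _)))) (sym zero₂)) ⟩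
        y′ * 0#                                ≈⟨ zeroʳ y′ ⟩
        0# ∎)
        where
        x′ = ⟦ deriv xs ⟧ t
        y′ = ⟦ deriv ys ⟧ t
        s₁ = (∂₁ s ∘γ) t
        s₂ = (∂₂ s ∘γ) t
        G₂≈0 : (∂₂ G ∘γ) t ≈ 0#
        G₂≈0 = trans (δ-X _ _)
          (trans (-‿cong (trans (δ-on-line′ X (⟦⟧-hasDeriv xs) t) (trans (*-congʳ z) (zeroˡ _)))) -0≈0)
        G₁≈0 : (∂₁ G ∘γ) t ≈ 0#
        G₁≈0 = trans (δ-Y _ _)
          (trans (δ-on-line′ Y (⟦⟧-hasDeriv ys) t) (trans (*-congʳ z) (zeroˡ _)))
        simplify : ∀ {u v g h} → g ≈ 0# → u ≈ v + (g + 0#) * h → u ≈ v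
        simplify {u} {v} {g} {h} g≈0 e = trans e (trans (+-congˡ (*-congʳ (+-congʳ g≈0))) (solve 2 (λ v h → v :+ (:0 :+ :0) :* h := v) refl v h))
        hX = lift-from-line X {xs} (λ _ → refl)
        hY = lift-from-line Y {ys} (λ _ → refl)
        one₁ : 1# ≈ x′ * s₁
        one₁ = simplify G₁≈0 (derive-on-line ∂₁-derivation X {xs} {proj₁ hX} (proj₂ hX) t)
        zero₂ : 0# ≈ x′ * s₂
        zero₂ = simplify G₂≈0 (derive-on-line ∂₂-derivation X {xs} {proj₁ hX} (proj₂ hX) t)
        one₂ : 1# ≈ y′ * s₂
        one₂ = simplify G₂≈0 (derive-on-line ∂₂-derivation Y {ys} {proj₁ hY} (proj₂ hY) t)

      -- The choice of the parameter 0 is immaterial: δ s has no zero on the line, so it is constant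
      -- there.
      λ₀ : Carrier
      λ₀ = (δ s ∘γ) 0#

      λ₀≉0 : ¬ λ₀ ≈ 0#
      λ₀≉0 = δs≉0 0#

      δ-on-line : ∀ f {f′} → HasDeriv (f ∘γ) f′ → ∀ t → (δ f ∘γ) t ≈ λ₀ * f′ t
      δ-on-line f {f′} H t = trans (δ-on-line′ f H t) (*-congʳ (nonvanishing⇒const (restrict-isPoly (δ s) xs ys) δs≉0 t 0#))

      iter-δ-zero : ∀ n f {as} → length as ℕ.≤ n → (∀ t → (f ∘γ) t ≈ ⟦ as ⟧ t) → ∀ t → (iter δ n f ∘γ) t ≈ 0#
      iter-δ-zero 0       f {[]} le v t = v t
      iter-δ-zero (suc n) f {as} le v = iter-δ-zero n (δ f) {scale λ₀ (deriv as)}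
        (≡.subst (ℕ._≤ n) (≡.sym (List.length-map _ (deriv as))) (length-deriv as le))
        (λ t → trans (δ-on-line f (hasDeriv as v (λ _ → refl)) t) (sym (⟦⟧-scale λ₀ (deriv as) t)))

      s-injective : ∀ {t u} → ⟦ xs ⟧ t ≈ ⟦ xs ⟧ u → ⟦ ys ⟧ t ≈ ⟦ ys ⟧ u → t ≈ u
      s-injective {t} {u} p q = trans (sym (s∘γ t)) (trans (⟪⟫-cong s p q) (s∘γ u))

      iter-δ-X : ∀ {n} → length (HasDeriv.coeffs (∂₂-hasDeriv G 0#)) ℕ.≤ suc n → ∀ t → (iter δ (suc n) X ∘γ) t ≈ 0#
      iter-δ-X {n} le = let as , len , v = bound in iter-δ-zero (suc n) X {as} len v
        where
        bound = degree-bound {z = ⟦ xs ⟧} {w = ⟦ ys ⟧} {a = a} {n = n} (⟦⟧-hasDeriv xs) (∂₂-hasDeriv G 0#) le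
          (λ t z → trans (⟪⟫-cong G (sym z) refl) (on t))
          (λ zs zt e → s-injective (trans zs (sym zt)) e)
          (λ t z z′ → trans (⟪⟫-cong (∂₂ G) (sym z) refl) (trans (δ-X _ _)
            (trans (-‿cong (trans (δ-on-line X (⟦⟧-hasDeriv xs) t) (trans (*-congˡ z′) (zeroʳ _)))) -0≈0)))
          noncritical₂

      iter-δ-Y : ∀ {n} → length (HasDeriv.coeffs (∂₁-hasDeriv G 0#)) ℕ.≤ suc n → ∀ t → (iter δ (suc n) Y ∘γ) t ≈ 0#
      iter-δ-Y {n} le = let as , len , v = bound in iter-δ-zero (suc n) Y {as} len v
        where
        bound = degree-bound {z = ⟦ ys ⟧} {w = ⟦ xs ⟧} {a = a} {n = n} (⟦⟧-hasDeriv ys) (∂₁-hasDeriv G 0#) le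
          (λ t z → trans (⟪⟫-cong G refl (sym z)) (on t))
          (λ zs zt e → s-injective e (trans zs (sym zt)))
          (λ t z z′ → trans (⟪⟫-cong (∂₁ G) refl (sym z)) (trans (δ-Y _ _)
            (trans (δ-on-line Y (⟦⟧-hasDeriv ys) t) (trans (*-congˡ z′) (zeroʳ _)))))
          noncritical₁

      τ : Carrier
      τ = ⟪ s ⟫ px py

      F-root : ∃[ l ] ∃[ k ] ¬ l ≈ 0# × (∀ t → (F ∘γ) t ≈ l * (t - τ) ^ suc k)
      F-root = unique-root (restrict-isPoly F xs ys) (trans (sym (γ∘s F px py G-p)) F-p)
        (λ t z → trans (sym (s∘γ t)) (⟪⟫-cong s (p-unique₁ _ _ (on t) z) (p-unique₂ _ _ (on t) z)))

      genericLine : GenericLine F a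
      genericLine = record
        { xs = xs ; ys = ys ; s = s ; on = on ; γ∘s = γ∘s ; divisible = divisible ; λ₀ = λ₀ ; λ₀≉0 = λ₀≉0 ; δ-on-line = δ-on-line
        ; iter-δ-X = iter-δ-X (ℕ.n≤1+n _) ; iter-δ-Y = iter-δ-Y (ℕ.n≤1+n _)
        ; τ = τ ; l = proj₁ F-root ; k = proj₁ (proj₂ F-root) ; l≉0 = proj₁ (proj₂ (proj₂ F-root)) ; F-eq = proj₂ (proj₂ (proj₂ F-root)) }

  -- The bracket of G and F

  -- To be read with w = t - τ, f = F, T = δᵐF and P = δᵐ⁺¹F. The constants l, L and κ of the
  -- individual line are eliminated and only the number N remains, so that the identity can spread
  -- from lines to the plane.
  power-identity : ∀ m {L κ l N w P T f} → P ≈ L * κ → T ≈ κ * w → f ≈ l * w ^ suc m → κ ≈ L ^ m * (l * N) → P * T ^ suc m ≈ N * (P ^ suc m * f)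
  power-identity m {L} {κ} {l} {N} {w} {P} {T} {f} P-eq T-eq f-eq κ-eq = begin
    P * T ^ suc m                     ≈⟨ *-cong P-eq (trans (^-cong (suc m) T-eq) (^-* κ w (suc m))) ⟩
    L * κ * (κ ^ suc m * w ^ suc m)   ≈⟨ *-congʳ (*-congˡ κ-eq) ⟩
    L * (L ^ m * (l * N)) * (κ ^ suc m * w ^ suc m)
      ≈⟨ solve 6 (λ L p l N k w → L :* (p :* (l :* N)) :* (k :* w) := N :* (L :* p :* k :* (l :* w))) refl L (L ^ m) l N (κ ^ suc m) (w ^ suc m) ⟩
    N * (L ^ suc m * κ ^ suc m * (l * w ^ suc m)) ≈⟨ *-congˡ (*-cong (trans (^-cong (suc m) P-eq) (^-* L κ (suc m))) f-eq) ⟨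
    N * (P ^ suc m * f) ∎

  -- Covers the lines on which F has a zero of smaller multiplicity: there P = 0 and both sides
  -- vanish.
  power-identity₀ : ∀ m {N P T f} → P ≈ 0# → P * T ^ suc m ≈ N * (P ^ suc m * f)
  power-identity₀ m {N} {P} {T} {f} z = trans (trans (*-congʳ z) (zeroˡ _)) (sym (trans (*-congˡ (trans (*-congʳ (trans (*-congʳ z) (zeroˡ _))) (zeroˡ f))) (zeroʳ N)))

  power-expr : ∀ {p} {Q : Carrier → Carrier → Set p} → (∀ e e′ → (∀ x y → Q x y → ⟪ e ⟫ x y ≈ ⟪ e′ ⟫ x y) → e ≗ e′) →
    ∀ P T F N n → (∀ x y → Q x y → ⟪ P ⟫ x y * ⟪ T ⟫ x y ^ n ≈ N * (⟪ P ⟫ x y ^ n * ⟪ F ⟫ x y)) → P ⊗ T ⊛ n ≗ const N ⊗ (P ⊛ n ⊗ F)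
  power-expr dense P T F N n e = dense (P ⊗ T ⊛ n) (const N ⊗ (P ⊛ n ⊗ F)) λ x y q →
    trans (*-congˡ (⟪⟫-⊛ T n x y)) (trans (e x y q) (*-congˡ (*-congʳ (sym (⟪⟫-⊛ P n x y)))))

  -- Differentiating P Tⁿ⁺² = N Pⁿ⁺² F at a zero of T and F.
  power-derivative : ∀ {d} → IsDerivation d → ∀ P T F N n → P ⊗ T ⊛ suc (suc n) ≗ const N ⊗ (P ⊛ suc (suc n) ⊗ F) →
    ∀ {x y} → ¬ N ≈ 0# → ¬ ⟪ P ⟫ x y ≈ 0# → ⟪ T ⟫ x y ≈ 0# → ⟪ F ⟫ x y ≈ 0# → ⟪ d F ⟫ x y ≈ 0#
  power-derivative {d} D P T F N n identity {x} {y} N≉0 P≉0 T≈0 F≈0 = cancel (*-≉0 N≉0 (λ e → ^-≉0 (suc (suc n)) P≉0 (trans (sym (⟪⟫-⊛ P (suc (suc n)) x y)) e))) (begin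
    N * Pn * dx F ≈⟨ solve 4 (λ N p f g → N :* p :* f := :0 :* (p :* :0) :+ N :* (g :* :0 :+ p :* f)) refl N Pn (dx F) (dx (P ⊛ suc (suc n))) ⟩
    0# * (Pn * 0#) + N * (dx (P ⊛ suc (suc n)) * 0# + Pn * dx F) ≈⟨ +-cong (*-congˡ (*-congˡ (sym F≈0))) (*-congˡ (+-congʳ (*-congˡ (sym F≈0)))) ⟩
    0# * (Pn * ⟪ F ⟫ x y) + N * (dx (P ⊛ suc (suc n)) * ⟪ F ⟫ x y + Pn * dx F)
      ≈⟨ trans (d-⊗ (const N) (P ⊛ suc (suc n) ⊗ F) x y) (+-cong (*-congʳ (d-const N x y)) (*-congˡ (d-⊗ (P ⊛ suc (suc n)) F x y))) ⟨
    dx (const N ⊗ (P ⊛ suc (suc n) ⊗ F)) ≈⟨ d-cong {P ⊗ T ⊛ suc (suc n)} {const N ⊗ (P ⊛ suc (suc n) ⊗ F)} identity x y ⟨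
    dx (P ⊗ T ⊛ suc (suc n)) ≈⟨ d-⊗ P (T ⊛ suc (suc n)) x y ⟩
    dx P * ⟪ T ⊛ suc (suc n) ⟫ x y + ⟪ P ⟫ x y * dx (T ⊛ suc (suc n))
      ≈⟨ +-cong (*-congˡ (trans (*-congʳ T≈0) (zeroˡ _))) (*-congˡ (trans (d-⊗ T (T ⊛ suc n) x y) (+-cong (*-congˡ (trans (*-congʳ T≈0) (zeroˡ _))) (*-congʳ T≈0)))) ⟩
    dx P * 0# + ⟪ P ⟫ x y * (dx T * 0# + 0# * dx (T ⊛ suc n))
      ≈⟨ solve 4 (λ a p t b → a :* :0 :+ p :* (t :* :0 :+ :0 :* b) := :0) refl (dx P) (⟪ P ⟫ x y) (dx T) (dx (T ⊛ suc n)) ⟩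
    0# ∎)
    where
    open IsDerivation D
    dx : Expr → Carrier
    dx f = ⟪ d f ⟫ x y
    Pn = ⟪ P ⊛ suc (suc n) ⟫ x y

  module Pencils (F G : Expr) (M : MonicInY G) (exceptions : List Carrier) (lines : ∀ a → a ∉ exceptions → Line F G a)
    (smooth : ∀ x y → ⟪ F ⟫ x y ≈ 0# → ⟪ ∂₁ F ⟫ x y ≈ 0# → ¬ ⟪ ∂₂ F ⟫ x y ≈ 0#) where
    open MonicInY M
    open MonicG G M public
    open IsDerivation (br-derivationʳ G)
    open Iterate (br-derivationʳ G)

    private
      crit₁ = critical-values (∂₁-hasDeriv G 0#)
      crit₂ = critical-values (∂₂-hasDeriv G 0#)

    -- Besides the given exceptions, the critical values of G on both coordinate axes, so that
    -- `OnLine` applies to all other lines.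
    bad : List Carrier
    bad = exceptions ++ proj₁ crit₁ ++ proj₁ crit₂

    abstract
      line : ∀ a → a ∉ bad → GenericLine F a
      line a a∉ = OnLine.genericLine F a (lines a (λ m → a∉ (++⁺ˡ m)))
        (λ y z e → a∉ (++⁺ʳ exceptions (++⁺ʳ (proj₁ crit₁) (∈-resp-≈ (sym e) (proj₂ crit₂ y z)))))
        (λ x z e → a∉ (++⁺ʳ exceptions (++⁺ˡ (∈-resp-≈ (sym e) (proj₂ crit₁ x z)))))

    module Generic (a : Carrier) (a∉ : a ∉ bad) = GenericLine (line a a∉)

    vanish-generic : ∀ f → (∀ a a∉ t → (Generic._∘γ a a∉ f) t ≈ 0#) → Zero f
    vanish-generic f z = dense bad f (λ x y ∉bad → Generic.on-line _ ∉bad f (z _ ∉bad) x y refl)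

    δ-nilpotent-X : Zero (iter δ nX X)
    δ-nilpotent-X = vanish-generic (iter δ nX X) Generic.iter-δ-X

    δ-nilpotent-Y : Zero (iter δ nY Y)
    δ-nilpotent-Y = vanish-generic (iter δ nY Y) Generic.iter-δ-Y

    Zero? : ∀ f → Dec (Zero f)
    Zero? f with search₂ f
    ... | inj₁ (i , j , nz) = no (λ z → nz (z _ _))
    ... | inj₂ z            = yes z

    abstract
      F-order : ∃[ m ] Zero (iter δ (suc m) F) × (∀ k → k ℕ.< m → ¬ Zero (iter δ (suc k) F))
      F-order = let n , z = nilpotent nX nY δ-nilpotent-X δ-nilpotent-Y F
                in least (λ k → Zero? (iter δ (suc k) F)) n (iter-above {n} {suc n} {F} (ℕ.n≤1+n n) z)

    module _ (a : Carrier) (a∉ : a ∉ bad) where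
      open Generic a a∉

      multiplicity : ℕ
      multiplicity = suc k

      -- Otherwise δᵐ⁺¹F would be a nonzero multiple of a power of t - τ on the line, hence not 0 at
      -- τ + 1.
      multiplicity-bound : ∀ m → Zero (iter δ (suc m) F) → multiplicity ℕ.≤ m
      multiplicity-bound m z = ℕ.≮⇒≥ λ lt →
        let n = multiplicity ℕ.∸ suc m
            e = iter-δ-power (suc m) n F {l} (≡.subst (λ k → ∀ t → (F ∘γ) t ≈ l * (t - τ) ^ k) (≡.sym (ℕ.m+[n∸m]≡n lt)) F-eq) (τ + 1#)
        in *-≉0 (*-≉0 (^-≉0 (suc m) λ₀≉0) (*-≉0 l≉0 (falling≉0 (suc m) n))) (^-≉0 n (λ w → 1≉0 (trans (solve 1 (λ t → :1 := t :+ :1 :- t) refl τ) w)))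
             (trans (sym e) (z _ _))

      vanish-above : ∀ k → multiplicity ℕ.< k → ∀ t → (iter δ k F ∘γ) t ≈ 0#
      vanish-above (suc k) (s≤s lt) t = trans (reflexive (≡.cong (λ e → (e ∘γ) t) (iter-suc δ k F))) (begin
        (δ (iter δ k F) ∘γ) t ≈⟨ δ-on-line (iter δ k F) (hasDeriv-resp (const-value k lt) (λ _ → refl) (const-hasDeriv (C k))) t ⟩
        λ₀ * 0# ≈⟨ zeroʳ λ₀ ⟩
        0# ∎)
        where
        C : ℕ → Carrier
        C k with k ℕ.≟ multiplicity
        ... | yes _ = λ₀ ^ multiplicity * (l * falling multiplicity 0)
        ... | no  _ = 0#
        const-value : ∀ k → multiplicity ℕ.≤ k → ∀ t → (iter δ k F ∘γ) t ≈ C k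
        const-value k le t with k ℕ.≟ multiplicity
        ... | yes ≡.refl = trans (iter-δ-power multiplicity 0 F {l} (λ t → trans (F-eq t) (*-congˡ (reflexive (≡.cong ((t - τ) ^_) (≡.sym (ℕ.+-identityʳ multiplicity)))))) t) (*-identityʳ _)
        ... | no  neq    = vanish-above k (ℕ.≤∧≢⇒< le (λ e → neq (≡.sym e))) t

      top-two : ∀ m → multiplicity ≡ suc m → ∃[ κ ] ¬ κ ≈ 0# × κ ≈ λ₀ ^ m * (l * falling m 1) ×
        (∀ t → (iter δ m F ∘γ) t ≈ κ * (t - τ)) × (∀ t → (iter δ (suc m) F ∘γ) t ≈ λ₀ * κ)
      top-two m eq = κ , *-≉0 (^-≉0 m λ₀≉0) (*-≉0 l≉0 (falling≉0 m 1)) , refl , (λ t → trans (T-eq t) (*-congˡ (*-identityʳ _))) ,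
        λ t → trans (reflexive (≡.cong (λ e → (e ∘γ) t) (iter-suc δ m F))) (trans (δ-power (iter δ m F) {κ} {0} T-eq t)
          (solve 2 (λ L k → L :* (k :* (:1 :+ :0)) :* :1 := L :* k) refl λ₀ κ))
        where
        κ = λ₀ ^ m * (l * falling m 1)
        T-eq : ∀ t → (iter δ m F ∘γ) t ≈ κ * (t - τ) ^ 1
        T-eq = iter-δ-power m 1 F {l} (≡.subst (λ k → ∀ t → (F ∘γ) t ≈ l * (t - τ) ^ k) (≡.trans eq (ℕ.+-comm 1 m)) F-eq)

      -- With T = δᵐF and P = δᵐ⁺¹F, on every generic line P Tᵐ⁺¹ = (m+1)! Pᵐ⁺¹ F.
      top-identity : ∀ m → Zero (iter δ (suc (suc m)) F) → ∀ t →
        (iter δ (suc m) F ∘γ) t * (iter δ m F ∘γ) t ^ suc m ≈ falling m 1 * ((iter δ (suc m) F ∘γ) t ^ suc m * (F ∘γ) t)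
      top-identity m z t = [ below , equal ]′ (ℕ.m≤n⇒m<n∨m≡n (multiplicity-bound (suc m) z))
        where
        below = λ lt → power-identity₀ m (vanish-above (suc m) lt t)
        equal = λ eq →
          let κ , κ≉0 , κ-eq , T-eq , P-eq = top-two m eq
          in power-identity m {λ₀} {κ} {l} {falling m 1} (P-eq t) (T-eq t) (≡.subst (λ n → (F ∘γ) t ≈ l * (t - τ) ^ n) eq (F-eq t)) κ-eq

      F-p-on : (F ∘γ) τ ≈ 0#
      F-p-on = trans (F-eq τ) (trans (*-congˡ (trans (*-congʳ (-‿inverseʳ τ)) (zeroˡ _))) (zeroʳ l))

    -- Suppose F has multiplicity m + 2 on some generic line. At its zero there T = F = 0 and P ≠ 0,
    -- and the identity valid in the plane has exponent at least 2, so both partial derivatives of F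
    -- vanish: the curve would be singular. Hence the multiplicity is smaller on every generic line,
    -- and P vanishes on all of them.
    order-not-≥2 : ∀ m → Zero (iter δ (suc (suc (suc m))) F) → Zero (iter δ (suc (suc m)) F)
    order-not-≥2 m z = vanish-generic P (λ a a∉ → [ vanish-above a a∉ (suc (suc m)) , (λ eq → ⊥-elim (impossible a a∉ eq)) ]′ (ℕ.m≤n⇒m<n∨m≡n (multiplicity-bound a a∉ (suc (suc m)) z)))
      where
      T = iter δ (suc m) F
      P = iter δ (suc (suc m)) F
      N = falling (suc m) 1
      identity : ∀ x y → ⟪ G ⟫ x y ∉ bad → ⟪ P ⟫ x y * ⟪ T ⟫ x y ^ suc (suc m) ≈ N * (⟪ P ⟫ x y ^ suc (suc m) * ⟪ F ⟫ x y)
      identity x y ∉bad =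
        let open Generic _ ∉bad
            P-eq = γ∘s P x y refl
        in begin
          ⟪ P ⟫ x y * ⟪ T ⟫ x y ^ suc (suc m)        ≈⟨ *-cong P-eq (^-cong (suc (suc m)) (γ∘s T x y refl)) ⟩
          _                                          ≈⟨ top-identity _ ∉bad (suc m) z (⟪ s ⟫ x y) ⟩
          _                                          ≈⟨ *-congˡ (*-cong (^-cong (suc (suc m)) P-eq) (γ∘s F x y refl)) ⟨
          N * (⟪ P ⟫ x y ^ suc (suc m) * ⟪ F ⟫ x y)  ∎
      identity′ = power-expr (dense-≗ bad) P T F N (suc (suc m)) identity
      impossible : ∀ a a∉ → multiplicity a a∉ ≡ suc (suc m) → ⊥
      impossible a a∉ eq =
        let open Generic a a∉
            κ , κ≉0 , _ , T-eq , P-eq = top-two a a∉ (suc m) eq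
            P≉0 = λ e → *-≉0 λ₀≉0 κ≉0 (trans (sym (P-eq τ)) e)
            T≈0 = trans (T-eq τ) (trans (*-congˡ (-‿inverseʳ τ)) (zeroʳ κ))
            F≈0 = F-p-on a a∉
        in smooth _ _ F≈0 (power-derivative ∂₁-derivation P T F N m identity′ (falling≉0 (suc m) 1) P≉0 T≈0 F≈0)
                          (power-derivative ∂₂-derivation P T F N m identity′ (falling≉0 (suc m) 1) P≉0 T≈0 F≈0)

    u : Expr
    u = δ F

    δ-u : Zero (δ u)
    δ-u = go (proj₁ F-order) (proj₁ (proj₂ F-order)) (proj₂ (proj₂ F-order))
      where
      go : ∀ m → Zero (iter δ (suc m) F) → (∀ k → k ℕ.< m → ¬ Zero (iter δ (suc k) F)) → Zero (δ u)
      go 0             z _     = d-zero {u} z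
      go 1             z _     = z
      go (suc (suc m)) z below = ⊥-elim (below (suc m) ℕ.≤-refl (order-not-≥2 m z))

    -- The multiplicity of F on the line is positive, and at most 1 because δ u = 0; so u is there
    -- the nonzero constant λ₀ κ.
    u≉0 : ∀ x y → ⟪ G ⟫ x y ∉ bad → ¬ ⟪ u ⟫ x y ≈ 0#
    u≉0 x y ∉bad u≈0 =
      let open Generic _ ∉bad
          κ , κ≉0 , _ , _ , P-eq = top-two _ ∉bad 0 (ℕ.≤-antisym (multiplicity-bound _ ∉bad 1 δ-u) (s≤s z≤n))
      in *-≉0 λ₀≉0 κ≉0 (trans (sym (P-eq _)) (trans (sym (γ∘s u x y refl)) u≈0))

    -- The length bound on the quotient drives the induction in `kernel-δ′`; in `remove-factors` it
    -- leaves no room for a quotient at all.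
    const-on-line : ∀ {fs} → All IsPoly fs → ∀ a → a ∉ bad → ∀ b → (∀ x y → ⟪ G ⟫ x y ≈ a → ⟦ fs ⟧₂ x y ≈ b) →
      ∃[ qs ] All IsPoly qs × (∀ n → length fs ℕ.≤ suc n → length qs ℕ.≤ suc n ℕ.∸ degree) × (∀ x y → ⟦ fs ⟧₂ x y ≈ b + ⟪ G- a ⟫ x y * ⟦ qs ⟧₂ x y)
    const-on-line {fs} ps a a∉ b v =
      let qs , qp , len , e = divisible {hs} (All-⊞ ps (isPoly-const (- b) ∷ [])) (λ x y g → trans (hs-eq x y) (x≈y⇒x-y≈0 (v x y g)))
      in qs , qp , (λ n le → ℕ.≤-trans len (ℕ.∸-monoˡ-≤ degree (length-⊞F fs ((λ _ → - b) ∷ []) le (s≤s z≤n)))) ,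
         λ x y → trans (solve 2 (λ f b → f := b :+ (f :- b)) refl _ b) (+-congˡ (trans (sym (hs-eq x y)) (e x y)))
      where
      open Generic a a∉
      hs = fs ⊞F ((λ _ → - b) ∷ [])
      hs-eq : ∀ x y → ⟦ hs ⟧₂ x y ≈ ⟦ fs ⟧₂ x y - b
      hs-eq x y = trans (⟦⟧F-⊞ x fs ((λ _ → - b) ∷ []) y) (+-congˡ (solve 2 (λ b y → :- b :+ y :* :0 := :- b) refl b y))

    private
      a₀ = proj₁ (fresh bad)
      a₀∉ = proj₂ (fresh bad)

    -- One generic line suffices: an element of the kernel is constant on it, since δ is there a
    -- nonzero multiple of d/dt. Subtracting this constant and dividing by G - a₀ leaves an element
    -- of the kernel of lower degree in y.
    kernel-δ′ : ∀ n {fs} (ps : All IsPoly fs) → length fs ℕ.≤ n → Zero (δ (expr ps)) → ∃[ ψ ] expr ps ≗ app ψ G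
    kernel-δ′ 0       []  le z = [] , λ x y → refl
    kernel-δ′ (suc n) {fs} ps le z =
      let qs , qp , len , e = const-on-line ps a₀ a₀∉ b on-a₀
          q-zero : Zero (δ (expr qp))
          q-zero = dense (a₀ ∷ []) (δ (expr qp)) λ x y g∉ → cancel (λ w → g∉ (here (x-y≈0⇒x≈y w))) (begin
            ⟪ G- a₀ ⟫ x y * ⟪ δ (expr qp) ⟫ x y ≈⟨ solve 3 (λ g d q → g :* d := :0 :+ (:0 :* q :+ g :* d)) refl _ _ (⟪ expr qp ⟫ x y) ⟩
            0# + (0# * ⟪ expr qp ⟫ x y + ⟪ G- a₀ ⟫ x y * ⟪ δ (expr qp) ⟫ x y) ≈⟨ +-cong (d-const b x y) (trans (d-⊗ (G- a₀) (expr qp) x y) (+-congʳ (*-congʳ (δ-G a₀ x y)))) ⟨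
            ⟪ δ (const b) ⟫ x y + ⟪ δ ((G- a₀) ⊗ expr qp) ⟫ x y ≈⟨ d-⊕ _ _ x y ⟨
            ⟪ δ (const b ⊕ (G- a₀) ⊗ expr qp) ⟫ x y ≈⟨ d-cong {expr ps} {const b ⊕ (G- a₀) ⊗ expr qp} (λ x y → trans (⟪⟫-expr ps x y) (trans (e x y) (+-congˡ (*-congˡ (sym (⟪⟫-expr qp x y)))))) x y ⟨
            ⟪ δ (expr ps) ⟫ x y ≈⟨ z x y ⟩
            0# ∎)
          ψ , ψ-eq = kernel-δ′ n qp (ℕ.≤-trans (len n le) (ℕ.m∸n≤m n (length others))) q-zero
          ψ′ = (b ∷ []) ⊞ (- a₀ ∷ 1# ∷ []) ⊠ ψ
      in ψ′ , λ x y → begin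
        ⟪ expr ps ⟫ x y ≈⟨ trans (⟪⟫-expr ps x y) (e x y) ⟩
        b + ⟪ G- a₀ ⟫ x y * ⟦ qs ⟧₂ x y ≈⟨ +-congˡ (*-congˡ (trans (sym (⟪⟫-expr qp x y)) (trans (ψ-eq x y) (⟪⟫-app ψ G x y)))) ⟩
        b + ⟪ G- a₀ ⟫ x y * ⟦ ψ ⟧ (⟪ G ⟫ x y) ≈⟨ solve 4 (λ b g a p → b :+ (g :+ :- a) :* p := (b :+ g :* :0) :+ ((:- a :+ g :* (:1 :+ g :* :0)) :* p)) refl b (⟪ G ⟫ x y) a₀ (⟦ ψ ⟧ (⟪ G ⟫ x y)) ⟩
        ⟦ b ∷ [] ⟧ (⟪ G ⟫ x y) + ⟦ - a₀ ∷ 1# ∷ [] ⟧ (⟪ G ⟫ x y) * ⟦ ψ ⟧ (⟪ G ⟫ x y) ≈⟨ trans (⟦⟧-⊞ (b ∷ []) ((- a₀ ∷ 1# ∷ []) ⊠ ψ) _) (+-congˡ (⟦⟧-⊠ (- a₀ ∷ 1# ∷ []) ψ _)) ⟨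
        ⟦ ψ′ ⟧ (⟪ G ⟫ x y) ≈⟨ ⟪⟫-app ψ′ G x y ⟨
        ⟪ app ψ′ G ⟫ x y ∎
      where
      open Generic a₀ a₀∉
      f = expr ps
      b = (f ∘γ) 0#
      on-a₀ : ∀ x y → ⟪ G ⟫ x y ≈ a₀ → ⟦ fs ⟧₂ x y ≈ b
      on-a₀ x y g = let f′ , H = isPoly-hasDeriv (restrict-isPoly f xs ys) in
        trans (sym (⟪⟫-expr ps x y)) (trans (γ∘s f x y g) (hasDeriv-const H (λ t → cancel λ₀≉0 (trans (sym (δ-on-line f H t)) (z _ _))) _ _))

    kernel-δ : ∀ f → Zero (δ f) → ∃[ ψ ] f ≗ app ψ G
    kernel-δ f z =
      let ps = coeffs₂-isPoly f
          e : f ≗ expr ps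
          e x y = trans (⟪⟫-coeffs₂ f x y) (sym (⟪⟫-expr ps x y))
          ψ , eq = kernel-δ′ _ ps ℕ.≤-refl (λ x y → trans (sym (d-cong {f} {expr ps} e x y)) (z x y))
      in ψ , λ x y → trans (e x y) (eq x y)

  -- The degree of p, where {G , F} = p(G)

  br-self : ∀ f → Zero (br f f)
  br-self f x y = trans (reflexive (br-def f f x y)) (solve 2 (λ a b → a :* b :+ :- :1 :* (b :* a) := :0) refl (⟪ ∂₁ f ⟫ x y) (⟪ ∂₂ f ⟫ x y))

  module Flow (G : Expr) (nx ny : ℕ) (zX : Zero (iter (br G) nx X)) (zY : Zero (iter (br G) ny Y)) (x y : Carrier) where
    open IsDerivation (br-derivationʳ G)
    open Iterate (br-derivationʳ G)
    open TaylorAt (br-derivationʳ G) x y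

    private
      δ = br G

    flow-x flow-y : List Carrier
    flow-x = prefix nx (taylor X)
    flow-y = prefix ny (taylor Y)

    coef-flow-x : ∀ k → coef flow-x k ≈ taylor X k
    coef-flow-x = coef-prefix nx (taylor X) (λ k le → taylor-zero {X} {k} (iter-above {nx} {k} {X} le zX))

    coef-flow-y : ∀ k → coef flow-y k ≈ taylor Y k
    coef-flow-y = coef-prefix ny (taylor Y) (λ k le → taylor-zero {Y} {k} (iter-above {ny} {k} {Y} le zY))

    flow-G : ∀ s → ⟪ G ⟫ (⟦ flow-x ⟧ s) (⟦ flow-y ⟧ s) ≈ ⟪ G ⟫ x y
    flow-G s =
      let es , v , ce = flow flow-x flow-y coef-flow-x coef-flow-y G
      in trans (v s) (trans (coef-const es (λ k → trans (ce (suc k)) (trans (*-congˡ (iter-zero k (br-self G) x y)) (zeroʳ _))) s) (trans (ce 0) (*-identityˡ _)))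

    flow-slice : ∀ h → Zero (δ (δ h)) → ∀ s → ⟪ h ⟫ (⟦ flow-x ⟧ s) (⟦ flow-y ⟧ s) ≈ ⟪ h ⟫ x y + s * ⟪ δ h ⟫ x y
    flow-slice h z s =
      let es , v , ce = flow flow-x flow-y coef-flow-x coef-flow-y h
      in trans (v s) (trans (coef-linear es (λ k → trans (ce (suc (suc k))) (trans (*-congˡ (iter-zero k z x y)) (zeroʳ _))) s)
           (+-cong (trans (ce 0) (*-identityˡ _)) (*-congˡ (trans (ce 1) (begin
             taylor h 1 ≈⟨ solve 1 (λ t → t := (:1 :+ :0) :* t) refl (taylor h 1) ⟩
             nat 1 * taylor h 1 ≈⟨ taylor-suc h 0 ⟩
             taylor (δ h) 0 ≈⟨ *-identityˡ _ ⟩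
             ⟪ δ h ⟫ x y ∎)))))

    -- Along the flow G is constant and h is linear in the time with slope δ h ≠ 0, so h reaches 0
    -- on the same level of G.
    flow-to : ∀ h → Zero (δ (δ h)) → ¬ ⟪ δ h ⟫ x y ≈ 0# → ∃[ x′ ] ∃[ y′ ] ⟪ G ⟫ x′ y′ ≈ ⟪ G ⟫ x y × ⟪ h ⟫ x′ y′ ≈ 0#
    flow-to h z nz = _ , _ , flow-G s , trans (flow-slice h z s) (begin
      h₀ + - (h₀ * i) * d ≈⟨ solve 3 (λ h i d → h :+ :- (h :* i) :* d := h :- h :* (d :* i)) refl h₀ i d ⟩
      h₀ - h₀ * (d * i)   ≈⟨ +-congˡ (-‿cong (trans (*-congˡ (*-inverse d nz)) (*-identityʳ h₀))) ⟩
      h₀ - h₀             ≈⟨ -‿inverseʳ h₀ ⟩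
      0#                  ∎)
      where
      h₀ = ⟪ h ⟫ x y
      d = ⟪ δ h ⟫ x y
      i = d ⁻¹⟨ nz ⟩
      s = - (h₀ * i)

  minus : Expr → Carrier → Expr
  minus f a = f ⊕ const (- a)

  ∏-of : Expr → List Carrier → Expr
  ∏-of e []       = const 1#
  ∏-of e (r ∷ rs) = minus e r ⊗ ∏-of e rs

  ⟪⟫-∏-of : ∀ e rs x y → ⟪ ∏-of e rs ⟫ x y ≈ ∏ rs (⟪ e ⟫ x y)
  ⟪⟫-∏-of e []       x y = refl
  ⟪⟫-∏-of e (r ∷ rs) x y = *-congˡ (⟪⟫-∏-of e rs x y)

  ∏-++ : ∀ rs ss t → ∏ (rs ++ ss) t ≈ ∏ rs t * ∏ ss t
  ∏-++ []       ss t = sym (*-identityˡ _)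
  ∏-++ (r ∷ rs) ss t = trans (*-congˡ (∏-++ rs ss t)) (sym (*-assoc _ _ _))

  repeat : ℕ → List Carrier → List Carrier
  repeat 0       rs = []
  repeat (suc k) rs = rs ++ repeat k rs

  ∏-repeat : ∀ k rs t → ∏ (repeat k rs) t ≈ ∏ rs t ^ k
  ∏-repeat 0       rs t = refl
  ∏-repeat (suc k) rs t = trans (∏-++ rs (repeat k rs) t) (*-congˡ (∏-repeat k rs t))

  cancel-x : ∀ ξ e e′ → (∀ x y → (x - ξ) * ⟪ e ⟫ x y ≈ (x - ξ) * ⟪ e′ ⟫ x y) → e ≗ e′
  cancel-x ξ e e′ z x y = x-y≈0⇒x≈y (trans (+-congˡ (solve 1 (λ v → :- v := :- :1 :* v) refl _))
    (let as , v = hasDeriv-isPoly (∂₁-hasDeriv (e ⊕ ⊝ e′) y) in trans (v x) (vanish-off-point {as} ξ (λ t t≉ξ → trans (sym (v t))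
      (trans (+-congʳ (cancel-≈ (λ w → t≉ξ (x-y≈0⇒x≈y w)) (z t y))) (solve 1 (λ v → v :+ :- :1 :* v := :0) refl _))) x)))

  divide-x : ∀ ξ {fs} → All IsPoly fs → All (_≈ 0#) (at ξ fs) →
    ∃[ gs ] All IsPoly gs × length gs ≡ length fs × (∀ x y → ⟦ fs ⟧₂ x y ≈ (x - ξ) * ⟦ gs ⟧₂ x y)
  divide-x ξ [] [] = [] , [] , ≡.refl , λ x y → sym (zeroʳ _)
  divide-x ξ {f ∷ fs} ((as , v) ∷ ps) (z ∷ zs) =
    let gs , qs , l , e = divide-x ξ ps zs
        g , gp , ge = go as v
    in g ∷ gs , gp ∷ qs , ≡.cong suc l , λ x y → trans (+-cong (ge x) (*-congˡ (e x y))) (solve 4 (λ w y g r → w :* g :+ y :* (w :* r) := w :* (g :+ y :* r)) refl (x - ξ) y (g x) (⟦ gs ⟧₂ x y))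
    where
    go : ∀ as → (∀ t → f t ≈ ⟦ as ⟧ t) → ∃[ g ] IsPoly g × (∀ x → f x ≈ (x - ξ) * g x)
    go []       v = _ , isPoly-0 , λ x → trans (v x) (sym (zeroʳ _))
    go (a ∷ as) v = ⟦ horner ξ as ⟧ , (horner ξ as , λ _ → refl) , λ x → trans (v x) (root-factor {ξ} {a} {as} (trans (sym (v ξ)) z) x)

  -- The curve as a piece of the G-line, and the exclusion of degrees 0 and 1

  module Punctures (F G : Expr) (M : MonicInY G) (exceptions : List Carrier) (lines : ∀ a → a ∉ exceptions → Line F G a)
    (smooth : ∀ x y → ⟪ F ⟫ x y ≈ 0# → ⟪ ∂₁ F ⟫ x y ≈ 0# → ¬ ⟪ ∂₂ F ⟫ x y ≈ 0#) where
    open MonicInY M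
    open Pencils F G M exceptions lines smooth
    open IsDerivation (br-derivationʳ G)
    open Iterate (br-derivationʳ G)
    module FlowG = Flow G nX nY δ-nilpotent-X δ-nilpotent-Y

    u-poly : ∃[ p ] u ≗ app p G
    u-poly = kernel-δ u δ-u

    -- Where u ≠ 0, F / u is a slice of δ, and an f with δⁿ⁺¹f = 0 is a polynomial of degree at most
    -- n in F whose coefficients δ kills. `Λ n` annihilates the term in Fⁿ, without dividing by u.
    Λ : ℕ → Expr → Expr
    Λ n f = const (nat n) ⊗ (u ⊗ f) ⊕ ⊝ (F ⊗ δ f)

    δ-Λ : ∀ n f → δ (Λ (suc n) f) ≗ Λ n (δ f)
    δ-Λ n f x y = begin
      ⟪ δ (Λ (suc n) f) ⟫ x y ≈⟨ trans (d-⊕ _ _ x y) (+-cong (trans (d-⊗ _ _ x y) (+-cong (*-congʳ (d-const _ x y)) (*-congˡ (trans (d-⊗ u f x y) (+-congʳ (*-congʳ (δ-u x y)))))))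
          (trans (d-⊗ _ _ x y) (+-cong (*-congʳ (d-const _ x y)) (*-congˡ (d-⊗ F (δ f) x y))))) ⟩
      0# * (U * f₀) + (1# + nat n) * (0# * f₀ + U * f₁) + (0# * (F₀ * f₁) + - 1# * (U * f₁ + F₀ * f₂))
        ≈⟨ solve 6 (λ U f₀ n f₁ F f₂ → :0 :* (U :* f₀) :+ (:1 :+ n) :* (:0 :* f₀ :+ U :* f₁) :+ (:0 :* (F :* f₁) :+ :- :1 :* (U :* f₁ :+ F :* f₂)) := n :* (U :* f₁) :+ :- :1 :* (F :* f₂)) refl U f₀ (nat n) f₁ F₀ f₂ ⟩
      nat n * (U * f₁) + - 1# * (F₀ * f₂) ∎
      where
      U = ⟪ u ⟫ x y
      F₀ = ⟪ F ⟫ x y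
      f₀ = ⟪ f ⟫ x y
      f₁ = ⟪ δ f ⟫ x y
      f₂ = ⟪ δ (δ f) ⟫ x y

    iter-Λ : ∀ n f → iter δ n (Λ n f) ≗ Λ 0 (iter δ n f)
    iter-Λ 0       f x y = refl
    iter-Λ (suc n) f x y = trans (iter-cong n (δ-Λ n f) x y) (iter-Λ n (δ f) x y)

    -- Λ n lowers the nilpotency order and is multiplication by n u on the curve.
    on-curve : ∀ n f → Zero (iter δ n f) → ∃[ k ] ∃[ ψ ] ∀ x y → ⟪ F ⟫ x y ≈ 0# → ⟪ u ⟫ x y ^ k * ⟪ f ⟫ x y ≈ ⟦ ψ ⟧ (⟪ G ⟫ x y)
    on-curve 0       f z = 0 , [] , λ x y _ → trans (*-identityˡ _) (z x y)
    on-curve 1       f z = let ψ , e = kernel-δ f z in 0 , ψ , λ x y _ → trans (*-identityˡ _) (trans (e x y) (⟪⟫-app ψ G x y))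
    on-curve (suc (suc n)) f z = step (on-curve (suc n) (Λ (suc n) f) (λ x y → trans (iter-Λ (suc n) f x y)
            (trans (+-congˡ (*-congˡ (*-congˡ (trans (reflexive (≡.cong (λ g → ⟪ g ⟫ x y) (≡.sym (iter-suc δ (suc n) f)))) (z x y)))))
              (solve 2 (λ a b → :0 :* a :+ :- :1 :* (b :* :0) := :0) refl _ (⟪ F ⟫ x y)))))
      where
      N = nat (suc n)
      i = N ⁻¹⟨ nat-suc≉0 n ⟩
      step : (∃[ k ] ∃[ ψ ] ∀ x y → ⟪ F ⟫ x y ≈ 0# → ⟪ u ⟫ x y ^ k * ⟪ Λ (suc n) f ⟫ x y ≈ ⟦ ψ ⟧ (⟪ G ⟫ x y)) →
        ∃[ k ] ∃[ ψ ] ∀ x y → ⟪ F ⟫ x y ≈ 0# → ⟪ u ⟫ x y ^ k * ⟪ f ⟫ x y ≈ ⟦ ψ ⟧ (⟪ G ⟫ x y)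
      step (k , ψ , e) = suc k , scale i ψ , λ x y F≈0 → let U = ⟪ u ⟫ x y ; f₀ = ⟪ f ⟫ x y in begin
        U * U ^ k * f₀ ≈⟨ trans (sym (*-identityˡ _)) (*-congʳ (sym (*-inverse N (nat-suc≉0 n)))) ⟩
        N * i * (U * U ^ k * f₀) ≈⟨ solve 6 (λ N i U p f w → N :* i :* (U :* p :* f) := i :* (p :* (N :* (U :* f) :+ :- :1 :* (:0 :* w)))) refl N i U (U ^ k) f₀ (⟪ δ f ⟫ x y) ⟩
        i * (U ^ k * (N * (U * f₀) + - 1# * (0# * ⟪ δ f ⟫ x y))) ≈⟨ *-congˡ (*-congˡ (+-congˡ (*-congˡ (*-congʳ F≈0)))) ⟨
        i * (U ^ k * ⟪ Λ (suc n) f ⟫ x y) ≈⟨ *-congˡ (e x y F≈0) ⟩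
        i * ⟦ ψ ⟧ (⟪ G ⟫ x y) ≈⟨ ⟦⟧-scale i ψ _ ⟨
        ⟦ scale i ψ ⟧ (⟪ G ⟫ x y) ∎

    pow : List Carrier → ℕ → List Carrier
    pow p 0       = 1# ∷ []
    pow p (suc n) = p ⊠ pow p n

    ⟦⟧-pow : ∀ p n t → ⟦ pow p n ⟧ t ≈ ⟦ p ⟧ t ^ n
    ⟦⟧-pow p 0       t = solve 1 (λ t → :1 :+ t :* :0 := :1) refl t
    ⟦⟧-pow p (suc n) t = trans (⟦⟧-⊠ p (pow p n) t) (*-congˡ (⟦⟧-pow p n t))

    multiply : ∀ n ζ {v} x y {m w} → w ≈ ⟪ u ⟫ x y ^ n * ⟪ u ⟫ x y ^ m → ⟪ u ⟫ x y ^ m * v ≈ ⟦ ζ ⟧ (⟪ G ⟫ x y) → w * v ≈ ⟦ pow (proj₁ u-poly) n ⊠ ζ ⟧ (⟪ G ⟫ x y)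
    multiply n ζ {v} x y {m} {w} eq e = begin
      w * v ≈⟨ trans (*-congʳ eq) (*-assoc _ _ _) ⟩
      ⟪ u ⟫ x y ^ n * (⟪ u ⟫ x y ^ m * v) ≈⟨ *-cong (trans (^-cong n (trans (proj₂ u-poly x y) (⟪⟫-app p G x y))) (sym (⟦⟧-pow p n _))) e ⟩
      ⟦ pow p n ⟧ _ * ⟦ ζ ⟧ _ ≈⟨ ⟦⟧-⊠ (pow p n) ζ _ ⟨
      ⟦ pow p n ⊠ ζ ⟧ _ ∎
      where p = proj₁ u-poly

    OnCurve : ℕ → List Carrier → List Carrier → Set (c ⊔ ℓ)
    OnCurve n ξ η = ∀ x y → ⟪ F ⟫ x y ≈ 0# → ⟪ u ⟫ x y ^ n * x ≈ ⟦ ξ ⟧ (⟪ G ⟫ x y) × ⟪ u ⟫ x y ^ n * y ≈ ⟦ η ⟧ (⟪ G ⟫ x y)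

    abstract
      on-curve-XY : ∃[ n ] ∃[ ξ ] ∃[ η ] OnCurve n ξ η
      on-curve-XY = combine (on-curve nX X δ-nilpotent-X) (on-curve nY Y δ-nilpotent-Y)
        where
        combine : (∃[ k ] ∃[ ψ ] ∀ x y → ⟪ F ⟫ x y ≈ 0# → ⟪ u ⟫ x y ^ k * x ≈ ⟦ ψ ⟧ (⟪ G ⟫ x y)) → (∃[ k ] ∃[ ψ ] ∀ x y → ⟪ F ⟫ x y ≈ 0# → ⟪ u ⟫ x y ^ k * y ≈ ⟦ ψ ⟧ (⟪ G ⟫ x y)) → ∃[ n ] ∃[ ξ ] ∃[ η ] OnCurve n ξ η
        combine (j , ξ , e) (k , η , e′) = j ℕ.+ k , pow (proj₁ u-poly) k ⊠ ξ , pow (proj₁ u-poly) j ⊠ η , λ x y F≈0 →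
          multiply k ξ x y {j} (trans (^-+ _ j k) (*-comm _ _)) (e x y F≈0) , multiply j η x y {k} (^-+ _ j k) (e′ x y F≈0)

    -- G is an isomorphism from the curve to 𝔸¹ with inverse (ξ , η), stated through values only;
    -- `affine⇒≅` undoes the shear and translates it to varieties.
    Affine : Set (c ⊔ ℓ)
    Affine = ∃[ ξ ] ∃[ η ] (∀ x y → ⟪ F ⟫ x y ≈ 0# → x ≈ ⟦ ξ ⟧ (⟪ G ⟫ x y) × y ≈ ⟦ η ⟧ (⟪ G ⟫ x y)) ×
      (∀ a → ⟪ F ⟫ (⟦ ξ ⟧ a) (⟦ η ⟧ a) ≈ 0# × ⟪ G ⟫ (⟦ ξ ⟧ a) (⟦ η ⟧ a) ≈ a)

    -- G - r is an isomorphism from the curve to 𝔸¹*. The inverse has coordinates ξ(r + z) / zⁿ and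
    -- η(r + z) / zⁿ, with denominators multiplied out.
    Punctured : Set (c ⊔ ℓ)
    Punctured = ∃[ r ] ∃[ n ] ∃[ ξ ] ∃[ η ]
      (∀ x y → ⟪ F ⟫ x y ≈ 0# → ¬ ⟪ G ⟫ x y - r ≈ 0# × (⟪ G ⟫ x y - r) ^ n * x ≈ ⟦ ξ ⟧ (⟪ G ⟫ x y) × (⟪ G ⟫ x y - r) ^ n * y ≈ ⟦ η ⟧ (⟪ G ⟫ x y)) ×
      (∀ z x y → ¬ z ≈ 0# → z ^ n * x ≈ ⟦ ξ ⟧ (r + z) → z ^ n * y ≈ ⟦ η ⟧ (r + z) → ⟪ F ⟫ x y ≈ 0# × ⟪ G ⟫ x y - r ≈ z)

    unscale : ∀ {l} (l≉0 : ¬ l ≈ 0#) {v w} → l * v ≈ w → v ≈ l ⁻¹⟨ l≉0 ⟩ * w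
    unscale {l} l≉0 {v} {w} e = begin
      v ≈⟨ trans (sym (*-identityˡ v)) (*-congʳ (sym (*-inverse l l≉0))) ⟩
      l * l ⁻¹⟨ l≉0 ⟩ * v ≈⟨ solve 3 (λ l i v → l :* i :* v := i :* (l :* v)) refl l _ v ⟩
      l ⁻¹⟨ l≉0 ⟩ * (l * v) ≈⟨ *-congˡ e ⟩
      l ⁻¹⟨ l≉0 ⟩ * w ∎

    -- The level has a point over x = 0, and from there the flow of δ runs inside the level to a
    -- zero of F.
    to-curve : ∀ a → (∀ x y → ⟪ G ⟫ x y ≈ a → ¬ ⟪ u ⟫ x y ≈ 0#) → ∃[ x ] ∃[ y ] ⟪ G ⟫ x y ≈ a × ⟪ F ⟫ x y ≈ 0#
    to-curve a nz =
      let y₀ , g = solve-G 0# a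
          x′ , y′ , g′ , f = FlowG.flow-to 0# y₀ F δ-u (nz 0# y₀ g)
      in x′ , y′ , trans g′ g , f

    degree-0⇒affine : ∀ {l} → ¬ l ≈ 0# → (∀ x y → ⟪ u ⟫ x y ≈ l) → Affine
    degree-0⇒affine {l} l≉0 u≈l = go on-curve-XY
      where
      go : (∃[ n ] ∃[ ξ ] ∃[ η ] OnCurve n ξ η) → Affine
      go (n , ξ , η , on) = scale i ξ , scale i η , on₁ , λ a → on₂ (to-curve a (λ x y _ e → l≉0 (trans (sym (u≈l x y)) e)))
        where
        nz = ^-≉0 n l≉0
        i = (l ^ n) ⁻¹⟨ nz ⟩
        rescale : ∀ ζ x y {v} → ⟪ u ⟫ x y ^ n * v ≈ ⟦ ζ ⟧ (⟪ G ⟫ x y) → v ≈ ⟦ scale i ζ ⟧ (⟪ G ⟫ x y)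
        rescale ζ x y e = trans (unscale nz (trans (*-congʳ (^-cong n (sym (u≈l x y)))) e)) (sym (⟦⟧-scale i ζ _))
        on₁ : ∀ x y → ⟪ F ⟫ x y ≈ 0# → x ≈ ⟦ scale i ξ ⟧ (⟪ G ⟫ x y) × y ≈ ⟦ scale i η ⟧ (⟪ G ⟫ x y)
        on₁ x y f = rescale ξ x y (proj₁ (on x y f)) , rescale η x y (proj₂ (on x y f))
        on₂ : ∀ {a} → (∃[ x ] ∃[ y ] ⟪ G ⟫ x y ≈ a × ⟪ F ⟫ x y ≈ 0#) → ⟪ F ⟫ (⟦ scale i ξ ⟧ a) (⟦ scale i η ⟧ a) ≈ 0# × ⟪ G ⟫ (⟦ scale i ξ ⟧ a) (⟦ scale i η ⟧ a) ≈ a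
        on₂ (x , y , g , f) = trans (⟪⟫-cong F ex ey) f , trans (⟪⟫-cong G ex ey) g
          where
          ex = trans (sym (⟦⟧-cong (scale i ξ) g)) (sym (proj₁ (on₁ x y f)))
          ey = trans (sym (⟦⟧-cong (scale i η) g)) (sym (proj₂ (on₁ x y f)))

    module Degree1 {l r : Carrier} (l≉0 : ¬ l ≈ 0#) (u-eq : ∀ x y → ⟪ u ⟫ x y ≈ l * (⟪ G ⟫ x y - r)) where

      avoids⇒punctured : (∀ x y → ⟪ F ⟫ x y ≈ 0# → ¬ ⟪ G ⟫ x y - r ≈ 0#) → Punctured
      avoids⇒punctured avoids = go on-curve-XY
        where
        go : (∃[ n ] ∃[ ξ ] ∃[ η ] OnCurve n ξ η) → Punctured
        go (n , ξ , η , on) = r , n , scale i ξ , scale i η , (λ x y f → avoids x y f , on₁ x y f) ,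
          λ z x y z≉0 ex ey → on₂ z≉0 ex ey (to-curve (r + z) (λ x y g e → *-≉0 l≉0 z≉0 (trans (*-congˡ (sym (G-r g))) (trans (sym (u-eq x y)) e))))
          where
          nz = ^-≉0 n l≉0
          i = (l ^ n) ⁻¹⟨ nz ⟩
          rescale : ∀ ζ x y {v} → ⟪ u ⟫ x y ^ n * v ≈ ⟦ ζ ⟧ (⟪ G ⟫ x y) → (⟪ G ⟫ x y - r) ^ n * v ≈ ⟦ scale i ζ ⟧ (⟪ G ⟫ x y)
          rescale ζ x y e = trans (unscale nz (trans (sym (*-assoc _ _ _)) (trans (*-congʳ (sym (trans (^-cong n (u-eq x y)) (^-* l _ n)))) e))) (sym (⟦⟧-scale i ζ _))
          on₁ : ∀ x y → ⟪ F ⟫ x y ≈ 0# → (⟪ G ⟫ x y - r) ^ n * x ≈ ⟦ scale i ξ ⟧ (⟪ G ⟫ x y) × (⟪ G ⟫ x y - r) ^ n * y ≈ ⟦ scale i η ⟧ (⟪ G ⟫ x y)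
          on₁ x y f = rescale ξ x y (proj₁ (on x y f)) , rescale η x y (proj₂ (on x y f))
          G-r : ∀ {g z} → g ≈ r + z → g - r ≈ z
          G-r {g} {z} e = trans (+-congʳ e) (solve 2 (λ r z → r :+ z :- r := z) refl r z)
          same : ∀ ζ {x y z v w} → ¬ z ≈ 0# → ⟪ G ⟫ x y ≈ r + z → z ^ n * v ≈ ⟦ scale i ζ ⟧ (r + z) → (⟪ G ⟫ x y - r) ^ n * w ≈ ⟦ scale i ζ ⟧ (⟪ G ⟫ x y) → v ≈ w
          same ζ z≉0 g ev ew = cancel-≈ (^-≉0 n z≉0) (trans ev (trans (sym (⟦⟧-cong (scale i ζ) g)) (trans (sym ew) (*-congʳ (^-cong n (G-r g))))))
          on₂ : ∀ {z x y} → ¬ z ≈ 0# → z ^ n * x ≈ ⟦ scale i ξ ⟧ (r + z) → z ^ n * y ≈ ⟦ scale i η ⟧ (r + z) → (∃[ x ] ∃[ y ] ⟪ G ⟫ x y ≈ r + z × ⟪ F ⟫ x y ≈ 0#) → ⟪ F ⟫ x y ≈ 0# × ⟪ G ⟫ x y - r ≈ z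
          on₂ z≉0 ex ey (x′ , y′ , g , f) = trans (⟪⟫-cong F x≈x′ y≈y′) f , trans (+-congʳ (⟪⟫-cong G x≈x′ y≈y′)) (G-r g)
            where
            x≈x′ = same ξ z≉0 g ex (proj₁ (on₁ x′ y′ f))
            y≈y′ = same η z≉0 g ey (proj₂ (on₁ x′ y′ f))

      -- The case to be refuted: the curve meets G = r. The field {· , F} is tangent to the curve,
      -- and by `u-eq` also to G = r. Its formal trajectory through the common point lies in both,
      -- so F and G - r have a common factor; division shows that G - r itself divides F.
      module At (qx qy : Carrier) (F-q : ⟪ F ⟫ qx qy ≈ 0#) (G-q : ⟪ G ⟫ qx qy - r ≈ 0#) where
        private
          D = br-derivationˡ F
          module D = IsDerivation D
          d = λ f → br f F
          module ID = Iterate D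
        open TaylorAt D qx qy

        kernel-F : Kernel F
        kernel-F 0       = trans (*-identityˡ _) F-q
        kernel-F (suc k) = trans (*-congˡ (ID.iter-zero k {d F} (br-self F) qx qy)) (zeroʳ _)

        -- Since d G = l (G - r), every iterate of d on G - r is a constant multiple of G - r, which
        -- vanishes at the point.
        kernel-G : Kernel (G- r)
        kernel-G k = trans (*-congˡ (go k (G- r) 1# (λ x y → sym (*-identityˡ _)))) (zeroʳ _)
          where
          go : ∀ k f e → f ≗ const e ⊗ (G- r) → ⟪ iter d k f ⟫ qx qy ≈ 0#
          go 0       f e eq = trans (eq qx qy) (trans (*-congˡ G-q) (zeroʳ e))
          go (suc k) f e eq = go k (d f) (e * l) λ x y → begin
            ⟪ d f ⟫ x y ≈⟨ D.d-cong {f} {const e ⊗ (G- r)} eq x y ⟩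
            ⟪ d (const e ⊗ (G- r)) ⟫ x y ≈⟨ trans (D.d-⊗ (const e) (G- r) x y) (+-cong (*-congʳ (D.d-const e x y)) (*-congˡ (D.d-⊕ G (const (- r)) x y))) ⟩
            0# * ⟪ G- r ⟫ x y + e * (⟪ u ⟫ x y + ⟪ d (const (- r)) ⟫ x y) ≈⟨ +-congˡ (*-congˡ (+-cong (u-eq x y) (D.d-const (- r) x y))) ⟩
            0# * ⟪ G- r ⟫ x y + e * (l * ⟪ G- r ⟫ x y + 0#) ≈⟨ solve 3 (λ e l g → :0 :* g :+ e :* (l :* g :+ :0) := e :* l :* g) refl e l (⟪ G- r ⟫ x y) ⟩
            e * l * ⟪ G- r ⟫ x y ∎

        kernel-derivative : ∀ {f} → Kernel f → ⟪ d f ⟫ qx qy ≈ 0#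
        kernel-derivative {f} z = trans (sym (*-identityˡ _)) (trans (sym (taylor-suc f 0)) (trans (*-congˡ (z 1)) (zeroʳ _)))

        d-X : ∀ a → ⟪ d (minus X a) ⟫ qx qy ≈ ⟪ ∂₂ F ⟫ qx qy
        d-X a = trans (reflexive (br-def _ F qx qy)) (solve 2 (λ p q → (:1 :+ :0) :* q :+ :- :1 :* ((:0 :+ :0) :* p) := q) refl (⟪ ∂₁ F ⟫ qx qy) (⟪ ∂₂ F ⟫ qx qy))

        d-Y : ∀ a → ⟪ d (minus Y a) ⟫ qx qy ≈ - ⟪ ∂₁ F ⟫ qx qy
        d-Y a = trans (reflexive (br-def _ F qx qy)) (solve 2 (λ p q → (:0 :+ :0) :* q :+ :- :1 :* ((:1 :+ :0) :* p) := :- p) refl (⟪ ∂₁ F ⟫ qx qy) (⟪ ∂₂ F ⟫ qx qy))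

        kernel-const : ∀ {a} → Kernel (const a) → a ≈ 0#
        kernel-const {a} z = kernel-eval {const a} z

        -- If x were constant along the formal trajectory of D through the point, so
        -- would be y, because G is monic in y; but D does not vanish on the smooth curve.
        X∉kernel : ∀ ξ → ¬ Kernel (minus X ξ)
        X∉kernel ξ X∈ = ∏∉ rs (kernel-prime {const lead} (∏-of Y rs) (λ z → lead≉0 (kernel-const z)) (kernel-cong {(G- r) ⊕ ⊝ (minus X ξ ⊗ expr ps)} {const lead ⊗ ∏-of Y rs} eq
          (kernel-⊕ {G- r} {⊝ (minus X ξ ⊗ expr ps)} kernel-G (kernel-cong {(minus X ξ ⊗ expr ps) ⊗ const (- 1#)} {⊝ (minus X ξ ⊗ expr ps)} (λ x y → *-comm _ _) (kernel-⊗ {minus X ξ ⊗ expr ps} (const (- 1#)) (kernel-⊗ {minus X ξ} (expr ps) X∈))))))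
          where
          ∂₂F≈0 : ⟪ ∂₂ F ⟫ qx qy ≈ 0#
          ∂₂F≈0 = trans (sym (d-X ξ)) (kernel-derivative {minus X ξ} X∈)
          ∏∉ : ∀ rs → ¬ Kernel (∏-of Y rs)
          ∏∉ []       z = 1≉0 (kernel-const z)
          ∏∉ (a ∷ rs) z = ∏∉ rs (kernel-prime {minus Y a} (∏-of Y rs) (λ Y∈ → smooth qx qy F-q
            (trans (solve 1 (λ p → p := :- (:- p)) refl _) (trans (-‿cong (trans (sym (d-Y a)) (kernel-derivative {minus Y a} Y∈))) -0≈0)) ∂₂F≈0) z)
          factored = Mon-factor degree (at ξ (coeffs- r)) (≡.cong suc (List.length-map _ others)) lead≉0
          rs = proj₁ factored
          diff = (G- r) ⊕ ⊝ (const lead ⊗ ∏-of Y rs)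
          divided = divide-x ξ (coeffs₂-isPoly diff) (vanish⇒zero _ λ y → trans (sym (⟪⟫-coeffs₂ diff ξ y))
            (trans (+-cong (trans (G-≈ r ξ y) (proj₂ (proj₂ factored) y)) (*-congˡ (*-congˡ (⟪⟫-∏-of Y rs ξ y)))) (solve 1 (λ v → v :+ :- :1 :* v := :0) refl _)))
          ps = proj₁ (proj₂ divided)
          eq : (G- r) ⊕ ⊝ (minus X ξ ⊗ expr ps) ≗ const lead ⊗ ∏-of Y rs
          eq x y = begin
            g + - 1# * ((x + - ξ) * ⟪ expr ps ⟫ x y) ≈⟨ +-congˡ (*-congˡ (trans (*-congˡ (⟪⟫-expr ps x y)) (sym (trans (⟪⟫-coeffs₂ diff x y) (proj₂ (proj₂ (proj₂ divided)) x y))))) ⟩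
            g + - 1# * (g + - 1# * h) ≈⟨ solve 2 (λ g h → g :+ :- :1 :* (g :+ :- :1 :* h) := h) refl g h ⟩
            h ∎
            where
            g = ⟪ G- r ⟫ x y
            h = ⟪ const lead ⊗ ∏-of Y rs ⟫ x y

        -- Gauss's lemma by hand: each x - ξ divides one of the two factors. If it divides f, the
        -- quotient stays in the prime ideal because x - ξ is not in it. When no factor is left, f
        -- divides a nonzero multiple of G - r, so it has no zero on a generic line and is constant
        -- there; its small degree in y makes it constant in the plane, and a constant in the kernel
        -- is 0.
        remove-factors : ∀ ξs {κ} → ¬ κ ≈ 0# → ∀ {fs qs} (ps : All IsPoly fs) (qp : All IsPoly qs) → length fs ℕ.≤ degree → Kernel (expr ps) →
          (∀ x y → κ * ∏ ξs x * ⟪ G- r ⟫ x y ≈ ⟦ fs ⟧₂ x y * ⟦ qs ⟧₂ x y) → ∀ x y → ⟦ fs ⟧₂ x y ≈ 0#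
        remove-factors [] {κ} κ≉0 {fs} {qs} ps qp le f∈ eq x y =
          let ss , sp , len , e = const-on-line ps a a∉bad b f-on-line
              e′ = constant ss (len (length others) le) e
          in trans (e′ x y) (kernel-const (kernel-cong {expr ps} {const b} (λ x y → trans (⟪⟫-expr ps x y) (e′ x y)) f∈))
          where
          a = proj₁ (fresh (r ∷ bad))
          a∉bad : a ∉ bad
          a∉bad m = proj₂ (fresh (r ∷ bad)) (there m)
          a-r≉0 : ¬ a - r ≈ 0#
          a-r≉0 e = proj₂ (fresh (r ∷ bad)) (here (x-y≈0⇒x≈y e))
          open Generic a a∉bad
          f = expr ps
          b = (f ∘γ) 0#
          nonvanishing : ∀ t → ¬ (f ∘γ) t ≈ 0#
          nonvanishing t z = *-≉0 (*-≉0 κ≉0 1≉0) a-r≉0 (begin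
            κ * 1# * (a - r) ≈⟨ *-congˡ (+-congʳ (on t)) ⟨
            κ * 1# * ⟪ G- r ⟫ (⟦ xs ⟧ t) (⟦ ys ⟧ t) ≈⟨ eq _ _ ⟩
            ⟦ fs ⟧₂ (⟦ xs ⟧ t) (⟦ ys ⟧ t) * ⟦ qs ⟧₂ (⟦ xs ⟧ t) (⟦ ys ⟧ t) ≈⟨ trans (*-congʳ (trans (sym (⟪⟫-expr ps _ _)) z)) (zeroˡ _) ⟩
            0# ∎)
          f-on-line : ∀ x y → ⟪ G ⟫ x y ≈ a → ⟦ fs ⟧₂ x y ≈ b
          f-on-line x y g = trans (sym (⟪⟫-expr ps x y)) (trans (γ∘s f x y g) (nonvanishing⇒const (restrict-isPoly f xs ys) nonvanishing _ _))
          constant : ∀ ss → length ss ℕ.≤ degree ℕ.∸ degree → (∀ x y → ⟦ fs ⟧₂ x y ≈ b + ⟪ G- a ⟫ x y * ⟦ ss ⟧₂ x y) → ∀ x y → ⟦ fs ⟧₂ x y ≈ b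
          constant []       _  e x y = trans (e x y) (trans (+-congˡ (zeroʳ _)) (+-identityʳ b))
          constant (s ∷ ss) le e x y = ⊥-elim (ℕ.n≮0 (≡.subst (suc (length ss) ℕ.≤_) (ℕ.n∸n≡0 (length others)) le))
        remove-factors (ξ ∷ ξs) {κ} κ≉0 {fs} {qs} ps qp le f∈ eq x y = [ (λ (j , nz) → divide-q (λ y → trans (sym (⟪⟫-expr qp ξ y)) (q-zero j nz y))) , divide-f ]′ (search (at ξ fs))
          where
          E = const κ ⊗ ∏-of X ξs ⊗ (G- r)
          E-eq : ∀ x y → ⟪ E ⟫ x y ≈ κ * ∏ ξs x * ⟪ G- r ⟫ x y
          E-eq x y = *-congʳ (*-congˡ (⟪⟫-∏-of X ξs x y))
          eq-E : ∀ x y → (x - ξ) * ⟪ E ⟫ x y ≈ ⟦ fs ⟧₂ x y * ⟦ qs ⟧₂ x y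
          eq-E x y = trans (*-congˡ (E-eq x y)) (trans (solve 4 (λ w k p g → w :* (k :* p :* g) := k :* (w :* p) :* g) refl (x - ξ) κ (∏ ξs x) (⟪ G- r ⟫ x y)) (eq x y))
          q-zero : ∀ j → ¬ ⟦ at ξ fs ⟧ (nat j) ≈ 0# → ∀ y → ⟪ expr qp ⟫ ξ y ≈ 0#
          q-zero j nz = poly-domain (hasDeriv-isPoly (∂₂-hasDeriv (expr ps) ξ)) (hasDeriv-isPoly (∂₂-hasDeriv (expr qp) ξ))
            (λ y → trans (*-cong (⟪⟫-expr ps ξ y) (⟪⟫-expr qp ξ y)) (trans (sym (eq-E ξ y)) (trans (*-congʳ (-‿inverseʳ ξ)) (zeroˡ _)))) {nat j} (λ z → nz (trans (sym (⟪⟫-expr ps ξ _)) z))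
          divide-q : (∀ y → ⟦ qs ⟧₂ ξ y ≈ 0#) → ⟦ fs ⟧₂ x y ≈ 0#
          divide-q z =
            let qs′ , qp′ , _ , e = divide-x ξ qp (vanish⇒zero _ z)
            in remove-factors ξs κ≉0 ps qp′ le f∈ (λ x y → trans (sym (E-eq x y)) (trans (cancel-x ξ E (expr ps ⊗ expr qp′) (λ x y → begin
                 (x - ξ) * ⟪ E ⟫ x y                   ≈⟨ eq-E x y ⟩
                 ⟦ fs ⟧₂ x y * ⟦ qs ⟧₂ x y             ≈⟨ *-congˡ (e x y) ⟩
                 ⟦ fs ⟧₂ x y * ((x - ξ) * ⟦ qs′ ⟧₂ x y) ≈⟨ solve 3 (λ f w q → f :* (w :* q) := w :* (f :* q)) refl (⟦ fs ⟧₂ x y) (x - ξ) (⟦ qs′ ⟧₂ x y) ⟩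
                 (x - ξ) * (⟦ fs ⟧₂ x y * ⟦ qs′ ⟧₂ x y) ≈⟨ *-congˡ (*-cong (⟪⟫-expr ps x y) (⟪⟫-expr qp′ x y)) ⟨
                 (x - ξ) * ⟪ expr ps ⊗ expr qp′ ⟫ x y   ∎) x y) (*-cong (⟪⟫-expr ps x y) (⟪⟫-expr qp′ x y)))) x y
          divide-f : (∀ y → ⟦ fs ⟧₂ ξ y ≈ 0#) → ⟦ fs ⟧₂ x y ≈ 0#
          divide-f z =
            let fs′ , ps′ , len , e = divide-x ξ ps (vanish⇒zero _ z)
                f∈′ : Kernel (expr ps′)
                f∈′ = kernel-prime {minus X ξ} (expr ps′) (X∉kernel ξ) (kernel-cong {expr ps} {minus X ξ ⊗ expr ps′} (λ x y → trans (⟪⟫-expr ps x y) (trans (e x y) (*-congˡ (sym (⟪⟫-expr ps′ x y))))) f∈)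
            in trans (e x y) (trans (*-congˡ (remove-factors ξs κ≉0 ps′ qp (≡.subst (ℕ._≤ degree) (≡.sym len) le) f∈′ (λ x y → trans (sym (E-eq x y)) (trans (cancel-x ξ E (expr ps′ ⊗ expr qp) (λ x y → begin
                 (x - ξ) * ⟪ E ⟫ x y                   ≈⟨ eq-E x y ⟩
                 ⟦ fs ⟧₂ x y * ⟦ qs ⟧₂ x y             ≈⟨ trans (*-congʳ (e x y)) (*-assoc _ _ _) ⟩
                 (x - ξ) * (⟦ fs′ ⟧₂ x y * ⟦ qs ⟧₂ x y) ≈⟨ *-congˡ (*-cong (⟪⟫-expr ps′ x y) (⟪⟫-expr qp x y)) ⟨
                 (x - ξ) * ⟪ expr ps′ ⊗ expr qp ⟫ x y   ∎) x y) (*-cong (⟪⟫-expr ps′ x y) (⟪⟫-expr qp x y)))) x y)) (zeroʳ _))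

        combination : ∀ a b {f} e → a ≗ b ⊕ e → Kernel a → (∀ x y → ⟪ b ⟫ x y ≈ ⟪ f ⟫ x y) → Kernel f → Kernel e
        combination a b {f} e eq a∈ b≗f f∈ = kernel-cong {a ⊕ f ⊗ const (- 1#)} {e}
          (λ x y → trans (+-cong (eq x y) (*-congʳ (sym (b≗f x y)))) (solve 2 (λ b e → b :+ e :+ b :* :- :1 := e) refl (⟪ b ⟫ x y) (⟪ e ⟫ x y)))
          (kernel-⊕ {a} {f ⊗ const (- 1#)} a∈ (kernel-⊗ {f} (const (- 1#)) f∈))

        -- No nonzero element of the kernel has smaller degree in y than G - r. Pseudo-dividing G -
        -- r by such an element leaves a remainder in the kernel, zero by induction; so a power of
        -- the leading coefficient times G - r is a multiple of the element, and `remove-factors`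
        -- applies.
        small-kernel : ∀ n {fs} (ps : All IsPoly fs) → length fs ℕ.≤ n → n ℕ.≤ degree → Kernel (expr ps) → ∀ x y → ⟦ fs ⟧₂ x y ≈ 0#
        small-kernel 0       []  le len f∈ x y = refl
        small-kernel (suc n) {fs} ps le len f∈ = go fs (List.initLast fs) ps le f∈
          where
          go : ∀ fs → List.InitLast fs → (ps : All IsPoly fs) → length fs ℕ.≤ suc n → Kernel (expr ps) → ∀ x y → ⟦ fs ⟧₂ x y ≈ 0#
          go .[] List.[] ps le f∈ x y = refl
          go .(gs List.∷ʳ g) (gs List.∷ʳ′ g) ps le f∈ = [ top-zero , top-nonzero ]′ (strip-factor as)
            where
            fs′ = gs ++ g ∷ []
            gp : All IsPoly gs
            gp = ++⁻ˡ gs ps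
            as = proj₁ (All.head (++⁻ʳ gs ps))
            v = proj₂ (All.head (++⁻ʳ gs ps))
            le′ : length gs ℕ.≤ n
            le′ = ℕ.≤-pred (≡.subst (ℕ._≤ suc n) (≡.trans (List.length-++ gs) (ℕ.+-comm (length gs) 1)) le)
            Mon-eq : ∀ x y → Mon (at x gs) (g x) y ≈ ⟦ fs′ ⟧₂ x y
            Mon-eq x y = trans (Mon-snoc (at x gs) (g x) y) (reflexive (≡.cong (λ l → ⟦ l ⟧ y) (≡.sym (List.map-++ (λ f → f x) gs (g ∷ [])))))
            top-zero : (∀ t → ⟦ as ⟧ t ≈ 0#) → ∀ x y → ⟦ fs′ ⟧₂ x y ≈ 0#
            top-zero z x y = trans (fs-eq x y) (small-kernel n gp le′ (ℕ.<⇒≤ len) (kernel-cong {expr ps} {expr gp} (λ x y → trans (⟪⟫-expr ps x y) (trans (fs-eq x y) (sym (⟪⟫-expr gp x y)))) f∈) x y)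
              where
              fs-eq : ∀ x y → ⟦ fs′ ⟧₂ x y ≈ ⟦ gs ⟧₂ x y
              fs-eq x y = trans (sym (Mon-eq x y)) (trans (Mon-⟦⟧ (at x gs) (g x) y) (trans (+-congˡ (trans (*-congʳ (trans (v x) (z x))) (zeroˡ _))) (+-identityʳ _)))
            module Div = Division {P = IsPoly} isPoly-+ isPoly-* isPoly-neg isPoly-0 (isPoly-const 1#) g (as , v)
            open Div.DivMod (Div.divMod gs (coeffs₂ (G- r)) gp (coeffs₂-isPoly (G- r)))
            ρ = expr P-remainder
            q = expr P-quotient
            eqn : (app as X ⊛ power) ⊗ (G- r) ≗ expr ps ⊗ q ⊕ ρ
            eqn x y = begin
              ⟪ app as X ⊛ power ⟫ x y * ⟪ G- r ⟫ x y ≈⟨ *-cong (trans (⟪⟫-⊛ (app as X) power x y) (^-cong power (trans (⟪⟫-app as X x y) (sym (v x))))) (⟪⟫-coeffs₂ (G- r) x y) ⟩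
              g x ^ power * ⟦ coeffs₂ (G- r) ⟧₂ x y ≈⟨ equation x y ⟩
              Mon (at x gs) (g x) y * ⟦ quotient ⟧₂ x y + ⟦ remainder ⟧₂ x y ≈⟨ +-cong (*-cong (trans (Mon-eq x y) (sym (⟪⟫-expr ps x y))) (sym (⟪⟫-expr P-quotient x y))) (sym (⟪⟫-expr P-remainder x y)) ⟩
              ⟪ expr ps ⊗ q ⊕ ρ ⟫ x y ∎
            ρ∈ : Kernel ρ
            ρ∈ = combination ((app as X ⊛ power) ⊗ (G- r)) (expr ps ⊗ q) {expr ps ⊗ q} ρ eqn
              (kernel-cong {(G- r) ⊗ (app as X ⊛ power)} {(app as X ⊛ power) ⊗ (G- r)} (λ x y → *-comm _ _) (kernel-⊗ {G- r} (app as X ⊛ power) kernel-G))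
              (λ x y → refl) (kernel-⊗ {expr ps} q f∈)
            rem0 : ∀ x y → ⟦ remainder ⟧₂ x y ≈ 0#
            rem0 = small-kernel n P-remainder (ℕ.≤-trans length-remainder le′) (ℕ.<⇒≤ len) ρ∈
            top-nonzero : (∃[ l ] ∃[ rs ] ¬ l ≈ 0# × (∀ t → ⟦ as ⟧ t ≈ l * ∏ rs t) × length rs ℕ.< length as) → ∀ x y → ⟦ fs′ ⟧₂ x y ≈ 0#
            top-nonzero (l , rs , l≉0 , e , _) = remove-factors (repeat power rs) (^-≉0 power l≉0) ps P-quotient (ℕ.≤-trans le len) f∈ λ x y → begin
              l ^ power * ∏ (repeat power rs) x * ⟪ G- r ⟫ x y ≈⟨ *-congʳ (trans (*-congˡ (∏-repeat power rs x)) (trans (sym (^-* l (∏ rs x) power)) (trans (^-cong power (trans (sym (e x)) (sym (⟪⟫-app as X x y)))) (sym (⟪⟫-⊛ (app as X) power x y))))) ⟩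
              ⟪ (app as X ⊛ power) ⊗ (G- r) ⟫ x y ≈⟨ eqn x y ⟩
              ⟪ expr ps ⟫ x y * ⟪ q ⟫ x y + ⟪ ρ ⟫ x y ≈⟨ +-cong (*-cong (⟪⟫-expr ps x y) (⟪⟫-expr P-quotient x y)) (trans (⟪⟫-expr P-remainder x y) (rem0 x y)) ⟩
              ⟦ fs′ ⟧₂ x y * ⟦ quotient ⟧₂ x y + 0# ≈⟨ +-identityʳ _ ⟩
              ⟦ fs′ ⟧₂ x y * ⟦ quotient ⟧₂ x y ∎

        F-divisible : ∃[ h ] F ≗ (G- r) ⊗ h
        F-divisible = const i ⊗ q , λ x y → cancel-≈ (^-≉0 power lead≉0) (begin
          lead ^ power * ⟪ F ⟫ x y ≈⟨ trans (eqn x y) (trans (+-congˡ (trans (⟪⟫-expr P-remainder x y) (rem0 x y))) (+-identityʳ _)) ⟩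
          ⟪ G- r ⟫ x y * ⟪ q ⟫ x y ≈⟨ trans (sym (*-identityˡ _)) (*-congʳ (sym (*-inverse (lead ^ power) (^-≉0 power lead≉0)))) ⟩
          lead ^ power * i * (⟪ G- r ⟫ x y * ⟪ q ⟫ x y) ≈⟨ solve 4 (λ p i g q → p :* i :* (g :* q) := p :* (g :* (i :* q))) refl (lead ^ power) i (⟪ G- r ⟫ x y) (⟪ q ⟫ x y) ⟩
          lead ^ power * (⟪ G- r ⟫ x y * (i * ⟪ q ⟫ x y)) ∎)
          where
          module Div = Division {P = IsPoly} isPoly-+ isPoly-* isPoly-neg isPoly-0 (isPoly-const 1#) (λ _ → lead) (isPoly-const lead)
          open Div.DivMod (Div.divMod (coeffs- r) (coeffs₂ F) (coeffs-isPoly r) (coeffs₂-isPoly F))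
          i = (lead ^ power) ⁻¹⟨ ^-≉0 power lead≉0 ⟩
          q = expr P-quotient
          ρ = expr P-remainder
          eqn : const (lead ^ power) ⊗ F ≗ (G- r) ⊗ q ⊕ ρ
          eqn x y = trans (*-congˡ (⟪⟫-coeffs₂ F x y)) (trans (equation x y) (+-cong (*-cong (sym (G-≈ r x y)) (sym (⟪⟫-expr P-quotient x y))) (sym (⟪⟫-expr P-remainder x y))))
          rem0 : ∀ x y → ⟦ remainder ⟧₂ x y ≈ 0#
          rem0 = small-kernel degree P-remainder length-remainder ℕ.≤-refl (combination (const (lead ^ power) ⊗ F) ((G- r) ⊗ q) {(G- r) ⊗ q} ρ eqn
            (kernel-cong {F ⊗ const (lead ^ power)} {const (lead ^ power) ⊗ F} (λ x y → *-comm _ _) (kernel-⊗ {F} (const (lead ^ power)) kernel-F)) (λ x y → refl) (kernel-⊗ {G- r} q kernel-G))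

        -- From F = (G - r) h and δ F = l (G - r) follows δ h = l. The flow of δ then finds a zero
        -- of h on G = r, where both factors of F vanish and the curve is singular.
        impossible : ⊥
        impossible = at-zero (proj₁ F-divisible) (proj₂ F-divisible)
          where
          slice : ∀ h → F ≗ (G- r) ⊗ h → δ h ≗ const l
          slice h F-eq = dense-≗ (r ∷ []) (δ h) (const l) λ x y g∉ → cancel-≈ (λ w → g∉ (here (x-y≈0⇒x≈y w))) (begin
            ⟪ G- r ⟫ x y * ⟪ δ h ⟫ x y ≈⟨ solve 3 (λ g d q → g :* d := :0 :* q :+ g :* d) refl (⟪ G- r ⟫ x y) (⟪ δ h ⟫ x y) (⟪ h ⟫ x y) ⟩
            0# * ⟪ h ⟫ x y + ⟪ G- r ⟫ x y * ⟪ δ h ⟫ x y ≈⟨ trans (d-⊗ (G- r) h x y) (+-congʳ (*-congʳ (δ-G r x y))) ⟨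
            ⟪ δ ((G- r) ⊗ h) ⟫ x y ≈⟨ d-cong {F} {(G- r) ⊗ h} F-eq x y ⟨
            ⟪ u ⟫ x y ≈⟨ trans (u-eq x y) (*-comm _ _) ⟩
            ⟪ G- r ⟫ x y * l ∎)
          singular : ∀ h → F ≗ (G- r) ⊗ h → ∀ {x y} → ⟪ G- r ⟫ x y ≈ 0# → ⟪ h ⟫ x y ≈ 0# → ∀ {e} → IsDerivation e → ⟪ e F ⟫ x y ≈ 0#
          singular h F-eq {x} {y} g≈0 h≈0 {e} E = trans (E.d-cong {F} {(G- r) ⊗ h} F-eq x y) (trans (E.d-⊗ (G- r) h x y)
            (trans (+-cong (*-congˡ h≈0) (*-congʳ g≈0)) (solve 2 (λ a b → a :* :0 :+ :0 :* b := :0) refl _ _)))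
            where module E = IsDerivation E
          at-point : ∀ h → F ≗ (G- r) ⊗ h → ∀ {x y} → ⟪ G- r ⟫ x y ≈ 0# → ⟪ h ⟫ x y ≈ 0# → ⊥
          at-point h F-eq {x} {y} g≈0 h≈0 = smooth x y (trans (F-eq x y) (trans (*-congʳ g≈0) (zeroˡ _))) (singular h F-eq g≈0 h≈0 ∂₁-derivation) (singular h F-eq g≈0 h≈0 ∂₂-derivation)
          y₀ = proj₁ (solve-G 0# r)
          at-zero : ∀ h → F ≗ (G- r) ⊗ h → ⊥
          at-zero h F-eq =
            let _ , _ , g , h≈0 = FlowG.flow-to 0# y₀ h (λ x y → trans (d-cong {δ h} {const l} (slice h F-eq) x y) (d-const l x y)) (λ z → l≉0 (trans (sym (slice h F-eq 0# y₀)) z))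
            in at-point h F-eq (x≈y⇒x-y≈0 (trans g (proj₂ (solve-G 0# r)))) h≈0

    degree-≥2 : ¬ Affine → ¬ Punctured → ∃[ bs ] ∃[ l ] ¬ l ≈ 0# × 2 ℕ.≤ length bs × (∀ x y → ⟪ u ⟫ x y ≈ Mon bs l (⟪ G ⟫ x y))
    degree-≥2 ¬A ¬P = go (strip (proj₁ u-poly))
      where
      p = proj₁ u-poly
      u-eq : ∀ x y → ⟪ u ⟫ x y ≈ ⟦ p ⟧ (⟪ G ⟫ x y)
      u-eq x y = trans (proj₂ u-poly x y) (⟪⟫-app p G x y)
      go : (∀ t → ⟦ p ⟧ t ≈ 0#) ⊎ (∃[ bs ] ∃[ l ] ¬ l ≈ 0# × (∀ t → ⟦ p ⟧ t ≈ Mon bs l t) × length bs ℕ.< length p) →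
        ∃[ bs ] ∃[ l ] ¬ l ≈ 0# × 2 ℕ.≤ length bs × (∀ x y → ⟪ u ⟫ x y ≈ Mon bs l (⟪ G ⟫ x y))
      go (inj₁ z) = let b , b∉ = fresh bad ; y , g = solve-G 0# b in ⊥-elim (u≉0 0# y (λ m → b∉ (∈-resp-≈ (sym g) m)) (trans (u-eq 0# y) (z _)))
      go (inj₂ ([] , l , l≉0 , e , _)) = ⊥-elim (¬A (degree-0⇒affine l≉0 (λ x y → trans (u-eq x y) (e _))))
      go (inj₂ (b ∷ [] , l , l≉0 , e , _)) = ⊥-elim (¬P (Degree1.avoids⇒punctured l≉0 eq (λ x y f g → Degree1.At.impossible l≉0 eq x y f g)))
        where
        i = l ⁻¹⟨ l≉0 ⟩
        eq : ∀ x y → ⟪ u ⟫ x y ≈ l * (⟪ G ⟫ x y - - (b * i))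
        eq x y = trans (u-eq x y) (trans (e _) (begin
          b + ⟪ G ⟫ x y * l ≈⟨ +-congʳ (trans (sym (*-identityʳ b)) (*-congˡ (sym (*-inverse l l≉0)))) ⟩
          b * (l * i) + ⟪ G ⟫ x y * l ≈⟨ solve 4 (λ b l i g → b :* (l :* i) :+ g :* l := l :* (g :- :- (b :* i))) refl b l i (⟪ G ⟫ x y) ⟩
          l * (⟪ G ⟫ x y - - (b * i)) ∎))
      go (inj₂ (b ∷ b′ ∷ bs , l , l≉0 , e , _)) = b ∷ b′ ∷ bs , l , l≉0 , s≤s (s≤s z≤n) , λ x y → trans (u-eq x y) (e _)

  -- Rational elements of ℚ̄

  int : ℤ → Carrier
  int i = ι (fromℤ i)

  int-* : ∀ i j → int (i ℤ.* j) ≈ int i * int j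
  int-* i j = trans (ι-cong (fromℤ-* i j)) (ι-* _ _)

  int-+ : ∀ i j → int (i ℤ.+ j) ≈ int i + int j
  int-+ i j = trans (ι-cong (fromℤ-+ i j)) (ι-+ _ _)

  int-^ : ∀ i n → int (i ℤ.^ n) ≈ int i ^ n
  int-^ i 0       = ι-1
  int-^ i (suc n) = trans (int-* i (i ℤ.^ n)) (*-congˡ (int-^ i n))

  int-injective : ∀ {i j} → int i ≈ int j → i ≡ j
  int-injective e = fromℤ-injective (ι-injective e)

  Rational : Carrier → Set ℓ
  Rational α = ∃[ q ] α ≈ ι q

  Cleared : ℤ → List ℤ → List ℚ → Set ℓ
  Cleared d = Pointwise (λ b q → int b ≈ int d * ι q)

  clear-step : ∀ {d bs cs} e → Cleared d bs cs → Cleared (e ℤ.* d) (map (e ℤ.*_) bs) cs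
  clear-step e []       = []
  clear-step {d} {b ∷ bs} e (x ∷ xs) = trans (int-* e b) (trans (*-congˡ x) (trans (sym (*-assoc _ _ _)) (*-congʳ (sym (int-* e d))))) ∷ clear-step {d} e xs

  clear : ∀ cs → ∃[ d ] ∃[ bs ] ¬ d ≡ + 0 × Cleared d bs cs
  clear []       = + 1 , [] , (λ ()) , []
  clear (q ∷ cs) =
    let d , bs , d≢0 , e = clear cs
    in ↧ q ℤ.* d , ↥ q ℤ.* d ∷ map (↧ q ℤ.*_) bs , (λ z → [ ↧≢0 q , d≢0 ]′ (ℤ.i*j≡0⇒i≡0∨j≡0 (↧ q) z)) ,
       ((begin
           int (↥ q ℤ.* d)       ≈⟨ int-* (↥ q) d ⟩
           int (↥ q) * int d     ≈⟨ *-congʳ (trans (ι-cong (≡.sym (denominator-* q))) (ι-* _ _)) ⟩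
           int (↧ q) * ι q * int d ≈⟨ solve 3 (λ a b c → a :* b :* c := a :* c :* b) refl (int (↧ q)) (ι q) (int d) ⟩
           int (↧ q) * int d * ι q ≈⟨ *-congʳ (int-* (↧ q) d) ⟨
           int (↧ q ℤ.* d) * ι q ∎) ∷ clear-step {d} (↧ q) e)
    where
    ↧≢0 : ∀ q → ¬ ↧ q ≡ + 0
    ↧≢0 q@record{} ()

  -- Σ aᵢ zⁱ wⁿ⁻ⁱ + d zⁿ
  hom : List ℤ → ℤ → ℤ → ℤ → ℤ
  hom []       d z w = d
  hom (a ∷ as) d z w = a ℤ.* w ℤ.^ suc (length as) ℤ.+ z ℤ.* hom as d z w

  hom-Mon : ∀ {d bs cs} z w {α} → int w * α ≈ int z → Cleared d bs cs → int (hom bs d z w) ≈ int w ^ length bs * (int d * Mon (map ι cs) 1# α)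
  hom-Mon z w e []       = sym (trans (*-identityˡ _) (*-identityʳ _))
  hom-Mon {d} {b ∷ bs} {q ∷ cs} z w {α} e (x ∷ xs) = begin
    int (b ℤ.* w ℤ.^ suc n ℤ.+ z ℤ.* hom bs d z w) ≈⟨ trans (int-+ (b ℤ.* w ℤ.^ suc n) (z ℤ.* hom bs d z w)) (+-cong (int-* b (w ℤ.^ suc n)) (int-* z (hom bs d z w))) ⟩
    int b * int (w ℤ.^ suc n) + int z * int (hom bs d z w) ≈⟨ +-cong (*-cong x (int-^ w (suc n))) (*-cong (sym e) (hom-Mon {d} {bs} {cs} z w e xs)) ⟩
    int d * ι q * (int w * int w ^ n) + int w * α * (int w ^ n * (int d * M))
      ≈⟨ solve 6 (λ d q w p a m → d :* q :* (w :* p) :+ w :* a :* (p :* (d :* m)) := w :* p :* (d :* (q :+ a :* m))) refl (int d) (ι q) (int w) (int w ^ n) α M ⟩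
    int w * int w ^ n * (int d * (ι q + α * M)) ∎
    where
    n = length bs
    M = Mon (map ι cs) 1# α

  coprime-power : ∀ {m n} k {o} → Coprime m n → m ∣ n ℕ.^ k ℕ.* o → m ∣ o
  coprime-power 0 {o} c d = ≡.subst (_ ∣_) (ℕ.+-identityʳ o) d
  coprime-power {m} {n} (suc k) {o} c d = coprime-power k c (coprime-divisor c (≡.subst (m ∣_) (ℕ.*-assoc n (n ℕ.^ k) o) d))

  abs-^ : ∀ i n → ℤ.∣ i ℤ.^ n ∣ ≡ ℤ.∣ i ∣ ℕ.^ n
  abs-^ i 0       = ≡.refl
  abs-^ i (suc n) = ≡.trans (ℤ.abs-* i (i ℤ.^ n)) (≡.cong (ℤ.∣ i ∣ ℕ.*_) (abs-^ i n))

  -- Every term of `hom` but the first contains z, and z is coprime to w: half of the rational root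
  -- theorem. The other half, for the leading coefficient, is `hom-lead`.
  hom-first : ∀ {b bs d z w} → Coprime ℤ.∣ z ∣ ℤ.∣ w ∣ → hom (b ∷ bs) d z w ≡ + 0 → ℤ.∣ z ∣ ∣ ℤ.∣ b ∣
  hom-first {b} {bs} {d} {z} {w} c e = coprime-power (suc n) c (divides ℤ.∣ h ∣ (≡.trans (≡.cong₂ ℕ._*_ (≡.sym (abs-^ w (suc n))) ≡.refl)
    (≡.trans (ℕ.*-comm (ℤ.∣ w ℤ.^ suc n ∣) ℤ.∣ b ∣) (≡.trans (≡.sym (ℤ.abs-* b (w ℤ.^ suc n))) (≡.trans (≡.cong ℤ.∣_∣ (ℤ.i-j≡0⇒i≡j (b ℤ.* w ℤ.^ suc n) (ℤ.- (z ℤ.* h)) (≡.trans (≡.cong (λ v → b ℤ.* w ℤ.^ suc n ℤ.+ v) (ℤ.neg-involutive (z ℤ.* h))) e)))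
    (≡.trans (ℤ.∣-i∣≡∣i∣ (z ℤ.* h)) (≡.trans (ℤ.abs-* z h) (ℕ.*-comm ℤ.∣ z ∣ ℤ.∣ h ∣))))))))
    where
    n = length bs
    h = hom bs d z w

  hom-last : ∀ bs {d z w} → ∃[ h ] hom bs d z w ≡ w ℤ.* h ℤ.+ z ℤ.^ length bs ℤ.* d
  hom-last []       {d} {z} {w} = + 0 , ≡.sym (≡.trans (≡.cong₂ ℤ._+_ (ℤ.*-zeroʳ w) (ℤ.*-identityˡ d)) (ℤ.+-identityˡ d))
  hom-last (b ∷ bs) {d} {z} {w} =
    let h , e = hom-last bs {d} {z} {w}
    in b ℤ.* w ℤ.^ length bs ℤ.+ z ℤ.* h , ≡.trans (≡.cong (λ v → b ℤ.* w ℤ.^ suc (length bs) ℤ.+ z ℤ.* v) e)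
         (ℤS.solve 6 (λ b w p z h q → b ℤS.:* (w ℤS.:* p) ℤS.:+ z ℤS.:* (w ℤS.:* h ℤS.:+ q) ℤS.:= w ℤS.:* (b ℤS.:* p ℤS.:+ z ℤS.:* h) ℤS.:+ z ℤS.:* q) ≡.refl b w (w ℤ.^ length bs) z h (z ℤ.^ length bs ℤ.* d) ∙
          ≡.cong (λ v → w ℤ.* (b ℤ.* w ℤ.^ length bs ℤ.+ z ℤ.* h) ℤ.+ v) (≡.sym (ℤ.*-assoc z (z ℤ.^ length bs) d)))
    where _∙_ = ≡.trans

  hom-lead : ∀ bs {d z w} → Coprime ℤ.∣ w ∣ ℤ.∣ z ∣ → hom bs d z w ≡ + 0 → ℤ.∣ w ∣ ∣ ℤ.∣ d ∣
  hom-lead bs {d} {z} {w} c e =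
    let h , e′ = hom-last bs {d} {z} {w}
        zd≡ : z ℤ.^ length bs ℤ.* d ≡ ℤ.- (w ℤ.* h)
        zd≡ = ℤ.i-j≡0⇒i≡j (z ℤ.^ length bs ℤ.* d) (ℤ.- (w ℤ.* h)) (≡.trans (≡.cong (λ v → z ℤ.^ length bs ℤ.* d ℤ.+ v) (ℤ.neg-involutive (w ℤ.* h))) (≡.trans (ℤ.+-comm (z ℤ.^ length bs ℤ.* d) (w ℤ.* h)) (≡.trans (≡.sym e′) e)))
    in coprime-power (length bs) c (divides ℤ.∣ h ∣ (≡.trans (≡.cong (ℕ._* ℤ.∣ d ∣) (≡.sym (abs-^ z (length bs)))) (≡.trans (≡.sym (ℤ.abs-* (z ℤ.^ length bs) d))
         (≡.trans (≡.cong ℤ.∣_∣ zd≡) (≡.trans (ℤ.∣-i∣≡∣i∣ (w ℤ.* h)) (≡.trans (ℤ.abs-* w h) (ℕ.*-comm ℤ.∣ w ∣ ℤ.∣ h ∣)))))))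

  root-bound : ∀ cs → ∃[ N ] ∀ q → Mon (map ι cs) 1# (ι q) ≈ 0# → ℤ.∣ ↥ q ∣ ℕ.≤ N × ↧ₙ q ℕ.≤ N
  root-bound []       = 0 , λ q e → ⊥-elim (1≉0 e)
  root-bound (c ∷ cs) with c ℚ.≟ 0ℚ
  ... | yes c≡0 =
    let N , bound = root-bound cs
    -- With constant term 0, either q is a root of the quotient by t or q = 0; the denominator 1 of
    -- the latter is the reason for `suc`.
    in suc N , λ q e → zero-case N bound q (trans (sym (trans (+-congʳ (trans (ι-cong c≡0) ι-0)) (+-identityˡ _))) e)
    where
    zero-case : ∀ N → (∀ q → Mon (map ι cs) 1# (ι q) ≈ 0# → ℤ.∣ ↥ q ∣ ℕ.≤ N × ↧ₙ q ℕ.≤ N) → ∀ q → ι q * Mon (map ι cs) 1# (ι q) ≈ 0# → ℤ.∣ ↥ q ∣ ℕ.≤ suc N × ↧ₙ q ℕ.≤ suc N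
    zero-case N bound q e with ι q ≟ 0#
    ... | yes z = ≡.subst (λ q → ℤ.∣ ↥ q ∣ ℕ.≤ suc N × ↧ₙ q ℕ.≤ suc N) (≡.sym (ι-≈0 z)) (z≤n , s≤s z≤n)
    ... | no nz = let p , p′ = bound q (cancel nz e) in ℕ.m≤n⇒m≤1+n p , ℕ.m≤n⇒m≤1+n p′
  ... | no c≢0 = go (clear (c ∷ cs))
    where
    go : ∃[ d ] ∃[ bs ] ¬ d ≡ + 0 × Cleared d bs (c ∷ cs) → ∃[ N ] ∀ q → Mon (map ι (c ∷ cs)) 1# (ι q) ≈ 0# → ℤ.∣ ↥ q ∣ ℕ.≤ N × ↧ₙ q ℕ.≤ N
    go (d , b ∷ bs , d≢0 , x ∷ xs) = ℤ.∣ b ∣ ℕ.+ ℤ.∣ d ∣ , λ q e →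
      let hom≡0 : hom (b ∷ bs) d (↥ q) (↧ q) ≡ + 0
          hom≡0 = int-injective (trans (hom-Mon {d} {b ∷ bs} {c ∷ cs} (↥ q) (↧ q) (trans (sym (ι-* _ _)) (ι-cong (denominator-* q))) (x ∷ xs)) (trans (*-congˡ (trans (*-congˡ e) (zeroʳ _))) (trans (zeroʳ _) (sym ι-0))))
      in ℕ.≤-trans (ℕ∣.∣⇒≤ {{ℕ.≢-nonZero (λ z → b≢0 (ℤ.∣i∣≡0⇒i≡0 z))}} (hom-first {b} {bs} {d} {↥ q} {↧ q} (coprime q) hom≡0)) (ℕ.m≤m+n _ _) ,
         ℕ.≤-trans (ℕ∣.∣⇒≤ {{ℕ.≢-nonZero (λ z → d≢0 (ℤ.∣i∣≡0⇒i≡0 z))}} (hom-lead (b ∷ bs) {d} {↥ q} {↧ q} (Coprimality.sym (coprime q)) hom≡0)) (ℕ.m≤n+m _ _)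
      where
      coprime : ∀ q → Coprime ℤ.∣ ↥ q ∣ (↧ₙ q)
      coprime (mkℚ z d-1 cp) = Coprimality.recompute cp
      b≢0 : ¬ b ≡ + 0
      b≢0 b≡0 = *-≉0 (λ z → d≢0 (int-injective (trans z (sym ι-0)))) (λ z → c≢0 (ι-≈0 z)) (trans (sym x) (trans (reflexive (≡.cong int b≡0)) ι-0))

  tabulate-sum : ∀ n (f : Fin n → Carrier) t → ⟦ List.tabulate f ⟧ t ≈ sum (λ i → f i * t ^ Fin.toℕ i)
  tabulate-sum 0       f t = refl
  tabulate-sum (suc n) f t = +-cong (sym (*-identityʳ _)) (trans (*-congˡ (tabulate-sum n (λ i → f (Fin.suc i)) t))
    (*-sum-cong n t {λ i → f (Fin.suc i) * t ^ Fin.toℕ i} {λ i → f (Fin.suc i) * (t * t ^ Fin.toℕ i)} λ i → solve 3 (λ t x p → t :* (x :* p) := x :* (t :* p)) refl t _ _))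

  algebraic-Mon : ∀ α → ∃[ cs ] Mon (map ι cs) 1# α ≈ 0#
  algebraic-Mon α =
    let n , a , e = algebraic α
        len : length (map ι (List.tabulate a)) ≡ n
        len = ≡.trans (List.length-map ι (List.tabulate a)) (List.length-tabulate a)
    in List.tabulate a , (begin
      Mon (map ι (List.tabulate a)) 1# α ≈⟨ Mon-⟦⟧ (map ι (List.tabulate a)) 1# α ⟩
      ⟦ map ι (List.tabulate a) ⟧ α + 1# * α ^ length (map ι (List.tabulate a)) ≈⟨ +-cong (trans (reflexive (≡.cong (λ l → ⟦ l ⟧ α) (List.map-tabulate a ι))) (tabulate-sum n (λ i → ι (a i)) α)) (trans (*-identityˡ _) (reflexive (≡.cong (α ^_) len))) ⟩
      sum (λ i → ι (a i) * α ^ Fin.toℕ i) + α ^ n ≈⟨ +-comm _ _ ⟩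
      evalMonic (λ i → ι (a i)) α ≈⟨ e ⟩
      0# ∎)

  Mon-cong-t : ∀ cs {s t} → s ≈ t → Mon (map ι cs) 1# s ≈ Mon (map ι cs) 1# t
  Mon-cong-t cs = Mon-cong (map ι cs) 1#

  -- An algebraic number is a root of a monic rational polynomial, so numerator and denominator of a
  -- rational value are bounded and a finite search decides. This removes the double negations with
  -- which conjugations come.
  rational? : ∀ α → Dec (Rational α)
  rational? α =
    let cs , e = algebraic-Mon α
        N , bound = root-bound cs
    in map′ (λ (m , _ , n , _ , z) → [ (λ w → _ , w) , (λ w → _ , w) ]′ z)
        (λ (q , w) → found N q w (bound q (trans (Mon-cong-t cs (sym w)) e)))
        -- Absolute numerators m run from 0 to N, denominators n + 1 from 1 to N: hence the bounds
        -- `suc N` and `N`.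
        (ℕ.anyUpTo? (λ m → ℕ.anyUpTo? (λ n → (α ≟ ι (+ m ℚ./ suc n)) ⊎-dec (α ≟ ι (ℤ.- (+ m) ℚ./ suc n))) N) (suc N))
    where
    found : ∀ N q → α ≈ ι q → ℤ.∣ ↥ q ∣ ℕ.≤ N × ↧ₙ q ℕ.≤ N → ∃[ m ] m ℕ.< suc N × (∃[ n ] n ℕ.< N × (α ≈ ι (+ m ℚ./ suc n) ⊎ α ≈ ι (ℤ.- (+ m) ℚ./ suc n)))
    found N q@(mkℚ (+ m)    n _) w (p , p′) = m , s≤s p , n , p′ , inj₁ (trans w (ι-cong (≡.sym (ℚ.↥p/↧p≡p q))))
    found N q@(mkℚ -[1+ m ] n _) w (p , p′) = suc m , s≤s p , n , p′ , inj₂ (trans w (ι-cong (≡.sym (ℚ.↥p/↧p≡p q))))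

  rational-stable : ∀ {α} → ¬ ¬ Rational α → Rational α
  rational-stable {α} nn with rational? α
  ... | yes r = r
  ... | no ¬r = ⊥-elim (nn ¬r)

  -- Conjugation

  rational-ι : ∀ q → Rational (ι q)
  rational-ι q = q , refl

  rational-resp : ∀ {a b} → b ≈ a → Rational a → Rational b
  rational-resp e (q , w) = q , trans e w

  rational-* : ∀ {a b} → Rational a → Rational b → Rational (a * b)
  rational-* (p , v) (q , w) = p ℚ.* q , trans (*-cong v w) (sym (ι-* p q))

  rational-neg : ∀ {a} → Rational a → Rational (- a)
  rational-neg (p , v) = ℚ.- p , trans (-‿cong v) (sym (ι-neg p))

  rational-nat : ∀ n → Rational (nat n)
  rational-nat n = _ , nat≈ι n

  rational-inverse : ∀ {a} (a≉0 : ¬ a ≈ 0#) → Rational a → Rational (a ⁻¹⟨ a≉0 ⟩)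
  rational-inverse {a} a≉0 (q , v) = (ℚ.1/ q) {{nz}} , cancel-≈ a≉0 (trans (*-inverse a a≉0) (sym (begin
    a * ι ((ℚ.1/ q) {{nz}})     ≈⟨ trans (*-congʳ v) (sym (ι-* _ _)) ⟩
    ι (q ℚ.* (ℚ.1/ q) {{nz}})   ≈⟨ ι-cong (ℚ.*-inverseʳ q {{nz}}) ⟩
    ι 1ℚ                        ≈⟨ ι-1 ⟩
    1#                          ∎)))
    where
    nz = ℚ.≢-nonZero {q} (λ q≡0 → a≉0 (trans v (trans (ι-cong q≡0) ι-0)))

  -- The graph of a homomorphism to ℚ̄ from a subring of ℚ̄.
  record PartialHom : Set (Level.suc (c ⊔ ℓ)) where
    field
      R      : Carrier → Carrier → Set (c ⊔ ℓ)
      R-resp : ∀ {x x′ y y′} → x ≈ x′ → y ≈ y′ → R x y → R x′ y′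
      R-ι    : ∀ q → R (ι q) (ι q)
      R-+    : ∀ {x x′ y y′} → R x y → R x′ y′ → R (x + x′) (y + y′)
      R-*    : ∀ {x x′ y y′} → R x y → R x′ y′ → R (x * x′) (y * y′)
      R-zero : ∀ {x y} → R x y → x ≈ 0# → y ≈ 0#

    R-rational : ∀ {x} → Rational x → R x x
    R-rational (q , v) = R-resp (sym v) (sym v) (R-ι q)

    R-0 : R 0# 0#
    R-0 = R-rational (0ℚ , sym ι-0)

    R-1 : R 1# 1#
    R-1 = R-rational (1ℚ , sym ι-1)

    R-neg : ∀ {x y} → R x y → R (- x) (- y)
    R-neg {x} {y} r = R-resp (solve 1 (λ x → :- :1 :* x := :- x) refl x) (solve 1 (λ x → :- :1 :* x := :- x) refl y) (R-* (R-rational (rational-neg (1ℚ , sym ι-1))) r)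

    functional : ∀ {x x′ y y′} → R x y → R x′ y′ → x ≈ x′ → y ≈ y′
    functional r r′ e = x-y≈0⇒x≈y (R-zero (R-+ r (R-neg r′)) (x≈y⇒x-y≈0 e))

    R-^ : ∀ {x y} n → R x y → R (x ^ n) (y ^ n)
    R-^ 0       r = R-1
    R-^ (suc n) r = R-* r (R-^ n r)

    R-Mon : ∀ cs {x y} → R x y → R (Mon (map ι cs) 1# x) (Mon (map ι cs) 1# y)
    R-Mon []       r = R-1
    R-Mon (q ∷ cs) r = R-+ (R-ι q) (R-* r (R-Mon cs r))

    -- The domain is algebraic over ℚ, hence a field.
    R-inverse : ∀ {x y} → R x y → ¬ x ≈ 0# → ∃[ w ] ∃[ w′ ] R w w′ × x * w ≈ 1#
    R-inverse {x} {y} r x≉0 = go (proj₁ (algebraic-Mon x)) (proj₂ (algebraic-Mon x))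
      where
      go : ∀ cs → Mon (map ι cs) 1# x ≈ 0# → ∃[ w ] ∃[ w′ ] R w w′ × x * w ≈ 1#
      go []       e = ⊥-elim (1≉0 e)
      go (q ∷ cs) e with ι q ≟ 0#
      ... | yes z = go cs (cancel x≉0 (trans (sym (trans (+-congʳ z) (+-identityˡ _))) e))
      ... | no nz = _ , _ , R-* (R-neg (R-rational (rational-inverse nz (q , refl)))) (R-Mon cs r) , (begin
        x * (- i * M)          ≈⟨ solve 4 (λ x i m q → x :* (:- i :* m) := q :* i :- i :* (q :+ x :* m)) refl x i M (ι q) ⟩
        ι q * i - i * (ι q + x * M) ≈⟨ +-cong (*-inverse (ι q) nz) (-‿cong (*-congˡ e)) ⟩
        1# - i * 0#            ≈⟨ solve 1 (λ i → :1 :- i :* :0 := :1) refl i ⟩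
        1# ∎)
        where
        i = ι q ⁻¹⟨ nz ⟩
        M = Mon (map ι cs) 1# x

    R-injective : ∀ {x y} → R x y → y ≈ 0# → x ≈ 0#
    R-injective {x} {y} r y≈0 = ≈-stable λ x≉0 →
      let w , w′ , rw , e = R-inverse r x≉0
      in 1≉0 (trans (functional R-1 (R-* r rw) (sym e)) (trans (*-congʳ y≈0) (zeroˡ _)))

  rationals : PartialHom
  rationals = record
    { R      = λ x y → Lift c (∃[ q ] x ≈ ι q × y ≈ ι q)
    ; R-resp = λ e e′ (lift (q , v , w)) → lift (q , trans (sym e) v , trans (sym e′) w)
    ; R-ι    = λ q → lift (q , refl , refl)
    ; R-+    = λ (lift (p , v , w)) (lift (q , v′ , w′)) → lift (p ℚ.+ q , trans (+-cong v v′) (sym (ι-+ p q)) , trans (+-cong w w′) (sym (ι-+ p q)))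
    ; R-*    = λ (lift (p , v , w)) (lift (q , v′ , w′)) → lift (p ℚ.* q , trans (*-cong v v′) (sym (ι-* p q)) , trans (*-cong w w′) (sym (ι-* p q)))
    ; R-zero = λ (lift (q , v , w)) z → trans w (trans (sym v) z)
    }

  -- Meant for `Monic`, for which no decision procedure is at hand: the least degree is available
  -- only up to double negation.
  ¬¬-least : ∀ {p} {P : ℕ → Set p} n → P n → ¬ ¬ (∃[ m ] P m × (∀ k → k ℕ.< m → ¬ P k))
  ¬¬-least {P = P} = <-rec _ λ n rec pn k → k (n , pn , λ m lt pm → rec lt pm k)

  module Extend (φ : PartialHom) (α : Carrier) where
    open PartialHom φ
    open Param Bool using () renaming (at to atB; _⊞F_ to _⊞B_; _⊠F_ to _⊠B_; scaleF to scaleB; ⟦⟧F-⊞ to ⟦⟧B-⊞; ⟦⟧F-⊠ to ⟦⟧B-⊠; ⟦⟧F-scale to ⟦⟧B-scale; module ClosedF to ClosedB; module Division to DivisionB)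

    -- A coefficient is an element of the domain of φ, at `false`, together with its image, at
    -- `true`. One list is thus a polynomial and its conjugate at the same time.
    P : (Bool → Carrier) → Set (c ⊔ ℓ)
    P f = R (f false) (f true)

    open ClosedB {P = P} R-+ R-* R-0 renaming (All-⊞ to All-⊞B; All-⊠ to All-⊠B; All-scale to All-scaleB)

    Monic : ℕ → Set (c ⊔ ℓ)
    Monic n = ∃[ ms ] All P ms × length ms ≡ n × Mon (atB false ms) 1# α ≈ 0#

    rational-coeffs : ∀ {as} → All Rational as → ∃[ ms ] All P ms × length ms ≡ length as × (∀ b → atB b ms ≡ as)
    rational-coeffs []              = [] , [] , ≡.refl , λ _ → ≡.refl
    rational-coeffs {a ∷ _} (p ∷ ps) = let ms , q , l , e = rational-coeffs ps in (λ _ → a) ∷ ms , R-rational p ∷ q , ≡.cong suc l , λ b → ≡.cong (a ∷_) (e b)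

    monic-exists : ∃ Monic
    monic-exists =
      let cs , e = algebraic-Mon α
          ms , p , _ , eq = rational-coeffs (all-rational cs)
      in length ms , ms , p , ≡.refl , trans (reflexive (≡.cong (λ l → Mon l 1# α) (eq false))) e
      where
      all-rational : ∀ cs → All Rational (map ι cs)
      all-rational []       = []
      all-rational (q ∷ cs) = rational-ι q ∷ all-rational cs

    record Minimal : Set (c ⊔ ℓ) where
      field
        ms      : List (Bool → Carrier)
        ms-P    : All P ms
        ms-root : Mon (atB false ms) 1# α ≈ 0#
        smaller : ∀ k → k ℕ.< length ms → ¬ Monic k

    minimal : ¬ ¬ Minimal
    minimal k = ¬¬-least {P = Monic} (proj₁ monic-exists) (proj₂ monic-exists) λ { (n , (ms , p , ≡.refl , e) , l) → k (record { ms = ms ; ms-P = p ; ms-root = e ; smaller = l }) }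

    stripB : ∀ {ρ} → All P ρ → All (λ f → f false ≈ 0#) ρ ⊎
      (∃[ bs ] ∃[ g ] All P bs × P g × ¬ g false ≈ 0# × length bs ℕ.< length ρ × (∀ t → ⟦ atB false ρ ⟧ t ≈ Mon (atB false bs) (g false) t))
    stripB [] = inj₁ []
    stripB {f ∷ ρ} (p ∷ ps) with stripB ps
    ... | inj₂ (bs , g , bp , gp , g≉0 , lt , e) = inj₂ (f ∷ bs , g , p ∷ bp , gp , g≉0 , s≤s lt , λ t → +-congˡ (*-congˡ (e t)))
    ... | inj₁ zs with f false ≟ 0#
    ...   | yes z = inj₁ (z ∷ zs)
    ...   | no nz = inj₂ ([] , f , [] , p , nz , s≤s z≤n , λ t → trans (+-congˡ (*-congˡ (zero⇒vanish (at-zero zs) t))) (trans (+-congˡ (zeroʳ t)) (+-identityʳ _)))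
      where
      at-zero : ∀ {ρ} → All (λ f → f false ≈ 0#) ρ → All (_≈ 0#) (atB false ρ)
      at-zero []       = []
      at-zero (z ∷ zs) = z ∷ at-zero zs

    Mon-scale : ∀ w bs l t → w * Mon bs l t ≈ Mon (scale w bs) (w * l) t
    Mon-scale w []       l t = refl
    Mon-scale w (b ∷ bs) l t = trans (solve 4 (λ w b t m → w :* (b :+ t :* m) := w :* b :+ t :* (w :* m)) refl w b t (Mon bs l t)) (+-congˡ (*-congˡ (Mon-scale w bs l t)))

    module WithMinimal (μ : Minimal) where
      open Minimal μ

      -- A nonzero polynomial of smaller degree with root α could be made monic, the domain being a
      -- field (`R-inverse`), against minimality.
      small-zero : ∀ {ρ} → All P ρ → length ρ ℕ.≤ length ms → ⟦ atB false ρ ⟧ α ≈ 0# → All (λ f → f false ≈ 0#) ρ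
      small-zero {ρ} ps le z with stripB ps
      ... | inj₁ zs = zs
      ... | inj₂ (bs , g , bp , gp , g≉0 , lt , e) =
        let w , w′ , rw , gw≈1 = R-inverse gp g≉0
            W : Bool → Carrier
            W b = if b then w′ else w
        in ⊥-elim (smaller (length bs) (ℕ.<-≤-trans lt le) (scaleB W bs , All-scaleB {W} rw bp , List.length-map _ bs , (begin
          Mon (atB false (scaleB W bs)) 1# α ≈⟨ Mon-lead (at-scale W bs) (trans (*-comm w (g false)) gw≈1) ⟩
          Mon (scale w (atB false bs)) (w * g false) α ≈⟨ Mon-scale w (atB false bs) (g false) α ⟨
          w * Mon (atB false bs) (g false) α ≈⟨ trans (*-congˡ (trans (sym (e α)) z)) (zeroʳ w) ⟩
          0# ∎)))
        where
        at-scale : ∀ (W : Bool → Carrier) bs → atB false (scaleB W bs) ≡ scale (W false) (atB false bs)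
        at-scale = Param.at-scale Bool false
        Mon-lead : ∀ {as bs l t} → as ≡ bs → l ≈ 1# → Mon as 1# t ≈ Mon bs l t
        Mon-lead {[]}     ≡.refl e = sym e
        Mon-lead {a ∷ as} ≡.refl e = +-congˡ (*-congˡ (Mon-lead {as} ≡.refl e))

      module AtRoot (β : Carrier) (β-root : Mon (atB true ms) 1# β ≈ 0#) where

        R′ : Carrier → Carrier → Set (c ⊔ ℓ)
        R′ x y = ∃[ fs ] All P fs × x ≈ ⟦ atB false fs ⟧ α × y ≈ ⟦ atB true fs ⟧ β

        private
          module Div = DivisionB {P = P} R-+ R-* R-neg R-0 R-1 (λ _ → 1#) R-1

        -- Well-definedness of f(α) ↦ f^φ(β): division by the minimal polynomial preserves both
        -- values, since α and β are roots of it and of its conjugate, and the remainder is zero by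
        -- minimality.
        R′-zero : ∀ {x y} → R′ x y → x ≈ 0# → y ≈ 0#
        R′-zero {x} {y} (fs , fp , v , w) x≈0 = trans w (trans (reduce true β-root) (zero⇒vanish (at-zero (small-zero P-remainder length-remainder (trans (sym (reduce false ms-root)) (trans (sym v) x≈0))) P-remainder) β))
          where
          open Div.DivMod (Div.divMod ms fs ms-P fp)
          reduce : ∀ b {t} → Mon (atB b ms) 1# t ≈ 0# → ⟦ atB b fs ⟧ t ≈ ⟦ atB b remainder ⟧ t
          reduce b {t} root = begin
            ⟦ atB b fs ⟧ t ≈⟨ trans (sym (*-identityˡ _)) (*-congʳ (sym (1^ power))) ⟩
            1# ^ power * ⟦ atB b fs ⟧ t ≈⟨ equation b t ⟩
            Mon (atB b ms) 1# t * ⟦ atB b quotient ⟧ t + ⟦ atB b remainder ⟧ t ≈⟨ trans (+-congʳ (trans (*-congʳ root) (zeroˡ _))) (+-identityˡ _) ⟩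
            ⟦ atB b remainder ⟧ t ∎
          at-zero : ∀ {ρ} → All (λ f → f false ≈ 0#) ρ → All P ρ → All (_≈ 0#) (atB true ρ)
          at-zero []       []       = []
          at-zero (z ∷ zs) (p ∷ ps) = R-zero p z ∷ at-zero zs ps

        single : ∀ {x y} → R x y → R′ x y
        single {x} {y} r = (λ b → if b then y else x) ∷ [] , r ∷ [] , solve 2 (λ x t → x := x :+ t :* :0) refl x α , solve 2 (λ x t → x := x :+ t :* :0) refl y β

        extension : PartialHom
        extension = record
          { R      = R′
          ; R-resp = λ e e′ (fs , p , v , w) → fs , p , trans (sym e) v , trans (sym e′) w
          ; R-ι    = λ q → single (R-ι q)
          ; R-+    = λ (fs , p , v , w) (gs , q , v′ , w′) → fs ⊞B gs , All-⊞B p q , trans (+-cong v v′) (sym (⟦⟧B-⊞ false fs gs α)) , trans (+-cong w w′) (sym (⟦⟧B-⊞ true fs gs β))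
          ; R-*    = λ (fs , p , v , w) (gs , q , v′ , w′) → fs ⊠B gs , All-⊠B p q , trans (*-cong v v′) (sym (⟦⟧B-⊠ false fs gs α)) , trans (*-cong w w′) (sym (⟦⟧B-⊠ true fs gs β))
          ; R-zero = R′-zero
          }

        α-β : R′ α β
        α-β = (λ _ → 0#) ∷ (λ _ → 1#) ∷ [] , R-0 ∷ R-1 ∷ [] , solve 1 (λ t → t := :0 :+ t :* (:1 :+ t :* :0)) refl α , solve 1 (λ t → t := :0 :+ t :* (:1 :+ t :* :0)) refl β

      root : ∃[ β ] Mon (atB true ms) 1# β ≈ 0#
      root with ms | ms-root
      ... | []      | e = ⊥-elim (1≉0 e)
      ... | m ∷ ms′ | _ = Mon-root (m true) (atB true ms′) 1≉0

  _⊑_ : PartialHom → PartialHom → Set (c ⊔ ℓ)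
  φ ⊑ ψ = ∀ {x y} → PartialHom.R φ x y → PartialHom.R ψ x y

  extend : ∀ φ α → ¬ ¬ (∃[ ψ ] φ ⊑ ψ × (∃[ β ] PartialHom.R ψ α β))
  extend φ α k = Extend.minimal φ α λ μ →
    let open Extend φ α
        open WithMinimal μ
        β , e = root
        open AtRoot β e
    in k (extension , single , β , α-β)

  extend-all : ∀ φ αs → ¬ ¬ (∃[ ψ ] φ ⊑ ψ × All (λ α → ∃[ β ] PartialHom.R ψ α β) αs)
  extend-all φ []       k = k (φ , (λ r → r) , [])
  extend-all φ (α ∷ αs) k = extend φ α λ (ψ , φ⊑ψ , β , r) → extend-all ψ αs λ (χ , ψ⊑χ , rs) → k (χ , (λ r → ψ⊑χ (φ⊑ψ r)) , (β , ψ⊑χ r) ∷ rs)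

  derivFrom-Mon : ∀ k cs t → ⟦ derivFrom k (cs ++ 1# ∷ []) ⟧ t ≈ Mon (derivFrom k cs) (nat (k ℕ.+ length cs)) t
  derivFrom-Mon k []       t = trans (solve 2 (λ n t → n :* :1 :+ t :* :0 := n) refl (nat k) t) (reflexive (≡.cong nat (≡.sym (ℕ.+-identityʳ k))))
  derivFrom-Mon k (a ∷ as) t = +-congˡ (*-congˡ (trans (derivFrom-Mon (suc k) as t) (reflexive (≡.cong (λ n → Mon (derivFrom (suc k) as) (nat n) t) (≡.sym (ℕ.+-suc k (length as)))))))

  derivFrom-rational : ∀ k {cs} → All Rational cs → All Rational (derivFrom k cs)
  derivFrom-rational k []       = []
  derivFrom-rational k (p ∷ ps) = rational-* (rational-nat k) p ∷ derivFrom-rational (suc k) ps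

  -- The minimal polynomial of α over ℚ has simple roots, so α ∉ ℚ has a conjugate β ≠ α.
  move : ∀ α → ¬ Rational α → ¬ ¬ (∃[ ψ ] ∃[ β ] PartialHom.R ψ α β × ¬ β ≈ α)
  move α irrational k = minimal λ μ → go μ
    where
    open PartialHom rationals using (R)
    open Extend rationals α
    go : Minimal → ⊥
    go μ = all-equal (λ β root β≉α → let open WithMinimal.AtRoot μ β root in k (extension , β , α-β , β≉α))
      where
      open Minimal μ
      at′ = map (λ (f : Bool → Carrier) → f true)
      at₀ = map (λ (f : Bool → Carrier) → f false)
      Mon-same : ∀ {ms} → All P ms → ∀ t → Mon (at₀ ms) 1# t ≈ Mon (at′ ms) 1# t
      Mon-same []       t = refl
      Mon-same (p ∷ ps) t = +-cong (let q , v , w = lower p in trans v (sym w)) (*-congˡ (Mon-same ps t))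
      rational-at : ∀ {ms} → All P ms → All Rational (at′ ms)
      rational-at []       = []
      rational-at (p ∷ ps) = (let q , v , w = lower p in q , w) ∷ rational-at ps
      -- If α is the only root, degree 1 makes α rational. In degree at least 2, α is a double root,
      -- so the derivative, made monic by dividing by the degree, vanishes at α too and contradicts
      -- minimality.
      all-equal : ¬ (∀ β → Mon (at′ ms) 1# β ≈ 0# → ¬ ¬ β ≈ α)
      all-equal same = contradiction ms ms-P smaller factored (trans (sym (Mon-same ms-P α)) ms-root)
        where
        f = Mon-factor (length ms) (at′ ms) (List.length-map _ ms) 1≉0
        factored : ∃[ rs ] length rs ≡ length ms × All (_≈ α) rs × (∀ t → Mon (at′ ms) 1# t ≈ 1# * ∏ rs t)
        factored = let rs , l , e = f in rs , l , All.map (λ {r} z → ≈-stable (same r (trans (e r) (trans (*-congˡ z) (zeroʳ _))))) (∏-roots rs) , e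
        contradiction : ∀ ms → All P ms → (∀ k → k ℕ.< length ms → ¬ Monic k) → (∃[ rs ] length rs ≡ length ms × All (_≈ α) rs × (∀ t → Mon (at′ ms) 1# t ≈ 1# * ∏ rs t)) →
          Mon (at′ ms) 1# α ≈ 0# → ⊥
        contradiction [] _ _ _ e = 1≉0 e
        contradiction (m ∷ []) (p ∷ []) _ _ e = irrational (let q , v , w = lower p in rational-resp
          (trans (solve 2 (λ a m → a := m :+ a :* :1 :- m) refl α (m true)) (trans (+-congʳ e) (+-identityˡ _))) (rational-neg (q , w)))
        contradiction (m ∷ m′ ∷ ms) (p ∷ ps) least (r ∷ r′ ∷ rs , l , e₁ ∷ e₂ ∷ _ , e) _ =
          least (suc (length ms)) (s≤s (s≤s ℕ.≤-refl)) (proj₁ lifted , proj₁ (proj₂ lifted) , ≡.trans (proj₁ (proj₂ (proj₂ lifted))) lengths , (begin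
            Mon (map (λ f → f false) (proj₁ lifted)) 1# α ≈⟨ reflexive (≡.cong (λ l → Mon l 1# α) (proj₂ (proj₂ (proj₂ lifted)) false)) ⟩
            Mon (scale i (derivFrom 1 as)) 1# α ≈⟨ Mon-lead (scale i (derivFrom 1 as)) (trans (*-comm i N) (*-inverse N N≉0)) ⟨
            Mon (scale i (derivFrom 1 as)) (i * N) α ≈⟨ Mon-scale i (derivFrom 1 as) N α ⟨
            i * Mon (derivFrom 1 as) N α ≈⟨ *-congˡ (derivFrom-Mon 1 as α) ⟨
            i * ⟦ derivFrom 1 (as ++ 1# ∷ []) ⟧ α ≈⟨ trans (*-congˡ double) (zeroʳ i) ⟩
            0# ∎))
          where
          as = at′ (m′ ∷ ms)
          N = nat (suc (length as))
          N≉0 = nat-suc≉0 (length as)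
          i = N ⁻¹⟨ N≉0 ⟩
          Mon-lead : ∀ bs {l} → l ≈ 1# → Mon bs l α ≈ Mon bs 1# α
          Mon-lead []       e = e
          Mon-lead (b ∷ bs) e = +-congˡ (*-congˡ (Mon-lead bs e))
          scale-rational : ∀ {bs} → All Rational bs → All Rational (scale i bs)
          scale-rational []       = []
          scale-rational (q ∷ qs) = rational-* (rational-inverse N≉0 (rational-nat (suc (length as)))) q ∷ scale-rational qs
          lifted = rational-coeffs (scale-rational (derivFrom-rational 1 (rational-at ps)))
          lengths : length (scale i (derivFrom 1 as)) ≡ suc (length ms)
          lengths = ≡.trans (List.length-map _ (derivFrom 1 as)) (≡.trans (length-derivFrom 1 as) (List.length-map _ (m′ ∷ ms)))
          double : ⟦ derivFrom 1 (as ++ 1# ∷ []) ⟧ α ≈ 0#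
          double = proj₂ (double-root {Mon (m true ∷ as) 1#} {⟦ derivFrom 1 (as ++ 1# ∷ []) ⟧} {α} {rs} {1#} (hasDeriv (m true ∷ as ++ 1# ∷ []) (Mon-snoc (m true ∷ as) 1#) (λ _ → refl))
            (λ t → trans (e t) (*-congˡ (*-cong (+-congˡ (-‿cong e₁)) (*-congʳ (+-congˡ (-‿cong e₂)))))))
        contradiction (m ∷ m′ ∷ ms) _ _ ([]     , () , _)
        contradiction (m ∷ m′ ∷ ms) _ _ (r ∷ [] , () , _)

  -- Descent of ad G / {G , F} to ℚ

  iter-kernel : ∀ {d} (D : IsDerivation d) {q} → Zero (d q) → ∀ k g → iter d k (q ⊗ g) ≗ q ⊗ iter d k g
  iter-kernel D z 0 g x y = refl
  iter-kernel {d} D {q} z (suc k) g x y = trans (Iterate.iter-cong D k {d (q ⊗ g)} {q ⊗ d g}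
    (λ x y → trans (IsDerivation.d-⊗ D q g x y) (trans (+-congʳ (trans (*-congʳ (z x y)) (zeroˡ _))) (+-identityˡ _))) x y) (iter-kernel D z k (d g) x y)

  MonE : List Carrier → Carrier → Expr → Expr
  MonE []       l e = const l
  MonE (a ∷ as) l e = const a ⊕ e ⊗ MonE as l e

  ⟪⟫-MonE : ∀ as l e x y → ⟪ MonE as l e ⟫ x y ≈ Mon as l (⟪ e ⟫ x y)
  ⟪⟫-MonE []       l e x y = refl
  ⟪⟫-MonE (a ∷ as) l e x y = +-congˡ (*-congˡ (⟪⟫-MonE as l e x y))

  MonE-app : ∀ as l e → MonE as l e ≗ app (as ++ l ∷ []) e
  MonE-app as l e x y = trans (⟪⟫-MonE as l e x y) (trans (Mon-snoc as l _) (sym (⟪⟫-app (as ++ l ∷ []) e x y)))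

  -- If {G , F} is a polynomial in G, then ad G and ad F commute up to ad G.
  module Commute (F G : Expr) (p : List Carrier) (u-eq : br G F ≗ app p G) where
    private
      δ = br G
      D : Expr → Expr
      D f = br f F
    open IsDerivation (br-derivationʳ G)
    open Iterate (br-derivationʳ G)
    module D = IsDerivation (br-derivationˡ F)

    -- The Jacobi identity together with {f , p(G)} = p′(G) {f , G}.
    δ-D : ∀ f → δ (D f) ≗ D (δ f) ⊕ ⊝ (app (deriv p) G ⊗ δ f)
    δ-D f x y = begin
      ⟪ br G (br f F) ⟫ x y ≈⟨ jacobi G f F x y ⟩
      ⟪ br (br G f) F ⟫ x y + ⟪ br f (br G F) ⟫ x y ≈⟨ +-congˡ (trans (E.d-cong {br G F} {app p G} u-eq x y) (trans (E.d-app p G x y) (*-congˡ (br-antisym f G x y)))) ⟩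
      ⟪ br (br G f) F ⟫ x y + ⟪ app (deriv p) G ⟫ x y * - ⟪ br G f ⟫ x y ≈⟨ +-congˡ (solve 2 (λ a b → a :* :- b := :- :1 :* (a :* b)) refl _ _) ⟩
      ⟪ br (br G f) F ⟫ x y + - 1# * (⟪ app (deriv p) G ⟫ x y * ⟪ br G f ⟫ x y) ∎
      where module E = IsDerivation (br-derivationʳ f)

    kernel-app : ∀ q → Zero (δ (app q G))
    kernel-app q x y = trans (d-app q G x y) (trans (*-congˡ (trans (reflexive (br-def G G x y)) (solve 2 (λ a b → a :* b :+ :- :1 :* (b :* a) := :0) refl _ _))) (zeroʳ _))

    -- The commutator of δ and D is δ times p′(G), which δ kills; so D preserves the kernel of every
    -- power of δ.
    iter-D-zero : ∀ k f → Zero (iter δ k f) → Zero (iter δ k (D f))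
    iter-D-zero 0       f z = D.d-zero {f} z
    iter-D-zero (suc k) f z x y = begin
      ⟪ iter δ k (δ (D f)) ⟫ x y ≈⟨ iter-cong k {δ (D f)} {D (δ f) ⊕ ⊝ (q ⊗ δ f)} (δ-D f) x y ⟩
      ⟪ iter δ k (D (δ f) ⊕ ⊝ (q ⊗ δ f)) ⟫ x y ≈⟨ iter-⊕ k (D (δ f)) (⊝ (q ⊗ δ f)) x y ⟩
      ⟪ iter δ k (D (δ f)) ⟫ x y + ⟪ iter δ k (⊝ (q ⊗ δ f)) ⟫ x y
        ≈⟨ +-cong (iter-D-zero k (δ f) z x y) (trans (iter-kernel (br-derivationʳ G) {const (- 1#)} (d-const (- 1#)) k (q ⊗ δ f) x y) (*-congˡ (trans (iter-kernel (br-derivationʳ G) {q} (kernel-app (deriv p)) k (δ f) x y) (trans (*-congˡ (z x y)) (zeroʳ _))))) ⟩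
      0# + - 1# * 0# ≈⟨ solve 0 (:0 :+ :- :1 :* :0 := :0) refl ⟩
      0# ∎
      where q = app (deriv p) G

  module TopDegree (G : Expr) (x y : Carrier) where
    open TaylorAt (br-derivationʳ G) x y

    -- If the series of H stops at index N > 0, the coefficient of a polynomial of degree m in H at
    -- the index m N comes from the leading term alone.
    taylor-Mon : ∀ H N → 0 ℕ.< N → (∀ i → N ℕ.< i → taylor H i ≈ 0#) → ∀ bs l →
      taylor (MonE bs l H) (length bs ℕ.* N) ≈ l * taylor H N ^ length bs × (∀ i → length bs ℕ.* N ℕ.< i → taylor (MonE bs l H) i ≈ 0#)
    taylor-Mon H N N>0 z []       l = trans (*-identityˡ l) (sym (*-identityʳ l)) , λ { (suc i) _ → taylor-const l i }
    taylor-Mon H N N>0 z (b ∷ bs) l =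
      let top , above = taylor-Mon H N N>0 z bs l
          M = MonE bs l H
          split : ∀ i → 0 ℕ.< i → taylor (const b ⊕ H ⊗ M) i ≈ conv (taylor H) (taylor M) i
          split = λ { (suc i) _ → trans (taylor-⊕ (const b) (H ⊗ M) (suc i)) (trans (+-cong (taylor-const b i) (taylor-⊗ H M (suc i))) (+-identityˡ _)) }
      in trans (split (N ℕ.+ length bs ℕ.* N) (ℕ.≤-trans N>0 (ℕ.m≤m+n N _))) (trans (conv-highest (taylor H) (taylor M) N (length bs ℕ.* N) z above)
           (trans (*-congˡ top) (solve 3 (λ t l p → t :* (l :* p) := l :* (t :* p)) refl (taylor H N) l (taylor H N ^ length bs)))) ,
         λ i lt → trans (split i (ℕ.≤-trans (s≤s z≤n) lt)) (conv-above (taylor H) (taylor M) N (length bs ℕ.* N) z above i lt)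

  -- D H = q(H) with deg q ≥ 2, whereas D does not raise the degree in the
  -- direction of ad G.
  module Conjugate (F G H : Expr) (p : List Carrier) (u-eq : br G F ≗ app p G)
    (bs : List Carrier) (l : Carrier) (l≉0 : ¬ l ≈ 0#) (len : 2 ℕ.≤ length bs) (u′-eq : br H F ≗ MonE bs l H) where
    private
      δ = br G
    open Iterate (br-derivationʳ G)
    open Commute F G p u-eq

    -- Let c be the last Taylor coefficient of H, at N = n + 1, and m the degree of q. Then q(H) has
    -- coefficient l cᵐ at m N, whereas {H , F} has none beyond N by `iter-D-zero`. As m ≥ 2 and N ≥
    -- 1, m N exceeds N and c = 0, at every point.
    lower-degree : ∀ n → Zero (iter δ (suc (suc n)) H) → Zero (iter δ (suc n) H)
    lower-degree n z x y = cancel (recip-!≉0 N) (^-≈0 (length bs) (cancel l≉0 (trans (sym top) (trans (sym (taylor-cong {br H F} {MonE bs l H} u′-eq k)) (taylor-zero {br H F} {k} (iter-above {suc N} {k} {br H F} big (iter-D-zero (suc N) H z)))))))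
      where
      N = suc n
      k = length bs ℕ.* N
      open TaylorAt (br-derivationʳ G) x y
      open TopDegree G x y
      top = proj₁ (taylor-Mon H N (s≤s z≤n) (λ i lt → taylor-zero {H} {i} (iter-above {suc N} {i} {H} lt z)) bs l)
      big : suc N ℕ.≤ k
      big = ℕ.≤-trans (s≤s (ℕ.≤-trans (ℕ.m≤n+m N n) (ℕ.≤-reflexive (≡.cong (n ℕ.+_) (≡.sym (ℕ.+-identityʳ N)))))) (ℕ.*-monoˡ-≤ N len)

    bracket-zero : ∀ {k} → Zero (iter δ k H) → Zero (br G H)
    bracket-zero {0}           z = IsDerivation.d-zero (br-derivationʳ G) {H} z
    bracket-zero {1}           z = z
    bracket-zero {suc (suc k)} z = bracket-zero {suc k} (lower-degree k z)

  -- A common direction: if {G , H} = 0, then ad G / {G , F} = ad H / {H , F}.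
  module SameDirection (F G H : Expr) (GH≈0 : Zero (br G H)) (u-eq : ∃[ p ] br G F ≗ app p G) (u′-eq : ∃[ q ] br H F ≗ app q H) where
    private
      u = br G F
      u′ = br H F
    open IsDerivation (br-derivationʳ H)

    -- The Plücker relation between the gradients of F, G, H and g in dimension two: the two sides
    -- differ by {G , H} {F , g}, up to sign.
    plücker : ∀ g x y → ⟪ u′ ⟫ x y * ⟪ br G g ⟫ x y ≈ ⟪ u ⟫ x y * ⟪ br H g ⟫ x y
    plücker g x y = x-y≈0⇒x≈y (begin
      ⟪ u′ ⟫ x y * ⟪ br G g ⟫ x y - ⟪ u ⟫ x y * ⟪ br H g ⟫ x y ≈⟨ +-cong (reflexive (≡.cong₂ _*_ (br-def H F x y) (br-def G g x y))) (-‿cong (reflexive (≡.cong₂ _*_ (br-def G F x y) (br-def H g x y)))) ⟩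
      _ ≈⟨ solve 8 (λ F₁ F₂ G₁ G₂ H₁ H₂ g₁ g₂ →
             (H₁ :* F₂ :+ :- :1 :* (H₂ :* F₁)) :* (G₁ :* g₂ :+ :- :1 :* (G₂ :* g₁)) :- (G₁ :* F₂ :+ :- :1 :* (G₂ :* F₁)) :* (H₁ :* g₂ :+ :- :1 :* (H₂ :* g₁))
             := :- ((G₁ :* H₂ :+ :- :1 :* (G₂ :* H₁)) :* (F₁ :* g₂ :+ :- :1 :* (F₂ :* g₁)))) refl
             (⟪ ∂₁ F ⟫ x y) (⟪ ∂₂ F ⟫ x y) (⟪ ∂₁ G ⟫ x y) (⟪ ∂₂ G ⟫ x y) (⟪ ∂₁ H ⟫ x y) (⟪ ∂₂ H ⟫ x y) (⟪ ∂₁ g ⟫ x y) (⟪ ∂₂ g ⟫ x y) ⟩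
      _ ≈⟨ -‿cong (*-congʳ (reflexive (br-def G H x y))) ⟨
      _ ≈⟨ -‿cong (trans (*-congʳ (GH≈0 x y)) (zeroˡ _)) ⟩
      - 0# ≈⟨ solve 0 (:- :0 := :0) refl ⟩
      0# ∎)

    δ-app-zero : ∀ {f e p} → Zero (br H e) → f ≗ app p e → Zero (br H f)
    δ-app-zero {f} {e} {p} z eq x y = trans (d-cong {f} {app p e} eq x y) (trans (d-app p e x y) (trans (*-congˡ (z x y)) (zeroʳ _)))

    δu : Zero (br H u)
    δu = δ-app-zero {u} {G} {proj₁ u-eq} (λ x y → trans (br-antisym H G x y) (trans (-‿cong (GH≈0 x y)) (solve 0 (:- :0 := :0) refl))) (proj₂ u-eq)

    δu′ : Zero (br H u′)
    δu′ = δ-app-zero {u′} {H} {proj₁ u′-eq} (λ x y → trans (reflexive (br-def H H x y)) (solve 2 (λ a b → a :* b :+ :- :1 :* (b :* a) := :0) refl _ _)) (proj₂ u′-eq)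

    δ-⊛ : ∀ {e} → Zero (br H e) → ∀ n → Zero (br H (e ⊛ n))
    δ-⊛ z 0       x y = d-const 1# x y
    δ-⊛ {e} z (suc n) x y = trans (d-⊗ e (e ⊛ n) x y) (trans (+-cong (trans (*-congʳ (z x y)) (zeroˡ _)) (trans (*-congˡ (δ-⊛ z n x y)) (zeroʳ _))) (+-identityʳ 0#))

    δ-⊛-⊗ : ∀ {e} → Zero (br H e) → ∀ n g x y → ⟪ br H (e ⊛ n ⊗ g) ⟫ x y ≈ ⟪ e ⊛ n ⟫ x y * ⟪ br H g ⟫ x y
    δ-⊛-⊗ {e} z n g x y = trans (d-⊗ (e ⊛ n) g x y) (trans (+-congʳ (trans (*-congʳ (δ-⊛ {e} z n x y)) (zeroˡ _))) (+-identityˡ _))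

    -- The k-fold iterate of `plücker`. Both u and u′ are killed by ad H, so their powers pass
    -- through it. Stated without denominators.
    same-iterates : ∀ k f → u′ ⊛ k ⊗ iter (br G) k f ≗ u ⊛ k ⊗ iter (br H) k f
    same-iterates 0       f x y = refl
    same-iterates (suc k) f x y = begin
      U′ * U′ᵏ * ⟪ iter (br G) (suc k) f ⟫ x y ≈⟨ *-congˡ (reflexive (≡.cong (λ e → ⟪ e ⟫ x y) (iter-suc (br G) k f))) ⟩
      U′ * U′ᵏ * ⟪ br G g ⟫ x y ≈⟨ solve 3 (λ a b c → a :* b :* c := b :* (a :* c)) refl U′ U′ᵏ (⟪ br G g ⟫ x y) ⟩
      U′ᵏ * (U′ * ⟪ br G g ⟫ x y) ≈⟨ *-congˡ (plücker g x y) ⟩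
      U′ᵏ * (U * ⟪ br H g ⟫ x y) ≈⟨ solve 3 (λ a b c → b :* (a :* c) := a :* (b :* c)) refl U U′ᵏ (⟪ br H g ⟫ x y) ⟩
      U * (U′ᵏ * ⟪ br H g ⟫ x y) ≈⟨ *-congˡ (trans (sym (δ-⊛-⊗ {u′} δu′ k g x y)) (trans (d-cong {u′ ⊛ k ⊗ g} {u ⊛ k ⊗ h} (same-iterates k f) x y) (δ-⊛-⊗ {u} δu k h x y))) ⟩
      U * (⟪ u ⊛ k ⟫ x y * ⟪ br H h ⟫ x y) ≈⟨ sym (*-assoc _ _ _) ⟩
      U * ⟪ u ⊛ k ⟫ x y * ⟪ br H h ⟫ x y ≈⟨ *-congˡ (reflexive (≡.cong (λ e → ⟪ e ⟫ x y) (≡.sym (iter-suc (br H) k f)))) ⟩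
      U * ⟪ u ⊛ k ⟫ x y * ⟪ iter (br H) (suc k) f ⟫ x y ∎
      where
      U = ⟪ u ⟫ x y
      U′ = ⟪ u′ ⟫ x y
      U′ᵏ = ⟪ u′ ⊛ k ⟫ x y
      g = iter (br G) k f
      h = iter (br H) k f

  -- Conjugate polynomials and rationality of the trajectory

  consts : Expr → List Carrier
  consts (const a) = a ∷ []
  consts X         = []
  consts Y         = []
  consts (f ⊕ g)   = consts f ++ consts g
  consts (f ⊗ g)   = consts f ++ consts g

  module Related (φ : PartialHom) where
    open PartialHom φ

    -- The second expression is the first with its constants conjugated: a relation, as φ is given
    -- only by its graph.
    data Rel : Expr → Expr → Set (c ⊔ ℓ) where
      const : ∀ {a b} → R a b → Rel (const a) (const b)
      X     : Rel X X
      Y     : Rel Y Y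
      _⊕_   : ∀ {f f′ g g′} → Rel f f′ → Rel g g′ → Rel (f ⊕ g) (f′ ⊕ g′)
      _⊗_   : ∀ {f f′ g g′} → Rel f f′ → Rel g g′ → Rel (f ⊗ g) (f′ ⊗ g′)

    rel-⟪⟫ : ∀ {f f′ x x′ y y′} → Rel f f′ → R x x′ → R y y′ → R (⟪ f ⟫ x y) (⟪ f′ ⟫ x′ y′)
    rel-⟪⟫ (const r) p q = r
    rel-⟪⟫ X         p q = p
    rel-⟪⟫ Y         p q = q
    rel-⟪⟫ (f ⊕ g)   p q = R-+ (rel-⟪⟫ f p q) (rel-⟪⟫ g p q)
    rel-⟪⟫ (f ⊗ g)   p q = R-* (rel-⟪⟫ f p q) (rel-⟪⟫ g p q)

    rel-∂₁ : ∀ {f f′} → Rel f f′ → Rel (∂₁ f) (∂₁ f′)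
    rel-∂₁ (const r) = const R-0
    rel-∂₁ X         = const R-1
    rel-∂₁ Y         = const R-0
    rel-∂₁ (f ⊕ g)   = rel-∂₁ f ⊕ rel-∂₁ g
    rel-∂₁ (f ⊗ g)   = rel-∂₁ f ⊗ g ⊕ f ⊗ rel-∂₁ g

    rel-∂₂ : ∀ {f f′} → Rel f f′ → Rel (∂₂ f) (∂₂ f′)
    rel-∂₂ (const r) = const R-0
    rel-∂₂ X         = const R-0
    rel-∂₂ Y         = const R-1
    rel-∂₂ (f ⊕ g)   = rel-∂₂ f ⊕ rel-∂₂ g
    rel-∂₂ (f ⊗ g)   = rel-∂₂ f ⊗ g ⊕ f ⊗ rel-∂₂ g

    rel-⊝ : ∀ {f f′} → Rel f f′ → Rel (⊝ f) (⊝ f′)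
    rel-⊝ f = const (R-neg R-1) ⊗ f

    rel-br : ∀ {f f′ g g′} → Rel f f′ → Rel g g′ → Rel (br f g) (br f′ g′)
    rel-br {f} {f′} {g} {g′} p q = ≡.subst (λ b → Rel (b f g) (b f′ g′)) (≡.sym br≡br₀) (rel-∂₁ p ⊗ rel-∂₂ q ⊕ rel-⊝ (rel-∂₂ p ⊗ rel-∂₁ q))

    rel-iter : ∀ {G H} → Rel G H → ∀ k {f f′} → Rel f f′ → Rel (iter (br G) k f) (iter (br H) k f′)
    rel-iter p 0       q = q
    rel-iter p (suc k) q = rel-iter p k (rel-br p q)

    rel-MonE : ∀ {as bs l l′ f f′} → Pointwise R as bs → R l l′ → Rel f f′ → Rel (MonE as l f) (MonE bs l′ f′)
    rel-MonE []       r p = const r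
    rel-MonE (q ∷ qs) r p = const q ⊕ p ⊗ rel-MonE qs r p

    rel-exists : ∀ f → All (λ a → ∃[ b ] R a b) (consts f) → ∃[ f′ ] Rel f f′
    rel-exists (const a) ((b , r) ∷ []) = const b , const r
    rel-exists X         _  = X , X
    rel-exists Y         _  = Y , Y
    rel-exists (f ⊕ g)   rs = let f′ , p = rel-exists f (++⁻ˡ (consts f) rs) ; g′ , q = rel-exists g (++⁻ʳ (consts f) rs) in f′ ⊕ g′ , p ⊕ q
    rel-exists (f ⊗ g)   rs = let f′ , p = rel-exists f (++⁻ˡ (consts f) rs) ; g′ , q = rel-exists g (++⁻ʳ (consts f) rs) in f′ ⊗ g′ , p ⊗ q

    rel-refl : ∀ f → All Rational (consts f) → Rel f f
    rel-refl (const a) (r ∷ []) = const (R-rational r)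
    rel-refl X         _  = X
    rel-refl Y         _  = Y
    rel-refl (f ⊕ g)   rs = rel-refl f (++⁻ˡ (consts f) rs) ⊕ rel-refl g (++⁻ʳ (consts f) rs)
    rel-refl (f ⊗ g)   rs = rel-refl f (++⁻ˡ (consts f) rs) ⊗ rel-refl g (++⁻ʳ (consts f) rs)

    rel-list : ∀ {as} → All (λ a → ∃[ b ] R a b) as → ∃[ bs ] Pointwise R as bs
    rel-list []             = [] , []
    rel-list ((b , r) ∷ rs) = let bs , p = rel-list rs in b ∷ bs , r ∷ p

    -- If f′ were not zero, it would be nonzero at a point with natural coordinates; these are fixed
    -- by conjugation, so f would be nonzero there.
    rel-zero : ∀ {f f′} → Rel f f′ → Zero f → Zero f′
    rel-zero {f} {f′} p z = [ (λ (i , j , nz) → ⊥-elim (nz (R-zero (rel-⟪⟫ p (R-rational (rational-nat i)) (R-rational (rational-nat j))) (z _ _)))) , (λ z′ → z′) ]′ (search₂ f′)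

  module RationalFlow (F G : Expr) (F-rational : All Rational (consts F)) {nx ny : ℕ} (zX : Zero (iter (br G) nx X)) (zY : Zero (iter (br G) ny Y))
    (bs : List Carrier) (l : Carrier) (l≉0 : ¬ l ≈ 0#) (len : 2 ℕ.≤ length bs) (u-eq : ∀ x y → ⟪ br G F ⟫ x y ≈ Mon bs l (⟪ G ⟫ x y))
    {x y : Carrier} (x-rational : Rational x) (y-rational : Rational y) (u≉0 : ¬ ⟪ br G F ⟫ x y ≈ 0#) where

    u-MonE : br G F ≗ MonE bs l G
    u-MonE x y = trans (u-eq x y) (sym (⟪⟫-MonE bs l G x y))

    u-app : br G F ≗ app (bs ++ l ∷ []) G
    u-app x y = trans (u-MonE x y) (MonE-app bs l G x y)

    -- Here z is the k-th iterate of ad G / {G , F} on f at a rational point. An irrational z would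
    -- be moved to some β ≠ z by a conjugation, which extends to the coefficients of G and p. It
    -- turns G into H, and β is then the same expression formed with H; `same-iterates` gives z = β.
    rational-iterates : ∀ f → All Rational (consts f) → ∀ k z → z * ⟪ br G F ⟫ x y ^ k ≈ ⟪ iter (br G) k f ⟫ x y → Rational z
    rational-iterates f f-rational k z z-eq = rational-stable λ irrational →
      move z irrational λ (φ , β , zβ , β≉z) →
      extend-all φ (consts G ++ bs ++ l ∷ []) λ (ψ , φ⊑ψ , rs) → β≉z (sym (conclude ψ (φ⊑ψ zβ) rs))
      where
      conclude : ∀ ψ {β} → PartialHom.R ψ z β → All (λ a → ∃[ b ] PartialHom.R ψ a b) (consts G ++ bs ++ l ∷ []) → z ≈ β
      conclude ψ {β} zβ rs = cancel-≈ (*-≉0 (^-≉0 k u≉0) (^-≉0 k u′≉0)) (begin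
        u₀ ^ k * u₀′ ^ k * z ≈⟨ solve 3 (λ a b z → a :* b :* z := b :* (z :* a)) refl (u₀ ^ k) (u₀′ ^ k) z ⟩
        u₀′ ^ k * (z * u₀ ^ k) ≈⟨ *-cong (sym (⟪⟫-⊛ (br H F) k x y)) z-eq ⟩
        ⟪ br H F ⊛ k ⊗ iter (br G) k f ⟫ x y ≈⟨ same-iterates k f x y ⟩
        ⟪ br G F ⊛ k ⊗ iter (br H) k f ⟫ x y ≈⟨ *-cong (⟪⟫-⊛ (br G F) k x y) (sym β-eq) ⟩
        u₀ ^ k * (β * u₀′ ^ k) ≈⟨ solve 3 (λ a b z → a :* (z :* b) := a :* b :* z) refl (u₀ ^ k) (u₀′ ^ k) β ⟩
        u₀ ^ k * u₀′ ^ k * β ∎)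
        where
        open PartialHom ψ
        open Related ψ
        G-exists = rel-exists G (++⁻ˡ (consts G) rs)
        H = proj₁ G-exists
        GH : Rel G H
        GH = proj₂ G-exists
        FF : Rel F F
        FF = rel-refl F F-rational
        bl = ++⁻ʳ (consts G) rs
        bs-exists = rel-list (++⁻ˡ bs bl)
        bs′ = proj₁ bs-exists
        bsR = proj₂ bs-exists
        l′ = proj₁ (All.head (++⁻ʳ bs bl))
        ll′ = proj₂ (All.head (++⁻ʳ bs bl))
        u₀ = ⟪ br G F ⟫ x y
        u₀′ = ⟪ br H F ⟫ x y
        xx = R-rational x-rational
        yy = R-rational y-rational
        uu′ : R u₀ u₀′
        uu′ = rel-⟪⟫ (rel-br GH FF) xx yy
        u′≉0 : ¬ u₀′ ≈ 0#
        u′≉0 e = u≉0 (R-injective uu′ e)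
        β-eq : β * u₀′ ^ k ≈ ⟪ iter (br H) k f ⟫ x y
        β-eq = functional (R-* zβ (R-^ k uu′)) (rel-⟪⟫ (rel-iter GH k (rel-refl f f-rational)) xx yy) z-eq
        difference = br G F ⊕ ⊝ MonE bs l G
        u′-MonE : br H F ≗ MonE bs′ l′ H
        u′-MonE x y = x-y≈0⇒x≈y (trans (+-congˡ (solve 1 (λ v → :- v := :- :1 :* v) refl _))
          (rel-zero {difference} {br H F ⊕ ⊝ MonE bs′ l′ H} (rel-br GH FF ⊕ rel-⊝ (rel-MonE bsR ll′ GH))
            (λ x y → trans (+-congʳ (u-MonE x y)) (solve 1 (λ v → v :+ :- :1 :* v := :0) refl _)) x y))
        GH≈0 : Zero (br G H)
        GH≈0 = let n , zn = Iterate.nilpotent (br-derivationʳ G) nx ny zX zY H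
               in Conjugate.bracket-zero F G H (bs ++ l ∷ []) u-app bs′ l′ (λ e → l≉0 (R-injective ll′ e)) (≡.subst (2 ℕ.≤_) (Pointwise.Pointwise-length bsR) len) u′-MonE {n} zn
        open SameDirection F G H GH≈0 (bs ++ l ∷ [] , u-app) (bs′ ++ l′ ∷ [] , λ x y → trans (u′-MonE x y) (MonE-app bs′ l′ H x y))

  -- Weak approximation along a rational curve

  prefix-cong : ∀ n {f g : Seq} → (∀ k → f k ≈ g k) → ∀ t → ⟦ prefix n f ⟧ t ≈ ⟦ prefix n g ⟧ t
  prefix-cong 0       e t = refl
  prefix-cong (suc n) e t = +-cong (e 0) (*-congˡ (prefix-cong n (λ k → e (suc k)) t))

  prefix-dilate : ∀ n f a i s → ⟦ prefix n (λ k → a * (i ^ k * f k)) ⟧ s ≈ a * ⟦ prefix n f ⟧ (i * s)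
  prefix-dilate 0       f a i s = sym (zeroʳ a)
  prefix-dilate (suc n) f a i s = begin
    a * (1# * f 0) + s * ⟦ prefix n (λ k → a * (i * i ^ k * f (suc k))) ⟧ s
      ≈⟨ +-congˡ (*-congˡ (trans (prefix-cong n (λ k → solve 4 (λ a i p f → a :* (i :* p :* f) := a :* i :* (p :* f)) refl a i (i ^ k) (f (suc k))) s) (prefix-dilate n (tail f) (a * i) i s))) ⟩
    a * (1# * f 0) + s * (a * i * ⟦ prefix n (tail f) ⟧ (i * s)) ≈⟨ solve 5 (λ a f s i p → a :* (:1 :* f) :+ s :* (a :* i :* p) := a :* (f :+ i :* s :* p)) refl a (f 0) s i (⟦ prefix n (tail f) ⟧ (i * s)) ⟩
    a * (f 0 + i * s * ⟦ prefix n (tail f) ⟧ (i * s)) ∎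

  evalℚ : List ℚ → ℚ → ℚ
  evalℚ []       s = 0ℚ
  evalℚ (q ∷ qs) s = q ℚ.+ s ℚ.* evalℚ qs s

  rational-prefix : ∀ n (f : Seq) → (∀ k → Rational (f k)) → ∃[ qs ] ∀ s → ⟦ prefix n f ⟧ (ι s) ≈ ι (evalℚ qs s)
  rational-prefix 0       f r = [] , λ s → sym ι-0
  rational-prefix (suc n) f r =
    let qs , e = rational-prefix n (tail f) (λ k → r (suc k))
    in proj₁ (r 0) ∷ qs , λ s → trans (+-cong (proj₂ (r 0)) (trans (*-congˡ (e s)) (sym (ι-* _ _)))) (sym (ι-+ _ _))

  -- A common denominator of the coefficients is also one for the values at integers, by Horner's
  -- scheme.
  integral-eval : ∀ {d bs qs} → Cleared d bs qs → ∀ m → ∃[ e ] int e ≈ int d * ι (evalℚ qs (fromℤ m))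
  integral-eval []       m = + 0 , trans ι-0 (sym (trans (*-congˡ ι-0) (zeroʳ _)))
  integral-eval {d} {b ∷ bs} {q ∷ qs} (x ∷ xs) m =
    let e , eq = integral-eval {d} {bs} {qs} xs m
    in b ℤ.+ m ℤ.* e , (begin
      int (b ℤ.+ m ℤ.* e) ≈⟨ trans (int-+ b (m ℤ.* e)) (+-congˡ (int-* m e)) ⟩
      int b + int m * int e ≈⟨ +-cong x (*-congˡ eq) ⟩
      int d * ι q + int m * (int d * E) ≈⟨ solve 4 (λ d q m e → d :* q :+ m :* (d :* e) := d :* (q :+ m :* e)) refl (int d) (ι q) (int m) E ⟩
      int d * (ι q + int m * E) ≈⟨ *-congˡ (trans (ι-+ _ _) (+-congˡ (ι-* _ _))) ⟨
      int d * ι (q ℚ.+ fromℤ m ℚ.* evalℚ qs (fromℤ m)) ∎)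
    where E = ι (evalℚ qs (fromℤ m))

  <-fromℤ : ∀ q → q ℚ.< fromℤ (+ suc ℤ.∣ ↥ q ∣)
  <-fromℤ q@(ℚ.mkℚ n d-1 _) = ℚ.toℚᵘ-cancel-< (ℚᵘ.<-respʳ-≃ (ℚᵘ.≃-sym (toℚᵘ-fromℤ (+ suc ℤ.∣ n ∣))) (*<* (ℤ.≤-<-trans {j = + ℤ.∣ n ∣} (≤-abs n) (ℤ.+<+ (ℕ.<-≤-trans (ℕ.n<1+n ℤ.∣ n ∣) (ℕ.m≤m*n (suc ℤ.∣ n ∣) (suc d-1)))))))
    where
    ≤-abs : ∀ n → n ℤ.* + 1 ℤ.≤ + ℤ.∣ n ∣
    ≤-abs (+ n)        = ℤ.≤-reflexive (ℤ.*-identityʳ (+ n))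
    ≤-abs ℤ.-[1+ n ]   = ℤ.≤-trans (ℤ.≤-reflexive (ℤ.*-identityʳ ℤ.-[1+ n ])) ℤ.-≤+

  fromℤ-mono-≤ : ∀ {i j} → i ℤ.≤ j → fromℤ i ℚ.≤ fromℤ j
  fromℤ-mono-≤ {i} {j} le = ℚ.toℚᵘ-cancel-≤ (ℚᵘ.≤-respˡ-≃ (ℚᵘ.≃-sym (toℚᵘ-fromℤ i)) (ℚᵘ.≤-respʳ-≃ (ℚᵘ.≃-sym (toℚᵘ-fromℤ j)) (ℚᵘ.*≤* (ℤ.*-monoʳ-≤-nonNeg (+ 1) le))))

  square-bound : ∀ D → ¬ D ≡ + 0 → ∀ N T → 0 ℕ.< N → + T ℤ.≤ (+ N ℤ.* (D ℤ.* D)) ℤ.* + T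
  square-bound D D≢0 (suc N) T _ = ≡.subst (+ T ℤ.≤_) (≡.trans (ℤ.pos-* (suc N ℕ.* (ℤ.∣ D ∣ ℕ.* ℤ.∣ D ∣)) T) (≡.cong (ℤ._* + T) (≡.trans (ℤ.pos-* (suc N) (ℤ.∣ D ∣ ℕ.* ℤ.∣ D ∣)) (≡.cong (+ suc N ℤ.*_) (square D)))))
    (ℤ.+≤+ (ℕ.m≤n*m T (suc N ℕ.* (ℤ.∣ D ∣ ℕ.* ℤ.∣ D ∣)) {{ℕ.≢-nonZero (λ z → [ (λ ()) , (λ w → [ D0 , D0 ]′ (ℕ.m*n≡0⇒m≡0∨n≡0 ℤ.∣ D ∣ w)) ]′ (ℕ.m*n≡0⇒m≡0∨n≡0 (suc N) z))}}))
    where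
    D0 : ℤ.∣ D ∣ ≡ 0 → ⊥
    D0 z = D≢0 (ℤ.∣i∣≡0⇒i≡0 z)
    square : ∀ D → + (ℤ.∣ D ∣ ℕ.* ℤ.∣ D ∣) ≡ D ℤ.* D
    square (+ n)      = ℤ.pos-* n n
    square ℤ.-[1+ n ] = ≡.refl

  negative : ∀ v D → ¬ D ≡ + 0 → ∀ N → 0 ℕ.< N → v ℚ.+ fromℤ (ℤ.- ((+ N ℤ.* (D ℤ.* D)) ℤ.* + suc ℤ.∣ ↥ v ∣)) ℚ.< 0ℚ
  negative v D D≢0 N N>0 = ℚ.<-≤-trans (ℚ.+-monoˡ-< (fromℤ (ℤ.- M)) (<-fromℤ v)) (ℚ.≤-trans (ℚ.≤-reflexive (≡.sym (fromℤ-+ (+ T) (ℤ.- M))))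
    (fromℤ-mono-≤ (ℤ.i≤j⇒i-j≤0 (square-bound D D≢0 N T N>0))))
    where
    T = suc ℤ.∣ ↥ v ∣
    M = (+ N ℤ.* (D ℤ.* D)) ℤ.* + T

  module Approximation (F G : Expr) (M : MonicInY G) (exceptions : List Carrier) (lines : ∀ a → a ∉ exceptions → Line F G a)
    (smooth : ∀ x y → ⟪ F ⟫ x y ≈ 0# → ⟪ ∂₁ F ⟫ x y ≈ 0# → ¬ ⟪ ∂₂ F ⟫ x y ≈ 0#)
    (F-rational : All Rational (consts F)) (Fℚ : ℚ → ℚ → ℚ) (Fℚ-eq : ∀ x y → ι (Fℚ x y) ≈ ⟪ F ⟫ (ι x) (ι y)) where
    open Pencils F G M exceptions lines smooth
    open Punctures F G M exceptions lines smooth using (Affine; Punctured; degree-≥2)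

    module _ (¬affine : ¬ Affine) (¬punctured : ¬ Punctured) (x₀ y₀ : ℚ) (N : ℕ) (N>0 : 0 ℕ.< N) where

      private
        K = int (+ N)
        K≉0 : ¬ K ≈ 0#
        K≉0 e = ℕ.<⇒≢ N>0 (≡.sym (ℤ.+-injective (int-injective (trans e (sym ι-0)))))

      translated : Expr
      translated = subst u (const (ι x₀) ⊕ const K ⊗ X) (const (ι y₀) ⊕ const K ⊗ Y)

      ¬translated-zero : ¬ Zero translated
      ¬translated-zero z =
        let b , b∉ = fresh bad
            y , g = solve-G 0# b
            i = K ⁻¹⟨ K≉0 ⟩
            inverse : ∀ v w → v + K * (i * (w - v)) ≈ w
            inverse v w = trans (+-congˡ (trans (sym (*-assoc _ _ _)) (trans (*-congʳ (*-inverse K K≉0)) (*-identityˡ _)))) (solve 2 (λ v w → v :+ (w :- v) := w) refl v w)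
        in u≉0 0# y (λ m → b∉ (∈-resp-≈ (sym g) m)) (trans (⟪⟫-cong u (sym (inverse (ι x₀) 0#)) (sym (inverse (ι y₀) y)))
             (trans (reflexive (≡.sym (⟪⟫-subst u (const (ι x₀) ⊕ const K ⊗ X) (const (ι y₀) ⊕ const K ⊗ Y) (i * (0# - ι x₀)) (i * (y - ι y₀))))) (z _ _)))

      -- The congruence class of (x₀ , y₀) modulo N is not contained in u = 0: after the
      -- substitution of x₀ + N X and y₀ + N Y, u is still a nonzero polynomial and has a nonzero
      -- value at natural numbers.
      base-point : ∃[ i ] ∃[ j ] ¬ ⟪ u ⟫ (ι (x₀ ℚ.+ fromℤ (+ N ℤ.* + i))) (ι (y₀ ℚ.+ fromℤ (+ N ℤ.* + j))) ≈ 0#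
      base-point = [ (λ (i , j , nz) → i , j , λ e → nz (trans (reflexive (⟪⟫-subst u (const (ι x₀) ⊕ const K ⊗ X) (const (ι y₀) ⊕ const K ⊗ Y) (nat i) (nat j)))
          (trans (⟪⟫-cong u (point x₀ i) (point y₀ j)) e))) , (λ z → ⊥-elim (¬translated-zero z)) ]′ (search₂ translated)
        where
        point : ∀ v i → ι v + K * nat i ≈ ι (v ℚ.+ fromℤ (+ N ℤ.* + i))
        point v i = trans (+-congˡ (trans (*-congˡ (nat≈ι i)) (sym (int-* (+ N) (+ i))))) (sym (ι-+ _ _))

      module From (i j : ℕ) (nz : ¬ ⟪ u ⟫ (ι (x₀ ℚ.+ fromℤ (+ N ℤ.* + i))) (ι (y₀ ℚ.+ fromℤ (+ N ℤ.* + j))) ≈ 0#)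
        (bs : List Carrier) (l : Carrier) (l≉0 : ¬ l ≈ 0#) (len : 2 ℕ.≤ length bs) (u-eq : ∀ x y → ⟪ u ⟫ x y ≈ Mon bs l (⟪ G ⟫ x y)) where
        x₁ = x₀ ℚ.+ fromℤ (+ N ℤ.* + i)
        y₁ = y₀ ℚ.+ fromℤ (+ N ℤ.* + j)
        U = ⟪ u ⟫ (ι x₁) (ι y₁)
        V = U ⁻¹⟨ nz ⟩
        open TaylorAt (br-derivationʳ G) (ι x₁) (ι y₁)
        module FlowG = Flow G nX nY δ-nilpotent-X δ-nilpotent-Y (ι x₁) (ι y₁)
        module Rational-flow = RationalFlow F G F-rational {nX} {nY} δ-nilpotent-X δ-nilpotent-Y bs l l≉0 len u-eq (x₁ , refl) (y₁ , refl) nz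

        recip-!-rational : ∀ k → Rational (recip-! k)
        recip-!-rational 0       = _ , sym ι-1
        recip-!-rational (suc k) = rational-* (rational-inverse (nat-suc≉0 k) (rational-nat (suc k))) (recip-!-rational k)

        -- As ad G kills u, the trajectory of ad G / u is that of ad G with the time multiplied by V
        -- = 1 / u; its coefficients carry the factors Vᵏ. The leading 1# is the starting value of
        -- the accumulator in `prefix-dilate`.
        taylor-rational : ∀ f → All Rational (consts f) → ∀ k → Rational (1# * (V ^ k * taylor f k))
        taylor-rational f fr k = rational-resp (solve 3 (λ v r d → :1 :* (v :* (r :* d)) := r :* (d :* v)) refl (V ^ k) (recip-! k) _)
          (rational-* (recip-!-rational k) (Rational-flow.rational-iterates f fr k _ (trans (*-assoc _ _ _) (trans (*-congˡ (begin
            V ^ k * U ^ k ≈⟨ ^-* V U k ⟨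
            (V * U) ^ k   ≈⟨ ^-cong k (trans (*-comm V U) (*-inverse U nz)) ⟩
            1# ^ k        ≈⟨ 1^ k ⟩
            1#            ∎)) (*-identityʳ _)))))

        curve : ∀ n f → All Rational (consts f) → ∃[ qs ] ∀ s → ⟦ prefix n (taylor f) ⟧ (V * ι s) ≈ ι (evalℚ qs s)
        curve n f fr = let qs , e = rational-prefix n _ (taylor-rational f fr) in qs , λ s → trans (sym (*-identityˡ _)) (trans (sym (prefix-dilate n (taylor f) 1# V (ι s))) (e s))

        abstract
          curve-x : ∃[ qs ] ∀ s → ⟦ FlowG.flow-x ⟧ (V * ι s) ≈ ι (evalℚ qs s)
          curve-x = curve nX X []
          curve-y : ∃[ qs ] ∀ s → ⟦ FlowG.flow-y ⟧ (V * ι s) ≈ ι (evalℚ qs s)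
          curve-y = curve nY Y []

        -- In the rescaled time F grows with slope V·U = 1.
        value : ∀ s → Fℚ (evalℚ (proj₁ curve-x) s) (evalℚ (proj₁ curve-y) s) ≡ Fℚ x₁ y₁ ℚ.+ s
        value s = ι-injective (begin
          ι (Fℚ (evalℚ (proj₁ curve-x) s) (evalℚ (proj₁ curve-y) s)) ≈⟨ Fℚ-eq _ _ ⟩
          ⟪ F ⟫ (ι (evalℚ (proj₁ curve-x) s)) (ι (evalℚ (proj₁ curve-y) s)) ≈⟨ ⟪⟫-cong F (sym (proj₂ curve-x s)) (sym (proj₂ curve-y s)) ⟩
          ⟪ F ⟫ (⟦ FlowG.flow-x ⟧ (V * ι s)) (⟦ FlowG.flow-y ⟧ (V * ι s)) ≈⟨ FlowG.flow-slice F δ-u (V * ι s) ⟩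
          ⟪ F ⟫ (ι x₁) (ι y₁) + V * ι s * U ≈⟨ +-cong (sym (Fℚ-eq x₁ y₁)) (trans (solve 3 (λ v s u → v :* s :* u := u :* v :* s) refl V (ι s) U) (trans (*-congʳ (*-inverse U nz)) (*-identityˡ _))) ⟩
          ι (Fℚ x₁ y₁) + ι s ≈⟨ ι-+ _ _ ⟨
          ι (Fℚ x₁ y₁ ℚ.+ s) ∎)

        at-0 : ∀ as t → t ≈ 0# → ⟦ as ⟧ t ≈ coef as 0
        at-0 []       t e = refl
        at-0 (a ∷ as) t e = trans (+-congˡ (trans (*-congʳ e) (zeroˡ _))) (+-identityʳ a)

        at-ι0 : ∀ {v} → v * ι 0ℚ ≈ 0#
        at-ι0 = trans (*-congˡ ι-0) (zeroʳ _)

        start-x : ι (evalℚ (proj₁ curve-x) 0ℚ) ≈ ι x₁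
        start-x = trans (sym (proj₂ curve-x 0ℚ)) (trans (at-0 FlowG.flow-x _ at-ι0) (trans (FlowG.coef-flow-x 0) (*-identityˡ _)))

        start-y : ι (evalℚ (proj₁ curve-y) 0ℚ) ≈ ι y₁
        start-y = trans (sym (proj₂ curve-y 0ℚ)) (trans (at-0 FlowG.flow-y _ at-ι0) (trans (FlowG.coef-flow-y 0) (*-identityˡ _)))

      -- d is a common denominator of the coefficients other than the constant one. At the parameter
      -- N d m these contribute an element of Nℤ, and the constant term v is already congruent to
      -- v₀.
      congruent : ∀ qs {v v₀ k} → ι (evalℚ qs 0ℚ) ≈ ι v → v ≡ v₀ ℚ.+ fromℤ (+ N ℤ.* k) →
        ∃[ d ] ¬ d ≡ + 0 × (∀ m → (evalℚ qs (fromℤ (+ N ℤ.* (d ℤ.* m))) ℚ.- v₀) ∈ N ·ℤ)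
      congruent [] {v} {v₀} {k} e ve = + 1 , (λ ()) , λ m → k , ι-injective (begin
        ι (0ℚ ℚ.- v₀) ≈⟨ trans (ι-+ _ _) (+-cong (trans e (trans (ι-cong ve) (ι-+ _ _))) (ι-neg v₀)) ⟩
        ι v₀ + int (+ N ℤ.* k) - ι v₀ ≈⟨ solve 2 (λ v n → v :+ n :- v := n) refl (ι v₀) (int (+ N ℤ.* k)) ⟩
        int (+ N ℤ.* k) ∎)
      congruent (q ∷ qs) {v} {v₀} {k} e ve = go (clear qs)
        where
        q≈v : ι q ≈ ι v
        q≈v = trans (sym (trans (trans (ι-+ q (0ℚ ℚ.* evalℚ qs 0ℚ)) (+-congˡ (trans (ι-* 0ℚ (evalℚ qs 0ℚ)) (trans (*-congʳ ι-0) (zeroˡ _))))) (+-identityʳ _))) e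
        go : (∃[ d ] ∃[ bs ] ¬ d ≡ + 0 × Cleared d bs qs) → ∃[ d ] ¬ d ≡ + 0 × (∀ m → (evalℚ (q ∷ qs) (fromℤ (+ N ℤ.* (d ℤ.* m))) ℚ.- v₀) ∈ N ·ℤ)
        go (d , bs , d≢0 , cl) = d , d≢0 , λ m →
          let s = + N ℤ.* (d ℤ.* m)
              f , f-eq = integral-eval {d} {bs} {qs} cl s
          in k ℤ.+ m ℤ.* f , ι-injective (final m s ≡.refl f f-eq)
          where
          final : ∀ m s → s ≡ + N ℤ.* (d ℤ.* m) → ∀ f → int f ≈ int d * ι (evalℚ qs (fromℤ s)) → ι (evalℚ (q ∷ qs) (fromℤ s) ℚ.- v₀) ≈ int (+ N ℤ.* (k ℤ.+ m ℤ.* f))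
          final m s s-eq f f-eq = begin
            ι (q ℚ.+ fromℤ s ℚ.* E ℚ.- v₀) ≈⟨ trans (ι-+ _ _) (+-cong (trans (ι-+ _ _) (+-cong (trans q≈v (trans (ι-cong ve) (trans (ι-+ _ _) (+-congˡ (int-* (+ N) k))))) (ι-* _ _))) (ι-neg v₀)) ⟩
            ι v₀ + K * int k + int s * ι E - ι v₀ ≈⟨ +-congʳ (+-congˡ (*-congʳ (trans (reflexive (≡.cong int s-eq)) (trans (int-* (+ N) (d ℤ.* m)) (*-congˡ (int-* d m)))))) ⟩
            ι v₀ + K * int k + K * (int d * int m) * ι E - ι v₀ ≈⟨ solve 6 (λ v K k d m E → v :+ K :* k :+ K :* (d :* m) :* E :- v := K :* (k :+ m :* (d :* E))) refl (ι v₀) K (int k) (int d) (int m) (ι E) ⟩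
            K * (int k + int m * (int d * ι E)) ≈⟨ *-congˡ (+-congˡ (*-congˡ f-eq)) ⟨
            K * (int k + int m * int f) ≈⟨ trans (int-* (+ N) (k ℤ.+ m ℤ.* f)) (*-congˡ (trans (int-+ k (m ℤ.* f)) (+-congˡ (int-* m f)))) ⟨
            int (+ N ℤ.* (k ℤ.+ m ℤ.* f)) ∎
            where E = evalℚ qs (fromℤ s)

      approximate : ∃[ x ] ∃[ y ] Fℚ x y ℚ.< 0ℚ × (x ℚ.- x₀) ∈ N ·ℤ × (y ℚ.- y₀) ∈ N ·ℤ
      approximate = go base-point (degree-≥2 ¬affine ¬punctured)
        where
        go : (∃[ i ] ∃[ j ] ¬ ⟪ u ⟫ (ι (x₀ ℚ.+ fromℤ (+ N ℤ.* + i))) (ι (y₀ ℚ.+ fromℤ (+ N ℤ.* + j))) ≈ 0#) →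
          (∃[ bs ] ∃[ l ] ¬ l ≈ 0# × 2 ℕ.≤ length bs × (∀ x y → ⟪ u ⟫ x y ≈ Mon bs l (⟪ G ⟫ x y))) → ∃[ x ] ∃[ y ] Fℚ x y ℚ.< 0ℚ × (x ℚ.- x₀) ∈ N ·ℤ × (y ℚ.- y₀) ∈ N ·ℤ
        go (i , j , nz) (bs , l , l≉0 , len , u-eq) = finish (congruent (proj₁ C.curve-x) {k = + i} C.start-x ≡.refl) (congruent (proj₁ C.curve-y) {k = + j} C.start-y ≡.refl)
          where
          module C = From i j nz bs l l≉0 len u-eq
          v = Fℚ C.x₁ C.y₁
          finish : (∃[ d ] ¬ d ≡ + 0 × (∀ m → (evalℚ (proj₁ C.curve-x) (fromℤ (+ N ℤ.* (d ℤ.* m))) ℚ.- x₀) ∈ N ·ℤ)) → (∃[ d ] ¬ d ≡ + 0 × (∀ m → (evalℚ (proj₁ C.curve-y) (fromℤ (+ N ℤ.* (d ℤ.* m))) ℚ.- y₀) ∈ N ·ℤ)) →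
            ∃[ x ] ∃[ y ] Fℚ x y ℚ.< 0ℚ × (x ℚ.- x₀) ∈ N ·ℤ × (y ℚ.- y₀) ∈ N ·ℤ
          finish (d , d≢0 , on-x) (e , e≢0 , on-y) = evalℚ (proj₁ C.curve-x) (fromℤ s) , evalℚ (proj₁ C.curve-y) (fromℤ s) ,
            ≡.subst (ℚ._< 0ℚ) (≡.sym (C.value (fromℤ s))) (negative v D (λ z → [ d≢0 , e≢0 ]′ (ℤ.i*j≡0⇒i≡0∨j≡0 d z)) N N>0) ,
            ≡.subst (λ s → (evalℚ (proj₁ C.curve-x) (fromℤ s) ℚ.- x₀) ∈ N ·ℤ) (split₁ (+ N) d e T) (on-x (e ℤ.* ℤ.- (D ℤ.* T))) ,
            ≡.subst (λ s → (evalℚ (proj₁ C.curve-y) (fromℤ s) ℚ.- y₀) ∈ N ·ℤ) (split₂ (+ N) d e T) (on-y (d ℤ.* ℤ.- (D ℤ.* T)))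
            where
            D = d ℤ.* e
            T = + suc ℤ.∣ ↥ v ∣
            -- Divisible by N d and by N e, as both coordinates require. Of d and e only d, e ≠ 0 is
            -- recorded, so D enters squared to fix the sign. T exceeds the value v of F at the base
            -- point, hence v + s < 0.
            s = ℤ.- ((+ N ℤ.* (D ℤ.* D)) ℤ.* T)
            split₁ : ∀ N d e T → N ℤ.* (d ℤ.* (e ℤ.* ℤ.- (d ℤ.* e ℤ.* T))) ≡ ℤ.- ((N ℤ.* ((d ℤ.* e) ℤ.* (d ℤ.* e))) ℤ.* T)
            split₁ = ℤS.solve 4 (λ N d e T → N ℤS.:* (d ℤS.:* (e ℤS.:* ℤS.:- (d ℤS.:* e ℤS.:* T))) ℤS.:= ℤS.:- ((N ℤS.:* ((d ℤS.:* e) ℤS.:* (d ℤS.:* e))) ℤS.:* T)) ≡.refl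
            split₂ : ∀ N d e T → N ℤ.* (e ℤ.* (d ℤ.* ℤ.- (d ℤ.* e ℤ.* T))) ≡ ℤ.- ((N ℤ.* ((d ℤ.* e) ℤ.* (d ℤ.* e))) ℤ.* T)
            split₂ = ℤS.solve 4 (λ N d e T → N ℤS.:* (e ℤS.:* (d ℤS.:* ℤS.:- (d ℤS.:* e ℤS.:* T))) ℤS.:= ℤS.:- ((N ℤS.:* ((d ℤS.:* e) ℤS.:* (d ℤS.:* e))) ℤS.:* T)) ≡.refl

  -- Shearing G to a polynomial monic in y

  module P = Polynomials commutativeRing
  module S = RawSemiringDefs (Semiring.rawSemiring semiring)

  toExpr : Poly Carrier 2 → Expr
  toExpr []                      = const 0#
  toExpr ((a , i ∷ j ∷ []) ∷ F) = const a ⊗ (X ⊛ i ⊗ (Y ⊛ j ⊗ const 1#)) ⊕ toExpr F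

  ⟪⟫-toExpr : ∀ F x y → ⟪ toExpr F ⟫ x y ≈ P.eval F (x ∷ y ∷ [])
  ⟪⟫-toExpr []                      x y = refl
  ⟪⟫-toExpr ((a , i ∷ j ∷ []) ∷ F) x y = +-cong (*-congˡ (*-cong (⟪⟫-⊛ X i x y) (*-congʳ (⟪⟫-⊛ Y j x y)))) (⟪⟫-toExpr F x y)

  ·-nat : ∀ n a → n S.× a ≈ nat n * a
  ·-nat 0       a = sym (zeroˡ a)
  ·-nat (suc n) a = trans (+-congˡ (·-nat n a)) (solve 2 (λ n a → a :+ n :* a := (:1 :+ n) :* a) refl (nat n) a)

  ∂₁-X⊛ : ∀ i x y → ⟪ ∂₁ (X ⊛ i) ⟫ x y ≈ nat i * x ^ ℕ.pred i
  ∂₁-X⊛ 0             x y = sym (zeroˡ _)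
  ∂₁-X⊛ 1             x y = solve 1 (λ x → :1 :* :1 :+ x :* :0 := (:1 :+ :0) :* :1) refl x
  ∂₁-X⊛ (suc (suc i)) x y = trans (+-cong (*-congˡ (*-congˡ (⟪⟫-⊛ X i x y))) (*-congˡ (∂₁-X⊛ (suc i) x y)))
    (solve 3 (λ x p n → :1 :* (x :* p) :+ x :* ((:1 :+ n) :* p) := (:1 :+ (:1 :+ n)) :* (x :* p)) refl x (x ^ i) (nat i))

  ∂₂-Y⊛ : ∀ j x y → ⟪ ∂₂ (Y ⊛ j) ⟫ x y ≈ nat j * y ^ ℕ.pred j
  ∂₂-Y⊛ 0             x y = sym (zeroˡ _)
  ∂₂-Y⊛ 1             x y = solve 1 (λ x → :1 :* :1 :+ x :* :0 := (:1 :+ :0) :* :1) refl y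
  ∂₂-Y⊛ (suc (suc i)) x y = trans (+-cong (*-congˡ (*-congˡ (⟪⟫-⊛ Y i x y))) (*-congˡ (∂₂-Y⊛ (suc i) x y)))
    (solve 3 (λ x p n → :1 :* (x :* p) :+ x :* ((:1 :+ n) :* p) := (:1 :+ (:1 :+ n)) :* (x :* p)) refl y (y ^ i) (nat i))

  ∂₂-X⊛ : ∀ i x y → ⟪ ∂₂ (X ⊛ i) ⟫ x y ≈ 0#
  ∂₂-X⊛ 0       x y = refl
  ∂₂-X⊛ (suc i) x y = trans (+-cong (zeroˡ _) (trans (*-congˡ (∂₂-X⊛ i x y)) (zeroʳ x))) (+-identityʳ 0#)

  ∂₁-Y⊛ : ∀ j x y → ⟪ ∂₁ (Y ⊛ j) ⟫ x y ≈ 0#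
  ∂₁-Y⊛ 0       x y = refl
  ∂₁-Y⊛ (suc j) x y = trans (+-cong (zeroˡ _) (trans (*-congˡ (∂₁-Y⊛ j x y)) (zeroʳ y))) (+-identityʳ 0#)

  ∂₁-toExpr : ∀ F x y → ⟪ ∂₁ (toExpr F) ⟫ x y ≈ P.eval (P.∂ Fin.zero F) (x ∷ y ∷ [])
  ∂₁-toExpr []                      x y = refl
  ∂₁-toExpr ((a , i ∷ j ∷ []) ∷ F) x y = +-cong (begin
    0# * ⟪ X ⊛ i ⊗ (Y ⊛ j ⊗ const 1#) ⟫ x y + a * (⟪ ∂₁ (X ⊛ i) ⟫ x y * (⟪ Y ⊛ j ⟫ x y * 1#) + ⟪ X ⊛ i ⟫ x y * (⟪ ∂₁ (Y ⊛ j) ⟫ x y * 1# + ⟪ Y ⊛ j ⟫ x y * 0#))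
      ≈⟨ +-congˡ (*-congˡ (+-cong (*-cong (∂₁-X⊛ i x y) (*-congʳ (⟪⟫-⊛ Y j x y))) (*-congˡ (+-congʳ (*-congʳ (∂₁-Y⊛ j x y)))))) ⟩
    0# * ⟪ X ⊛ i ⊗ (Y ⊛ j ⊗ const 1#) ⟫ x y + a * (nat i * x ^ ℕ.pred i * (y ^ j * 1#) + ⟪ X ⊛ i ⟫ x y * (0# * 1# + ⟪ Y ⊛ j ⟫ x y * 0#))
      ≈⟨ solve 7 (λ w a n p q r s → :0 :* w :+ a :* (n :* p :* (q :* :1) :+ r :* (:0 :* :1 :+ s :* :0)) := n :* a :* (p :* (q :* :1))) refl _ a (nat i) (x ^ ℕ.pred i) (y ^ j) _ _ ⟩
    nat i * a * (x ^ ℕ.pred i * (y ^ j * 1#)) ≈⟨ *-congʳ (·-nat i a) ⟨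
    i S.× a * (x ^ ℕ.pred i * (y ^ j * 1#)) ∎) (∂₁-toExpr F x y)

  ∂₂-toExpr : ∀ F x y → ⟪ ∂₂ (toExpr F) ⟫ x y ≈ P.eval (P.∂ (Fin.suc Fin.zero) F) (x ∷ y ∷ [])
  ∂₂-toExpr []                      x y = refl
  ∂₂-toExpr ((a , i ∷ j ∷ []) ∷ F) x y = +-cong (begin
    0# * ⟪ X ⊛ i ⊗ (Y ⊛ j ⊗ const 1#) ⟫ x y + a * (⟪ ∂₂ (X ⊛ i) ⟫ x y * (⟪ Y ⊛ j ⟫ x y * 1#) + ⟪ X ⊛ i ⟫ x y * (⟪ ∂₂ (Y ⊛ j) ⟫ x y * 1# + ⟪ Y ⊛ j ⟫ x y * 0#))
      ≈⟨ +-congˡ (*-congˡ (+-cong (*-congʳ (∂₂-X⊛ i x y)) (*-cong (⟪⟫-⊛ X i x y) (+-congʳ (*-congʳ (∂₂-Y⊛ j x y)))))) ⟩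
    0# * ⟪ X ⊛ i ⊗ (Y ⊛ j ⊗ const 1#) ⟫ x y + a * (0# * (⟪ Y ⊛ j ⟫ x y * 1#) + x ^ i * (nat j * y ^ ℕ.pred j * 1# + ⟪ Y ⊛ j ⟫ x y * 0#))
      ≈⟨ solve 6 (λ w a n p q s → :0 :* w :+ a :* (:0 :* (s :* :1) :+ p :* (n :* q :* :1 :+ s :* :0)) := n :* a :* (p :* (q :* :1))) refl _ a (nat j) (x ^ i) (y ^ ℕ.pred j) _ ⟩
    nat j * a * (x ^ i * (y ^ ℕ.pred j * 1#)) ≈⟨ *-congʳ (·-nat j a) ⟨
    j S.× a * (x ^ i * (y ^ ℕ.pred j * 1#)) ∎) (∂₂-toExpr F x y)

  -- Polynomials of degree below n in y, with polynomials in x as coefficients.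
  Low : ℕ → (Carrier → Carrier → Carrier) → Set (c ⊔ ℓ)
  Low n f = ∃[ fs ] All IsPoly fs × length fs ℕ.≤ n × (∀ x y → f x y ≈ ⟦ fs ⟧₂ x y)

  low-≤ : ∀ {m n f} → m ℕ.≤ n → Low m f → Low n f
  low-≤ le (fs , p , l , e) = fs , p , ℕ.≤-trans l le , e

  low-resp : ∀ {n f g} → (∀ x y → g x y ≈ f x y) → Low n f → Low n g
  low-resp eq (fs , p , l , e) = fs , p , l , λ x y → trans (eq x y) (e x y)

  low-+ : ∀ {n f g} → Low n f → Low n g → Low n (λ x y → f x y + g x y)
  low-+ (fs , p , l , e) (gs , q , m , e′) = fs ⊞F gs , All-⊞ p q , length-⊞F fs gs l m , λ x y → trans (+-cong (e x y) (e′ x y)) (sym (⟦⟧F-⊞ x fs gs y))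

  low-* : ∀ {m n f g} → Low m f → Low (suc n) g → Low (m ℕ.+ n) (λ x y → f x y * g x y)
  low-* (fs , p , l , e) (gs , q , m , e′) = fs ⊠F gs , All-⊠ p q , length-⊠F fs gs l m , λ x y → trans (*-cong (e x y) (e′ x y)) (sym (⟦⟧F-⊠ x fs gs y))

  low-x : ∀ {f} → IsPoly f → Low 1 (λ x y → f x)
  low-x {f} p = f ∷ [] , p ∷ [] , s≤s z≤n , λ x y → solve 2 (λ f y → f := f :+ y :* :0) refl (f x) y

  low-y^ : ∀ a n → Low (suc n) (λ x y → a * y ^ n)
  low-y^ a 0       = low-resp (λ x y → *-identityʳ a) (low-x (isPoly-const a))
  low-y^ a (suc n) = let fs , p , l , e = low-y^ a n in (λ _ → 0#) ∷ fs , isPoly-0 ∷ p , s≤s l ,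
    λ x y → trans (solve 3 (λ a y p → a :* (y :* p) := :0 :+ y :* (a :* p)) refl a y (y ^ n)) (+-congˡ (*-congˡ (e x y)))

  -- The coefficient a of yⁿ is a constant, not a polynomial in x; this is the condition that
  -- survives products and leads to `MonicInY`.
  Leading : ℕ → Carrier → (Carrier → Carrier → Carrier) → Set (c ⊔ ℓ)
  Leading n a f = ∃[ r ] Low n r × (∀ x y → f x y ≈ r x y + a * y ^ n)

  leading-low : ∀ {n a f} → Leading n a f → Low (suc n) f
  leading-low {n} {a} (r , l , e) = low-resp e (low-+ (low-≤ (ℕ.n≤1+n n) l) (low-y^ a n))

  low-leading : ∀ {n f} → Low n f → Leading n 0# f
  low-leading {n} {f} l = f , l , λ x y → solve 2 (λ f p → f := f :+ :0 :* p) refl (f x y) (y ^ n)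

  leading-+ : ∀ {n a b f g} → Leading n a f → Leading n b g → Leading n (a + b) (λ x y → f x y + g x y)
  leading-+ {n} {a} {b} (r , l , e) (s , m , e′) = _ , low-+ l m , λ x y → trans (+-cong (e x y) (e′ x y)) (solve 5 (λ r s a b p → r :+ a :* p :+ (s :+ b :* p) := r :+ s :+ (a :+ b) :* p) refl (r x y) (s x y) a b (y ^ n))

  leading-* : ∀ {m n a b f g} → Leading m a f → Leading n b g → Leading (m ℕ.+ n) (a * b) (λ x y → f x y * g x y)
  leading-* {m} {n} {a} {b} {f} {g} F@(r , l , e) G@(s , k , e′) = (λ x y → r x y * g x y + a * y ^ m * s x y) ,
    low-+ (low-* l (leading-low G)) (≡.subst (λ d → Low d (λ x y → a * y ^ m * s x y)) (ℕ.+-comm n m) (low-resp (λ x y → *-comm _ _) (low-* k (low-y^ a m)))) ,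
    λ x y → begin
      f x y * g x y ≈⟨ *-congʳ (e x y) ⟩
      (r x y + a * y ^ m) * g x y ≈⟨ trans (distribʳ _ _ _) (+-congˡ (*-congˡ (e′ x y))) ⟩
      r x y * g x y + a * y ^ m * (s x y + b * y ^ n) ≈⟨ solve 6 (λ w a p s b q → w :+ a :* p :* (s :+ b :* q) := w :+ a :* p :* s :+ a :* b :* (p :* q)) refl (r x y * g x y) a (y ^ m) (s x y) b (y ^ n) ⟩
      r x y * g x y + a * y ^ m * s x y + a * b * (y ^ m * y ^ n) ≈⟨ +-congˡ (*-congˡ (^-+ y m n)) ⟨
      r x y * g x y + a * y ^ m * s x y + a * b * y ^ (m ℕ.+ n) ∎

  leading-const : ∀ a → Leading 0 a (λ x y → a)
  leading-const a = (λ _ _ → 0#) , ([] , [] , z≤n , λ _ _ → refl) , λ x y → solve 1 (λ a → a := :0 :+ a :* :1) refl a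

  leading-^ : ∀ {a f} n → Leading 1 a f → Leading n (a ^ n) (λ x y → f x y ^ n)
  leading-^ 0       l = leading-const 1#
  leading-^ (suc n) l = leading-* l (leading-^ n l)

  deg : Vec ℕ 2 → ℕ
  deg (i ∷ j ∷ []) = i ℕ.+ j

  keep drop : ℕ → Poly Carrier 2 → Poly Carrier 2
  keep n [] = []
  keep n ((a , e) ∷ F) with deg e ℕ.≟ n
  ... | yes _ = (a , e) ∷ keep n F
  ... | no  _ = keep n F
  drop n [] = []
  drop n ((a , e) ∷ F) with deg e ℕ.≟ n
  ... | yes _ = drop n F
  ... | no  _ = (a , e) ∷ drop n F

  keep-drop : ∀ n F x y → ⟪ toExpr F ⟫ x y ≈ ⟪ toExpr (keep n F) ⟫ x y + ⟪ toExpr (drop n F) ⟫ x y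
  keep-drop n [] x y = sym (+-identityʳ 0#)
  keep-drop n ((a , i ∷ j ∷ []) ∷ F) x y with (i ℕ.+ j) ℕ.≟ n
  ... | yes _ = trans (+-congˡ (keep-drop n F x y)) (sym (+-assoc _ _ _))
  ... | no  _ = trans (+-congˡ (keep-drop n F x y)) (solve 3 (λ t k d → t :+ (k :+ d) := k :+ (t :+ d)) refl _ _ _)

  drop-deg : ∀ n F → All (λ (_ , e) → deg e ℕ.≤ suc n) F → All (λ (_ , e) → deg e ℕ.≤ n) (drop (suc n) F)
  drop-deg n [] [] = []
  drop-deg n ((a , e) ∷ F) (p ∷ ps) with deg e ℕ.≟ suc n
  ... | yes _  = drop-deg n F ps
  ... | no neq = ℕ.≤-pred (ℕ.≤∧≢⇒< p neq) ∷ drop-deg n F ps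

  homogeneous : ∀ n F z y → ⟪ toExpr (keep n F) ⟫ (z * y) y ≈ y ^ n * ⟪ toExpr (keep n F) ⟫ z 1#
  homogeneous n [] z y = sym (zeroʳ _)
  homogeneous n ((a , i ∷ j ∷ []) ∷ F) z y with (i ℕ.+ j) ℕ.≟ n
  ... | no  _ = homogeneous n F z y
  ... | yes ≡.refl = trans (+-cong (begin
    a * (⟪ X ⊛ i ⟫ (z * y) y * (⟪ Y ⊛ j ⟫ (z * y) y * 1#)) ≈⟨ *-congˡ (*-cong (trans (⟪⟫-⊛ X i (z * y) y) (^-* z y i)) (*-congʳ (⟪⟫-⊛ Y j (z * y) y))) ⟩
    a * (z ^ i * y ^ i * (y ^ j * 1#)) ≈⟨ solve 4 (λ a p q r → a :* (p :* q :* (r :* :1)) := q :* r :* (a :* (p :* (:1 :* :1)))) refl a (z ^ i) (y ^ i) (y ^ j) ⟩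
    y ^ i * y ^ j * (a * (z ^ i * (1# * 1#))) ≈⟨ *-cong (^-+ y i j) (*-congˡ (*-cong (⟪⟫-⊛ X i z 1#) (*-congʳ (trans (⟪⟫-⊛ Y j z 1#) (1^ j))))) ⟨
    y ^ (i ℕ.+ j) * (a * (⟪ X ⊛ i ⟫ z 1# * (⟪ Y ⊛ j ⟫ z 1# * 1#))) ∎) (homogeneous (i ℕ.+ j) F z y)) (sym (distribˡ _ _ _))

  -- For y ≠ 0 a form of degree n is yⁿ times its value at (x / y , 1).
  homogeneous-zero : ∀ n F → (∀ z → ⟪ toExpr (keep n F) ⟫ z 1# ≈ 0#) → Zero (toExpr (keep n F))
  homogeneous-zero n F z x y =
    let as , v = hasDeriv-isPoly (∂₂-hasDeriv (toExpr (keep n F)) x)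
    in trans (v y) (vanish-off-point {as} 0# (λ t t≉0 → trans (sym (v t)) (trans (⟪⟫-cong (toExpr (keep n F)) (sym (trans (*-assoc x _ t) (trans (*-congˡ (trans (*-comm _ t) (*-inverse t t≉0))) (*-identityʳ x)))) refl)
         (trans (homogeneous n F (x * t ⁻¹⟨ t≉0 ⟩) t) (trans (*-congˡ (z _)) (zeroʳ _))))) y)

  leading-linear : ∀ κ → Leading 1 κ (λ x y → x + κ * y)
  leading-linear κ = (λ x y → x) , low-x isPoly-id , λ x y → +-congˡ (*-congˡ (sym (*-identityʳ y)))

  leading-y : Leading 1 1# (λ x y → y)
  leading-y = (λ x y → 0#) , ([] , [] , z≤n , λ _ _ → refl) , λ x y → solve 1 (λ y → y := :0 :+ :1 :* (y :* :1)) refl y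

  leading-term : ∀ κ a i j → Leading (i ℕ.+ j) (a * (κ ^ i * 1# ^ j)) (λ x y → a * (⟪ X ⊛ i ⟫ (x + κ * y) y * (⟪ Y ⊛ j ⟫ (x + κ * y) y * 1#)))
  leading-term κ a i j =
    let r , l , e = leading-* (leading-const a) (leading-* (leading-^ i (leading-linear κ)) (leading-^ j leading-y))
    in r , l , λ x y → trans (*-congˡ (*-cong (⟪⟫-⊛ X i _ _) (trans (*-identityʳ _) (⟪⟫-⊛ Y j _ _)))) (e x y)

  -- Under x ↦ x + κ y a monomial of total degree n contributes its value at (κ , 1) to the
  -- coefficient of yⁿ, and one of smaller degree contributes nothing.
  leading-sheared : ∀ κ n F → All (λ (_ , e) → deg e ℕ.≤ n) F → Leading n (⟪ toExpr (keep n F) ⟫ κ 1#) (λ x y → ⟪ toExpr F ⟫ (x + κ * y) y)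
  leading-sheared κ n [] [] = low-leading ([] , [] , z≤n , λ _ _ → refl)
  leading-sheared κ n ((a , i ∷ j ∷ []) ∷ F) (p ∷ ps) with (i ℕ.+ j) ℕ.≟ n
  ... | no neq =
    let r , l , e = leading-+ (low-leading (low-≤ (ℕ.≤∧≢⇒< p neq) (leading-low (leading-term κ a i j)))) (leading-sheared κ n F ps)
    in r , l , λ x y → trans (e x y) (+-congˡ (*-congʳ (+-identityˡ _)))
  ... | yes ≡.refl =
    let r , l , e = leading-+ (leading-term κ a i j) (leading-sheared κ n F ps)
    in r , l , λ x y → trans (e x y) (+-congˡ (*-congʳ (+-congʳ (*-congˡ (sym (*-cong (⟪⟫-⊛ X i κ 1#) (trans (*-identityʳ _) (⟪⟫-⊛ Y j κ 1#))))))))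

  pad : ∀ n {fs} → All IsPoly fs → length fs ℕ.≤ n → ∃[ gs ] All IsPoly gs × length gs ≡ n × (∀ x y → ⟦ fs ⟧₂ x y ≈ ⟦ gs ⟧₂ x y)
  pad 0       []       le       = [] , [] , ≡.refl , λ x y → refl
  pad (suc n) []       le       = let gs , q , l , e = pad n [] z≤n in (λ _ → 0#) ∷ gs , isPoly-0 ∷ q , ≡.cong suc l , λ x y → trans (solve 1 (λ y → :0 := :0 :+ y :* :0) refl y) (+-congˡ (*-congˡ (e x y)))
  pad (suc n) (p ∷ ps) (s≤s le) = let gs , q , l , e = pad n ps le in _ ∷ gs , p ∷ q , ≡.cong suc l , λ x y → +-congˡ (*-congˡ (e x y))

  leading-monic : ∀ {n a f} → ¬ a ≈ 0# → Leading (suc n) a f → ∀ G → (∀ x y → ⟪ G ⟫ x y ≈ f x y) → MonicInY G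
  leading-monic {n} {a} {f} a≉0 (r , (fs , p , le , e) , eq) G G-eq = go (pad (suc n) p le)
    where
    go : (∃[ gs ] All IsPoly gs × length gs ≡ suc n × (∀ x y → ⟦ fs ⟧₂ x y ≈ ⟦ gs ⟧₂ x y)) → MonicInY G
    go (g ∷ gs , q ∷ qs , l , e′) = record
      { first = g ; others = gs ; lead = a ; lead≉0 = a≉0 ; first-isPoly = q ; others-isPoly = qs
      ; monic = λ x y → trans (G-eq x y) (trans (eq x y) (trans (+-cong (trans (e x y) (e′ x y)) (*-congˡ (reflexive (≡.cong (y ^_) (≡.sym (≡.trans (List.length-map _ (g ∷ gs)) l)))))) (sym (Mon-⟦⟧ (at x (g ∷ gs)) a y)))) }

  shear : ℕ → Expr → Expr
  shear κ f = subst f (X ⊕ const (nat κ) ⊗ Y) Y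

  ⟪⟫-shear : ∀ κ f x y → ⟪ shear κ f ⟫ x y ≡ ⟪ f ⟫ (x + nat κ * y) y
  ⟪⟫-shear κ f x y = ⟪⟫-subst f (X ⊕ const (nat κ) ⊗ Y) Y x y

  constant : ∀ F → All (λ (_ , e) → deg e ℕ.≤ 0) F → ∀ x y → ⟪ toExpr F ⟫ x y ≈ ⟪ toExpr F ⟫ 0# 0#
  constant [] [] x y = refl
  constant ((a , 0 ∷ 0 ∷ []) ∷ F) (p ∷ ps) x y = +-congˡ (constant F ps x y)
  constant ((a , 0 ∷ suc j ∷ []) ∷ F) (() ∷ ps) x y
  constant ((a , suc i ∷ j ∷ []) ∷ F) (() ∷ ps) x y

  degree-bounded : ∀ F → ∃[ n ] All (λ ((_ , e) : Carrier × Vec ℕ 2) → deg e ℕ.≤ n) F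
  degree-bounded [] = 0 , []
  degree-bounded ((a , e) ∷ F) = let n , ps = degree-bounded F in deg e ℕ.+ n , ℕ.m≤m+n _ n ∷ All.map (λ le → ℕ.≤-trans le (ℕ.m≤n+m n _)) ps

  -- A nonzero top form has a nonzero value at (κ , 1) for some natural κ; if the top form vanishes
  -- it is dropped and the degree bound decreases. An integral κ keeps the shear rational and
  -- compatible with congruences.
  monic-shear : ∀ F → (∃[ κ ] MonicInY (shear κ (toExpr F))) ⊎ (∀ x y → ⟪ toExpr F ⟫ x y ≈ ⟪ toExpr F ⟫ 0# 0#)
  monic-shear F = go (proj₁ (degree-bounded F)) F (proj₂ (degree-bounded F)) (λ _ _ → refl)
    where
    go : ∀ n F′ → All (λ (_ , e) → deg e ℕ.≤ n) F′ → toExpr F ≗ toExpr F′ → (∃[ κ ] MonicInY (shear κ (toExpr F))) ⊎ (∀ x y → ⟪ toExpr F ⟫ x y ≈ ⟪ toExpr F ⟫ 0# 0#)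
    go 0       F′ ps e = inj₂ λ x y → trans (e x y) (trans (constant F′ ps x y) (sym (e 0# 0#)))
    go (suc n) F′ ps e = [ found , descend ]′ (search as)
      where
      as = proj₁ (hasDeriv-isPoly (∂₁-hasDeriv (toExpr (keep (suc n) F′)) 1#))
      v = proj₂ (hasDeriv-isPoly (∂₁-hasDeriv (toExpr (keep (suc n) F′)) 1#))
      found : (∃[ κ ] ¬ ⟦ as ⟧ (nat κ) ≈ 0#) → (∃[ κ ] MonicInY (shear κ (toExpr F))) ⊎ (∀ x y → ⟪ toExpr F ⟫ x y ≈ ⟪ toExpr F ⟫ 0# 0#)
      found (κ , nz) = inj₁ (κ , leading-monic (λ z → nz (trans (sym (v (nat κ))) z)) (leading-sheared (nat κ) (suc n) F′ ps) (shear κ (toExpr F)) (λ x y → trans (reflexive (⟪⟫-shear κ (toExpr F) x y)) (e _ _)))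
      descend : (∀ t → ⟦ as ⟧ t ≈ 0#) → (∃[ κ ] MonicInY (shear κ (toExpr F))) ⊎ (∀ x y → ⟪ toExpr F ⟫ x y ≈ ⟪ toExpr F ⟫ 0# 0#)
      descend z = go n (drop (suc n) F′) (drop-deg n F′ ps) λ x y → trans (e x y) (trans (keep-drop (suc n) F′ x y) (trans (+-congʳ (homogeneous-zero (suc n) F′ (λ t → trans (v t) (z t)) x y)) (+-identityˡ _)))

  ∂₁-subst : ∀ f p q → ∂₁ (subst f p q) ≗ subst (∂₁ f) p q ⊗ ∂₁ p ⊕ subst (∂₂ f) p q ⊗ ∂₁ q
  ∂₁-subst (const a) p q x y = solve 2 (λ u v → :0 := :0 :* u :+ :0 :* v) refl _ _
  ∂₁-subst X p q x y = solve 2 (λ u v → u := :1 :* u :+ :0 :* v) refl _ _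
  ∂₁-subst Y p q x y = solve 2 (λ u v → v := :0 :* u :+ :1 :* v) refl _ _
  ∂₁-subst (f ⊕ g) p q x y = trans (+-cong (∂₁-subst f p q x y) (∂₁-subst g p q x y)) (solve 6 (λ a b c d u v → a :* u :+ c :* v :+ (b :* u :+ d :* v) := (a :+ b) :* u :+ (c :+ d) :* v) refl _ _ _ _ _ _)
  ∂₁-subst (f ⊗ g) p q x y = trans (+-cong (*-congʳ (∂₁-subst f p q x y)) (*-congˡ (∂₁-subst g p q x y)))
    (solve 8 (λ f f₁ f₂ g g₁ g₂ u v → (f₁ :* u :+ f₂ :* v) :* g :+ f :* (g₁ :* u :+ g₂ :* v) := (f₁ :* g :+ f :* g₁) :* u :+ (f₂ :* g :+ f :* g₂) :* v) refl _ _ _ _ _ _ _ _)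

  ∂₂-subst : ∀ f p q → ∂₂ (subst f p q) ≗ subst (∂₁ f) p q ⊗ ∂₂ p ⊕ subst (∂₂ f) p q ⊗ ∂₂ q
  ∂₂-subst (const a) p q x y = solve 2 (λ u v → :0 := :0 :* u :+ :0 :* v) refl _ _
  ∂₂-subst X p q x y = solve 2 (λ u v → u := :1 :* u :+ :0 :* v) refl _ _
  ∂₂-subst Y p q x y = solve 2 (λ u v → v := :0 :* u :+ :1 :* v) refl _ _
  ∂₂-subst (f ⊕ g) p q x y = trans (+-cong (∂₂-subst f p q x y) (∂₂-subst g p q x y)) (solve 6 (λ a b c d u v → a :* u :+ c :* v :+ (b :* u :+ d :* v) := (a :+ b) :* u :+ (c :+ d) :* v) refl _ _ _ _ _ _)
  ∂₂-subst (f ⊗ g) p q x y = trans (+-cong (*-congʳ (∂₂-subst f p q x y)) (*-congˡ (∂₂-subst g p q x y)))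
    (solve 8 (λ f f₁ f₂ g g₁ g₂ u v → (f₁ :* u :+ f₂ :* v) :* g :+ f :* (g₁ :* u :+ g₂ :* v) := (f₁ :* g :+ f :* g₁) :* u :+ (f₂ :* g :+ f :* g₂) :* v) refl _ _ _ _ _ _ _ _)

  shear-smooth : ∀ κ f → (∀ x y → ⟪ f ⟫ x y ≈ 0# → ⟪ ∂₁ f ⟫ x y ≈ 0# → ¬ ⟪ ∂₂ f ⟫ x y ≈ 0#) →
    ∀ x y → ⟪ shear κ f ⟫ x y ≈ 0# → ⟪ ∂₁ (shear κ f) ⟫ x y ≈ 0# → ¬ ⟪ ∂₂ (shear κ f) ⟫ x y ≈ 0#
  shear-smooth κ f smooth x y z z₁ z₂ = smooth (x + nat κ * y) y (trans (reflexive (≡.sym (⟪⟫-shear κ f x y))) z) f₁≈0 f₂≈0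
    where
    p = X ⊕ const (nat κ) ⊗ Y
    f₁ = ⟪ ∂₁ f ⟫ (x + nat κ * y) y
    f₂ = ⟪ ∂₂ f ⟫ (x + nat κ * y) y
    f₁≈0 : f₁ ≈ 0#
    f₁≈0 = begin
      f₁ ≈⟨ solve 4 (λ f₁ f₂ κ y → f₁ := f₁ :* (:1 :+ (:0 :* y :+ κ :* :0)) :+ f₂ :* :0) refl f₁ f₂ (nat κ) y ⟩
      f₁ * (1# + (0# * y + nat κ * 0#)) + f₂ * 0# ≈⟨ +-cong (*-congʳ (reflexive (⟪⟫-subst (∂₁ f) p Y x y))) (*-congʳ (reflexive (⟪⟫-subst (∂₂ f) p Y x y))) ⟨
      _ ≈⟨ ∂₁-subst f p Y x y ⟨
      _ ≈⟨ z₁ ⟩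
      0# ∎
    f₂≈0 : f₂ ≈ 0#
    f₂≈0 = begin
      f₂ ≈⟨ solve 3 (λ f₂ κ y → f₂ := :0 :* (:0 :+ (:0 :* y :+ κ :* :1)) :+ f₂ :* :1) refl f₂ (nat κ) y ⟩
      0# * (0# + (0# * y + nat κ * 1#)) + f₂ * 1# ≈⟨ +-congʳ (*-congʳ f₁≈0) ⟨
      f₁ * (0# + (0# * y + nat κ * 1#)) + f₂ * 1# ≈⟨ +-cong (*-congʳ (reflexive (⟪⟫-subst (∂₁ f) p Y x y))) (*-congʳ (reflexive (⟪⟫-subst (∂₂ f) p Y x y))) ⟨
      _ ≈⟨ ∂₂-subst f p Y x y ⟨
      _ ≈⟨ z₂ ⟩
      0# ∎

  -- From varieties to polynomials

  open Geometry field′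
  open Variety
  open _∋_
  open Morphism
  open Polynomials commutativeRing using (_⊖_; var) renaming (eval to evalK; const to constP)
  module Pℚ = Polynomials ℚ.+-*-commutativeRing
  module Sℚ = RawSemiringDefs (Semiring.rawSemiring (CommutativeRing.semiring ℚ.+-*-commutativeRing))

  monomial₁ : ℕ → Carrier → List Carrier
  monomial₁ 0       a = a ∷ []
  monomial₁ (suc i) a = 0# ∷ monomial₁ i a

  ⟦⟧-monomial₁ : ∀ i a t → a * (t ^ i * 1#) ≈ ⟦ monomial₁ i a ⟧ t
  ⟦⟧-monomial₁ 0       a t = solve 2 (λ a t → a :* (:1 :* :1) := a :+ t :* :0) refl a t
  ⟦⟧-monomial₁ (suc i) a t = trans (solve 3 (λ a t p → a :* (t :* p :* :1) := :0 :+ t :* (a :* (p :* :1))) refl a t (t ^ i)) (+-congˡ (*-congˡ (⟦⟧-monomial₁ i a t)))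

  coeffs₁ : Poly Carrier 1 → List Carrier
  coeffs₁ []                 = []
  coeffs₁ ((a , i ∷ []) ∷ F) = monomial₁ i a ⊞ coeffs₁ F

  ⟦⟧-coeffs₁ : ∀ F t → evalK F (t ∷ []) ≈ ⟦ coeffs₁ F ⟧ t
  ⟦⟧-coeffs₁ []                 t = refl
  ⟦⟧-coeffs₁ ((a , i ∷ []) ∷ F) t = trans (+-cong (⟦⟧-monomial₁ i a t) (⟦⟧-coeffs₁ F t)) (sym (⟦⟧-⊞ (monomial₁ i a) (coeffs₁ F) t))

  toPoly : ℕ → List Carrier → Poly Carrier 1
  toPoly k []       = []
  toPoly k (a ∷ as) = (a , k ∷ []) ∷ toPoly (suc k) as

  eval-toPoly : ∀ k as t → evalK (toPoly k as) (t ∷ []) ≈ t ^ k * ⟦ as ⟧ t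
  eval-toPoly k []       t = sym (zeroʳ _)
  eval-toPoly k (a ∷ as) t = trans (+-congˡ (eval-toPoly (suc k) as t)) (solve 4 (λ a t p q → a :* (p :* :1) :+ t :* p :* q := p :* (a :+ t :* q)) refl a t (t ^ k) (⟦ as ⟧ t))

  eval-cong₂ : ∀ F {x x′ y y′} → x ≈ x′ → y ≈ y′ → evalK F (x ∷ y ∷ []) ≈ evalK F (x′ ∷ y′ ∷ [])
  eval-cong₂ F p q = trans (sym (⟪⟫-toExpr F _ _)) (trans (⟪⟫-cong (toExpr F) p q) (⟪⟫-toExpr F _ _))

  ⟪⟫-⊖ : ∀ G a x y → evalK (G ⊖ a) (x ∷ y ∷ []) ≈ ⟪ toExpr G ⟫ x y - a
  ⟪⟫-⊖ []                     a x y = solve 1 (λ a → :- a :* (:1 :* (:1 :* :1)) :+ :0 := :0 :- a) refl a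
  ⟪⟫-⊖ ((b , i ∷ j ∷ []) ∷ G) a x y = trans (+-cong (*-congˡ (sym (*-cong (⟪⟫-⊛ X i x y) (*-congʳ (⟪⟫-⊛ Y j x y))))) (⟪⟫-⊖ G a x y)) (sym (+-assoc _ _ _))

  eval-const₁ : ∀ t → evalK {1} (constP 1#) (t ∷ []) ≈ 1#
  eval-const₁ t = solve 0 (:1 :* (:1 :* :1) :+ :0 := :1) refl

  eval-const₂ : ∀ x y → evalK {2} (constP 1#) (x ∷ y ∷ []) ≈ 1#
  eval-const₂ x y = solve 0 (:1 :* (:1 :* (:1 :* :1)) :+ :0 := :1) refl

  eval-var : ∀ t → evalK {1} (var Fin.zero) (t ∷ []) ≈ t
  eval-var t = solve 1 (λ t → :1 :* (t :* :1 :* :1) :+ :0 := t) refl t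

  inverse-1 : ∀ {v} (nz : ¬ v ≈ 0#) → v ≈ 1# → ∀ k p → p * (v ⁻¹⟨ nz ⟩) ^ k ≈ p
  inverse-1 {v} nz v≈1 k p = trans (*-congˡ (trans (^-cong k (trans (sym (*-identityˡ _)) (trans (*-congʳ (sym v≈1)) (*-inverse v nz)))) (1^ k))) (*-identityʳ p)

  point₁ : Carrier → Point 𝔸¹
  point₁ t = t ∷ [] , record { vanishes = [] ; nonzero≉0 = λ z → 1≉0 (trans (sym (eval-const₁ t)) z) }

  member₂ : ∀ {F} x y → evalK F (x ∷ y ∷ []) ≈ 0# → V F ∋ (x ∷ y ∷ [])
  member₂ x y z = record { vanishes = z ∷ [] ; nonzero≉0 = λ e → 1≉0 (trans (sym (eval-const₂ x y)) e) }

  value₁ : ∀ (f : Regular 𝔸¹) P → value {𝔸¹} f P ≈ ⟦ coeffs₁ (proj₁ f) ⟧ (Vec.head (proj₁ P))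
  value₁ (p , k) (t ∷ [] , m) = trans (inverse-1 (nonzero≉0 m) (eval-const₁ t) k _) (⟦⟧-coeffs₁ p t)

  value₂ : ∀ F (f : Regular (V F)) x y m → value {V F} f (x ∷ y ∷ [] , m) ≈ ⟪ toExpr (proj₁ f) ⟫ x y
  value₂ F (p , k) x y m = trans (inverse-1 (nonzero≉0 m) (eval-const₂ x y) k _) (sym (⟪⟫-toExpr p x y))

  module Sheared (κ : ℕ) (F G : Poly Carrier 2) where
    k₀ = nat κ
    F′ = shear κ (toExpr F)
    G′ = shear κ (toExpr G)

    unshear : ∀ x y → (x - k₀ * y) + k₀ * y ≈ x
    unshear x y = solve 3 (λ x k y → x :- k :* y :+ k :* y := x) refl x k₀ y

    ⟪⟫-unshear : ∀ f {x y x′} → x′ ≈ x - k₀ * y → ⟪ shear κ f ⟫ x′ y ≈ ⟪ f ⟫ x y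
    ⟪⟫-unshear f {x} {y} {x′} e = trans (reflexive (⟪⟫-shear κ f x′ y)) (⟪⟫-cong f (trans (+-congʳ e) (unshear x y)) refl)

    ⟪⟫-shear≈ : ∀ f x y → ⟪ shear κ f ⟫ x y ≈ ⟪ f ⟫ (x + k₀ * y) y
    ⟪⟫-shear≈ f x y = reflexive (⟪⟫-shear κ f x y)

    -- On 𝔸¹ and on closed plane curves the denominators of regular functions are powers of 1, so
    -- the components of the isomorphism become polynomials; they are then expressed in sheared
    -- coordinates.
    line : ∀ a → V (G ⊖ a) ≅ 𝔸¹ → MeetInExactlyOnePoint (G ⊖ a) F → Line F′ G′ a
    line a iso (p₁ ∷ p₂ ∷ [] , (on-G , on-F) , unique) = go (components (_≅_.from iso)) (lands (_≅_.from iso)) (components (_≅_.to iso)) ≡.refl ≡.refl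
      where
      open _≅_ iso
      G-a = V (G ⊖ a)
      on-G₀ : ∀ x y → evalK (G ⊖ a) (x ∷ y ∷ []) ≈ 0# → ⟪ toExpr G ⟫ x y ≈ a
      on-G₀ x y z = x-y≈0⇒x≈y (trans (sym (⟪⟫-⊖ G a x y)) z)
      -- The component vectors enter as variables with equations, so that their entries can be
      -- matched while `from∘to` and `to∘from` remain statements about the given morphisms.
      go : ∀ (fs : Vec (Regular 𝔸¹) 2) → (∀ P → G-a ∋ Vec.map (λ f → value {𝔸¹} f P) fs) → ∀ (ss : Vec (Regular G-a) 1) → fs ≡ components from → ss ≡ components to → Line F′ G′ a
      go (f₁ ∷ f₂ ∷ []) lands′ (s₁ ∷ []) fs-eq ss-eq = record
        { xs = xs ; ys = ys ; s = shear κ s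
        ; on = λ t → trans (⟪⟫-unshear (toExpr G) (xs-eq t)) (on t)
        ; s∘γ = λ t → trans (⟪⟫-unshear s (xs-eq t)) (s∘γ t)
        ; γ∘s₁ = λ x y g → trans (xs-eq _) (trans (+-cong (trans (⟦⟧-cong us (s-eq x y)) (proj₁ (γ∘s x y g))) (-‿cong (*-congˡ (trans (⟦⟧-cong ys (s-eq x y)) (proj₂ (γ∘s x y g)))))) (solve 3 (λ x k y → x :+ k :* y :- k :* y := x) refl x k₀ y))
        ; γ∘s₂ = λ x y g → trans (⟦⟧-cong ys (s-eq x y)) (proj₂ (γ∘s x y g))
        ; px = p₁ - k₀ * p₂ ; py = p₂
        ; G-p = trans (⟪⟫-unshear (toExpr G) refl) (on-G₀ p₁ p₂ (All.head (vanishes on-G)))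
        ; F-p = trans (⟪⟫-unshear (toExpr F) refl) (trans (⟪⟫-toExpr F p₁ p₂) (All.head (vanishes on-F)))
        ; p-unique₁ = λ x y g f → trans (solve 3 (λ x k y → x := x :+ k :* y :- k :* y) refl x k₀ y) (+-cong (proj₁ (unique′ x y g f)) (-‿cong (*-congˡ (proj₂ (unique′ x y g f)))))
        ; p-unique₂ = λ x y g f → proj₂ (unique′ x y g f)
        }
        where
        us = coeffs₁ (proj₁ f₁)
        ys = coeffs₁ (proj₁ f₂)
        xs = us ⊞ scale (- k₀) ys
        s = toExpr (proj₁ s₁)
        xs-eq : ∀ t → ⟦ xs ⟧ t ≈ ⟦ us ⟧ t - k₀ * ⟦ ys ⟧ t
        xs-eq t = trans (⟦⟧-⊞ us (scale (- k₀) ys) t) (+-congˡ (trans (⟦⟧-scale (- k₀) ys t) (solve 2 (λ k y → :- k :* y := :- (k :* y)) refl k₀ (⟦ ys ⟧ t))))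
        s-eq : ∀ x y → ⟪ shear κ s ⟫ x y ≈ ⟪ s ⟫ (x + k₀ * y) y
        s-eq = ⟪⟫-shear≈ s
        on : ∀ t → ⟪ toExpr G ⟫ (⟦ us ⟧ t) (⟦ ys ⟧ t) ≈ a
        on t = trans (⟪⟫-cong (toExpr G) (sym (value₁ f₁ (point₁ t))) (sym (value₁ f₂ (point₁ t)))) (on-G₀ _ _ (All.head (vanishes (lands′ (point₁ t)))))
        s∘γ : ∀ t → ⟪ s ⟫ (⟦ us ⟧ t) (⟦ ys ⟧ t) ≈ t
        s∘γ t = head≈ (components from) fs-eq (components to) ss-eq (lands from (point₁ t)) (to∘from (point₁ t))
          where
          head≈ : ∀ fs → f₁ ∷ f₂ ∷ [] ≡ fs → ∀ ss → s₁ ∷ [] ≡ ss → (m : G-a ∋ Vec.map (λ f → value {𝔸¹} f (point₁ t)) fs) →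
            VecPointwise.Pointwise _≈_ (Vec.map (λ f → value {G-a} f (Vec.map (λ f → value {𝔸¹} f (point₁ t)) fs , m)) ss) (t ∷ []) → ⟪ s ⟫ (⟦ us ⟧ t) (⟦ ys ⟧ t) ≈ t
          head≈ _ ≡.refl _ ≡.refl m (e ∷ []) = trans (⟪⟫-cong s (sym (value₁ f₁ (point₁ t))) (sym (value₁ f₂ (point₁ t)))) (trans (sym (value₂ (G ⊖ a) s₁ _ _ m)) e)
        γ∘s : ∀ x y → ⟪ G′ ⟫ x y ≈ a → ⟦ us ⟧ (⟪ s ⟫ (x + k₀ * y) y) ≈ x + k₀ * y × ⟦ ys ⟧ (⟪ s ⟫ (x + k₀ * y) y) ≈ y
        γ∘s x y g = both (components from) fs-eq (components to) ss-eq (lands to P) (from∘to P)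
          where
          x′ = x + k₀ * y
          P : Point G-a
          P = x′ ∷ y ∷ [] , member₂ x′ y (trans (⟪⟫-⊖ G a x′ y) (x≈y⇒x-y≈0 (trans (sym (⟪⟫-shear≈ (toExpr G) x y)) g)))
          both : ∀ fs → f₁ ∷ f₂ ∷ [] ≡ fs → ∀ ss → s₁ ∷ [] ≡ ss → (m : 𝔸¹ ∋ Vec.map (λ f → value {G-a} f P) ss) →
            VecPointwise.Pointwise _≈_ (Vec.map (λ f → value {𝔸¹} f (Vec.map (λ f → value {G-a} f P) ss , m)) fs) (x′ ∷ y ∷ []) → ⟦ us ⟧ (⟪ s ⟫ x′ y) ≈ x′ × ⟦ ys ⟧ (⟪ s ⟫ x′ y) ≈ y
          both _ ≡.refl _ ≡.refl m (e₁ ∷ e₂ ∷ []) =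
            trans (⟦⟧-cong us (sym (value₂ (G ⊖ a) s₁ x′ y (proj₂ P)))) (trans (sym (value₁ f₁ (_ , m))) e₁) ,
            trans (⟦⟧-cong ys (sym (value₂ (G ⊖ a) s₁ x′ y (proj₂ P)))) (trans (sym (value₁ f₂ (_ , m))) e₂)
        unique′ : ∀ x y → ⟪ G′ ⟫ x y ≈ a → ⟪ F′ ⟫ x y ≈ 0# → x + k₀ * y ≈ p₁ × y ≈ p₂
        unique′ x y g f = split (unique (x + k₀ * y ∷ y ∷ [])
          (member₂ _ _ (trans (⟪⟫-⊖ G a _ _) (x≈y⇒x-y≈0 (trans (sym (⟪⟫-shear≈ (toExpr G) x y)) g))) ,
           member₂ _ _ (trans (sym (⟪⟫-toExpr F _ _)) (trans (sym (⟪⟫-shear≈ (toExpr F) x y)) f))))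
          where
          split : VecPointwise.Pointwise _≈_ (x + k₀ * y ∷ y ∷ []) (p₁ ∷ p₂ ∷ []) → x + k₀ * y ≈ p₁ × y ≈ p₂
          split (e₁ ∷ e₂ ∷ []) = e₁ , e₂

    shift : Carrier → List Carrier → List Carrier
    shift r []       = []
    shift r (a ∷ as) = (a ∷ []) ⊞ (r ∷ 1# ∷ []) ⊠ shift r as

    ⟦⟧-shift : ∀ r as t → ⟦ shift r as ⟧ t ≈ ⟦ as ⟧ (r + t)
    ⟦⟧-shift r []       t = refl
    ⟦⟧-shift r (a ∷ as) t = trans (⟦⟧-⊞ (a ∷ []) ((r ∷ 1# ∷ []) ⊠ shift r as) t) (trans (+-congˡ (trans (⟦⟧-⊠ (r ∷ 1# ∷ []) (shift r as) t) (*-congˡ (⟦⟧-shift r as t))))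
      (solve 4 (λ a r t q → a :+ t :* :0 :+ (r :+ t :* (:1 :+ t :* :0)) :* q := a :+ (r :+ t) :* q) refl a r t (⟦ as ⟧ (r + t))))

    combine : List Carrier → List Carrier → List Carrier
    combine ξ η = ξ ⊞ scale k₀ η

    ⟦⟧-combine : ∀ ξ η t → ⟦ combine ξ η ⟧ t ≈ ⟦ ξ ⟧ t + k₀ * ⟦ η ⟧ t
    ⟦⟧-combine ξ η t = trans (⟦⟧-⊞ ξ (scale k₀ η) t) (+-congˡ (⟦⟧-scale k₀ η t))

    module _ (M : MonicInY G′) (exceptions : List Carrier) (lines : ∀ a → a ∉ exceptions → Line F′ G′ a)
      (smooth : ∀ x y → ⟪ F′ ⟫ x y ≈ 0# → ⟪ ∂₁ F′ ⟫ x y ≈ 0# → ¬ ⟪ ∂₂ F′ ⟫ x y ≈ 0#) where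
      open Punctures F′ G′ M exceptions lines smooth using (Affine; Punctured)

      affine⇒≅ : Affine → V F ≅ 𝔸¹
      affine⇒≅ (ξ , η , on₁ , on₂) = record
        { to      = record { components = (G , 0) ∷ [] ; lands = λ P → proj₂ (point₁ _) }
        ; from    = record { components = (toPoly 0 ξ′ , 0) ∷ (toPoly 0 η , 0) ∷ [] ; lands = from-lands }
        ; from∘to = λ { (x ∷ y ∷ [] , m) →
            let e₁ , e₂ = on₁ (x - k₀ * y) y (trans (⟪⟫-unshear (toExpr F) refl) (trans (⟪⟫-toExpr F x y) (All.head (vanishes m))))
                g = trans (value₂ F (G , 0) x y m) (sym (⟪⟫-unshear (toExpr G) refl))
            in trans (x-value _ (proj₂ (point₁ _))) (trans (⟦⟧-cong ξ′ g) (trans (⟦⟧-combine ξ η _) (trans (+-cong (sym e₁) (*-congˡ (sym e₂))) (unshear x y)))) ∷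
               trans (y-value _ (proj₂ (point₁ _))) (trans (⟦⟧-cong η g) (sym e₂)) ∷ [] }
        ; to∘from = λ { P@(t ∷ [] , m) → trans (value₂ F (G , 0) _ _ (from-lands P)) (trans (⟪⟫-cong (toExpr G) (x-value t m) (y-value t m)) (G-on t)) ∷ [] }
        }
        where
        ξ′ = combine ξ η
        x-value : ∀ t m → value {𝔸¹} (toPoly 0 ξ′ , 0) (t ∷ [] , m) ≈ ⟦ ξ′ ⟧ t
        x-value t m = trans (*-identityʳ _) (trans (eval-toPoly 0 ξ′ t) (*-identityˡ _))
        y-value : ∀ t m → value {𝔸¹} (toPoly 0 η , 0) (t ∷ [] , m) ≈ ⟦ η ⟧ t
        y-value t m = trans (*-identityʳ _) (trans (eval-toPoly 0 η t) (*-identityˡ _))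
        sheared : ∀ f t → ⟪ toExpr f ⟫ (⟦ ξ′ ⟧ t) (⟦ η ⟧ t) ≈ ⟪ shear κ (toExpr f) ⟫ (⟦ ξ ⟧ t) (⟦ η ⟧ t)
        sheared f t = trans (⟪⟫-cong (toExpr f) (⟦⟧-combine ξ η t) refl) (sym (⟪⟫-shear≈ (toExpr f) _ _))
        F-on : ∀ t → ⟪ toExpr F ⟫ (⟦ ξ′ ⟧ t) (⟦ η ⟧ t) ≈ 0#
        F-on t = trans (sheared F t) (proj₁ (on₂ t))
        G-on : ∀ t → ⟪ toExpr G ⟫ (⟦ ξ′ ⟧ t) (⟦ η ⟧ t) ≈ t
        G-on t = trans (sheared G t) (proj₂ (on₂ t))
        from-lands : ∀ P → V F ∋ Vec.map (λ f → value {𝔸¹} f P) ((toPoly 0 ξ′ , 0) ∷ (toPoly 0 η , 0) ∷ [])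
        from-lands (t ∷ [] , m) = member₂ _ _ (trans (eval-cong₂ F (x-value t m) (y-value t m)) (trans (sym (⟪⟫-toExpr F _ _)) (F-on t)))

      -- On 𝔸¹* regular functions are quotients by powers of z; the exponent n of `Punctured`
      -- becomes that of the denominators of the inverse.
      punctured⇒≅ : Punctured → V F ≅ 𝔸¹*
      punctured⇒≅ (r , n , ξ , η , on₁ , on₂) = record
        { to      = record { components = (G ⊖ r , 0) ∷ [] ; lands = to-lands }
        ; from    = record { components = (toPoly 0 ξ′ , n) ∷ (toPoly 0 η′ , n) ∷ [] ; lands = from-lands }
        ; from∘to = λ { P@(x ∷ y ∷ [] , m) →
            let z = value {V F} (G ⊖ r , 0) P
                nz , e₁ , e₂ = on₁′ x y m
                z≈ = to-value x y m
                z≉0 = λ e → nz (trans (sym z≈) e)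
                back : r + z ≈ ⟪ toExpr G ⟫ x y
                back = trans (+-congˡ z≈) (solve 2 (λ r g → r :+ (g :- r) := g) refl r _)
            in cancel-≈ (^-≉0 n z≉0) (trans (value-eq ξ′ z (to-lands P)) (trans (⟦⟧-shift r (combine ξ η) z) (trans (⟦⟧-cong (combine ξ η) back) (trans (⟦⟧-combine ξ η _)
                 (trans (+-cong (sym e₁) (*-congˡ (sym e₂))) (trans (solve 4 (λ p x k y → p :* (x :- k :* y) :+ k :* (p :* y) := p :* x) refl _ x k₀ y) (*-congʳ (^-cong n (sym z≈))))))))) ∷
               cancel-≈ (^-≉0 n z≉0) (trans (value-eq η′ z (to-lands P)) (trans (⟦⟧-shift r η z) (trans (⟦⟧-cong η back) (trans (sym e₂) (*-congʳ (^-cong n (sym z≈))))))) ∷ [] }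
        ; to∘from = λ { P@(z ∷ [] , m) → trans (to-value _ _ (from-lands P)) (proj₂ (on₂′ z m)) ∷ [] }
        }
        where
        ξ′ = shift r (combine ξ η)
        η′ = shift r η
        to-value : ∀ x y m → value {V F} (G ⊖ r , 0) (x ∷ y ∷ [] , m) ≈ ⟪ toExpr G ⟫ x y - r
        to-value x y m = trans (*-identityʳ _) (⟪⟫-⊖ G r x y)
        on₁′ : ∀ x y → V F ∋ (x ∷ y ∷ []) → ¬ ⟪ toExpr G ⟫ x y - r ≈ 0# × (⟪ toExpr G ⟫ x y - r) ^ n * (x - k₀ * y) ≈ ⟦ ξ ⟧ (⟪ toExpr G ⟫ x y) × (⟪ toExpr G ⟫ x y - r) ^ n * y ≈ ⟦ η ⟧ (⟪ toExpr G ⟫ x y)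
        on₁′ x y m =
          let nz , e₁ , e₂ = on₁ (x - k₀ * y) y (trans (⟪⟫-unshear (toExpr F) refl) (trans (⟪⟫-toExpr F x y) (All.head (vanishes m))))
              g : ⟪ G′ ⟫ (x - k₀ * y) y ≈ ⟪ toExpr G ⟫ x y
              g = ⟪⟫-unshear (toExpr G) refl
          in (λ z → nz (trans (+-congʳ g) z)) , trans (*-congʳ (^-cong n (+-congʳ (sym g)))) (trans e₁ (⟦⟧-cong ξ g)) , trans (*-congʳ (^-cong n (+-congʳ (sym g)))) (trans e₂ (⟦⟧-cong η g))
        value-eq : ∀ as z m → z ^ n * value {𝔸¹*} (toPoly 0 as , n) (z ∷ [] , m) ≈ ⟦ as ⟧ z
        value-eq as z m = begin
          z ^ n * (evalK (toPoly 0 as) (z ∷ []) * i ^ n) ≈⟨ *-congˡ (*-congʳ (trans (eval-toPoly 0 as z) (*-identityˡ _))) ⟩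
          z ^ n * (⟦ as ⟧ z * i ^ n) ≈⟨ solve 3 (λ p a q → p :* (a :* q) := p :* q :* a) refl (z ^ n) (⟦ as ⟧ z) (i ^ n) ⟩
          z ^ n * i ^ n * ⟦ as ⟧ z ≈⟨ *-congʳ (trans (sym (^-* z i n)) (trans (^-cong n (trans (*-congʳ (sym (eval-var z))) (*-inverse _ (nonzero≉0 m)))) (1^ n))) ⟩
          1# * ⟦ as ⟧ z ≈⟨ *-identityˡ _ ⟩
          ⟦ as ⟧ z ∎
          where i = evalK (var Fin.zero) (z ∷ []) ⁻¹⟨ nonzero≉0 m ⟩
        on₂′ : ∀ z m → let x = value {𝔸¹*} (toPoly 0 ξ′ , n) (z ∷ [] , m) ; y = value {𝔸¹*} (toPoly 0 η′ , n) (z ∷ [] , m) in ⟪ toExpr F ⟫ x y ≈ 0# × ⟪ toExpr G ⟫ x y - r ≈ z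
        on₂′ z m =
          let x = value {𝔸¹*} (toPoly 0 ξ′ , n) (z ∷ [] , m)
              y = value {𝔸¹*} (toPoly 0 η′ , n) (z ∷ [] , m)
              ey = trans (value-eq η′ z m) (⟦⟧-shift r η z)
              ex = trans (value-eq ξ′ z m) (trans (⟦⟧-shift r (combine ξ η) z) (⟦⟧-combine ξ η (r + z)))
              f , g = on₂ z (x - k₀ * y) y (λ e → nonzero≉0 m (trans (eval-var z) e))
                (trans (solve 4 (λ p x k y → p :* (x :- k :* y) := p :* x :- k :* (p :* y)) refl (z ^ n) x k₀ y) (trans (+-cong ex (-‿cong (*-congˡ ey))) (solve 2 (λ a b → a :+ b :- b := a) refl _ _))) ey
          in trans (sym (⟪⟫-unshear (toExpr F) refl)) f , trans (+-congʳ (sym (⟪⟫-unshear (toExpr G) refl))) g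
        to-lands : ∀ P → 𝔸¹* ∋ Vec.map (λ f → value {V F} f P) ((G ⊖ r , 0) ∷ [])
        to-lands (x ∷ y ∷ [] , m) = record { vanishes = [] ; nonzero≉0 = λ z → proj₁ (on₁′ x y m) (trans (sym (to-value x y m)) (trans (sym (eval-var _)) z)) }
        from-lands : ∀ P → V F ∋ Vec.map (λ f → value {𝔸¹*} f P) ((toPoly 0 ξ′ , n) ∷ (toPoly 0 η′ , n) ∷ [])
        from-lands (z ∷ [] , m) = member₂ _ _ (trans (sym (⟪⟫-toExpr F _ _)) (proj₁ (on₂′ z m)))

  -- Rationality of the data and assembly

  ι-^ : ∀ q n → ι (q Sℚ.^ n) ≈ ι q ^ n
  ι-^ q 0       = ι-1
  ι-^ q (suc n) = trans (ι-* _ _) (*-congˡ (ι-^ q n))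

  ι-eval : ∀ F x y → ι (Pℚ.eval F (x ∷ y ∷ [])) ≈ evalK (mapCoeff ι F) (ι x ∷ ι y ∷ [])
  ι-eval []                     x y = ι-0
  ι-eval ((a , i ∷ j ∷ []) ∷ F) x y = trans (ι-+ _ _) (+-cong (trans (ι-* _ _) (*-congˡ (trans (ι-* _ _) (*-cong (ι-^ x i) (trans (ι-* _ _) (*-cong (ι-^ y j) ι-1)))))) (ι-eval F x y))

  ⊛-rational : ∀ {e} n → All Rational (consts e) → All Rational (consts (e ⊛ n))
  ⊛-rational 0       r = (_ , sym ι-1) ∷ []
  ⊛-rational (suc n) r = ++⁺ r (⊛-rational n r)

  toExpr-rational : ∀ F → All Rational (consts (toExpr (mapCoeff ι F)))
  toExpr-rational []                     = (_ , sym ι-0) ∷ []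
  toExpr-rational ((a , i ∷ j ∷ []) ∷ F) = rational-ι a ∷ ++⁺ (++⁺ (⊛-rational {X} i []) (++⁺ (⊛-rational {Y} j []) ((_ , sym ι-1) ∷ []))) (toExpr-rational F)

  subst-rational : ∀ f {p q} → All Rational (consts p) → All Rational (consts q) → All Rational (consts f) → All Rational (consts (subst f p q))
  subst-rational (const a) rp rq r = r
  subst-rational X         rp rq r = rp
  subst-rational Y         rp rq r = rq
  subst-rational (f ⊕ g)   rp rq r = ++⁺ (subst-rational f rp rq (++⁻ˡ (consts f) r)) (subst-rational g rp rq (++⁻ʳ (consts f) r))
  subst-rational (f ⊗ g)   rp rq r = ++⁺ (subst-rational f rp rq (++⁻ˡ (consts f) r)) (subst-rational g rp rq (++⁻ʳ (consts f) r))

  module _ (F : Poly ℚ 2) (smooth : IsSmoothPlaneCurve (mapCoeff ι F)) (¬affine : ¬ (V (mapCoeff ι F) ≅ 𝔸¹)) (¬punctured : ¬ (V (mapCoeff ι F) ≅ 𝔸¹*))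
    (G : Poly Carrier 2) (good₀ : (V (G ⊖ 0#) ≅ 𝔸¹) × MeetInExactlyOnePoint (G ⊖ 0#) (mapCoeff ι F))
    (exceptions : List Carrier) (good : ∀ a → a ∉ exceptions → (V (G ⊖ a) ≅ 𝔸¹) × MeetInExactlyOnePoint (G ⊖ a) (mapCoeff ι F)) where

    private
      F̄ = mapCoeff ι F

    smooth₀ : ∀ x y → ⟪ toExpr F̄ ⟫ x y ≈ 0# → ⟪ ∂₁ (toExpr F̄) ⟫ x y ≈ 0# → ¬ ⟪ ∂₂ (toExpr F̄) ⟫ x y ≈ 0#
    smooth₀ x y z z₁ z₂ = IsSmoothPlaneCurve.smooth smooth (x ∷ y ∷ []) (trans (sym (⟪⟫-toExpr F̄ x y)) z) (trans (sym (∂₁-toExpr F̄ x y)) z₁ , trans (sym (∂₂-toExpr F̄ x y)) z₂)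

    attains : ∀ a → MeetInExactlyOnePoint (G ⊖ a) F̄ → ∃[ x ] ∃[ y ] ⟪ toExpr G ⟫ x y ≈ a
    attains a (x ∷ y ∷ [] , (m , _) , _) = x , y , x-y≈0⇒x≈y (trans (sym (⟪⟫-⊖ G a x y)) (All.head (vanishes m)))

    -- The levels 0 and a, for some a ≠ 0, are both nonempty: each contains its intersection with
    -- the curve.
    nonconstant : ¬ (∀ x y → ⟪ toExpr G ⟫ x y ≈ ⟪ toExpr G ⟫ 0# 0#)
    nonconstant same =
      let a , a∉ = fresh (0# ∷ exceptions)
          x₀ , y₀ , e₀ = attains 0# (proj₂ good₀)
          x₁ , y₁ , e₁ = attains a (proj₂ (good a (λ m → a∉ (there m))))
      in a∉ (here (trans (sym e₁) (trans (same x₁ y₁) (trans (sym (same x₀ y₀)) e₀))))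

    weak-approximation : WeakApproximation (λ (x , y) → Pℚ.eval F (x ∷ y ∷ []) ℚ.< 0ℚ)
    weak-approximation x₀ y₀ N N>0 = [ sheared , (λ e → ⊥-elim (nonconstant e)) ]′ (monic-shear G)
      where
      sheared : (∃[ κ ] MonicInY (shear κ (toExpr G))) → ∃[ x ] ∃[ y ] Pℚ.eval F (x ∷ y ∷ []) ℚ.< 0ℚ × (x ℚ.- x₀) ∈ N ·ℤ × (y ℚ.- y₀) ∈ N ·ℤ
      sheared (κ , M) = unshear-point (Approximation.approximate F′ G′ M exceptions lines smooth′ rational Fℚ Fℚ-eq
          (λ A → ¬affine (affine⇒≅ M exceptions lines smooth′ A)) (λ P → ¬punctured (punctured⇒≅ M exceptions lines smooth′ P)) (x₀ ℚ.- κ′ ℚ.* y₀) y₀ N N>0)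
        where
        open Sheared κ F̄ G
        κ′ = fromℤ (+ κ)
        lines : ∀ a → a ∉ exceptions → Line F′ G′ a
        lines a a∉ = line a (proj₁ (good a a∉)) (proj₂ (good a a∉))
        smooth′ = shear-smooth κ (toExpr F̄) smooth₀
        rational : All Rational (consts F′)
        rational = subst-rational (toExpr F̄) (rational-nat κ ∷ []) [] (toExpr-rational F)
        Fℚ : ℚ → ℚ → ℚ
        Fℚ x y = Pℚ.eval F (x ℚ.+ κ′ ℚ.* y ∷ y ∷ [])
        Fℚ-eq : ∀ x y → ι (Fℚ x y) ≈ ⟪ F′ ⟫ (ι x) (ι y)
        Fℚ-eq x y = begin
          ι (Fℚ x y) ≈⟨ ι-eval F (x ℚ.+ κ′ ℚ.* y) y ⟩
          evalK F̄ (ι (x ℚ.+ κ′ ℚ.* y) ∷ ι y ∷ []) ≈⟨ ⟪⟫-toExpr F̄ _ _ ⟨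
          ⟪ toExpr F̄ ⟫ (ι (x ℚ.+ κ′ ℚ.* y)) (ι y) ≈⟨ ⟪⟫-cong (toExpr F̄) (trans (ι-+ _ _) (+-congˡ (trans (ι-* _ _) (*-congʳ (sym (nat≈ι κ)))))) refl ⟩
          ⟪ toExpr F̄ ⟫ (ι x + k₀ * ι y) (ι y) ≈⟨ ⟪⟫-shear≈ (toExpr F̄) (ι x) (ι y) ⟨
          ⟪ F′ ⟫ (ι x) (ι y) ∎
        -- The point found approximates (x₀ - κ y₀ , y₀), which the shear maps to (x₀ , y₀). Since κ
        -- is an integer, the congruences for x and y give the one for x + κ y.
        unshear-point : (∃[ x ] ∃[ y ] Fℚ x y ℚ.< 0ℚ × (x ℚ.- (x₀ ℚ.- κ′ ℚ.* y₀)) ∈ N ·ℤ × (y ℚ.- y₀) ∈ N ·ℤ) →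
          ∃[ x ] ∃[ y ] Pℚ.eval F (x ∷ y ∷ []) ℚ.< 0ℚ × (x ℚ.- x₀) ∈ N ·ℤ × (y ℚ.- y₀) ∈ N ·ℤ
        unshear-point (x , y , negative , (j , ej) , (k , ek)) = x ℚ.+ κ′ ℚ.* y , y , negative , (j ℤ.+ + κ ℤ.* k , ι-injective (begin
          ι (x ℚ.+ κ′ ℚ.* y ℚ.- x₀) ≈⟨ trans (ι-+ (x ℚ.+ κ′ ℚ.* y) (ℚ.- x₀)) (+-cong (trans (ι-+ x (κ′ ℚ.* y)) (+-congˡ (ι-* κ′ y))) (ι-neg x₀)) ⟩
          ι x + ι κ′ * ι y - ι x₀ ≈⟨ solve 5 (λ x κ y x₀ y₀ → x :+ κ :* y :- x₀ := x :- (x₀ :- κ :* y₀) :+ κ :* (y :- y₀)) refl (ι x) (ι κ′) (ι y) (ι x₀) (ι y₀) ⟩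
          (ι x - (ι x₀ - ι κ′ * ι y₀)) + ι κ′ * (ι y - ι y₀)
            ≈⟨ +-cong (trans (ι-+ x (ℚ.- (x₀ ℚ.- κ′ ℚ.* y₀))) (+-congˡ (trans (ι-neg (x₀ ℚ.- κ′ ℚ.* y₀)) (-‿cong (trans (ι-+ x₀ (ℚ.- (κ′ ℚ.* y₀))) (+-congˡ (trans (ι-neg (κ′ ℚ.* y₀)) (-‿cong (ι-* κ′ y₀)))))))))
                 (*-congˡ (trans (ι-+ y (ℚ.- y₀)) (+-congˡ (ι-neg y₀)))) ⟨
          ι (x ℚ.- (x₀ ℚ.- κ′ ℚ.* y₀)) + ι κ′ * ι (y ℚ.- y₀) ≈⟨ +-cong (ι-cong ej) (*-congˡ (ι-cong ek)) ⟩
          int (+ N ℤ.* j) + int (+ κ) * int (+ N ℤ.* k) ≈⟨ +-cong (int-* (+ N) j) (*-congˡ (int-* (+ N) k)) ⟩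
          int (+ N) * int j + int (+ κ) * (int (+ N) * int k) ≈⟨ solve 4 (λ N j κ k → N :* j :+ κ :* (N :* k) := N :* (j :+ κ :* k)) refl (int (+ N)) (int j) (int (+ κ)) (int k) ⟩
          int (+ N) * (int j + int (+ κ) * int k) ≈⟨ trans (int-* (+ N) (j ℤ.+ + κ ℤ.* k)) (*-congˡ (trans (int-+ j (+ κ ℤ.* k)) (+-congˡ (int-* (+ κ) k)))) ⟨
          int (+ N ℤ.* (j ℤ.+ + κ ℤ.* k)) ∎)) , (k , ek)

mainTheorem17 : ∀ {c ℓ} (ℚ̄ : AlgebraicClosureOfℚ c ℓ) →
  let open AlgebraicClosureOfℚ ℚ̄
      open Geometry field′
      open Polynomials commutativeRing using (_⊖_)
      open Polynomials +-*-commutativeRing using (eval)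
  in
  (F : Poly ℚ 2) →
  let F̄ = mapCoeff ι F
      C = V F̄
  in
  IsSmoothPlaneCurve F̄ →
  ¬ (C ≅ 𝔸¹) →
  ¬ (C ≅ 𝔸¹*) →
  (Σ[ G ∈ Poly Carrier 2 ]
    let Good = λ (a : Carrier) → (V (G ⊖ a) ≅ 𝔸¹) × MeetInExactlyOnePoint (G ⊖ a) F̄
    in Good 0# × AllButFinitelyMany Good) →
  WeakApproximation (λ (x , y) → eval F (x ∷ y ∷ []) < 0ℚ)
mainTheorem17 ℚ̄ F smooth ¬𝔸¹ ¬𝔸¹* (G , good₀ , exceptions , good) =
  Closure.weak-approximation ℚ̄ F smooth ¬𝔸¹ ¬𝔸¹* G good₀ exceptions good
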